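{- Let $A$ be a maximal indecomposable cyclotomic $\mathbb{Z}[i]$-matrix that has at least one nonzero entry on the diagonal. Then $A$ is equivalent to an adjacency matrix of one of the graphs $C_{2k}^{++}$ ($k\geqslant 2$), $C_{2k}^{+- }$ ($k\geqslant 2$), $C_{2k+1}$ ($k\geqslant 1$), $S_1$, $S_4$, $S_4^\dagger$, $S_7$, $S_8$, $S_8'$.
   Context: **Matrices.** Let $R=\mathbb{Z}[i]$. A cyclotomic matrix over $R$ is a (finite, square) Hermitian matrix with entries in $R$ all of whose eigenvalues lie in $[-2,2]$. A Hermitian $R$-matrix is the adjacency matrix $(w(u,v))_{u,v}$ of a weighted directed graph ($R$-graph) with weight function $w$ satisfying $w(v,u)=\overline{w(u,v)}$; $w(v,v)$ is the charge of $v$. A matrix is indecomposable if its underlying graph (distinct $u,v$ adjacent iff $w(u,v)\neq 0$) is connected. An indecomposable cyclotomic $R$-matrix is maximal if it is not a (proper) principal submatrix of any other indecomposable cyclotomic $R$-matrix. Two $n\times n$ matrices $A,B$ over $R$ are equivalent if $A=\pm\sigma(QBQ^*)$ for some unitary matrix $Q$ with entries in $R$ ($QQ^*=Q^*Q=I$), some choice of sign, and $\sigma$ either the identity or complex conjugation applied entrywise. **Graphs.** Weights not determined by the listed ones via $w(v,u)=\overline{w(u,v)}$ are $0$; in particular vertices are uncharged unless a charge is listed. "Ladder on $t_1,b_1,\dots,t_k,b_k$" means: for $1\le j\le k-1$, $w(t_j,t_{j+1})=w(t_j,b_{j+1})=1$ and $w(b_j,t_{j+1})=w(b_j,b_{j+1})=-1$.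 $C_{2k}^{++}$ ($k\ge2$): ladder on $t_1,b_1,\dots,t_k,b_k$, with $t_1,b_1,t_k,b_k$ of charge $1$, $w(t_1,b_1)=1$, $w(t_k,b_k)=-1$. $C_{2k}^{+- }$ ($k\ge2$): ladder on $t_1,b_1,\dots,t_k,b_k$, with $t_1,b_1$ of charge $1$, $t_k,b_k$ of charge $-1$, $w(t_1,b_1)=1$, $w(t_k,b_k)=1$. $C_{2k+1}$ ($k\ge1$): ladder on $t_1,b_1,\dots,t_k,b_k$ and one further vertex $p$, with $w(t_1,p)=w(b_1,p)=1+i$, $t_k,b_k$ of charge $1$, $w(t_k,b_k)=-1$. $S_1$: a single vertex of charge $2$. $S_4$: vertices $a,b,c,d$ of charges $1,-1,-1,1$; $w(a,b)=w(c,d)=1$, $w(a,c)=-1-i$, $w(b,d)=1+i$. $S_4^\dagger$: vertices $a,b,c,d$ of charges $1,0,-1,0$; $w(a,b)=w(c,d)=w(b,c)=1$, $w(a,d)=-1$, $w(c,a)=i$, $w(b,d)=1+i$. $S_7$: vertices $a,\dots,g$; $a,e,f$ have charge $1$, $d$ has charge $-1$, $b,c,g$ charge $0$; weight $1$: $ab, ad, cf, bg, de, df, cg, eg, bc$; weight $-1$: $ac, fg, be$. $S_8$: vertices $a,\dots,h$; $b,c,e,h$ have charge $1$, $a,d,f,g$ charge $-1$; weight $1$: $ab, ae, cg, cd, bd, ef, eg, fh, dh$; weight $-1$: $ac, bf, gh$. $S_8'$: vertices $a,\dots,h$; $b,g$ have charge $1$, $a,h$ charge $-1$, $c,d,e,f$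 charge $0$; weight $1$: $ab, ac, ae, cg, bd, ef, gh, fh, dh, df, ce$; weight $-1$: $cd, bf, eg$. -}

module Defs where

open import Algebra.Bundles using (CommutativeMonoid; RawRing)
import Algebra.Definitions.RawMonoid as RawMonoidDefs
import Algebra.Properties.CommutativeSemigroup as CommutativeSemigroupProperties
open import Data.Bool.Base using (Bool; if_then_else_; _∧_)
open import Data.Fin.Base as Fin using (Fin; zero; suc; toℕ; remQuot)
open import Data.Fin.Patterns using (0F; 1F; 2F; 3F; 4F; 5F; 6F; 7F)
import Data.Fin.Properties as Finₚ
open import Data.Integer.Base as ℤ using (ℤ)
open import Data.List.Base using (List; []; _∷_)
open import Data.Nat.Base as ℕ using (ℕ; zero; suc; _≡ᵇ_; _⊔_)
import Data.Nat.Properties as ℕₚ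
open import Data.Product.Base using (_×_; _,_; ∃; ∃-syntax)
open import Data.Rational.Base as ℚ using (ℚ; 0ℚ; 1ℚ; ½; ∣_∣; Positive)
import Data.Rational.Properties as ℚₚ
open import Data.Sign.Base as Sign using (Sign)
open import Data.Vec.Functional using (Vector)
open import Level using (0ℓ)
open import Relation.Binary.Construct.Closure.ReflexiveTransitive using (Star)
open import Relation.Binary.Core using (_Preserves_⟶_)
open import Relation.Binary.PropositionalEquality
  using (_≡_; _≢_; refl; sym; cong; cong₂; subst; module ≡-Reasoning)
open import Relation.Nullary.Decidable using (⌊_⌋)
open import Relation.Nullary.Negation using (¬_)

module _ where
  open import Data.Rational.Base using (_+_; _*_; _-_; -_; _<_; _≤_)

  IsCauchy : (ℕ → ℚ) → Set
  IsCauchy x =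
    ∀ ε → 0ℚ < ε → ∃[ N ] ∀ m n → N ℕ.≤ m → N ℕ.≤ n → ∣ x m - x n ∣ < ε

  record ℝ : Set where
    constructor mkℝ
    field
      seq    : ℕ → ℚ
      cauchy : IsCauchy seq
  open ℝ public

  infix 4 _≃ℝ_ _≤ℝ_

  _≃ℝ_ : ℝ → ℝ → Set
  x ≃ℝ y = ∀ ε → 0ℚ < ε → ∃[ N ] ∀ n → N ℕ.≤ n → ∣ seq x n - seq y n ∣ < ε

  _≤ℝ_ : ℝ → ℝ → Set
  x ≤ℝ y = ∀ ε → 0ℚ < ε → ∃[ N ] ∀ n → N ℕ.≤ n → seq x n < seq y n + ε

  fromℚ : ℚ → ℝ
  fromℚ q = mkℝ (λ _ → q) λ ε 0<ε → 0 , λ _ _ _ _ →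
    subst (_< ε) (sym (cong ∣_∣ (ℚₚ.+-inverseʳ q))) 0<ε

  fromℤ : ℤ → ℝ
  fromℤ z = fromℚ (z ℚ./ 1)

  private
    open CommutativeSemigroupProperties
      (CommutativeMonoid.commutativeSemigroup ℚₚ.+-0-commutativeMonoid)
      using (interchange)

    halve : ∀ ε → 0ℚ < ε → ∃[ δ ] 0ℚ < δ × δ + δ ≡ ε
    halve ε 0<ε = ½ * ε
      , subst (_< ½ * ε) (ℚₚ.*-zeroʳ ½) (ℚₚ.*-monoʳ-<-pos ½ 0<ε)
      , (begin
        ½ * ε + ½ * ε  ≡⟨ ℚₚ.*-distribʳ-+ ε ½ ½ ⟨
        1ℚ * ε         ≡⟨ ℚₚ.*-identityˡ ε ⟩
        ε              ∎)
      where open ≡-Reasoning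

    telescope : ∀ p q r → (p - q) + (q - r) ≡ p - r
    telescope p q r = begin
      (p - q) + (q - r)      ≡⟨ ℚₚ.+-assoc p (- q) (q - r) ⟩
      p + (- q + (q - r))    ≡⟨ cong (p +_) (ℚₚ.+-assoc (- q) q (- r)) ⟨
      p + ((- q + q) - r)    ≡⟨ cong (λ z → p + (z - r)) (ℚₚ.+-inverseˡ q) ⟩
      p + (0ℚ - r)           ≡⟨ cong (p +_) (ℚₚ.+-identityˡ (- r)) ⟩
      p - r                  ∎
      where open ≡-Reasoning

    +-diff : ∀ p q r s → (p + r) - (q + s) ≡ (p - q) + (r - s)
    +-diff p q r s = begin
      (p + r) - (q + s)        ≡⟨ cong ((p + r) +_) (ℚₚ.neg-distrib-+ q s) ⟩
      (p + r) + (- q + - s)    ≡⟨ interchange p r (- q) (- s) ⟩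
      (p - q) + (r - s)        ∎
      where open ≡-Reasoning

    *-diff : ∀ p q r s → p * r - q * s ≡ p * (r - s) + (p - q) * s
    *-diff p q r s = begin
      p * r - q * s
        ≡⟨ telescope (p * r) (p * s) (q * s) ⟨
      (p * r - p * s) + (p * s - q * s)
        ≡⟨ cong₂ (λ y z → (p * r + y) + (p * s + z))
                 (ℚₚ.neg-distribʳ-* p s) (ℚₚ.neg-distribˡ-* q s) ⟩
      (p * r + p * - s) + (p * s + - q * s)
        ≡⟨ cong₂ _+_ (ℚₚ.*-distribˡ-+ p r (- s)) (ℚₚ.*-distribʳ-+ s p (- q)) ⟨
      p * (r - s) + (p - q) * s ∎
      where open ≡-Reasoning

    add-back : ∀ p q → p ≡ (p - q) + q
    add-back p q = sym (begin
      (p - q) + q      ≡⟨ ℚₚ.+-assoc p (- q) q ⟩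
      p + (- q + q)    ≡⟨ cong (p +_) (ℚₚ.+-inverseˡ q) ⟩
      p + 0ℚ           ≡⟨ ℚₚ.+-identityʳ p ⟩
      p                ∎)
      where open ≡-Reasoning

    sum-cauchy : ∀ x y → IsCauchy x → IsCauchy y → IsCauchy (λ n → x n + y n)
    sum-cauchy x y cx cy ε 0<ε with halve ε 0<ε
    ... | ε/2 , 0<ε/2 , halves with cx ε/2 0<ε/2 | cy ε/2 0<ε/2
    ... | M , hx | N , hy = M ⊔ N , λ m n p q → begin-strict
      ∣ (x m + y m) - (x n + y n) ∣    ≡⟨ cong ∣_∣ (+-diff (x m) (x n) (y m) (y n)) ⟩
      ∣ (x m - x n) + (y m - y n) ∣    ≤⟨ ℚₚ.∣p+q∣≤∣p∣+∣q∣ (x m - x n) (y m - y n) ⟩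
      ∣ x m - x n ∣ + ∣ y m - y n ∣
        <⟨ ℚₚ.+-mono-< (hx m n (ℕₚ.m⊔n≤o⇒m≤o M N p) (ℕₚ.m⊔n≤o⇒m≤o M N q))
                       (hy m n (ℕₚ.m⊔n≤o⇒n≤o M N p) (ℕₚ.m⊔n≤o⇒n≤o M N q)) ⟩
      ε/2 + ε/2                        ≡⟨ halves ⟩
      ε                                ∎
      where open ℚₚ.≤-Reasoning

    neg-cauchy : ∀ x → IsCauchy x → IsCauchy (λ n → - x n)
    neg-cauchy x cx ε 0<ε with cx ε 0<ε
    ... | N , h = N , λ m n p q → subst (_< ε)
      (sym (begin
        ∣ (- x m) - (- x n) ∣  ≡⟨ cong ∣_∣ (sym (ℚₚ.neg-distrib-+ (x m) (- x n))) ⟩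
        ∣ - (x m - x n) ∣      ≡⟨ ℚₚ.∣-p∣≡∣p∣ (x m - x n) ⟩
        ∣ x m - x n ∣          ∎))
      (h m n p q)
      where open ≡-Reasoning

    tail-bound : ∀ x → IsCauchy x →
                 ∃[ K ] Positive K × ∃[ N ] ∀ n → N ℕ.≤ n → ∣ x n ∣ ≤ K
    tail-bound x cx with cx 1ℚ (ℚₚ.positive⁻¹ 1ℚ)
    ... | N , h = 1ℚ + ∣ x N ∣
                , ℚₚ.pos+nonNeg⇒pos 1ℚ ∣ x N ∣ {{ℚₚ.∣-∣-nonNeg (x N)}}
                , N , λ n p → begin
      ∣ x n ∣                    ≡⟨ cong ∣_∣ (add-back (x n) (x N)) ⟩
      ∣ (x n - x N) + x N ∣      ≤⟨ ℚₚ.∣p+q∣≤∣p∣+∣q∣ (x n - x N) (x N) ⟩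
      ∣ x n - x N ∣ + ∣ x N ∣
        ≤⟨ ℚₚ.+-monoˡ-≤ ∣ x N ∣ (ℚₚ.<⇒≤ (h n N p ℕₚ.≤-refl)) ⟩
      1ℚ + ∣ x N ∣               ∎
      where open ℚₚ.≤-Reasoning

    product-< : ∀ K .{{_ : Positive K}} ε → 0ℚ < ε →
                ∃[ δ ] 0ℚ < δ × (∀ {p q} → ∣ p ∣ ≤ K → ∣ q ∣ < δ → ∣ p * q ∣ < ε)
    product-< K ε 0<ε = K⁻¹ * ε , 0<δ , λ {p} {q} p≤K q<δ → begin-strict
      ∣ p * q ∣        ≡⟨ ℚₚ.∣p*q∣≡∣p∣*∣q∣ p q ⟩
      ∣ p ∣ * ∣ q ∣    ≤⟨ ℚₚ.*-monoʳ-≤-nonNeg ∣ q ∣ {{ℚₚ.∣-∣-nonNeg q}} p≤K ⟩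
      K * ∣ q ∣        <⟨ ℚₚ.*-monoʳ-<-pos K q<δ ⟩
      K * (K⁻¹ * ε)    ≡⟨ ℚₚ.*-assoc K K⁻¹ ε ⟨
      (K * K⁻¹) * ε    ≡⟨ cong (_* ε) (ℚₚ.*-inverseʳ K) ⟩
      1ℚ * ε           ≡⟨ ℚₚ.*-identityˡ ε ⟩
      ε                ∎
      where
      open ℚₚ.≤-Reasoning
      instance
        K≢0 : ℚ.NonZero K
        K≢0 = ℚₚ.pos⇒nonZero K
      K⁻¹ : ℚ
      K⁻¹ = ℚ.1/ K
      0<δ : 0ℚ < K⁻¹ * ε
      0<δ = subst (_< K⁻¹ * ε) (ℚₚ.*-zeroʳ K⁻¹)
              (ℚₚ.*-monoʳ-<-pos K⁻¹ {{ℚₚ.1/pos⇒pos K}} 0<ε)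

    module _ (A B C D : ℕ) {k : ℕ} (p : (A ⊔ B) ⊔ (C ⊔ D) ℕ.≤ k) where
      above₁ : A ℕ.≤ k
      above₁ = ℕₚ.m⊔n≤o⇒m≤o A B (ℕₚ.m⊔n≤o⇒m≤o (A ⊔ B) (C ⊔ D) p)
      above₂ : B ℕ.≤ k
      above₂ = ℕₚ.m⊔n≤o⇒n≤o A B (ℕₚ.m⊔n≤o⇒m≤o (A ⊔ B) (C ⊔ D) p)
      above₃ : C ℕ.≤ k
      above₃ = ℕₚ.m⊔n≤o⇒m≤o C D (ℕₚ.m⊔n≤o⇒n≤o (A ⊔ B) (C ⊔ D) p)
      above₄ : D ℕ.≤ k
      above₄ = ℕₚ.m⊔n≤o⇒n≤o C D (ℕₚ.m⊔n≤o⇒n≤o (A ⊔ B) (C ⊔ D) p)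

    product-cauchy : ∀ x y → IsCauchy x → IsCauchy y → IsCauchy (λ n → x n * y n)
    product-cauchy x y cx cy ε 0<ε =
      let ε/2 , 0<ε/2 , halves = halve ε 0<ε
          K , K>0 , A , bx     = tail-bound x cx
          L , L>0 , B , by     = tail-bound y cy
          δ , 0<δ , hδ         = product-< K {{K>0}} ε/2 0<ε/2
          η , 0<η , hη         = product-< L {{L>0}} ε/2 0<ε/2
          C , hy               = cy δ 0<δ
          D , hx               = cx η 0<η
      in (A ⊔ B) ⊔ (C ⊔ D) , λ m n p q → begin-strict
      ∣ x m * y m - x n * y n ∣
        ≡⟨ cong ∣_∣ (*-diff (x m) (x n) (y m) (y n)) ⟩
      ∣ x m * (y m - y n) + (x m - x n) * y n ∣
        ≤⟨ ℚₚ.∣p+q∣≤∣p∣+∣q∣ (x m * (y m - y n)) ((x m - x n) * y n) ⟩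
      ∣ x m * (y m - y n) ∣ + ∣ (x m - x n) * y n ∣
        ≡⟨ cong (λ z → ∣ x m * (y m - y n) ∣ + ∣ z ∣) (ℚₚ.*-comm (x m - x n) (y n)) ⟩
      ∣ x m * (y m - y n) ∣ + ∣ y n * (x m - x n) ∣
        <⟨ ℚₚ.+-mono-<
             (hδ {x m} {y m - y n} (bx m (above₁ A B C D p))
                (hy m n (above₃ A B C D p) (above₃ A B C D q)))
             (hη {y n} {x m - x n} (by n (above₂ A B C D q))
                (hx m n (above₄ A B C D p) (above₄ A B C D q))) ⟩
      ε/2 + ε/2
        ≡⟨ halves ⟩
      ε ∎
      where open ℚₚ.≤-Reasoning

  ℝ-rawRing : RawRing 0ℓ 0ℓ
  ℝ-rawRing = record
    { Carrier = ℝ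
    ; _≈_     = _≃ℝ_
    ; _+_     = λ x y → mkℝ (λ n → seq x n + seq y n)
                            (sum-cauchy (seq x) (seq y) (cauchy x) (cauchy y))
    ; _*_     = λ x y → mkℝ (λ n → seq x n * seq y n)
                            (product-cauchy (seq x) (seq y) (cauchy x) (cauchy y))
    ; -_      = λ x → mkℝ (λ n → - seq x n) (neg-cauchy (seq x) (cauchy x))
    ; 0#      = fromℚ 0ℚ
    ; 1#      = fromℚ 1ℚ
    }

-- Adjoining a square root of -1 to ℤ and to ℝ gives ℤ[i] and ℂ.
infix 6 _+i_

record Adjoin-i (K : Set) : Set where
  constructor _+i_
  field
    re im : K
open Adjoin-i public

adjoin-i : RawRing 0ℓ 0ℓ → RawRing 0ℓ 0ℓ
adjoin-i K = record
  { Carrier = Adjoin-i Carrier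
  ; _≈_     = λ x y → (re x ≈ re y) × (im x ≈ im y)
  ; _+_     = λ x y → (re x + re y) +i (im x + im y)
  ; _*_     = λ x y → (re x * re y + - (im x * im y)) +i (re x * im y + im x * re y)
  ; -_      = λ x → (- re x) +i (- im x)
  ; 0#      = 0# +i 0#
  ; 1#      = 1# +i 0#
  }
  where open RawRing K

ℤ[i]-rawRing ℂ-rawRing : RawRing 0ℓ 0ℓ
ℤ[i]-rawRing = adjoin-i ℤ.+-*-rawRing
ℂ-rawRing    = adjoin-i ℝ-rawRing

ℤ[i] ℂ : Set
ℤ[i] = Adjoin-i ℤ
ℂ    = Adjoin-i ℝ

module ℤi where
  open RawRing ℤ[i]-rawRing public using (_+_; _*_; -_; 0#; 1#; +-rawMonoid)
  open RawMonoidDefs +-rawMonoid public using (sum)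

  i : ℤ[i]
  i = ℤ.0ℤ +i ℤ.1ℤ

  conj : ℤ[i] → ℤ[i]
  conj (a +i b) = a +i (ℤ.- b)

module ℂ where
  open RawRing ℂ-rawRing public using (_≈_; _+_; _*_; 0#; +-rawMonoid)
  open RawMonoidDefs +-rawMonoid public using (sum)

  embed : ℤ[i] → ℂ
  embed (a +i b) = fromℤ a +i fromℤ b

open ℤi using (conj)

Matrix : ℕ → Set
Matrix n = Fin n → Fin n → ℤ[i]

infixl 7 _⊗_
infix  8 _*ᴴ

_⊗_ : ∀ {n} → Matrix n → Matrix n → Matrix n
(A ⊗ B) u v = ℤi.sum λ k → A u k ℤi.* B k v

_*ᴴ : ∀ {n} → Matrix n → Matrix n
(A *ᴴ) u v = conj (A v u)

𝟙 : ∀ {n} → Matrix n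
𝟙 u v = if ⌊ u Finₚ.≟ v ⌋ then ℤi.1# else ℤi.0#

infix 4 _≐_

_≐_ : ∀ {n} → Matrix n → Matrix n → Set
A ≐ B = ∀ u v → A u v ≡ B u v

Hermitian : ∀ {n} → Matrix n → Set
Hermitian A = A ≐ A *ᴴ

Unitary : ∀ {n} → Matrix n → Set
Unitary Q = (Q ⊗ Q *ᴴ ≐ 𝟙) × (Q *ᴴ ⊗ Q ≐ 𝟙)

-- μ is an arbitrary complex number; that the eigenvalues of a Hermitian
-- matrix are real is not built in.
IsEigenvalue : ∀ {n} → Matrix n → ℂ → Set
IsEigenvalue {n} A μ = ∃ λ (v : Vector ℂ n) →
  ¬ (∀ u → v u ℂ.≈ ℂ.0#) ×
  (∀ u → ℂ.sum (λ k → ℂ.embed (A u k) ℂ.* v k) ℂ.≈ μ ℂ.* v u)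

_∈[-2,2] : ℂ → Set
z ∈[-2,2] = (im z ≃ℝ fromℤ ℤ.0ℤ) × (fromℤ (ℤ.- (ℤ.+ 2)) ≤ℝ re z) × (re z ≤ℝ fromℤ (ℤ.+ 2))

Cyclotomic : ∀ {n} → Matrix n → Set
Cyclotomic A = Hermitian A × (∀ μ → IsEigenvalue A μ → μ ∈[-2,2])

Adjacent : ∀ {n} → Matrix n → Fin n → Fin n → Set
Adjacent A u v = u ≢ v × A u v ≢ ℤi.0#

Indecomposable : ∀ {n} → Matrix n → Set
Indecomposable A = ∀ u v → Star (Adjacent A) u v

-- A arises from B by selecting the rows and columns f 0 < f 1 < ⋯ .
IsPrincipalSubmatrix : ∀ {m n} → Matrix m → Matrix n → Set
IsPrincipalSubmatrix {m} {n} A B = ∃[ f ]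
  (f Preserves Fin._<_ {m} {m} ⟶ Fin._<_ {n} {n}) × (∀ u v → A u v ≡ B (f u) (f v))

MaximalIndecomposableCyclotomic : ∀ {m} → Matrix m → Set
MaximalIndecomposableCyclotomic {m} A =
  Indecomposable A × Cyclotomic A ×
  (∀ {n} (B : Matrix n) → Indecomposable B → Cyclotomic B →
     m ℕ.< n → ¬ IsPrincipalSubmatrix A B)

data Automorphism : Set where
  identity conjugation : Automorphism

apply : Automorphism → ℤ[i] → ℤ[i]
apply identity    z = z
apply conjugation z = conj z

signed : Sign → ℤ[i] → ℤ[i]
signed Sign.+ z = z
signed Sign.- z = ℤi.- z

infix 4 _∼_

-- A = ± σ(Q B Q*) with Q unitary over ℤ[i].
_∼_ : ∀ {n} → Matrix n → Matrix n → Set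
A ∼ B = ∃[ Q ] ∃[ s ] ∃[ σ ]
  Unitary Q × (A ≐ λ u v → signed s (apply σ ((Q ⊗ B ⊗ Q *ᴴ) u v)))

0ᵢ +1ᵢ -1ᵢ 1+i : ℤ[i]
0ᵢ  = ℤi.0#
+1ᵢ = ℤi.1#
-1ᵢ = ℤi.- ℤi.1#
1+i = ℤi.1# ℤi.+ ℤi.i

-- Column j : Fin k of the ladder carries the vertices t = (j , 0F) and
-- b = (j , 1F); vertices are numbered t₁ , b₁ , t₂ , b₂ , … by remQuot.
LadderVertex : ℕ → Set
LadderVertex k = Fin k × Fin 2

isFirst isLast : ∀ {k} → Fin k → Bool
isFirst     j = toℕ j ≡ᵇ 0
isLast  {k} j = suc (toℕ j) ≡ᵇ k

-- All edges from one column to the next leaving t have weight 1, and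
-- those leaving b have weight -1.
ladder : ∀ {k} → LadderVertex k → LadderVertex k → ℤ[i]
ladder (j , r) (l , s) =
  if toℕ l ≡ᵇ suc (toℕ j) then out r else
  if toℕ j ≡ᵇ suc (toℕ l) then out s else 0ᵢ
  where
  out : Fin 2 → ℤ[i]
  out 0F = +1ᵢ
  out 1F = -1ᵢ

-- Both vertices of a column get charge c and are joined with (real) weight w.
rung : (c w : ℤ[i]) → Fin 2 → Fin 2 → ℤ[i]
rung c w r s = if ⌊ r Finₚ.≟ s ⌋ then c else w

firstRung lastRung : ∀ {k} (c w : ℤ[i]) → LadderVertex k → LadderVertex k → ℤ[i]
firstRung c w (j , r) (l , s) = if isFirst j ∧ isFirst l then rung c w r s else 0ᵢ
lastRung  c w (j , r) (l , s) = if isLast  j ∧ isLast  l then rung c w r s else 0ᵢ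

C₂ₖ⁺⁺ C₂ₖ⁺⁻ : ∀ k → Matrix (k ℕ.* 2)
C₂ₖ⁺⁺ k u v = ladder x y ℤi.+ firstRung +1ᵢ +1ᵢ x y ℤi.+ lastRung +1ᵢ -1ᵢ x y
  where
  x y : LadderVertex k
  x = remQuot 2 u
  y = remQuot 2 v
C₂ₖ⁺⁻ k u v = ladder x y ℤi.+ firstRung +1ᵢ +1ᵢ x y ℤi.+ lastRung -1ᵢ +1ᵢ x y
  where
  x y : LadderVertex k
  x = remQuot 2 u
  y = remQuot 2 v

-- The vertex p is numbered zero.
C₂ₖ₊₁ : ∀ k → Matrix (suc (k ℕ.* 2))
C₂ₖ₊₁ k = w
  where
  toP : LadderVertex k → ℤ[i]
  toP (j , _) = if isFirst j then 1+i else 0ᵢ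

  w : Matrix (suc (k ℕ.* 2))
  w zero    zero    = 0ᵢ
  w (suc u) zero    = toP (remQuot 2 u)
  w zero    (suc v) = conj (toP (remQuot 2 v))
  w (suc u) (suc v) = ladder x y ℤi.+ lastRung +1ᵢ -1ᵢ x y
    where
    x y : LadderVertex k
    x = remQuot 2 u
    y = remQuot 2 v

-- An entry (u , v , z) stands for w(u , v) = z and w(v , u) = conj z; an
-- entry (u , u , c) gives u the charge c.
fromWeights : ∀ {n} → List (Fin n × Fin n × ℤ[i]) → Matrix n
fromWeights []                 x y = 0ᵢ
fromWeights ((u , v , z) ∷ es) x y =
  if ⌊ x Finₚ.≟ u ⌋ ∧ ⌊ y Finₚ.≟ v ⌋ then z else
  if ⌊ x Finₚ.≟ v ⌋ ∧ ⌊ y Finₚ.≟ u ⌋ then conj z else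
  fromWeights es x y

private
  pattern a = 0F
  pattern b = 1F
  pattern c = 2F
  pattern d = 3F
  pattern e = 4F
  pattern f = 5F
  pattern g = 6F
  pattern h = 7F

S₁ : Matrix 1
S₁ = fromWeights ((a , a , +1ᵢ ℤi.+ +1ᵢ) ∷ [])

S₄ : Matrix 4
S₄ = fromWeights
  ( (a , a , +1ᵢ) ∷ (b , b , -1ᵢ) ∷ (c , c , -1ᵢ) ∷ (d , d , +1ᵢ)
  ∷ (a , b , +1ᵢ) ∷ (c , d , +1ᵢ) ∷ (a , c , ℤi.- 1+i) ∷ (b , d , 1+i) ∷ [])

S₄† : Matrix 4
S₄† = fromWeights
  ( (a , a , +1ᵢ) ∷ (c , c , -1ᵢ)
  ∷ (a , b , +1ᵢ) ∷ (c , d , +1ᵢ) ∷ (b , c , +1ᵢ)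
  ∷ (a , d , -1ᵢ) ∷ (c , a , ℤi.i) ∷ (b , d , 1+i) ∷ [])

S₇ : Matrix 7
S₇ = fromWeights
  ( (a , a , +1ᵢ) ∷ (e , e , +1ᵢ) ∷ (f , f , +1ᵢ) ∷ (d , d , -1ᵢ)
  ∷ (a , b , +1ᵢ) ∷ (a , d , +1ᵢ) ∷ (c , f , +1ᵢ) ∷ (b , g , +1ᵢ) ∷ (d , e , +1ᵢ)
  ∷ (d , f , +1ᵢ) ∷ (c , g , +1ᵢ) ∷ (e , g , +1ᵢ) ∷ (b , c , +1ᵢ)
  ∷ (a , c , -1ᵢ) ∷ (f , g , -1ᵢ) ∷ (b , e , -1ᵢ) ∷ [])

S₈ : Matrix 8
S₈ = fromWeights
  ( (b , b , +1ᵢ) ∷ (c , c , +1ᵢ) ∷ (e , e , +1ᵢ) ∷ (h , h , +1ᵢ)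
  ∷ (a , a , -1ᵢ) ∷ (d , d , -1ᵢ) ∷ (f , f , -1ᵢ) ∷ (g , g , -1ᵢ)
  ∷ (a , b , +1ᵢ) ∷ (a , e , +1ᵢ) ∷ (c , g , +1ᵢ) ∷ (c , d , +1ᵢ) ∷ (b , d , +1ᵢ)
  ∷ (e , f , +1ᵢ) ∷ (e , g , +1ᵢ) ∷ (f , h , +1ᵢ) ∷ (d , h , +1ᵢ)
  ∷ (a , c , -1ᵢ) ∷ (b , f , -1ᵢ) ∷ (g , h , -1ᵢ) ∷ [])

S₈′ : Matrix 8
S₈′ = fromWeights
  ( (b , b , +1ᵢ) ∷ (g , g , +1ᵢ) ∷ (a , a , -1ᵢ) ∷ (h , h , -1ᵢ)
  ∷ (a , b , +1ᵢ) ∷ (a , c , +1ᵢ) ∷ (a , e , +1ᵢ) ∷ (c , g , +1ᵢ) ∷ (b , d , +1ᵢ)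
  ∷ (e , f , +1ᵢ) ∷ (g , h , +1ᵢ) ∷ (f , h , +1ᵢ) ∷ (d , h , +1ᵢ) ∷ (d , f , +1ᵢ)
  ∷ (c , e , +1ᵢ)
  ∷ (c , d , -1ᵢ) ∷ (b , f , -1ᵢ) ∷ (e , g , -1ᵢ) ∷ [])

data IsListed : ∀ {n} → Matrix n → Set where
  C⁺⁺  : ∀ k → 2 ℕ.≤ k → IsListed (C₂ₖ⁺⁺ k)
  C⁺⁻  : ∀ k → 2 ℕ.≤ k → IsListed (C₂ₖ⁺⁻ k)
  Cᵒᵈᵈ : ∀ k → 1 ℕ.≤ k → IsListed (C₂ₖ₊₁ k)
  S1   : IsListed S₁
  S4   : IsListed S₄
  S4†  : IsListed S₄†
  S7   : IsListed S₇
  S8   : IsListed S₈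
  S8′  : IsListed S₈′

-- The condition on the eigenvalues amounts to 2⟨x , x⟩ ± ⟨x , A x⟩ ≥ 0 for all Gaussian integer vectors x: if
-- this fails at x, bisection on the Lanczos polynomials of x produces a real eigenvalue outside [-2 , 2].
-- A vertex with column c can be joined to A as soon as (4 - A²) y is a multiple s c with s large compared to
-- ⟨y , (4 - A²) y⟩, which is impossible if A is maximal. Vectors y supported on one or two vertices then show
-- that every row of A has norm 4, i.e. A² = 4, once some vertex is charged. The orthogonality of the rows
-- now determines how A grows from a charged vertex: if two vertices with the same charge are joined by a
-- unit, A is a ladder and is recovered column by column; otherwise a finite search through the small
-- principal submatrices around the charged vertex ends in one of S₄, S₄†, S₇, S₈, S₈′.

module Submission where

open import Defs
open import Data.Empty using (⊥; ⊥-elim)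
open import Data.Fin.Base as Fin using (Fin; zero; suc)
import Data.Fin.Properties as Finₚ
open import Data.Integer.Base as ℤ using (ℤ)
import Data.Integer.Properties as ℤₚ
open import Data.List.Base using (List; []; _∷_)
open import Data.Nat.Base as ℕ using (ℕ; zero; suc; z≤n; s≤s)
import Data.Nat.Properties as ℕₚ
open import Data.Product.Base using (_×_; _,_; ∃; ∃-syntax; proj₁; proj₂)
open import Data.Sum.Base using (_⊎_; inj₁; inj₂)
open import Data.Unit.Base using (⊤; tt)
open import Function.Base using (_∘_)
open import Relation.Binary.PropositionalEquality
open import Relation.Nullary using (¬_; Dec; yes; no; contradiction)
open ℤi using (conj)

module InnerProduct where
  open import Algebra.Structures using (IsCommutativeRing)
  open import Algebra.Bundles using (CommutativeRing; RawRing)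
  open import Level using (0ℓ)
  import Algebra.Properties.Semiring.Sum as SemiringSum

  module Adjoined {C : Set} {_+_ _*_ : C → C → C} { -_ : C → C} {0# 1# : C}
    (isCR : IsCommutativeRing _≡_ _+_ _*_ -_ 0# 1#)
    (*-assoc-re : ∀ a b c d e f →
       ((((a * c) + (- (b * d))) * e) + (- (((a * d) + (b * c)) * f))) ≡
       ((a * ((c * e) + (- (d * f)))) + (- (b * ((c * f) + (d * e))))))
    (*-assoc-im : ∀ a b c d e f →
       ((((a * c) + (- (b * d))) * f) + (((a * d) + (b * c)) * e)) ≡
       ((a * ((c * f) + (d * e))) + (b * ((c * e) + (- (d * f))))))
    (distribˡ-re : ∀ a b c d e f →
       ((a * (c + e)) + (- (b * (d + f)))) ≡ (((a * c) + (- (b * d))) + ((a * e) + (- (b * f)))))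
    (distribˡ-im : ∀ a b c d e f →
       ((a * (d + f)) + (b * (c + e))) ≡ (((a * d) + (b * c)) + ((a * f) + (b * e))))
    (identityˡ-re : ∀ a b → ((1# * a) + (- (0# * b))) ≡ a)
    (identityˡ-im : ∀ a b → ((1# * b) + (0# * a)) ≡ b)
    (adjoint-eq : ∀ p q a b c d →
       ((p * ((a * c) + (- (b * d)))) + (q * ((a * d) + (b * c)))) ≡
       ((((a * p) + (- ((- b) * q))) * c) + (((a * q) + ((- b) * p)) * d)))
    where

    scalars : CommutativeRing 0ℓ 0ℓ
    scalars = record { isCommutativeRing = isCR }

    private
      module S = CommutativeRing scalars
      G : RawRing 0ℓ 0ℓ
      G = adjoin-i (CommutativeRing.rawRing scalars)
      open RawRing G using () renaming (_+_ to _⊞_; _*_ to _⊠_; -_ to ⊟_; 0# to 𝟎; 1# to 𝟏)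

    +i-comm-* : ∀ x y → x ⊠ y ≡ y ⊠ x
    +i-comm-* (a +i b) (c +i d) = cong₂ _+i_
      (cong₂ (λ u v → u + (- v)) (S.*-comm a c) (S.*-comm b d))
      (trans (S.+-comm (a * d) (b * c)) (cong₂ _+_ (S.*-comm b c) (S.*-comm a d)))

    isCommutativeRing : IsCommutativeRing _≡_ _⊞_ _⊠_ ⊟_ 𝟎 𝟏
    isCommutativeRing = record
      { isRing = record
        { +-isAbelianGroup = record
          { isGroup = record
            { isMonoid = record
              { isSemigroup = record
                { isMagma = record { isEquivalence = isEquivalence ; ∙-cong = cong₂ _⊞_ }
                ; assoc = λ x y z → cong₂ _+i_ (S.+-assoc (re x) (re y) (re z)) (S.+-assoc (im x) (im y) (im z)) }
              ; identity = (λ x → cong₂ _+i_ (S.+-identityˡ (re x)) (S.+-identityˡ (im x)))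
                         , (λ x → cong₂ _+i_ (S.+-identityʳ (re x)) (S.+-identityʳ (im x))) }
            ; inverse = (λ x → cong₂ _+i_ (S.-‿inverseˡ (re x)) (S.-‿inverseˡ (im x)))
                      , (λ x → cong₂ _+i_ (S.-‿inverseʳ (re x)) (S.-‿inverseʳ (im x)))
            ; ⁻¹-cong = cong ⊟_ }
          ; comm = λ x y → cong₂ _+i_ (S.+-comm (re x) (re y)) (S.+-comm (im x) (im y)) }
        ; *-cong = cong₂ _⊠_
        ; *-assoc = λ { (a +i b) (c +i d) (e +i f) → cong₂ _+i_ (*-assoc-re a b c d e f) (*-assoc-im a b c d e f) }
        ; *-identity = idˡ , λ x → trans (+i-comm-* x 𝟏) (idˡ x)
        ; distrib = dˡ , λ x y z → trans (+i-comm-* (y ⊞ z) x)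
            (trans (dˡ x y z) (cong₂ _⊞_ (+i-comm-* x y) (+i-comm-* x z))) }
      ; *-comm = +i-comm-* }
      where
      idˡ : ∀ x → 𝟏 ⊠ x ≡ x
      idˡ (a +i b) = cong₂ _+i_ (identityˡ-re a b) (identityˡ-im a b)
      dˡ : ∀ x y z → x ⊠ (y ⊞ z) ≡ (x ⊠ y) ⊞ (x ⊠ z)
      dˡ (a +i b) (c +i d) (e +i f) = cong₂ _+i_ (distribˡ-re a b c d e f) (distribˡ-im a b c d e f)

    gaussian : CommutativeRing 0ℓ 0ℓ
    gaussian = record { isCommutativeRing = isCommutativeRing }

    private
      module ΣS = SemiringSum (CommutativeRing.semiring scalars)
      module ΣG = SemiringSum (CommutativeRing.semiring gaussian)

    star : Adjoin-i C → Adjoin-i C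
    star (a +i b) = a +i (- b)

    re-sum : ∀ {n} (f : Fin n → Adjoin-i C) → re (ΣG.sum f) ≡ ΣS.sum (re ∘ f)
    re-sum {zero}  f = refl
    re-sum {suc n} f = cong (re (f zero) +_) (re-sum (f ∘ suc))

    im-sum : ∀ {n} (f : Fin n → Adjoin-i C) → im (ΣG.sum f) ≡ ΣS.sum (im ∘ f)
    im-sum {zero}  f = refl
    im-sum {suc n} f = cong (im (f zero) +_) (im-sum (f ∘ suc))

    Vec : ℕ → Set
    Vec n = Fin n → Adjoin-i C

    infixl 6 _⊕_
    infixr 7 _⊙_ _∙_

    _⊕_ : ∀ {n} → Vec n → Vec n → Vec n
    (x ⊕ y) u = x u ⊞ y u

    _⊙_ : ∀ {n} → Adjoin-i C → Vec n → Vec n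
    (s ⊙ x) u = s ⊠ x u

    _∙_ : ∀ {n} → (Fin n → Fin n → Adjoin-i C) → Vec n → Vec n
    (A ∙ x) u = ΣG.sum λ k → A u k ⊠ x k

    dot : Adjoin-i C → Adjoin-i C → C
    dot x y = (re x * re y) + (im x * im y)

    -- The real inner product Re ⟨x , y⟩; real-valuedness makes it symmetric.
    B : ∀ {n} → Vec n → Vec n → C
    B x y = ΣS.sum λ u → dot (x u) (y u)

    B-cong : ∀ {n} {x x′ y y′ : Vec n} → x ≗ x′ → y ≗ y′ → B x y ≡ B x′ y′
    B-cong p q = ΣS.sum-cong-≗ λ u → cong₂ dot (p u) (q u)

    dot-comm : ∀ x y → dot x y ≡ dot y x
    dot-comm (a +i b) (c +i d) = cong₂ _+_ (S.*-comm a c) (S.*-comm b d)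

    B-comm : ∀ {n} (x y : Vec n) → B x y ≡ B y x
    B-comm x y = ΣS.sum-cong-≗ λ u → dot-comm (x u) (y u)

    private
      interchange : ∀ a b c d → (a + b) + (c + d) ≡ (a + c) + (b + d)
      interchange a b c d = begin
        (a + b) + (c + d)  ≡⟨ S.+-assoc a b (c + d) ⟩
        a + (b + (c + d))  ≡⟨ cong (a +_) (S.+-assoc b c d) ⟨
        a + ((b + c) + d)  ≡⟨ cong (λ z → a + (z + d)) (S.+-comm b c) ⟩
        a + ((c + b) + d)  ≡⟨ cong (a +_) (S.+-assoc c b d) ⟩
        a + (c + (b + d))  ≡⟨ S.+-assoc a c (b + d) ⟨
        (a + c) + (b + d)  ∎
        where open ≡-Reasoning

    dot-⊞ʳ : ∀ x y z → dot x (y ⊞ z) ≡ dot x y + dot x z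
    dot-⊞ʳ (a +i b) (c +i d) (e +i f) =
      trans (cong₂ _+_ (S.distribˡ a c e) (S.distribˡ b d f)) (interchange _ _ _ _)

    B-⊕ʳ : ∀ {n} (x y z : Vec n) → B x (y ⊕ z) ≡ B x y + B x z
    B-⊕ʳ x y z = trans (ΣS.sum-cong-≗ λ u → dot-⊞ʳ (x u) (y u) (z u))
      (ΣS.∑-distrib-+ (λ u → dot (x u) (y u)) (λ u → dot (x u) (z u)))

    B-⊕ˡ : ∀ {n} (x y z : Vec n) → B (x ⊕ y) z ≡ B x z + B y z
    B-⊕ˡ x y z = trans (B-comm (x ⊕ y) z) (trans (B-⊕ʳ z x y) (cong₂ _+_ (B-comm z x) (B-comm z y)))

    dot-⊠ : ∀ x s y → dot x (s ⊠ y) ≡ dot (star s ⊠ x) y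
    dot-⊠ (p +i q) (a +i b) (c +i d) = adjoint-eq p q a b c d

    ∙-cong : ∀ {n} (A : Fin n → Fin n → Adjoin-i C) {x y : Vec n} → x ≗ y → A ∙ x ≗ A ∙ y
    ∙-cong A p u = ΣG.sum-cong-≗ λ k → cong (A u k ⊠_) (p k)

    ∙-⊕ : ∀ {n} (A : Fin n → Fin n → Adjoin-i C) (x y : Vec n) → A ∙ (x ⊕ y) ≗ A ∙ x ⊕ A ∙ y
    ∙-⊕ A x y u = trans (ΣG.sum-cong-≗ λ k → IsCommutativeRing.distribˡ isCommutativeRing (A u k) (x k) (y k))
      (ΣG.∑-distrib-+ (λ k → A u k ⊠ x k) (λ k → A u k ⊠ y k))

    ∙-⊙ : ∀ {n} (A : Fin n → Fin n → Adjoin-i C) s (x : Vec n) → A ∙ (s ⊙ x) ≗ s ⊙ (A ∙ x)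
    ∙-⊙ A s x u = trans (ΣG.sum-cong-≗ λ k → swap (A u k) s (x k))
      (sym (ΣG.*-distribˡ-sum s (λ k → A u k ⊠ x k)))
      where
      open IsCommutativeRing isCommutativeRing using (*-assoc; *-comm)
      swap : ∀ a b c → a ⊠ (b ⊠ c) ≡ b ⊠ (a ⊠ c)
      swap a b c = trans (sym (*-assoc a b c)) (trans (cong (_⊠ c) (*-comm a b)) (*-assoc b a c))

    dot-sumʳ : ∀ {n} x (f : Fin n → Adjoin-i C) → dot x (ΣG.sum f) ≡ ΣS.sum λ k → dot x (f k)
    dot-sumʳ {zero}  x f = trans (cong₂ _+_ (S.zeroʳ (re x)) (S.zeroʳ (im x))) (S.+-identityˡ 0#)
    dot-sumʳ {suc n} x f = trans (dot-⊞ʳ x (f zero) (ΣG.sum (f ∘ suc))) (cong (dot x (f zero) +_) (dot-sumʳ x (f ∘ suc)))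

    self-adjoint : ∀ {n} (A : Fin n → Fin n → Adjoin-i C) → (∀ u v → A u v ≡ star (A v u)) →
                   ∀ x y → B x (A ∙ y) ≡ B (A ∙ x) y
    self-adjoint A herm x y = begin
      B x (A ∙ y)
        ≡⟨ ΣS.sum-cong-≗ (λ u → dot-sumʳ (x u) (λ k → A u k ⊠ y k)) ⟩
      ΣS.sum (λ u → ΣS.sum λ k → dot (x u) (A u k ⊠ y k))
        ≡⟨ ΣS.∑-comm (λ u k → dot (x u) (A u k ⊠ y k)) ⟩
      ΣS.sum (λ k → ΣS.sum λ u → dot (x u) (A u k ⊠ y k))
        ≡⟨ ΣS.sum-cong-≗ (λ k → ΣS.sum-cong-≗ (λ u → flip-entry k u)) ⟩
      ΣS.sum (λ k → ΣS.sum λ u → dot (y k) (A k u ⊠ x u))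
        ≡⟨ ΣS.sum-cong-≗ (λ k → dot-sumʳ (y k) (λ u → A k u ⊠ x u)) ⟨
      B y (A ∙ x)
        ≡⟨ B-comm y (A ∙ x) ⟩
      B (A ∙ x) y ∎
      where
      open ≡-Reasoning
      flip-entry : ∀ k u → dot (x u) (A u k ⊠ y k) ≡ dot (y k) (A k u ⊠ x u)
      flip-entry k u = trans (dot-⊠ (x u) (A u k) (y k))
        (trans (cong (λ z → dot (z ⊠ x u) (y k)) (sym (herm k u))) (dot-comm (A k u ⊠ x u) (y k)))

    single : ∀ {n} → Fin n → Adjoin-i C → Vec n
    single zero    s zero    = s
    single zero    s (suc v) = 𝟎
    single (suc u) s zero    = 𝟎
    single (suc u) s (suc v) = single u s v

    private
      dot-0 : ∀ y → dot 𝟎 y ≡ 0#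
      dot-0 y = trans (cong₂ _+_ (S.zeroˡ (re y)) (S.zeroˡ (im y))) (S.+-identityˡ 0#)

    B-single : ∀ {n} u s (y : Vec n) → B (single u s) y ≡ dot s (y u)
    B-single {suc n} zero s y = trans (cong (dot s (y zero) +_)
      (trans (ΣS.sum-cong-≗ λ v → dot-0 (y (suc v))) (ΣS.sum-replicate-zero n))) (S.+-identityʳ _)
    B-single {suc n} (suc u) s y = trans (cong₂ _+_ (dot-0 (y zero)) (B-single u s (y ∘ suc))) (S.+-identityˡ _)

    single-self : ∀ {n} (u : Fin n) s → single u s u ≡ s
    single-self zero    s = refl
    single-self (suc u) s = single-self u s

    single-other : ∀ {n} (u v : Fin n) s → u ≢ v → single u s v ≡ 𝟎
    single-other zero    zero    s u≢v = contradiction refl u≢v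
    single-other zero    (suc v) s u≢v = refl
    single-other (suc u) zero    s u≢v = refl
    single-other (suc u) (suc v) s u≢v = single-other u v s (u≢v ∘ cong suc)

    ∙-single : ∀ {n} (A : Fin n → Fin n → Adjoin-i C) u s → A ∙ single u s ≗ λ v → A v u ⊠ s
    ∙-single A u s v = go (A v) u
      where
      open CommutativeRing gaussian using (zeroʳ; +-identityˡ; +-identityʳ)
      go : ∀ {m} (f : Vec m) (u : Fin m) → ΣG.sum (λ k → f k ⊠ single u s k) ≡ f u ⊠ s
      go {suc m} f zero = trans (cong ((f zero ⊠ s) ⊞_)
        (trans (ΣG.sum-cong-≗ λ k → zeroʳ (f (suc k))) (ΣG.sum-replicate-zero m))) (+-identityʳ _)
      go {suc m} f (suc u) = trans (cong₂ _⊞_ (zeroʳ (f zero)) (go (f ∘ suc) u)) (+-identityˡ _)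

module GaussianIntegers where
  open InnerProduct
  open import Data.Integer.Base using (_+_; _*_; -_; _-_; _≤_; 0ℤ; 1ℤ; +_)
  open import Data.Integer.Tactic.RingSolver using (solve-∀)

  private
    *-assoc-re : ∀ a b c d e f →
      (a * c + - (b * d)) * e + - ((a * d + b * c) * f) ≡ a * (c * e + - (d * f)) + - (b * (c * f + d * e))
    *-assoc-re = solve-∀

    *-assoc-im : ∀ a b c d e f →
      (a * c + - (b * d)) * f + (a * d + b * c) * e ≡ a * (c * f + d * e) + b * (c * e + - (d * f))
    *-assoc-im = solve-∀

    distribˡ-re : ∀ a b c d e f → a * (c + e) + - (b * (d + f)) ≡ (a * c + - (b * d)) + (a * e + - (b * f))
    distribˡ-re = solve-∀

    distribˡ-im : ∀ a b c d e f → a * (d + f) + b * (c + e) ≡ (a * d + b * c) + (a * f + b * e)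
    distribˡ-im = solve-∀

    identityˡ-re : ∀ a b → 1ℤ * a + - (0ℤ * b) ≡ a
    identityˡ-re = solve-∀

    identityˡ-im : ∀ a b → 1ℤ * b + 0ℤ * a ≡ b
    identityˡ-im = solve-∀

    adjoint : ∀ p q a b c d → p * (a * c + - (b * d)) + q * (a * d + b * c) ≡
      (a * p + - (- b * q)) * c + (a * q + - b * p) * d
    adjoint = solve-∀

  module Zi = Adjoined ℤₚ.+-*-isCommutativeRing
    *-assoc-re *-assoc-im distribˡ-re distribˡ-im identityˡ-re identityˡ-im adjoint

  Psd± : ∀ {n} → Matrix n → Set
  Psd± {n} A = ∀ (x : Zi.Vec n) →
    0ℤ ≤ + 2 * Zi.B x x + Zi.B x (A Zi.∙ x) × 0ℤ ≤ + 2 * Zi.B x x - Zi.B x (A Zi.∙ x)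

module GaussianRationals where
  open InnerProduct
  open GaussianIntegers public
  open import Data.Maybe.Base using (just; nothing)
  open import Data.Rational.Base as ℚ using (0ℚ; 1ℚ; _+_; _*_; -_)
  import Data.Rational.Properties as ℚₚ
  open import Data.Rational.Properties using () renaming (_≟_ to _≟q_)
  open import Tactic.RingSolver using () renaming (solve-∀ to solve-ring)
  open import Tactic.RingSolver.Core.AlmostCommutativeRing using (AlmostCommutativeRing; fromCommutativeRing)
  open import Level using (0ℓ)
  open import Data.Maybe.Base using (Maybe)

  isZero : ∀ q → Maybe (0ℚ ≡ q)
  isZero q with 0ℚ ≟q q
  ... | yes p = just p
  ... | no  _ = nothing

  ℚ-ring : AlmostCommutativeRing 0ℓ 0ℓ
  ℚ-ring = fromCommutativeRing ℚₚ.+-*-commutativeRing isZero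

  private
    *-assoc-re : ∀ a b c d e f →
      (a * c + - (b * d)) * e + - ((a * d + b * c) * f) ≡ a * (c * e + - (d * f)) + - (b * (c * f + d * e))
    *-assoc-re = solve-ring ℚ-ring

    *-assoc-im : ∀ a b c d e f →
      (a * c + - (b * d)) * f + (a * d + b * c) * e ≡ a * (c * f + d * e) + b * (c * e + - (d * f))
    *-assoc-im = solve-ring ℚ-ring

    distribˡ-re : ∀ a b c d e f → a * (c + e) + - (b * (d + f)) ≡ (a * c + - (b * d)) + (a * e + - (b * f))
    distribˡ-re = solve-ring ℚ-ring

    distribˡ-im : ∀ a b c d e f → a * (d + f) + b * (c + e) ≡ (a * d + b * c) + (a * f + b * e)
    distribˡ-im = solve-ring ℚ-ring

    identityˡ-re : ∀ a b → 1ℚ * a + - (0ℚ * b) ≡ a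
    identityˡ-re = solve-ring ℚ-ring

    identityˡ-im : ∀ a b → 1ℚ * b + 0ℚ * a ≡ b
    identityˡ-im = solve-ring ℚ-ring

    adjoint : ∀ p q a b c d → p * (a * c + - (b * d)) + q * (a * d + b * c) ≡
      (a * p + - (- b * q)) * c + (a * q + - b * p) * d
    adjoint = solve-ring ℚ-ring

  module Qi = Adjoined ℚₚ.+-*-isCommutativeRing
    *-assoc-re *-assoc-im distribˡ-re distribˡ-im identityˡ-re identityˡ-im adjoint

module RationalArithmetic where
  open GaussianRationals
  import Data.Integer.Tactic.RingSolver as ℤ-Solver
  open import Data.Rational.Base
  open import Data.Rational.Properties
  import Data.Rational.Unnormalised.Base as ℚᵘ
  import Data.Rational.Unnormalised.Properties as ℚᵘₚ
  open import Relation.Binary.Definitions using (tri<; tri≈; tri>)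
  open import Tactic.RingSolver using (solve-∀)
  import Algebra.Properties.Semiring.Sum as SemiringSum
  open import Algebra.Bundles using (CommutativeRing)

  <⇒≱ : ∀ {x y} → x < y → ¬ (y ≤ x)
  <⇒≱ p q = <-irrefl refl (<-≤-trans p q)

  ≤∧≢⇒< : ∀ {x y} → x ≤ y → x ≢ y → x < y
  ≤∧≢⇒< {x} {y} p ne with <-cmp x y
  ... | tri< a _ _ = a
  ... | tri≈ _ b _ = contradiction b ne
  ... | tri> _ _ c = contradiction p (<⇒≱ c)

  0≤-diff : ∀ {x y} → x ≤ y → 0ℚ ≤ y - x
  0≤-diff {x} {y} p = subst (_≤ y - x) (+-inverseʳ x) (+-monoˡ-≤ (- x) p)

  0<-diff : ∀ {x y} → x < y → 0ℚ < y - x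
  0<-diff {x} {y} p = subst (_< y - x) (+-inverseʳ x) (+-monoˡ-< (- x) p)

  ≤-by : ∀ {x y} z → 0ℚ ≤ z → x + z ≡ y → x ≤ y
  ≤-by {x} {y} z p e = subst₂ _≤_ (+-identityʳ x) e (+-monoʳ-≤ x p)

  <-by : ∀ {x y} z → 0ℚ < z → x + z ≡ y → x < y
  <-by {x} {y} z p e = subst₂ _<_ (+-identityʳ x) e (+-monoʳ-< x p)

  0≤* : ∀ {x y} → 0ℚ ≤ x → 0ℚ ≤ y → 0ℚ ≤ x * y
  0≤* {x} {y} p q = nonNegative⁻¹ (x * y) {{nonNeg*nonNeg⇒nonNeg x {{nonNegative p}} y {{nonNegative q}}}}

  0<* : ∀ {x y} → 0ℚ < x → 0ℚ < y → 0ℚ < x * y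
  0<* {x} {y} p q = positive⁻¹ (x * y) {{pos*pos⇒pos x {{positive p}} y {{positive q}}}}

  0≤+ : ∀ {x y} → 0ℚ ≤ x → 0ℚ ≤ y → 0ℚ ≤ x + y
  0≤+ {x} {y} p q = +-mono-≤ p q

  0<+≤ : ∀ {x y} → 0ℚ < x → 0ℚ ≤ y → 0ℚ < x + y
  0<+≤ p q = +-mono-<-≤ p q

  0≤-square : ∀ x → 0ℚ ≤ x * x
  0≤-square x with ≤-total 0ℚ x
  ... | inj₁ p = 0≤* p p
  ... | inj₂ p = subst (0ℚ ≤_) (lemma x) (0≤* (0≤-neg p) (0≤-neg p))
    where
    0≤-neg : ∀ {y} → y ≤ 0ℚ → 0ℚ ≤ - y
    0≤-neg q = neg-antimono-≤ q
    lemma : ∀ y → (- y) * (- y) ≡ y * y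
    lemma = solve-∀ ℚ-ring

  inv : ℚ → ℚ
  inv q with q ≟ 0ℚ
  ... | yes _ = 0ℚ
  ... | no ≢0 = 1/_ q {{≢-nonZero ≢0}}

  *-inv : ∀ q → q ≢ 0ℚ → q * inv q ≡ 1ℚ
  *-inv q q≢0 with q ≟ 0ℚ
  ... | yes p = contradiction p q≢0
  ... | no ≢0 = *-inverseʳ q {{≢-nonZero ≢0}}

  0≤inv : ∀ q → 0ℚ ≤ q → 0ℚ ≤ inv q
  0≤inv q 0≤q with q ≟ 0ℚ
  ... | yes p = ≤-refl
  ... | no ≢0 with ≤-total 0ℚ (1/_ q {{≢-nonZero ≢0}})
  ...   | inj₁ p = p
  ...   | inj₂ p = contradiction one≤0 (<⇒≱ {0ℚ} {1ℚ} (positive⁻¹ 1ℚ))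
    where
    one≤0 : 1ℚ ≤ 0ℚ
    one≤0 = subst₂ _≤_ (*-inverseʳ q {{≢-nonZero ≢0}}) (*-zeroʳ q) (*-monoˡ-≤-nonNeg q {{nonNegative 0≤q}} p)

  0<inv : ∀ q → 0ℚ < q → 0ℚ < inv q
  0<inv q 0<q = ≤∧≢⇒< (0≤inv q (<⇒≤ 0<q)) λ e → 1≢0 (trans (sym (*-inv q (≢-sym (<⇒≢ 0<q)))) (trans (cong (q *_) (sym e)) (*-zeroʳ q)))

  <∣∣ : ∀ {x e} → x < e → - e < x → ∣ x ∣ < e
  <∣∣ {x} {e} p q with ∣p∣≡p∨∣p∣≡-p x
  ... | inj₁ eq = subst (_< e) (sym eq) p
  ... | inj₂ eq = subst (_< e) (sym eq) (subst (- x <_) (-‿involutive e) (neg-antimono-< q))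
    where
    -‿involutive : ∀ y → - (- y) ≡ y
    -‿involutive = solve-∀ ℚ-ring

  x≤∣x∣ : ∀ x → x ≤ ∣ x ∣
  x≤∣x∣ x with ≤-total 0ℚ x
  ... | inj₁ p = ≤-reflexive (sym (0≤p⇒∣p∣≡p p))
  ... | inj₂ p = ≤-trans p (0≤∣p∣ x)

  -x≤∣x∣ : ∀ x → - x ≤ ∣ x ∣
  -x≤∣x∣ x = subst (- x ≤_) (∣-p∣≡∣p∣ x) (x≤∣x∣ (- x))

  ι : ℤ → ℚ
  ι z = z / 1

  module _ where
    private
      u : ∀ z → toℚᵘ (ι z) ℚᵘ.≃ ℚᵘ.mkℚᵘ z 0
      u z = toℚᵘ-fromℚᵘ (ℚᵘ.mkℚᵘ z 0)

    ι-+ : ∀ a b → ι (a ℤ.+ b) ≡ ι a + ι b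
    ι-+ a b = toℚᵘ-injective (ℚᵘₚ.≃-trans (u (a ℤ.+ b)) (ℚᵘₚ.≃-sym
      (ℚᵘₚ.≃-trans (toℚᵘ-homo-+ (ι a) (ι b)) (ℚᵘₚ.≃-trans (ℚᵘₚ.+-cong (u a) (u b)) (ℚᵘ.*≡* (lem a b))))))
      where
      lem : ∀ a b → (a ℤ.* ℤ.1ℤ ℤ.+ b ℤ.* ℤ.1ℤ) ℤ.* ℤ.1ℤ ≡ (a ℤ.+ b) ℤ.* ℤ.1ℤ
      lem = ℤ-Solver.solve-∀

    ι-* : ∀ a b → ι (a ℤ.* b) ≡ ι a * ι b
    ι-* a b = toℚᵘ-injective (ℚᵘₚ.≃-trans (u (a ℤ.* b)) (ℚᵘₚ.≃-sym
      (ℚᵘₚ.≃-trans (toℚᵘ-homo-* (ι a) (ι b)) (ℚᵘₚ.≃-trans (ℚᵘₚ.*-cong (u a) (u b)) (ℚᵘ.*≡* refl)))))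

    ι-neg : ∀ a → ι (ℤ.- a) ≡ - ι a
    ι-neg a = toℚᵘ-injective (ℚᵘₚ.≃-trans (u (ℤ.- a)) (ℚᵘₚ.≃-sym
      (ℚᵘₚ.≃-trans (toℚᵘ-homo‿- (ι a)) (ℚᵘₚ.-‿cong (u a)))))

    ι-mono-≤ : ∀ {a b} → a ℤ.≤ b → ι a ≤ ι b
    ι-mono-≤ {a} {b} p = toℚᵘ-cancel-≤ (ℚᵘₚ.≤-respˡ-≃ (ℚᵘₚ.≃-sym (u a)) (ℚᵘₚ.≤-respʳ-≃ (ℚᵘₚ.≃-sym (u b))
      (ℚᵘ.*≤* (ℤₚ.*-monoʳ-≤-nonNeg ℤ.1ℤ p))))

    ι-mono-< : ∀ {a b} → a ℤ.< b → ι a < ι b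
    ι-mono-< {a} {b} p = toℚᵘ-cancel-< (ℚᵘₚ.<-respˡ-≃ (ℚᵘₚ.≃-sym (u a)) (ℚᵘₚ.<-respʳ-≃ (ℚᵘₚ.≃-sym (u b))
      (ℚᵘ.*<* (ℤₚ.*-monoʳ-<-pos ℤ.1ℤ p))))

  ι-cancel-≤ : ∀ {a b} → ι a ≤ ι b → a ℤ.≤ b
  ι-cancel-≤ {a} {b} p with a ℤₚ.≤? b
  ... | yes q = q
  ... | no ¬q = contradiction p (<⇒≱ (ι-mono-< (ℤₚ.≰⇒> ¬q)))

  archimedean : ∀ q → ∃[ n ] q ≤ ι (ℤ.+ n)
  archimedean (mkℚ z d-1 _) = ℤ.∣ z ∣ , toℚᵘ-cancel-≤ (ℚᵘₚ.≤-respʳ-≃ (ℚᵘₚ.≃-sym (toℚᵘ-fromℚᵘ (ℚᵘ.mkℚᵘ (ℤ.+ ℤ.∣ z ∣) 0)))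
    (ℚᵘ.*≤* (ℤₚ.≤-trans (ℤₚ.≤-reflexive (ℤₚ.*-identityʳ z)) (bound z (suc d-1)))))
    where
    bound : ∀ z d .{{_ : ℕ.NonZero d}} → z ℤ.≤ (ℤ.+ ℤ.∣ z ∣) ℤ.* (ℤ.+ d)
    bound z (suc d) = ℤₚ.≤-trans (≤∣∣ z) (subst (ℤ.+ ℤ.∣ z ∣ ℤ.≤_) (ℤₚ.pos-* ℤ.∣ z ∣ (suc d))
      (ℤ.+≤+ (ℕₚ.m≤m*n ℤ.∣ z ∣ (suc d))))
      where
      ≤∣∣ : ∀ z → z ℤ.≤ ℤ.+ ℤ.∣ z ∣
      ≤∣∣ (ℤ.+ n) = ℤₚ.≤-refl
      ≤∣∣ ℤ.-[1+ n ] = ℤ.-≤+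

  module Σℚ = SemiringSum (CommutativeRing.semiring +-*-commutativeRing)

  Σ-nonneg : ∀ {n} (f : Fin n → ℚ) → (∀ u → 0ℚ ≤ f u) → 0ℚ ≤ Σℚ.sum f
  Σ-nonneg {zero}  f p = ≤-refl
  Σ-nonneg {suc n} f p = 0≤+ (p zero) (Σ-nonneg (f ∘ suc) (p ∘ suc))

  term≤Σ : ∀ {n} (f : Fin n → ℚ) → (∀ u → 0ℚ ≤ f u) → ∀ u → f u ≤ Σℚ.sum f
  term≤Σ {suc n} f p zero    = ≤-by (Σℚ.sum (f ∘ suc)) (Σ-nonneg (f ∘ suc) (p ∘ suc)) refl
  term≤Σ {suc n} f p (suc u) = ≤-trans (term≤Σ (f ∘ suc) (p ∘ suc) u) (≤-by (f zero) (p zero) (+-comm (Σℚ.sum (f ∘ suc)) (f zero)))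

module LanczosRecurrence where
  open InnerProduct
  open GaussianRationals
  open RationalArithmetic
  open import Data.Rational.Base
  open import Data.Rational.Properties
  open import Relation.Binary.Definitions using (tri<; tri≈; tri>)
  open import Tactic.RingSolver using (solve-∀)
  open Qi

  infixr 7 _·_

  _·_ : ∀ {n} → ℚ → Vec n → Vec n
  (c · x) u = (c * re (x u)) +i (c * im (x u))

  zeroVec : ∀ {n} → Vec n
  zeroVec u = 0ℚ +i 0ℚ

  ·≗⊙ : ∀ {n} c (x : Vec n) → c · x ≗ (c +i 0ℚ) ⊙ x
  ·≗⊙ c x u = cong₂ _+i_ (r c (re (x u)) (im (x u))) (i c (im (x u)) (re (x u)))
    where
    r : ∀ c a b → c * a ≡ c * a + - (0ℚ * b)
    r = solve-∀ ℚ-ring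
    i : ∀ c a b → c * a ≡ c * a + 0ℚ * b
    i = solve-∀ ℚ-ring

  ∙-· : ∀ {n} (A : Fin n → Fin n → Adjoin-i ℚ) c x → A ∙ (c · x) ≗ c · (A ∙ x)
  ∙-· A c x u = trans (∙-cong A (·≗⊙ c x) u) (trans (∙-⊙ A (c +i 0ℚ) x u) (sym (·≗⊙ c (A ∙ x) u)))

  B-·ʳ : ∀ {n} (x : Vec n) c y → B x (c · y) ≡ c * B x y
  B-·ʳ x c y = trans (Σℚ.sum-cong-≗ (λ u → lem c (re (x u)) (im (x u)) (re (y u)) (im (y u))))
    (sym (Σℚ.*-distribˡ-sum c (λ u → dot (x u) (y u))))
    where
    lem : ∀ c p q a b → p * (c * a) + q * (c * b) ≡ c * (p * a + q * b)
    lem = solve-∀ ℚ-ring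

  B-0ʳ : ∀ {n} (x : Vec n) → B x zeroVec ≡ 0ℚ
  B-0ʳ {n} x = trans (Σℚ.sum-cong-≗ (λ u → lem (re (x u)) (im (x u)))) (Σℚ.sum-replicate-zero n)
    where
    lem : ∀ p q → p * 0ℚ + q * 0ℚ ≡ 0ℚ
    lem = solve-∀ ℚ-ring

  0≤B : ∀ {n} (x : Vec n) → 0ℚ ≤ B x x
  0≤B x = Σ-nonneg _ λ u → 0≤+ (0≤-square (re (x u))) (0≤-square (im (x u)))

  private
    square-zero : ∀ a → a * a ≤ 0ℚ → a ≡ 0ℚ
    square-zero a p with <-cmp a 0ℚ
    ... | tri≈ _ e _ = e
    ... | tri> _ _ q = contradiction p (<⇒≱ (0<* q q))
    ... | tri< q _ _ = contradiction p (<⇒≱ (subst (0ℚ <_) (lem a) (0<* (neg-antimono-< q) (neg-antimono-< q))))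
      where
      lem : ∀ a → (- a) * (- a) ≡ a * a
      lem = solve-∀ ℚ-ring

  B≡0⇒0 : ∀ {n} (x : Vec n) → B x x ≡ 0ℚ → x ≗ zeroVec
  B≡0⇒0 x e u = cong₂ _+i_ (square-zero (re (x u)) (≤-trans (≤-by (im (x u) * im (x u)) (0≤-square (im (x u))) refl) d≤0))
                           (square-zero (im (x u)) (≤-trans (≤-by (re (x u) * re (x u)) (0≤-square (re (x u))) (+-comm (im (x u) * im (x u)) (re (x u) * re (x u)))) d≤0))
    where
    d≤0 : dot (x u) (x u) ≤ 0ℚ
    d≤0 = ≤-trans (term≤Σ _ (λ v → 0≤+ (0≤-square (re (x v))) (0≤-square (im (x v)))) u) (≤-reflexive e)

  module Lanczos {n} (H : Fin n → Fin n → Adjoin-i ℚ) (herm : ∀ u v → H u v ≡ star (H v u)) (x : Vec n) where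

    α β : Vec n → Vec n → ℚ
    α v w = B v (H ∙ v) * inv (B v v)
    β v w = B v v * inv (B w w)

    Y : ℕ → Vec n
    Y zero          = zeroVec
    Y (suc zero)    = x
    Y (suc (suc j)) = H ∙ Y (suc j) ⊕ (- α (Y (suc j)) (Y j)) · Y (suc j) ⊕ (- β (Y (suc j)) (Y j)) · Y j

    N : ℕ → ℚ
    N j = B (Y j) (Y j)

    a b κ : ℕ → ℚ
    a j = α (Y (suc j)) (Y j)
    b j = β (Y (suc j)) (Y j)
    κ j = inv (N j)

    recurrence : ∀ j z → B z (H ∙ Y (suc j)) ≡ B z (Y (suc (suc j))) + a j * B z (Y (suc j)) + b j * B z (Y j)
    recurrence j z = sym (begin
      B z (Y (2 ℕ.+ j)) + a j * B z (Y (suc j)) + b j * B z (Y j)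
        ≡⟨ cong (λ w → w + a j * B z (Y (suc j)) + b j * B z (Y j)) expand ⟩
      (B z (H ∙ Y (suc j)) + (- a j) * B z (Y (suc j)) + (- b j) * B z (Y j)) + a j * B z (Y (suc j)) + b j * B z (Y j)
        ≡⟨ lem (B z (H ∙ Y (suc j))) (a j) (B z (Y (suc j))) (b j) (B z (Y j)) ⟩
      B z (H ∙ Y (suc j)) ∎)
      where
      open ≡-Reasoning
      expand : B z (Y (2 ℕ.+ j)) ≡ B z (H ∙ Y (suc j)) + (- a j) * B z (Y (suc j)) + (- b j) * B z (Y j)
      expand = trans (B-⊕ʳ z (H ∙ Y (suc j) ⊕ (- a j) · Y (suc j)) ((- b j) · Y j))
        (cong₂ _+_ (trans (B-⊕ʳ z (H ∙ Y (suc j)) ((- a j) · Y (suc j))) (cong (B z (H ∙ Y (suc j)) +_) (B-·ʳ z (- a j) (Y (suc j)))))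
                   (B-·ʳ z (- b j) (Y j)))
      lem : ∀ h a p b q → (h + (- a) * p + (- b) * q) + a * p + b * q ≡ h
      lem = solve-∀ ℚ-ring

    recurrence′ : ∀ j z → B z (Y (suc (suc j))) ≡ B z (H ∙ Y (suc j)) - a j * B z (Y (suc j)) - b j * B z (Y j)
    recurrence′ j z = trans (lem (B z (Y (2 ℕ.+ j))) (a j * B z (Y (suc j))) (b j * B z (Y j)))
      (cong (λ w → w - a j * B z (Y (suc j)) - b j * B z (Y j)) (sym (recurrence j z)))
      where
      lem : ∀ h p q → h ≡ (h + p + q) - p - q
      lem = solve-∀ ℚ-ring

    NonzeroTo : ℕ → Set
    NonzeroTo m = ∀ j → j ℕ.< m → N (suc j) ≢ 0ℚ

    b-κ : ∀ j → N (suc j) ≢ 0ℚ → b j * κ (suc j) ≡ κ j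
    b-κ j nz = trans (lem (N (suc j)) (κ j) (κ (suc j))) (trans (cong (_* κ j) (*-inv (N (suc j)) nz)) (*-identityˡ (κ j)))
      where
      lem : ∀ p q r → p * q * r ≡ p * r * q
      lem = solve-∀ ℚ-ring

    orthogonal : ∀ m → NonzeroTo m → ∀ i j → i ℕ.< j → j ℕ.≤ suc m → B (Y i) (Y j) ≡ 0ℚ
    orthogonal m nz zero j i<j j≤m = trans (B-comm (Y 0) (Y j)) (B-0ʳ (Y j))
    orthogonal zero nz (suc i) (suc zero) (s≤s ()) j≤m
    orthogonal zero nz (suc i) (suc (suc j)) i<j (s≤s ())
    orthogonal (suc m) nz (suc i) j i<j j≤m with ℕₚ.m≤n⇒m<n∨m≡n j≤m
    ... | inj₁ (s≤s j≤m′) = orthogonal m (λ k k<m → nz k (ℕₚ.m≤n⇒m≤1+n k<m)) (suc i) j i<j j≤m′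
    ... | inj₂ refl = trans (recurrence′ m (Y (suc i))) (by-position (ℕₚ.m≤n⇒m<n∨m≡n (ℕₚ.≤-pred i<j)))
      where
      open ≡-Reasoning
      nz′ : NonzeroTo m
      nz′ k k<m = nz k (ℕₚ.m≤n⇒m≤1+n k<m)
      ih : ∀ i j → i ℕ.< j → j ℕ.≤ suc m → B (Y i) (Y j) ≡ 0ℚ
      ih = orthogonal m nz′
      goal : Set
      goal = B (Y (suc i)) (H ∙ Y (suc m)) - a m * B (Y (suc i)) (Y (suc m)) - b m * B (Y (suc i)) (Y m) ≡ 0ℚ
      -- H is self-adjoint, so the recurrence may be applied to the left argument.
      transfer : B (Y (suc i)) (H ∙ Y (suc m)) ≡ B (Y (suc m)) (Y (suc (suc i))) + a i * B (Y (suc m)) (Y (suc i)) + b i * B (Y (suc m)) (Y i)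
      transfer = trans (self-adjoint H herm (Y (suc i)) (Y (suc m))) (trans (B-comm (H ∙ Y (suc i)) (Y (suc m))) (recurrence i (Y (suc m))))
      by-position : suc i ℕ.< suc m ⊎ suc i ≡ suc m → goal
      by-position (inj₂ refl) = begin
        B (Y (suc m)) (H ∙ Y (suc m)) - a m * N (suc m) - b m * B (Y (suc m)) (Y m)
          ≡⟨ cong (λ w → B (Y (suc m)) (H ∙ Y (suc m)) - a m * N (suc m) - b m * w)
               (trans (B-comm (Y (suc m)) (Y m)) (ih m (suc m) ℕₚ.≤-refl ℕₚ.≤-refl)) ⟩
        B (Y (suc m)) (H ∙ Y (suc m)) - B (Y (suc m)) (H ∙ Y (suc m)) * κ (suc m) * N (suc m) - b m * 0ℚ
          ≡⟨ lem (B (Y (suc m)) (H ∙ Y (suc m))) (κ (suc m)) (N (suc m)) (b m) ⟩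
        B (Y (suc m)) (H ∙ Y (suc m)) * (1ℚ - N (suc m) * κ (suc m))
          ≡⟨ cong (λ w → B (Y (suc m)) (H ∙ Y (suc m)) * (1ℚ - w)) (*-inv (N (suc m)) (nz m ℕₚ.≤-refl)) ⟩
        B (Y (suc m)) (H ∙ Y (suc m)) * (1ℚ - 1ℚ)
          ≡⟨ *-zeroʳ (B (Y (suc m)) (H ∙ Y (suc m))) ⟩
        0ℚ ∎
        where
        lem : ∀ h k n b → h - h * k * n - b * 0ℚ ≡ h * (1ℚ - n * k)
        lem = solve-∀ ℚ-ring
      by-position (inj₁ (s≤s i<m)) with ℕₚ.m≤n⇒m<n∨m≡n i<m
      ... | inj₂ refl = begin
        B (Y (suc i)) (H ∙ Y (suc m)) - a m * B (Y m) (Y (suc m)) - b m * N m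
          ≡⟨ cong₂ (λ w z → w - a m * z - b m * N m) transfer (ih m (suc m) ℕₚ.≤-refl ℕₚ.≤-refl) ⟩
        (N (suc m) + a i * B (Y (suc m)) (Y m) + b i * B (Y (suc m)) (Y i)) - a m * 0ℚ - b m * N m
          ≡⟨ cong₂ (λ w z → (N (suc m) + a i * w + b i * z) - a m * 0ℚ - b m * N m)
               (trans (B-comm (Y (suc m)) (Y m)) (ih m (suc m) ℕₚ.≤-refl ℕₚ.≤-refl))
               (trans (B-comm (Y (suc m)) (Y i)) (ih i (suc m) (s≤s (ℕₚ.<⇒≤ ℕₚ.≤-refl)) ℕₚ.≤-refl)) ⟩
        (N (suc m) + a i * 0ℚ + b i * 0ℚ) - a m * 0ℚ - N (suc m) * κ m * N m
          ≡⟨ lem (N (suc m)) (a i) (b i) (a m) (κ m) (N m) ⟩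
        N (suc m) * (1ℚ - N m * κ m)
          ≡⟨ cong (λ w → N (suc m) * (1ℚ - w)) (*-inv (N m) (nz i (ℕₚ.m≤n⇒m≤1+n ℕₚ.≤-refl))) ⟩
        N (suc m) * (1ℚ - 1ℚ)
          ≡⟨ *-zeroʳ (N (suc m)) ⟩
        0ℚ ∎
        where
        lem : ∀ n a b a′ k n′ → (n + a * 0ℚ + b * 0ℚ) - a′ * 0ℚ - n * k * n′ ≡ n * (1ℚ - n′ * k)
        lem = solve-∀ ℚ-ring
      ... | inj₁ si<m = begin
        B (Y (suc i)) (H ∙ Y (suc m)) - a m * B (Y (suc i)) (Y (suc m)) - b m * B (Y (suc i)) (Y m)
          ≡⟨ cong₂ (λ w z → B (Y (suc i)) (H ∙ Y (suc m)) - a m * w - b m * z)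
               (ih (suc i) (suc m) (s≤s i<m) ℕₚ.≤-refl) (ih (suc i) m si<m (ℕₚ.n≤1+n m)) ⟩
        B (Y (suc i)) (H ∙ Y (suc m)) - a m * 0ℚ - b m * 0ℚ
          ≡⟨ cong (λ w → w - a m * 0ℚ - b m * 0ℚ) transfer ⟩
        (B (Y (suc m)) (Y (suc (suc i))) + a i * B (Y (suc m)) (Y (suc i)) + b i * B (Y (suc m)) (Y i)) - a m * 0ℚ - b m * 0ℚ
          ≡⟨ cong (λ w → w - a m * 0ℚ - b m * 0ℚ) (cong₂ _+_ (cong₂ _+_
               (zero-at (suc (suc i)) (s≤s si<m)) (cong (a i *_) (zero-at (suc i) (s≤s i<m))))
               (cong (b i *_) (zero-at i (s≤s (ℕₚ.<⇒≤ i<m))))) ⟩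
        (0ℚ + a i * 0ℚ + b i * 0ℚ) - a m * 0ℚ - b m * 0ℚ
          ≡⟨ lem (a i) (b i) (a m) (b m) ⟩
        0ℚ ∎
        where
        zero-at : ∀ k → k ℕ.< suc m → B (Y (suc m)) (Y k) ≡ 0ℚ
        zero-at k k<m = trans (B-comm (Y (suc m)) (Y k)) (ih k (suc m) k<m ℕₚ.≤-refl)
        lem : ∀ a b a′ b′ → (0ℚ + a * 0ℚ + b * 0ℚ) - a′ * 0ℚ - b′ * 0ℚ ≡ 0ℚ
        lem = solve-∀ ℚ-ring

module KrylovSpaces where
  open InnerProduct
  open GaussianRationals
  open RationalArithmetic
  open LanczosRecurrence
  open import Data.Rational.Base
  open import Data.Rational.Properties
  open import Tactic.RingSolver using (solve-∀)
  open Qi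

  module Krylov {n} (H : Fin n → Fin n → Adjoin-i ℚ) (herm : ∀ u v → H u v ≡ star (H v u)) (x : Vec n) where
    open Lanczos H herm x public

    proj : ℕ → Vec n → Vec n
    proj zero    z = zeroVec
    proj (suc m) z = proj m z ⊕ (κ (suc m) * B z (Y (suc m))) · Y (suc m)

    captured : ℕ → Vec n → ℚ
    captured zero    z = 0ℚ
    captured (suc m) z = captured m z + κ (suc m) * B z (Y (suc m)) * B z (Y (suc m))

    proj-orthogonal : ∀ M m z j → NonzeroTo M → m ℕ.< j → j ℕ.≤ suc M → B (proj m z) (Y j) ≡ 0ℚ
    proj-orthogonal M zero    z j nz m<j j≤M = trans (B-comm zeroVec (Y j)) (B-0ʳ (Y j))
    proj-orthogonal M (suc m) z j nz m<j j≤M = begin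
      B (proj m z ⊕ c · Y (suc m)) (Y j)          ≡⟨ B-⊕ˡ (proj m z) (c · Y (suc m)) (Y j) ⟩
      B (proj m z) (Y j) + B (c · Y (suc m)) (Y j)
        ≡⟨ cong₂ _+_ (proj-orthogonal M m z j nz (ℕₚ.<⇒≤ m<j) j≤M)
             (trans (B-comm (c · Y (suc m)) (Y j)) (trans (B-·ʳ (Y j) c (Y (suc m))) (cong (c *_) (trans (B-comm (Y j) (Y (suc m))) (orthogonal M nz (suc m) j m<j j≤M))))) ⟩
      0ℚ + c * 0ℚ                                   ≡⟨ trans (+-identityˡ (c * 0ℚ)) (*-zeroʳ c) ⟩
      0ℚ ∎
      where
      open ≡-Reasoning
      c = κ (suc m) * B z (Y (suc m))

    B-z-proj : ∀ m z → B z (proj m z) ≡ captured m z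
    B-z-proj zero    z = B-0ʳ z
    B-z-proj (suc m) z = trans (B-⊕ʳ z (proj m z) (c · Y (suc m))) (cong₂ _+_ (B-z-proj m z) (B-·ʳ z c (Y (suc m))))
      where c = κ (suc m) * B z (Y (suc m))

    B-proj-proj : ∀ m z → NonzeroTo m → B (proj m z) (proj m z) ≡ captured m z
    B-proj-proj zero    z nz = B-0ʳ (zeroVec {n})
    B-proj-proj (suc m) z nz = begin
      B (w ⊕ c · y) (w ⊕ c · y)
        ≡⟨ B-⊕ʳ (w ⊕ c · y) w (c · y) ⟩
      B (w ⊕ c · y) w + B (w ⊕ c · y) (c · y)
        ≡⟨ cong₂ _+_ (B-⊕ˡ w (c · y) w) (trans (B-·ʳ (w ⊕ c · y) c y) (cong (c *_) (B-⊕ˡ w (c · y) y))) ⟩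
      (B w w + B (c · y) w) + c * (B w y + B (c · y) y)
        ≡⟨ cong₂ (λ p q → (B w w + p) + c * (B w y + q))
             (trans (B-comm (c · y) w) (B-·ʳ w c y)) (trans (B-comm (c · y) y) (B-·ʳ y c y)) ⟩
      (B w w + c * B w y) + c * (B w y + c * B y y)
        ≡⟨ cong₂ (λ p q → (p + c * q) + c * (q + c * B y y)) (B-proj-proj m z nz′) (proj-orthogonal m m z (suc m) nz′ ℕₚ.≤-refl ℕₚ.≤-refl) ⟩
      (captured m z + c * 0ℚ) + c * (0ℚ + c * B y y)
        ≡⟨ lem (captured m z) (κ (suc m)) (B z y) (B y y) ⟩
      captured m z + κ (suc m) * B z y * B z y * (B y y * κ (suc m))
        ≡⟨ cong (λ q → captured m z + κ (suc m) * B z y * B z y * q) (*-inv (B y y) (nz m ℕₚ.≤-refl)) ⟩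
      captured m z + κ (suc m) * B z y * B z y * 1ℚ
        ≡⟨ cong (captured m z +_) (*-identityʳ (κ (suc m) * B z y * B z y)) ⟩
      captured m z + κ (suc m) * B z y * B z y ∎
      where
      open ≡-Reasoning
      w = proj m z
      y = Y (suc m)
      c = κ (suc m) * B z y
      nz′ : NonzeroTo m
      nz′ k k<m = nz k (ℕₚ.m≤n⇒m≤1+n k<m)
      lem : ∀ s k p q → (s + k * p * 0ℚ) + k * p * (0ℚ + k * p * q) ≡ s + k * p * p * (q * k)
      lem = solve-∀ ℚ-ring

    bessel : ∀ m z → NonzeroTo m → captured m z ≤ B z z
    bessel m z nz = ≤-by (B d d) (0≤B d) (trans (cong (captured m z +_) expand) (lem (captured m z) (B z z)))
      where
      w = proj m z
      d = z ⊕ (- 1ℚ) · w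
      lem : ∀ s b → s + (b + (- 1ℚ) * s + (- 1ℚ) * (s + (- 1ℚ) * s)) ≡ b
      lem = solve-∀ ℚ-ring
      open ≡-Reasoning
      expand : B d d ≡ B z z + (- 1ℚ) * captured m z + (- 1ℚ) * (captured m z + (- 1ℚ) * captured m z)
      expand = begin
        B d d                                     ≡⟨ B-⊕ʳ d z ((- 1ℚ) · w) ⟩
        B d z + B d ((- 1ℚ) · w)                  ≡⟨ cong₂ _+_ (B-⊕ˡ z ((- 1ℚ) · w) z) (trans (B-·ʳ d (- 1ℚ) w) (cong ((- 1ℚ) *_) (B-⊕ˡ z ((- 1ℚ) · w) w))) ⟩
        (B z z + B ((- 1ℚ) · w) z) + (- 1ℚ) * (B z w + B ((- 1ℚ) · w) w)
          ≡⟨ cong₂ (λ p q → (B z z + p) + (- 1ℚ) * (B z w + q)) (trans (B-comm ((- 1ℚ) · w) z) (B-·ʳ z (- 1ℚ) w)) (trans (B-comm ((- 1ℚ) · w) w) (B-·ʳ w (- 1ℚ) w)) ⟩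
        (B z z + (- 1ℚ) * B z w) + (- 1ℚ) * (B z w + (- 1ℚ) * B w w)
          ≡⟨ cong₂ (λ p q → (B z z + (- 1ℚ) * p) + (- 1ℚ) * (p + (- 1ℚ) * q)) (B-z-proj m z) (B-proj-proj m z nz) ⟩
        B z z + (- 1ℚ) * captured m z + (- 1ℚ) * (captured m z + (- 1ℚ) * captured m z) ∎

    private
      e i·e : Fin n → Vec n
      e u = single u (1ℚ +i 0ℚ)
      i·e u = single u (0ℚ +i 1ℚ)

      total : ℕ → ℚ
      total m = Σℚ.sum λ u → captured m (e u) + captured m (i·e u)

      total≡ : ∀ m → NonzeroTo m → total m ≡ ι (ℤ.+ m)
      total≡ zero    nz = Σℚ.sum-replicate-zero n
      total≡ (suc m) nz = begin
        total (suc m)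
          ≡⟨ Σℚ.sum-cong-≗ regroup ⟩
        (Σℚ.sum λ u → (captured m (e u) + captured m (i·e u)) + κ (suc m) * dot (y u) (y u))
          ≡⟨ Σℚ.∑-distrib-+ (λ u → captured m (e u) + captured m (i·e u)) (λ u → κ (suc m) * dot (y u) (y u)) ⟩
        total m + Σℚ.sum (λ u → κ (suc m) * dot (y u) (y u))
          ≡⟨ cong₂ _+_ (total≡ m λ k k<m → nz k (ℕₚ.m≤n⇒m≤1+n k<m)) (sym (Σℚ.*-distribˡ-sum (κ (suc m)) (λ u → dot (y u) (y u)))) ⟩
        ι (ℤ.+ m) + κ (suc m) * N (suc m)
          ≡⟨ cong (ι (ℤ.+ m) +_) (trans (*-comm (κ (suc m)) (N (suc m))) (*-inv (N (suc m)) (nz m ℕₚ.≤-refl))) ⟩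
        ι (ℤ.+ m) + 1ℚ
          ≡⟨ trans (ι-+ (ℤ.+ m) (ℤ.+ 1)) refl ⟨
        ι (ℤ.+ m ℤ.+ ℤ.+ 1)
          ≡⟨ cong (λ k → ι (ℤ.+ k)) (ℕₚ.+-comm m 1) ⟩
        ι (ℤ.+ suc m) ∎
        where
        open ≡-Reasoning
        y = Y (suc m)
        lem : ∀ s t k p q → (s + k * (1ℚ * p + 0ℚ * q) * (1ℚ * p + 0ℚ * q)) + (t + k * (0ℚ * p + 1ℚ * q) * (0ℚ * p + 1ℚ * q)) ≡ (s + t) + k * (p * p + q * q)
        lem = solve-∀ ℚ-ring
        regroup : ∀ u → captured (suc m) (e u) + captured (suc m) (i·e u) ≡ (captured m (e u) + captured m (i·e u)) + κ (suc m) * dot (y u) (y u)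
        regroup u = trans (cong₂ (λ p q → (captured m (e u) + κ (suc m) * p * p) + (captured m (i·e u) + κ (suc m) * q * q)) (B-single u (1ℚ +i 0ℚ) y) (B-single u (0ℚ +i 1ℚ) y))
          (lem (captured m (e u)) (captured m (i·e u)) (κ (suc m)) (re (y u)) (im (y u)))

    nonzero-bound : ∀ m → NonzeroTo m → m ℕ.≤ n ℕ.+ n
    nonzero-bound m nz = ℤₚ.drop‿+≤+ (ι-cancel-≤ (subst₂ _≤_ (total≡ m nz) (twos n) (Σ-mono (λ u → +-mono-≤ (≤-trans (bessel m (e u) nz) (unit u _ refl)) (≤-trans (bessel m (i·e u) nz) (unit u _ refl))))))
      where
      Σ-mono : ∀ {k} {f g : Fin k → ℚ} → (∀ u → f u ≤ g u) → Σℚ.sum f ≤ Σℚ.sum g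
      Σ-mono {zero}  p = ≤-refl
      Σ-mono {suc k} p = +-mono-≤ (p zero) (Σ-mono (p ∘ suc))
      twos : ∀ k → Σℚ.sum {k} (λ _ → 1ℚ + 1ℚ) ≡ ι (ℤ.+ (k ℕ.+ k))
      twos zero    = refl
      twos (suc k) = trans (cong ((1ℚ + 1ℚ) +_) (twos k)) (trans (sym (ι-+ (ℤ.+ 2) (ℤ.+ (k ℕ.+ k)))) (cong (λ j → ι (ℤ.+ suc j)) (sym (ℕₚ.+-suc k k))))
      unit : ∀ u s → dot s s ≡ 1ℚ → B (single u s) (single u s) ≤ 1ℚ
      unit u s eq = ≤-reflexive (trans (B-single u s (single u s)) (trans (cong (dot s) (single-self u s)) eq))

    terminates : N 1 ≢ 0ℚ → ∃[ d ] NonzeroTo (suc d) × N (suc (suc d)) ≡ 0ℚ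
    terminates N₁≢0 = search (n ℕ.+ n) 0 first (ℕₚ.≤-reflexive (sym (ℕₚ.+-identityʳ (n ℕ.+ n))))
      where
      first : NonzeroTo 1
      first zero    _         = N₁≢0
      first (suc _) (s≤s ())
      search : ∀ fuel m → NonzeroTo (suc m) → n ℕ.+ n ℕ.≤ fuel ℕ.+ m → ∃[ d ] NonzeroTo (suc d) × N (suc (suc d)) ≡ 0ℚ
      search fuel m nz bound with N (suc (suc m)) ≟ 0ℚ
      ... | yes p = m , nz , p
      search zero m nz bound | no _ = contradiction (ℕₚ.≤-trans (nonzero-bound (suc m) nz) bound) (ℕₚ.<⇒≱ ℕₚ.≤-refl)
      search (suc fuel) m nz bound | no ≢0 = search fuel (suc m) nz′ (ℕₚ.≤-trans bound (ℕₚ.≤-reflexive (sym (ℕₚ.+-suc fuel m))))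
        where
        nz′ : NonzeroTo (suc (suc m))
        nz′ k (s≤s k≤m) with ℕₚ.m≤n⇒m<n∨m≡n k≤m
        ... | inj₁ k<m  = nz k k<m
        ... | inj₂ refl = ≢0

    P : ℚ → ℕ → ℚ
    P t zero          = 0ℚ
    P t (suc zero)    = 1ℚ
    P t (suc (suc j)) = (t + - a j) * P t (suc j) + - (b j * P t j)

    V : ℚ → ℕ → Vec n
    V t zero    = zeroVec
    V t (suc m) = V t m ⊕ (P t (suc m) * κ (suc m)) · Y (suc m)

    eigen : ∀ t m → NonzeroTo m → H ∙ V t m ≗ t · V t m ⊕ (P t m * κ m) · Y (suc m) ⊕ (- (P t (suc m) * κ m)) · Y m
    eigen t zero    nz u = trans (trans (∙-cong H zero≗ u) (∙-· H 0ℚ zeroVec u))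
      (cong₂ _+i_ (lem t (κ 0) (re (x u)) (re ((H ∙ zeroVec) u))) (lem t (κ 0) (im (x u)) (im ((H ∙ zeroVec) u))))
      where
      zero≗ : zeroVec {n} ≗ 0ℚ · zeroVec
      zero≗ u = refl
      lem : ∀ t k y w → 0ℚ * w ≡ t * 0ℚ + 0ℚ * k * y + - (1ℚ * k) * 0ℚ
      lem = solve-∀ ℚ-ring
    eigen t (suc m) nz u = begin
      (H ∙ (V t m ⊕ c · Y (suc m))) u
        ≡⟨ ∙-⊕ H (V t m) (c · Y (suc m)) u ⟩
      (H ∙ V t m ⊕ H ∙ (c · Y (suc m))) u
        ≡⟨ cong₂ add (eigen t m (λ k k<m → nz k (ℕₚ.m≤n⇒m≤1+n k<m)) u) (∙-· H c (Y (suc m)) u) ⟩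
      add ((t · V t m ⊕ (P t m * κ m) · Y (suc m) ⊕ (- (P t (suc m) * κ m)) · Y m) u) ((c · (H ∙ Y (suc m))) u)
        ≡⟨ cong₂ _+i_ (component re) (component im) ⟩
      (t · V t (suc m) ⊕ (P t (suc m) * κ (suc m)) · Y (suc (suc m)) ⊕ (- (P t (suc (suc m)) * κ (suc m))) · Y (suc m)) u ∎
      where
      open ≡-Reasoning
      c = P t (suc m) * κ (suc m)
      add : Adjoin-i ℚ → Adjoin-i ℚ → Adjoin-i ℚ
      add p q = (re p + re q) +i (im p + im q)
      lem : ∀ t v p₀ p₁ k a b y₀ y₁ h →
        (t * v + p₀ * (b * k) * y₁ + - (p₁ * (b * k)) * y₀) + p₁ * k * h ≡
        t * (v + p₁ * k * y₁) + p₁ * k * (h + (- a) * y₁ + (- b) * y₀) + - (((t + - a) * p₁ + - (b * p₀)) * k) * y₁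
      lem = solve-∀ ℚ-ring
      component : (f : Adjoin-i ℚ → ℚ) →
        (t * f (V t m u) + P t m * κ m * f (Y (suc m) u) + - (P t (suc m) * κ m) * f (Y m u)) + c * f ((H ∙ Y (suc m)) u) ≡
        t * (f (V t m u) + c * f (Y (suc m) u)) + c * (f ((H ∙ Y (suc m)) u) + (- a m) * f (Y (suc m) u) + (- b m) * f (Y m u)) + - (P t (suc (suc m)) * κ (suc m)) * f (Y (suc m) u)
      component f = trans
        (cong (λ k → (t * f (V t m u) + P t m * k * f (Y (suc m) u) + - (P t (suc m) * k) * f (Y m u)) + c * f ((H ∙ Y (suc m)) u)) (sym (b-κ m (nz m ℕₚ.≤-refl))))
        (lem t (f (V t m u)) (P t m) (P t (suc m)) (κ (suc m)) (a m) (b m) (f (Y m u)) (f (Y (suc m) u)) (f ((H ∙ Y (suc m)) u)))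

    B-x-V : ∀ t m → NonzeroTo (suc m) → B x (V t (suc m)) ≡ 1ℚ
    B-x-V t zero nz = begin
      B x (zeroVec ⊕ (1ℚ * κ 1) · x)       ≡⟨ B-⊕ʳ x zeroVec ((1ℚ * κ 1) · x) ⟩
      B x zeroVec + B x ((1ℚ * κ 1) · x)   ≡⟨ cong₂ _+_ (B-0ʳ x) (B-·ʳ x (1ℚ * κ 1) x) ⟩
      0ℚ + 1ℚ * κ 1 * B x x                ≡⟨ lem (κ 1) (B x x) ⟩
      B x x * κ 1                          ≡⟨ *-inv (B x x) (nz 0 (s≤s z≤n)) ⟩
      1ℚ                                   ∎
      where
      open ≡-Reasoning
      lem : ∀ k n → 0ℚ + 1ℚ * k * n ≡ n * k
      lem = solve-∀ ℚ-ring
    B-x-V t (suc m) nz = begin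
      B x (V t (suc m) ⊕ c · Y (suc (suc m)))        ≡⟨ B-⊕ʳ x (V t (suc m)) (c · Y (suc (suc m))) ⟩
      B x (V t (suc m)) + B x (c · Y (suc (suc m)))
        ≡⟨ cong₂ _+_ (B-x-V t m nz′)
             (trans (B-·ʳ x c (Y (suc (suc m)))) (cong (c *_) (orthogonal (suc m) nz′ 1 (suc (suc m)) (s≤s (s≤s z≤n)) ℕₚ.≤-refl))) ⟩
      1ℚ + c * 0ℚ                                    ≡⟨ lem c ⟩
      1ℚ                                             ∎
      where
      open ≡-Reasoning
      c = P t (suc (suc m)) * κ (suc (suc m))
      nz′ : NonzeroTo (suc m)
      nz′ k k<m = nz k (ℕₚ.m≤n⇒m≤1+n k<m)
      lem : ∀ c → 1ℚ + c * 0ℚ ≡ 1ℚ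
      lem = solve-∀ ℚ-ring

module NullSequences where
  open InnerProduct
  open GaussianRationals
  open RationalArithmetic
  open LanczosRecurrence
  open KrylovSpaces
  open import Data.Bool.Base using (Bool; true; false; if_then_else_; not)
  open import Data.Rational.Base
  open import Data.Rational.Properties
  open import Tactic.RingSolver using (solve-∀)

  Eventually : (ℕ → Set) → Set
  Eventually Q = ∃[ N ] ∀ n → N ℕ.≤ n → Q n

  Frequently : (ℕ → Set) → Set
  Frequently Q = ∀ N → ∃[ n ] N ℕ.≤ n × Q n

  Null : (ℕ → ℚ) → Set
  Null x = ∀ ε → 0ℚ < ε → Eventually λ n → ∣ x n ∣ < ε

  BoundedBelow : (ℕ → ℚ) → Set
  BoundedBelow x = ∃[ η ] 0ℚ < η × Eventually λ n → η ≤ x n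

  both : ∀ {Q R : ℕ → Set} → Eventually Q → Eventually R → Eventually λ n → Q n × R n
  both (M , q) (N , r) = M ℕ.⊔ N , λ n p → q n (ℕₚ.m⊔n≤o⇒m≤o M N p) , r n (ℕₚ.m⊔n≤o⇒n≤o M N p)

  weaken : ∀ {Q R : ℕ → Set} → (∀ n → Q n → R n) → Eventually Q → Eventually R
  weaken f (N , q) = N , λ n p → f n (q n p)

  all-eventually : ∀ {Q : ℕ → ℕ → Set} m → (∀ j → j ℕ.< m → Eventually (Q j)) → Eventually λ n → ∀ j → j ℕ.< m → Q j n
  all-eventually zero    f = 0 , λ _ _ _ ()
  all-eventually {Q} (suc m) f = weaken merge (both (all-eventually m λ j p → f j (ℕₚ.m≤n⇒m≤1+n p)) (f m ℕₚ.≤-refl))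
    where
    merge : ∀ n → (∀ j → j ℕ.< m → Q j n) × Q m n → ∀ j → j ℕ.< suc m → Q j n
    merge n (q , r) j (s≤s j≤m) with ℕₚ.m≤n⇒m<n∨m≡n j≤m
    ... | inj₁ j<m  = q j j<m
    ... | inj₂ refl = r

  half : ℚ → ℚ
  half ε = ½ * ε

  0<half : ∀ {ε} → 0ℚ < ε → 0ℚ < half ε
  0<half {ε} p = 0<* {½} (positive⁻¹ ½) p

  half+half : ∀ ε → ½ * ε + ½ * ε ≡ ε
  half+half = solve-∀ ℚ-ring

  Null-+ : ∀ {x y} → Null x → Null y → Null λ n → x n + y n
  Null-+ {x} {y} p q ε 0<ε = weaken
    (λ n (a , b) → ≤-<-trans (∣p+q∣≤∣p∣+∣q∣ (x n) (y n)) (subst (∣ x n ∣ + ∣ y n ∣ <_) (half+half ε) (+-mono-< a b)))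
    (both (p (half ε) (0<half 0<ε)) (q (half ε) (0<half 0<ε)))

  Null-* : ∀ {x} c → Null x → Null λ n → c * x n
  Null-* {x} c p ε 0<ε = weaken bound (p (ε * inv k) (0<* 0<ε (0<inv k 0<k)))
    where
    k = ∣ c ∣ + 1ℚ
    0<k : 0ℚ < k
    0<k = subst (0ℚ <_) (+-comm 1ℚ ∣ c ∣) (0<+≤ (positive⁻¹ 1ℚ) (0≤∣p∣ c))
    lem : ∀ e k i → k * (e * i) ≡ e * (k * i)
    lem = solve-∀ ℚ-ring
    bound : ∀ n → ∣ x n ∣ < ε * inv k → ∣ c * x n ∣ < ε
    bound n q = begin-strict
      ∣ c * x n ∣            ≡⟨ ∣p*q∣≡∣p∣*∣q∣ c (x n) ⟩
      ∣ c ∣ * ∣ x n ∣        ≤⟨ *-monoʳ-≤-nonNeg ∣ x n ∣ {{∣-∣-nonNeg (x n)}} (≤-by {∣ c ∣} {k} 1ℚ (<⇒≤ (positive⁻¹ 1ℚ)) refl) ⟩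
      k * ∣ x n ∣            <⟨ *-monoʳ-<-pos k {{positive 0<k}} q ⟩
      k * (ε * inv k)        ≡⟨ lem ε k (inv k) ⟩
      ε * (k * inv k)        ≡⟨ cong (ε *_) (*-inv k (≢-sym (<⇒≢ 0<k))) ⟩
      ε * 1ℚ                 ≡⟨ *-identityʳ ε ⟩
      ε                      ∎
      where open ≤-Reasoning

  Null-resp : ∀ {x y} → x ≗ y → Null x → Null y
  Null-resp e p ε 0<ε = weaken (λ n → subst (λ z → ∣ z ∣ < ε) (e n)) (p ε 0<ε)

  Null-0 : Null λ _ → 0ℚ
  Null-0 ε 0<ε = 0 , λ _ _ → 0<ε

  Null-Σ : ∀ {m} (f : Fin m → ℕ → ℚ) → (∀ u → Null (f u)) → Null λ n → Σℚ.sum λ u → f u n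
  Null-Σ {zero}  f p = Null-0
  Null-Σ {suc m} f p = Null-+ (p zero) (Null-Σ (f ∘ suc) (p ∘ suc))

  private
    quarters : ∀ ε → ½ * ε + ½ * (½ * ε) + ½ * (½ * ε) ≡ ε
    quarters = solve-∀ ℚ-ring

    near : ∀ {x y δ} → ∣ x - y ∣ < δ → y - δ < x
    near {x} {y} {δ} p = <-by (δ - (y - x)) (0<-diff (≤-<-trans (subst (_≤ ∣ x - y ∣) (flip x y) (-x≤∣x∣ (x - y))) p)) (lem x y δ)
      where
      flip : ∀ x y → - (x - y) ≡ y - x
      flip = solve-∀ ℚ-ring
      lem : ∀ x y δ → y - δ + (δ - (y - x)) ≡ x
      lem = solve-∀ ℚ-ring

    close : ∀ {x y δ ε} → ∣ x - y ∣ < δ → ∣ y ∣ < ε → ∣ x ∣ < ε + δ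
    close {x} {y} {δ} {ε} p q = ≤-<-trans (subst (λ z → ∣ z ∣ ≤ ∣ y ∣ + ∣ x - y ∣) (lem x y) (∣p+q∣≤∣p∣+∣q∣ y (x - y))) (+-mono-< q p)
      where
      lem : ∀ x y → y + (x - y) ≡ x
      lem = solve-∀ ℚ-ring

    widen : ∀ {x ε} → 0ℚ < ε → ∣ x ∣ < half ε + half (half ε) → ∣ x ∣ < ε
    widen {x} {ε} 0<ε p = <-trans p (<-by (half (half ε)) (0<half (0<half 0<ε)) (quarters ε))

  Null-stable : ∀ {x} → IsCauchy x → ¬ ¬ Null x → Null x
  Null-stable {x} cauchy-x ¬¬null ε 0<ε with cauchy-x (half (half ε)) (0<half (0<half 0<ε))
  ... | N , c with ∣ x N ∣ <? half ε
  ...   | yes small = N , λ n p → widen 0<ε (close (c n N p ℕₚ.≤-refl) small)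
  ...   | no  large = contradiction notNull ¬¬null
    where
    notNull : ¬ Null x
    notNull null with null (half (half ε)) (0<half (0<half 0<ε))
    ... | M , s = large (≤-<-trans (subst (λ z → ∣ z ∣ ≤ ∣ x k ∣ + ∣ x N - x k ∣) (lem (x N) (x k)) (∣p+q∣≤∣p∣+∣q∣ (x k) (x N - x k)))
                   (subst (∣ x k ∣ + ∣ x N - x k ∣ <_) (half+half (half ε)) (+-mono-< (s k (ℕₚ.m≤n⊔m N M)) (c N k ℕₚ.≤-refl (ℕₚ.m≤m⊔n N M)))))
      where
      k = N ℕ.⊔ M
      lem : ∀ x y → y + (x - y) ≡ x
      lem = solve-∀ ℚ-ring

  ¬Null⇒BoundedBelow : ∀ {x} → IsCauchy x → Frequently (λ n → 0ℚ < x n) → ¬ Null x → ¬ ¬ BoundedBelow x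
  ¬Null⇒BoundedBelow {x} cauchy-x often ¬null ¬bounded = ¬null null
    where
    null : Null x
    null ε 0<ε with cauchy-x (half (half ε)) (0<half (0<half 0<ε))
    ... | N , c with often N
    ...   | k , N≤k , 0<xk with x k <? half ε
    ...     | yes small = N , λ n p → widen 0<ε (close (c n k p N≤k) (subst (_< half ε) (sym (0≤p⇒∣p∣≡p (<⇒≤ 0<xk))) small))
    ...     | no  large = contradiction (half (half ε) , 0<half (0<half 0<ε) , N , below) ¬bounded
      where
      lem : ∀ e → ½ * e - ½ * (½ * e) ≡ ½ * (½ * e)
      lem = solve-∀ ℚ-ring
      below : ∀ n → N ℕ.≤ n → half (half ε) ≤ x n
      below n p = ≤-trans (≤-reflexive (sym (lem ε))) (≤-trans (+-monoˡ-≤ (- half (half ε)) (≮⇒≥ large)) (<⇒≤ (near {x n} {x k} (c n k p N≤k))))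

  module Bisection (Q : ℚ → Set) (Q? : ∀ t → Dec (Q t)) (lo₀ hi₀ : ℚ) (lo≤hi₀ : lo₀ ≤ hi₀) (¬Qlo₀ : ¬ Q lo₀) (Qhi₀ : Q hi₀) where

    record Bracket : Set where
      field
        lo hi : ℚ
        lo≤hi : lo ≤ hi
        ¬Qlo  : ¬ Q lo
        Qhi   : Q hi
    open Bracket

    mid : ℚ → ℚ → ℚ
    mid a b = a + half (b - a)

    private
      lo≤mid : ∀ a b → a ≤ b → a ≤ mid a b
      lo≤mid a b p = ≤-by (half (b - a)) (0≤* {½} (<⇒≤ (positive⁻¹ ½)) (0≤-diff p)) refl
      mid≤hi : ∀ a b → a ≤ b → mid a b ≤ b
      mid≤hi a b p = ≤-by (half (b - a)) (0≤* {½} (<⇒≤ (positive⁻¹ ½)) (0≤-diff p)) (lem a b)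
        where
        lem : ∀ a b → a + ½ * (b - a) + ½ * (b - a) ≡ b
        lem = solve-∀ ℚ-ring

    next : Bracket → Bracket
    next s with Q? (mid (lo s) (hi s))
    ... | yes q = record { lo = lo s ; hi = mid (lo s) (hi s) ; lo≤hi = lo≤mid _ _ (lo≤hi s) ; ¬Qlo = ¬Qlo s ; Qhi = q }
    ... | no ¬q = record { lo = mid (lo s) (hi s) ; hi = hi s ; lo≤hi = mid≤hi _ _ (lo≤hi s) ; ¬Qlo = ¬q ; Qhi = Qhi s }

    bracket : ℕ → Bracket
    bracket zero    = record { lo = lo₀ ; hi = hi₀ ; lo≤hi = lo≤hi₀ ; ¬Qlo = ¬Qlo₀ ; Qhi = Qhi₀ }
    bracket (suc k) = next (bracket k)

    next-lo : ∀ s → lo s ≤ lo (next s)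
    next-lo s with Q? (mid (lo s) (hi s))
    ... | yes _ = ≤-refl
    ... | no  _ = lo≤mid _ _ (lo≤hi s)

    next-hi : ∀ s → hi (next s) ≤ hi s
    next-hi s with Q? (mid (lo s) (hi s))
    ... | yes _ = mid≤hi _ _ (lo≤hi s)
    ... | no  _ = ≤-refl

    next-width : ∀ s → hi (next s) - lo (next s) ≡ half (hi s - lo s)
    next-width s with Q? (mid (lo s) (hi s))
    ... | yes _ = lem (lo s) (hi s)
      where
      lem : ∀ a b → a + ½ * (b - a) - a ≡ ½ * (b - a)
      lem = solve-∀ ℚ-ring
    ... | no  _ = lem (lo s) (hi s)
      where
      lem : ∀ a b → b - (a + ½ * (b - a)) ≡ ½ * (b - a)
      lem = solve-∀ ℚ-ring

    nested : ∀ N k → lo (bracket N) ≤ lo (bracket (k ℕ.+ N)) × hi (bracket (k ℕ.+ N)) ≤ hi (bracket N)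
    nested N zero    = ≤-refl , ≤-refl
    nested N (suc k) = ≤-trans (proj₁ (nested N k)) (next-lo (bracket (k ℕ.+ N))) , ≤-trans (next-hi (bracket (k ℕ.+ N))) (proj₂ (nested N k))

    even : ℕ → Bool
    even zero    = true
    even (suc k) = not (even k)

    -- Alternating between the two ends keeps Q true infinitely often and false infinitely often.
    t : ℕ → ℚ
    t k = if even k then hi (bracket k) else lo (bracket k)

    t-within : ∀ N k → N ℕ.≤ k → lo (bracket N) ≤ t k × t k ≤ hi (bracket N)
    t-within N k N≤k = subst (λ m → lo (bracket N) ≤ t m × t m ≤ hi (bracket N)) (ℕₚ.m∸n+n≡m N≤k) (go (k ℕ.∸ N))
      where
      go : ∀ j → lo (bracket N) ≤ t (j ℕ.+ N) × t (j ℕ.+ N) ≤ hi (bracket N)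
      go j with even (j ℕ.+ N)
      ... | true  = ≤-trans (proj₁ (nested N j)) (lo≤hi (bracket (j ℕ.+ N))) , proj₂ (nested N j)
      ... | false = proj₁ (nested N j) , ≤-trans (lo≤hi (bracket (j ℕ.+ N))) (proj₂ (nested N j))

    lo₀≤t : ∀ k → lo₀ ≤ t k
    lo₀≤t k = proj₁ (t-within 0 k z≤n)

    t≤hi₀ : ∀ k → t k ≤ hi₀
    t≤hi₀ k = proj₂ (t-within 0 k z≤n)

    private
      w : ℕ → ℚ
      w k = hi (bracket k) - lo (bracket k)

      0≤w : ∀ k → 0ℚ ≤ w k
      0≤w k = 0≤-diff (lo≤hi (bracket k))

      width-bound : ∀ k → ι (ℤ.+ suc k) * w k ≤ w 0
      width-bound zero    = ≤-reflexive (*-identityˡ (w 0))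
      width-bound (suc k) = ≤-trans (≤-by (half (ι (ℤ.+ k) * w k)) (0≤* {½} (<⇒≤ (positive⁻¹ ½)) (0≤* {i} {w k} (ι-mono-≤ {ℤ.+ 0} {ℤ.+ k} (ℤ.+≤+ z≤n)) (0≤w k))) eq) (width-bound k)
        where
        open ≡-Reasoning
        i : ℚ
        i = ι (ℤ.+ k)
        suc-ι : ∀ m → ι (ℤ.+ suc m) ≡ 1ℚ + ι (ℤ.+ m)
        suc-ι m = ι-+ (ℤ.+ 1) (ℤ.+ m)
        lem : ∀ i v → (1ℚ + (1ℚ + i)) * (½ * v) + ½ * (i * v) ≡ (1ℚ + i) * v
        lem = solve-∀ ℚ-ring
        eq : ι (ℤ.+ suc (suc k)) * w (suc k) + half (i * w k) ≡ ι (ℤ.+ suc k) * w k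
        eq = begin
          ι (ℤ.+ suc (suc k)) * w (suc k) + half (i * w k)
            ≡⟨ cong₂ (λ p q → p * q + half (i * w k)) (trans (suc-ι (suc k)) (cong (1ℚ +_) (suc-ι k))) (next-width (bracket k)) ⟩
          (1ℚ + (1ℚ + i)) * half (w k) + half (i * w k)
            ≡⟨ lem i (w k) ⟩
          (1ℚ + i) * w k
            ≡⟨ cong (_* w k) (suc-ι k) ⟨
          ι (ℤ.+ suc k) * w k ∎

    t-cauchy : IsCauchy t
    t-cauchy ε 0<ε with archimedean (w 0 * inv ε)
    ... | M , q = M , λ m n p r → <∣∣
        (≤-<-trans (+-mono-≤ (proj₂ (t-within M m p)) (neg-antimono-≤ (proj₁ (t-within M n r)))) w<ε)
        (<-≤-trans (neg-antimono-< w<ε) (≤-trans (≤-reflexive (flip (hi (bracket M)) (lo (bracket M)))) (+-mono-≤ (proj₁ (t-within M m p)) (neg-antimono-≤ (proj₂ (t-within M n r))))))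
      where
      flip : ∀ x y → - (x - y) ≡ y - x
      flip = solve-∀ ℚ-ring
      0<M+1 : 0ℚ < ι (ℤ.+ suc M)
      0<M+1 = ι-mono-< {ℤ.+ 0} {ℤ.+ suc M} (ℤ.+<+ (s≤s z≤n))
      lem : ∀ a i e → a * (e * i) ≡ a * i * e
      lem = solve-∀ ℚ-ring
      w<ε : w M < ε
      w<ε = *-cancelˡ-<-nonNeg (ι (ℤ.+ suc M)) {{nonNegative (<⇒≤ 0<M+1)}} (begin-strict
        ι (ℤ.+ suc M) * w M        ≤⟨ width-bound M ⟩
        w 0                        ≡⟨ trans (cong (w 0 *_) (*-inv ε (≢-sym (<⇒≢ 0<ε)))) (*-identityʳ (w 0)) ⟨
        w 0 * (ε * inv ε)          ≡⟨ lem (w 0) (inv ε) ε ⟩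
        w 0 * inv ε * ε            ≤⟨ *-monoʳ-≤-nonNeg ε {{nonNegative (<⇒≤ 0<ε)}} q ⟩
        ι (ℤ.+ M) * ε              <⟨ *-monoˡ-<-pos ε {{positive 0<ε}} (ι-mono-< {ℤ.+ M} {ℤ.+ suc M} (ℤ.+<+ (ℕₚ.n<1+n M))) ⟩
        ι (ℤ.+ suc M) * ε          ∎)
        where open ≤-Reasoning

    private
      at-end : ∀ k → (even k ≡ true × Q (t k) × ¬ Q (t (suc k))) ⊎ (even k ≡ false × ¬ Q (t k) × Q (t (suc k)))
      at-end k with even k
      ... | true  = inj₁ (refl , Qhi (bracket k) , ¬Qlo (bracket (suc k)))
      ... | false = inj₂ (refl , ¬Qlo (bracket k) , Qhi (bracket (suc k)))

    Q-often : Frequently (Q ∘ t)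
    Q-often N with at-end N
    ... | inj₁ (_ , q , _) = N , ℕₚ.≤-refl , q
    ... | inj₂ (_ , _ , q) = suc N , ℕₚ.n≤1+n N , q

    ¬Q-often : Frequently (¬_ ∘ Q ∘ t)
    ¬Q-often N with at-end N
    ... | inj₁ (_ , _ , q) = suc N , ℕₚ.n≤1+n N , q
    ... | inj₂ (_ , q , _) = N , ℕₚ.≤-refl , q

module LargeEigenvalues where
  open InnerProduct
  open GaussianRationals
  open RationalArithmetic
  open LanczosRecurrence
  open KrylovSpaces
  open NullSequences
  import Algebra.Definitions.RawMonoid as RawMonoidDefs
  open import Algebra.Bundles using (RawRing)
  open import Data.Rational.Base
  open import Data.Rational.Properties
  open import Tactic.RingSolver using (solve-∀)
  open Qi using (B; _∙_; star; dot; B-comm; B-single)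

  module ℚi = RawRing (adjoin-i +-*-rawRing)

  module ℝ′ = RawRing ℝ-rawRing
  module Σℚi = RawMonoidDefs ℚi.+-rawMonoid

  -- The term at index k of (the sequences representing) a complex number.
  at : ℕ → ℂ → Adjoin-i ℚ
  at k z = seq (re z) k +i seq (im z) k

  at-sum : ∀ {n} k (f : Fin n → ℂ) → at k (ℂ.sum f) ≡ Σℚi.sum (at k ∘ f)
  at-sum {zero}  k f = refl
  at-sum {suc n} k f = cong (at k (f zero) ℚi.+_) (at-sum k (f ∘ suc))

  ιi : ℤ[i] → Adjoin-i ℚ
  ιi (a +i b) = ι a +i ι b

  module LargeEigenvalue {n} (H : Fin n → Fin n → Adjoin-i ℚ) (herm : ∀ u v → H u v ≡ star (H v u))
    (x : Qi.Vec n) where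
   open Krylov H herm x
   module Limit (m : ℕ) (t : ℕ → ℚ) (t-cauchy : IsCauchy t) where
    μ : ℝ
    μ = mkℝ t t-cauchy

    private
      Pℝ : ℕ → ℝ
      Pℝ zero          = fromℚ 0ℚ
      Pℝ (suc zero)    = fromℚ 1ℚ
      Pℝ (suc (suc j)) = ((μ ℝ′.+ fromℚ (- a j)) ℝ′.* Pℝ (suc j)) ℝ′.+ (ℝ′.- (fromℚ (b j) ℝ′.* Pℝ j))

      seq-P : ∀ j k → seq (Pℝ j) k ≡ P (t k) j
      seq-P zero          k = refl
      seq-P (suc zero)    k = refl
      seq-P (suc (suc j)) k = cong₂ (λ p q → (t k + - a j) * p + - (b j * q)) (seq-P (suc j) k) (seq-P j k)

    P-cauchy : ∀ j → IsCauchy λ k → P (t k) j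
    P-cauchy j ε 0<ε with cauchy (Pℝ j) ε 0<ε
    ... | M , c = M , λ k l p q → subst₂ (λ y z → ∣ y - z ∣ < ε) (seq-P j k) (seq-P j l) (c k l p q)

    private
      V-component : (Adjoin-i ℚ → ℚ) → ℕ → Fin n → ℝ
      V-component f zero    u = fromℚ 0ℚ
      V-component f (suc j) u = V-component f j u ℝ′.+ ((Pℝ (suc j) ℝ′.* fromℚ (κ (suc j))) ℝ′.* fromℚ (f (Y (suc j) u)))

    v : Fin n → ℂ
    v u = V-component re m u +i V-component im m u

    vt : ℕ → Qi.Vec n
    vt k = V (t k) m

    at-v : ∀ k u → at k (v u) ≡ vt k u
    at-v k u = cong₂ _+i_ (seq-V-re m) (seq-V-im m)
      where
      seq-V-re : ∀ j → seq (V-component re j u) k ≡ re (V (t k) j u)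
      seq-V-re zero    = refl
      seq-V-re (suc j) = cong₂ (λ p q → p + q * κ (suc j) * re (Y (suc j) u)) (seq-V-re j) (seq-P (suc j) k)
      seq-V-im : ∀ j → seq (V-component im j u) k ≡ im (V (t k) j u)
      seq-V-im zero    = refl
      seq-V-im (suc j) = cong₂ (λ p q → p + q * κ (suc j) * im (Y (suc j) u)) (seq-V-im j) (seq-P (suc j) k)

   module AtStep (d : ℕ) (nz : NonzeroTo (suc d)) (N-last : N (suc (suc d)) ≡ 0ℚ) where

    m : ℕ
    m = suc d

    private
      0≤N : ∀ j → 0ℚ ≤ N j
      0≤N j = 0≤B (Y j)

      0<N : ∀ j → j ℕ.< m → 0ℚ < N (suc j)
      0<N j j<m = ≤∧≢⇒< (0≤N (suc j)) (≢-sym (nz j j<m))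

      0≤b : ∀ j → 0ℚ ≤ b j
      0≤b j = 0≤* (0≤N (suc j)) (0≤inv (N j) (0≤N j))

      0<b : ∀ j → suc j ℕ.< m → 0ℚ < b (suc j)
      0<b j j<m = 0<* (0<N (suc j) j<m) (0<inv (N (suc j)) (0<N j (ℕₚ.<⇒≤ j<m)))

      AllPositive : ℚ → Set
      AllPositive t = ∀ {j} → j ℕ.< suc m → 0ℚ < P t (suc j)

      AllPositive? : ∀ t → Dec (AllPositive t)
      AllPositive? t = ℕₚ.allUpTo? (λ j → 0ℚ <? P t (suc j)) (suc m)

    module Vanishing (hi₀ : ℚ) (t : ℕ → ℚ) (t-cauchy : IsCauchy t) (t≤hi₀ : ∀ k → t k ≤ hi₀)
      (Q-often : Frequently λ k → AllPositive (t k)) (¬Q-often : Frequently λ k → ¬ AllPositive (t k)) where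
      open Limit m t t-cauchy

      -- If P (suc m) stayed away from 0, then so would successively all P j, since P (suc j) ≈ 0
      -- forces P (suc (suc j)) to have the sign opposite to P j.
      P-null : Null λ k → P (t k) (suc m)
      P-null = Null-stable (P-cauchy (suc m)) λ ¬null →
        all-bounded ¬null m ℕₚ.≤-refl λ below → not-all-bounded below
        where
        Pseq : ℕ → ℕ → ℚ
        Pseq j k = P (t k) (suc j)

        often-positive : ∀ j → j ℕ.< suc m → Frequently λ k → 0ℚ < Pseq j k
        often-positive j j<m M = proj₁ (Q-often M) , proj₁ (proj₂ (Q-often M)) , proj₂ (proj₂ (Q-often M)) j<m

        not-all-bounded : ¬ (∀ j → j ℕ.< suc m → BoundedBelow (Pseq j))
        not-all-bounded below = proj₂ (proj₂ at-M) λ {j} → proj₂ pos′ (proj₁ at-M) (proj₁ (proj₂ at-M)) j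
          where
          pos′ : Eventually λ k → ∀ j → j ℕ.< suc m → 0ℚ < Pseq j k
          pos′ = all-eventually {λ j k → 0ℚ < Pseq j k} (suc m)
            λ j p → weaken (λ k η≤ → <-≤-trans (proj₁ (proj₂ (below j p))) η≤) (proj₂ (proj₂ (below j p)))
          at-M : ∃[ k ] proj₁ pos′ ℕ.≤ k × ¬ AllPositive (t k)
          at-M = ¬Q-often (proj₁ pos′)

        descent : ∀ j → suc j ℕ.< m → BoundedBelow (Pseq j) → ¬ Null (Pseq (suc j))
        descent j j<m (η , 0<η , below) null = <-irrefl refl (<-trans (pos′ {suc (suc j)} (s≤s j<m))
          (<-by {P (t k) (suc (suc (suc j)))} {0ℚ} gap 0<gap (lem (t k) a′ p₁ b′ (Pseq j k) η hi₀)))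
          where
          a′ b′ : ℚ
          a′ = a (suc j)
          b′ = b (suc j)
          small : Eventually λ k → η ≤ Pseq j k × ∣ (hi₀ - a′) * Pseq (suc j) k ∣ < b′ * η
          small = both below (Null-* {Pseq (suc j)} (hi₀ - a′) null (b′ * η) (0<* {b′} {η} (0<b j j<m) 0<η))
          k : ℕ
          k = proj₁ (Q-often (proj₁ small))
          pos′ : AllPositive (t k)
          pos′ = proj₂ (proj₂ (Q-often (proj₁ small)))
          at-k : η ≤ Pseq j k × ∣ (hi₀ - a′) * Pseq (suc j) k ∣ < b′ * η
          at-k = proj₂ small k (proj₁ (proj₂ (Q-often (proj₁ small))))
          p₁ : ℚ
          p₁ = Pseq (suc j) k
          gap : ℚ
          gap = (b′ * η - (hi₀ - a′) * p₁) + ((hi₀ - t k) * p₁ + b′ * (Pseq j k - η))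
          0<gap : 0ℚ < gap
          0<gap = 0<+≤ {b′ * η - (hi₀ - a′) * p₁} {(hi₀ - t k) * p₁ + b′ * (Pseq j k - η)}
            (0<-diff {(hi₀ - a′) * p₁} {b′ * η} (≤-<-trans (x≤∣x∣ ((hi₀ - a′) * p₁)) (proj₂ at-k)))
            (0≤+ {(hi₀ - t k) * p₁} {b′ * (Pseq j k - η)} (0≤* {hi₀ - t k} {p₁} (0≤-diff {t k} {hi₀} (t≤hi₀ k)) (<⇒≤ (pos′ {suc j} (ℕₚ.m≤n⇒m≤1+n j<m))))
              (0≤* {b′} {Pseq j k - η} (0≤b (suc j)) (0≤-diff {η} {Pseq j k} (proj₁ at-k))))
          lem : ∀ t a p b q η h → (t + - a) * p + - (b * q) + ((b * η - (h - a) * p) + ((h - t) * p + b * (q - η))) ≡ 0ℚ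
          lem = solve-∀ ℚ-ring

        all-bounded : ¬ Null (Pseq m) → ∀ j → j ℕ.≤ m → ¬ ¬ (∀ i → i ℕ.< suc j → BoundedBelow (Pseq i))
        all-bounded ¬null zero j≤m ¬all = ¬all λ { zero _ → 1ℚ , positive⁻¹ 1ℚ , 0 , λ _ _ → ≤-refl ; (suc i) (s≤s ()) }
        all-bounded ¬null (suc j) j<m ¬all = all-bounded ¬null j (ℕₚ.<⇒≤ j<m) λ below →
          ¬Null⇒BoundedBelow (P-cauchy (suc (suc j))) (often-positive (suc j) (s≤s j<m)) (not-null below (ℕₚ.m≤n⇒m<n∨m≡n j<m)) λ bj →
          ¬all λ i i<2+j → extend below bj i i<2+j (ℕₚ.m≤n⇒m<n∨m≡n (ℕₚ.≤-pred i<2+j))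
          where
          not-null : (∀ i → i ℕ.< suc j → BoundedBelow (Pseq i)) → suc j ℕ.< m ⊎ suc j ≡ m → ¬ Null (Pseq (suc j))
          not-null below (inj₁ p)    = descent j p (below j ℕₚ.≤-refl)
          not-null below (inj₂ refl) = ¬null
          extend : (∀ i → i ℕ.< suc j → BoundedBelow (Pseq i)) → BoundedBelow (Pseq (suc j)) → ∀ i → i ℕ.< suc (suc j) → i ℕ.< suc j ⊎ i ≡ suc j → BoundedBelow (Pseq i)
          extend below bj i _ (inj₁ p)    = below i p
          extend below bj i _ (inj₂ refl) = bj

    private
      lo₀ : ℚ
      lo₀ = a 0

      ¬positive-lo₀ : ¬ AllPositive lo₀
      ¬positive-lo₀ pos′ = <-irrefl refl (subst (0ℚ <_) (lem (a 0) (b 0)) (pos′ {1} (s≤s (s≤s z≤n))))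
        where
        lem : ∀ a b → (a + - a) * 1ℚ + - (b * 0ℚ) ≡ 0ℚ
        lem = solve-∀ ℚ-ring

      bound : ℕ → ℚ
      bound zero    = ∣ lo₀ ∣ + 1ℚ
      bound (suc j) = bound j + (∣ a j ∣ + b j)

      bound-mono : ∀ i j → bound i ≤ bound (j ℕ.+ i)
      bound-mono i zero    = ≤-refl
      bound-mono i (suc j) = ≤-trans (bound-mono i j) (≤-by (∣ a (j ℕ.+ i) ∣ + b (j ℕ.+ i)) (0≤+ (0≤∣p∣ (a (j ℕ.+ i))) (0≤b (j ℕ.+ i))) refl)

      hi₀ : ℚ
      hi₀ = bound (suc m)

      bound≤hi₀ : ∀ j → j ℕ.≤ suc m → bound j ≤ hi₀
      bound≤hi₀ j j≤ = subst (λ k → bound j ≤ bound k) (ℕₚ.m∸n+n≡m j≤) (bound-mono j (suc m ℕ.∸ j))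

      1≤bound : ∀ j → 1ℚ ≤ bound j
      1≤bound j = ≤-trans (≤-by ∣ lo₀ ∣ (0≤∣p∣ lo₀) (+-comm 1ℚ ∣ lo₀ ∣)) (subst (λ k → bound 0 ≤ bound k) (ℕₚ.+-identityʳ j) (bound-mono 0 j))

      lo₀≤hi₀ : lo₀ ≤ hi₀
      lo₀≤hi₀ = ≤-trans (x≤∣x∣ lo₀) (≤-trans (≤-by 1ℚ (<⇒≤ (positive⁻¹ 1ℚ)) refl) (bound≤hi₀ 0 z≤n))

      hi₀-dominates : ∀ j → j ℕ.< suc m → 0ℚ ≤ hi₀ - a j - b j - 1ℚ
      hi₀-dominates j j<m = subst (0ℚ ≤_) (lem (bound j) ∣ a j ∣ (b j) (a j) hi₀)
        (0≤+ (0≤+ (0≤-diff (1≤bound j)) (0≤-diff (x≤∣x∣ (a j)))) (0≤-diff (bound≤hi₀ (suc j) j<m)))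
        where
        lem : ∀ s p b a h → (s - 1ℚ) + (p - a) + (h - (s + (p + b))) ≡ h - a - b - 1ℚ
        lem = solve-∀ ℚ-ring

      increasing : ∀ j → j ℕ.< suc m → 1ℚ ≤ P hi₀ (suc j) × 0ℚ ≤ P hi₀ (suc j) - P hi₀ j
      increasing zero    j<m = ≤-refl , <⇒≤ (positive⁻¹ 1ℚ)
      increasing (suc j) j<m = ≤-trans 1≤p (≤-by {p} {q} (q - p) step (lem′ p q)) , step
        where
        p₀ p q : ℚ
        p₀ = P hi₀ j
        p = P hi₀ (suc j)
        q = P hi₀ (suc (suc j))
        1≤p : 1ℚ ≤ p
        1≤p = proj₁ (increasing j (ℕₚ.<⇒≤ j<m))
        lem : ∀ h a b p q → (h - a - b - 1ℚ) * p + b * (p - q) ≡ (h + - a) * p + - (b * q) - p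
        lem = solve-∀ ℚ-ring
        lem′ : ∀ p q → p + (q - p) ≡ q
        lem′ = solve-∀ ℚ-ring
        step : 0ℚ ≤ q - p
        step = subst (0ℚ ≤_) (lem hi₀ (a j) (b j) p p₀)
          (0≤+ {(hi₀ - a j - b j - 1ℚ) * p} {b j * (p - p₀)} (0≤* {hi₀ - a j - b j - 1ℚ} {p} (hi₀-dominates j (ℕₚ.<⇒≤ j<m)) (≤-trans (<⇒≤ (positive⁻¹ 1ℚ)) 1≤p))
            (0≤* {b j} {p - p₀} (0≤b j) (proj₂ (increasing j (ℕₚ.<⇒≤ j<m)))))

      positive-hi₀ : AllPositive hi₀
      positive-hi₀ {j} j<m = <-≤-trans (positive⁻¹ 1ℚ) (proj₁ (increasing j j<m))

    open Bisection AllPositive AllPositive? lo₀ hi₀ lo₀≤hi₀ ¬positive-lo₀ positive-hi₀ using (t; t-cauchy; lo₀≤t; t≤hi₀; Q-often; ¬Q-often) public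
    open Limit m t t-cauchy public
    open Vanishing hi₀ t t-cauchy t≤hi₀ Q-often ¬Q-often public

module EigenvalueBounds where
  open InnerProduct
  open GaussianRationals
  open RationalArithmetic
  open LanczosRecurrence
  open KrylovSpaces
  open NullSequences
  open LargeEigenvalues
  open import Data.Rational.Base
  open import Data.Rational.Properties
  open import Tactic.RingSolver using (solve-∀)
  open Qi using (B; _∙_; star; dot; B-comm; B-single; B-⊕ʳ; B-cong)

  ι-dot : ∀ x y → ι (Zi.dot x y) ≡ dot (ιi x) (ιi y)
  ι-dot (a +i b) (c +i d) = trans (ι-+ (a ℤ.* c) (b ℤ.* d)) (cong₂ _+_ (ι-* a c) (ι-* b d))

  ι-B : ∀ {n} (x y : Zi.Vec n) → ι (Zi.B x y) ≡ B (ιi ∘ x) (ιi ∘ y)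
  ι-B {zero}  x y = refl
  ι-B {suc n} x y = trans (ι-+ (Zi.dot (x zero) (y zero)) (Zi.B (x ∘ suc) (y ∘ suc))) (cong₂ _+_ (ι-dot (x zero) (y zero)) (ι-B (x ∘ suc) (y ∘ suc)))

  ιi-* : ∀ x y → ιi (x ℤi.* y) ≡ ιi x ℚi.* ιi y
  ιi-* (a +i b) (c +i d) = cong₂ _+i_
    (trans (ι-+ (a ℤ.* c) (ℤ.- (b ℤ.* d))) (cong₂ _+_ (ι-* a c) (trans (ι-neg (b ℤ.* d)) (cong -_ (ι-* b d)))))
    (trans (ι-+ (a ℤ.* d) (b ℤ.* c)) (cong₂ _+_ (ι-* a d) (ι-* b c)))

  ιi-+ : ∀ x y → ιi (x ℤi.+ y) ≡ ιi x ℚi.+ ιi y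
  ιi-+ (a +i b) (c +i d) = cong₂ _+i_ (ι-+ a c) (ι-+ b d)

  ιi-sum : ∀ {n} (f : Fin n → ℤ[i]) → ιi (ℤi.sum f) ≡ Σℚi.sum (ιi ∘ f)
  ιi-sum {zero}  f = refl
  ιi-sum {suc n} f = trans (ιi-+ (f zero) (ℤi.sum (f ∘ suc))) (cong (ιi (f zero) ℚi.+_) (ιi-sum (f ∘ suc)))

  ιM : ∀ {n} → Matrix n → Fin n → Fin n → Adjoin-i ℚ
  ιM A u v = ιi (A u v)

  ι-∙ : ∀ {n} (A : Matrix n) (x : Zi.Vec n) → ιi ∘ (A Zi.∙ x) ≗ ιM A ∙ (ιi ∘ x)
  ι-∙ A x u = trans (ιi-sum λ k → A u k ℤi.* x k) (Qi-sum-cong λ k → ιi-* (A u k) (x k))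
    where
    Qi-sum-cong : ∀ {n} {f g : Fin n → Adjoin-i ℚ} → f ≗ g → Σℚi.sum f ≡ Σℚi.sum g
    Qi-sum-cong {zero}  e = refl
    Qi-sum-cong {suc n} e = cong₂ ℚi._+_ (e zero) (Qi-sum-cong (e ∘ suc))

  ιM-Hermitian : ∀ {n} (A : Matrix n) → Hermitian A → ∀ u v → ιM A u v ≡ star (ιM A v u)
  ιM-Hermitian A herm u v = trans (cong ιi (herm u v)) (cong (ι (re (A v u)) +i_) (ι-neg (im (A v u))))

  at-row : ∀ {n} (A : Matrix n) k (v : Fin n → ℂ) u → at k (ℂ.sum λ j → ℂ.embed (A u j) ℂ.* v j) ≡ (ιM A ∙ (at k ∘ v)) u
  at-row A k v u = at-sum k λ j → ℂ.embed (A u j) ℂ.* v j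

  module _ {n} (A A′ : Matrix n) (herm : Hermitian A′) (c : ℚ)
    (A≡cA′ : ∀ u v → ιM A u v ≡ (c * re (ιM A′ u v)) +i (c * im (ιM A′ u v))) (x : Zi.Vec n)
    (large : ι (ℤ.+ 2) * B (ιi ∘ x) (ιi ∘ x) < B (ιi ∘ x) (ιM A′ ∙ (ιi ∘ x))) where

    private
      H = ιM A′
      x′ : Qi.Vec n
      x′ = ιi ∘ x

    open Krylov H (ιM-Hermitian A′ herm) x′
    open LargeEigenvalue H (ιM-Hermitian A′ herm) x′

    private
      N≢0 : N 1 ≢ 0ℚ
      N≢0 e = <-irrefl refl (subst₂ _<_ (trans (cong (ι (ℤ.+ 2) *_) e) (*-zeroʳ (ι (ℤ.+ 2))))
        (trans (B-comm x′ (H ∙ x′)) (trans (B-cong {x = H ∙ x′} {y = x′} (λ _ → refl) (B≡0⇒0 x′ e)) (B-0ʳ (H ∙ x′)))) large)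

      0<N₁ : 0ℚ < N 1
      0<N₁ = ≤∧≢⇒< {0ℚ} {N 1} (0≤B x′) (≢-sym N≢0)

    2<a₀ : ι (ℤ.+ 2) < a 0
    2<a₀ = <-by {ι (ℤ.+ 2)} {a 0} ((B x′ (H ∙ x′) - ι (ℤ.+ 2) * N 1) * inv (N 1))
      (0<* (0<-diff large) (0<inv (N 1) 0<N₁))
      (trans (lem (ι (ℤ.+ 2)) (B x′ (H ∙ x′)) (N 1) (inv (N 1))) (trans (cong (λ q → ι (ℤ.+ 2) * (1ℚ - q) + a 0) (*-inv (N 1) N≢0))
         (trans (cong (_+ a 0) (*-zeroʳ (ι (ℤ.+ 2)))) (+-identityˡ (a 0)))))
      where
      lem : ∀ t b n i → t + (b - t * n) * i ≡ t * (1ℚ - n * i) + b * i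
      lem = solve-∀ ℚ-ring

    private
      c·_ : Adjoin-i ℚ → Adjoin-i ℚ
      c· z = (c * re z) +i (c * im z)

      c·-sum : ∀ {k} (e f g : Fin k → Adjoin-i ℚ) → (∀ j → e j ≡ c· f j) → Σℚi.sum (λ j → e j ℚi.* g j) ≡ c· Σℚi.sum (λ j → f j ℚi.* g j)
      c·-sum {zero}  e f g eq = cong₂ _+i_ (sym (*-zeroʳ c)) (sym (*-zeroʳ c))
      c·-sum {suc k} e f g eq = trans (cong₂ (λ p q → (p ℚi.* g zero) ℚi.+ q) (eq zero) (c·-sum (e ∘ suc) (f ∘ suc) (g ∘ suc) (eq ∘ suc)))
        (cong₂ _+i_ (r c (re (f zero)) (im (f zero)) (re (g zero)) (im (g zero)) (re (Σℚi.sum λ j → f (suc j) ℚi.* g (suc j)))) (i c (re (f zero)) (im (f zero)) (re (g zero)) (im (g zero)) (im (Σℚi.sum λ j → f (suc j) ℚi.* g (suc j)))))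
        where
        r : ∀ c a b p q s → (c * a * p + - (c * b * q)) + c * s ≡ c * ((a * p + - (b * q)) + s)
        r = solve-∀ ℚ-ring
        i : ∀ c a b p q s → (c * a * q + c * b * p) + c * s ≡ c * ((a * q + b * p) + s)
        i = solve-∀ ℚ-ring

      combination : (t p₀ p₁ k : ℚ) (w y₁ y₀ : Adjoin-i ℚ) → Adjoin-i ℚ
      combination t p₀ p₁ k w y₁ y₀ = c· ((t * re w + p₀ * k * re y₁ + - (p₁ * k) * re y₀) +i (t * im w + p₀ * k * im y₁ + - (p₁ * k) * im y₀))

      multiple : ℚ → Adjoin-i ℚ → Adjoin-i ℚ
      multiple t w = (c * t * re w + - (0ℚ * im w)) +i (c * t * im w + 0ℚ * re w)

      re-cancel : ∀ t p₀ p₁ k w y₁ y₀ → y₁ ≡ 0ℚ +i 0ℚ → re (combination t p₀ p₁ k w y₁ y₀) - re (multiple t w) ≡ - (c * k * re y₀) * p₁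
      re-cancel t p₀ p₁ k w y₁ y₀ refl = lem c t (re w) (im w) p₀ p₁ k (re y₀)
        where
        lem : ∀ c t p q a b k y → c * (t * p + a * k * 0ℚ + - (b * k) * y) - (c * t * p + - (0ℚ * q)) ≡ - (c * k * y) * b
        lem = solve-∀ ℚ-ring

      im-cancel : ∀ t p₀ p₁ k w y₁ y₀ → y₁ ≡ 0ℚ +i 0ℚ → im (combination t p₀ p₁ k w y₁ y₀) - im (multiple t w) ≡ - (c * k * im y₀) * p₁
      im-cancel t p₀ p₁ k w y₁ y₀ refl = lem c t (re w) (im w) p₀ p₁ k (im y₀)
        where
        lem : ∀ c t p q a b k y → c * (t * q + a * k * 0ℚ + - (b * k) * y) - (c * t * q + 0ℚ * p) ≡ - (c * k * y) * b
        lem = solve-∀ ℚ-ring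

    module _ (v : Fin n → ℂ) (w : ℕ → Qi.Vec n) (t : ℕ → ℚ) (t-cauchy : IsCauchy t) (p₀ p₁ : ℕ → ℚ) (κ : ℚ) (y₁ y₀ : Qi.Vec n)
      (at-v : ∀ k u → at k (v u) ≡ w k u)
      (eigen : ∀ k → H ∙ w k ≗ t k · w k Qi.⊕ (p₀ k * κ) · y₁ Qi.⊕ (- (p₁ k * κ)) · y₀)
      (y₁≗0 : ∀ u → y₁ u ≡ 0ℚ +i 0ℚ) (B-x-w : ∀ k → B x′ (w k) ≡ 1ℚ) (null : Null p₁) where

      private
        dot-Null : ∀ (z : Adjoin-i ℚ) (f : ℕ → Adjoin-i ℚ) → Null (re ∘ f) → Null (im ∘ f) → Null λ k → dot z (f k)
        dot-Null z f p q = Null-+ (Null-* {re ∘ f} (re z) p) (Null-* {im ∘ f} (im z) q)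

        x-0 : ∀ p → p - 0ℚ ≡ p
        x-0 = solve-∀ ℚ-ring

        v-nonzero : ¬ (∀ u → v u ℂ.≈ ℂ.0#)
        v-nonzero zero-v = <-irrefl refl (proj₂ one-small (proj₁ one-small) ℕₚ.≤-refl)
          where
          re-null : ∀ u → Null λ k → re (w k u)
          re-null u = Null-resp (λ k → trans (x-0 (seq (re (v u)) k)) (cong re (at-v k u))) (proj₁ (zero-v u))
          im-null : ∀ u → Null λ k → im (w k u)
          im-null u = Null-resp (λ k → trans (x-0 (seq (im (v u)) k)) (cong im (at-v k u))) (proj₂ (zero-v u))
          one-small : Eventually λ _ → 1ℚ < 1ℚ
          one-small = Null-resp B-x-w
            (Null-Σ (λ u k → dot (x′ u) (w k u)) λ u → dot-Null (x′ u) (λ k → w k u) (re-null u) (im-null u)) 1ℚ (positive⁻¹ 1ℚ)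

      eigenvalue : ℂ
      eigenvalue = (fromℚ c ℝ′.* mkℝ t t-cauchy) +i fromℤ ℤ.0ℤ

      private
        row : ∀ k u → at k (ℂ.sum λ j → ℂ.embed (A u j) ℂ.* v j) ≡ combination (t k) (p₀ k) (p₁ k) κ (w k u) (y₁ u) (y₀ u)
        row k u = begin
          at k (ℂ.sum λ j → ℂ.embed (A u j) ℂ.* v j)             ≡⟨ at-row A k v u ⟩
          (ιM A ∙ (at k ∘ v)) u                                   ≡⟨ Qi.∙-cong (ιM A) (at-v k) u ⟩
          (ιM A ∙ w k) u                                          ≡⟨ c·-sum (ιM A u) (H u) (w k) (A≡cA′ u) ⟩
          c· ((H ∙ w k) u)                                        ≡⟨ cong c·_ (eigen k u) ⟩
          combination (t k) (p₀ k) (p₁ k) κ (w k u) (y₁ u) (y₀ u) ∎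
          where open ≡-Reasoning

        scaled : ∀ k u → at k (eigenvalue ℂ.* v u) ≡ multiple (t k) (w k u)
        scaled k u = cong (multiple (t k)) (at-v k u)

      isEigenvalue : IsEigenvalue A eigenvalue
      isEigenvalue = v , v-nonzero , λ u →
          Null-resp (λ k → sym (re-diff k u)) (Null-* {p₁} (- (c * κ * re (y₀ u))) null)
        , Null-resp (λ k → sym (im-diff k u)) (Null-* {p₁} (- (c * κ * im (y₀ u))) null)
        where
        re-diff : ∀ k u → seq (re (ℂ.sum λ j → ℂ.embed (A u j) ℂ.* v j)) k - seq (re (eigenvalue ℂ.* v u)) k ≡ - (c * κ * re (y₀ u)) * p₁ k
        re-diff k u = trans (cong₂ (λ p q → re p - re q) (row k u) (scaled k u))
          (re-cancel (t k) (p₀ k) (p₁ k) κ (w k u) (y₁ u) (y₀ u) (y₁≗0 u))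
        im-diff : ∀ k u → seq (im (ℂ.sum λ j → ℂ.embed (A u j) ℂ.* v j)) k - seq (im (eigenvalue ℂ.* v u)) k ≡ - (c * κ * im (y₀ u)) * p₁ k
        im-diff k u = trans (cong₂ (λ p q → im p - im q) (row k u) (scaled k u))
          (im-cancel (t k) (p₀ k) (p₁ k) κ (w k u) (y₁ u) (y₀ u) (y₁≗0 u))

    LargeMultiple : Set
    LargeMultiple = ∃[ μ ] ∃[ a₀ ] ι (ℤ.+ 2) < a₀ × (∀ k → a₀ ≤ seq μ k) × IsEigenvalue A ((fromℚ c ℝ′.* μ) +i fromℤ ℤ.0ℤ)

    large-eigenvalue : LargeMultiple
    large-eigenvalue = from-stop (terminates N≢0)
      where
      from-stop : (∃[ d ] NonzeroTo (suc d) × N (suc (suc d)) ≡ 0ℚ) → LargeMultiple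
      from-stop (d , nz , N-last) = μ , a 0 , 2<a₀ , lo₀≤t ,
          isEigenvalue v vt t t-cauchy (λ k → P (t k) (suc d)) (λ k → P (t k) (suc (suc d))) (κ (suc d)) (Y (suc (suc d))) (Y (suc d))
            at-v (λ k → eigen (t k) (suc d) nz) (B≡0⇒0 (Y (suc (suc d))) N-last) (λ k → B-x-V (t k) d nz) P-null
        where open AtStep d nz N-last

  cyclotomic⇒psd : ∀ {n} (A : Matrix n) → Cyclotomic A → Psd± A
  cyclotomic⇒psd {n} A (herm , eigen∈) x = plus , minus
    where
    N b : ℤ
    N = Zi.B x x
    b = Zi.B x (A Zi.∙ x)

    minusA : Matrix n
    minusA u v = ℤi.- A u v

    herm- : Hermitian minusA
    herm- u v = cong (λ z → ℤi.- z) (herm u v)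

    B-minus : Zi.B x (minusA Zi.∙ x) ≡ ℤ.- b
    B-minus = trans (Zi.B-cong {x = x} {y = minusA Zi.∙ x} (λ _ → refl) (λ u → neg-row (A u) x)) (B-neg x (A Zi.∙ x))
      where
      open import Data.Integer.Tactic.RingSolver using () renaming (solve-∀ to solve-ℤ)
      neg-row : ∀ {k} (f g : Fin k → ℤ[i]) → ℤi.sum (λ j → (ℤi.- f j) ℤi.* g j) ≡ ℤi.- ℤi.sum (λ j → f j ℤi.* g j)
      neg-row {zero}  f g = refl
      neg-row {suc k} f g = trans (cong (((ℤi.- f zero) ℤi.* g zero) ℤi.+_) (neg-row (f ∘ suc) (g ∘ suc)))
        (cong₂ _+i_ (r (re (f zero)) (im (f zero)) (re (g zero)) (im (g zero)) _) (i (re (f zero)) (im (f zero)) (re (g zero)) (im (g zero)) _))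
        where
        r : ∀ a b p q s → ((ℤ.- a) ℤ.* p ℤ.+ ℤ.- ((ℤ.- b) ℤ.* q)) ℤ.+ (ℤ.- s) ≡ ℤ.- ((a ℤ.* p ℤ.+ ℤ.- (b ℤ.* q)) ℤ.+ s)
        r = solve-ℤ
        i : ∀ a b p q s → ((ℤ.- a) ℤ.* q ℤ.+ ((ℤ.- b) ℤ.* p)) ℤ.+ (ℤ.- s) ≡ ℤ.- ((a ℤ.* q ℤ.+ (b ℤ.* p)) ℤ.+ s)
        i = solve-ℤ
      B-neg : ∀ {k} (f g : Fin k → ℤ[i]) → Zi.B f (λ j → ℤi.- g j) ≡ ℤ.- Zi.B f g
      B-neg {zero}  f g = refl
      B-neg {suc k} f g = trans (cong (λ z → Zi.dot (f zero) (ℤi.- g zero) ℤ.+ z) (B-neg (f ∘ suc) (g ∘ suc)))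
        (r (re (f zero)) (im (f zero)) (re (g zero)) (im (g zero)) _)
        where
        r : ∀ a b p q s → (a ℤ.* (ℤ.- p) ℤ.+ b ℤ.* (ℤ.- q)) ℤ.+ (ℤ.- s) ≡ ℤ.- ((a ℤ.* p ℤ.+ b ℤ.* q) ℤ.+ s)
        r = solve-ℤ

    ι-large : ∀ M → ℤ.+ 2 ℤ.* N ℤ.< Zi.B x (M Zi.∙ x) → ι (ℤ.+ 2) * B (ιi ∘ x) (ιi ∘ x) < B (ιi ∘ x) (ιM M ∙ (ιi ∘ x))
    ι-large M p = subst₂ _<_ (trans (ι-* (ℤ.+ 2) N) (cong (ι (ℤ.+ 2) *_) (ι-B x x)))
      (trans (ι-B x (M Zi.∙ x)) (B-cong {x = ιi ∘ x} (λ _ → refl) (ι-∙ M x))) (ι-mono-< p)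

    impossible : ∀ {a₀} (t : ℕ → ℚ) → ι (ℤ.+ 2) < a₀ → (∀ k → a₀ ≤ t k) → (∀ ε → 0ℚ < ε → Eventually λ k → t k < ι (ℤ.+ 2) + ε) → ⊥
    impossible {a₀} t 2<a₀ a₀≤t upper = <⇒≱ (proj₂ at-K (proj₁ at-K) ℕₚ.≤-refl) (≤-trans (≤-reflexive (lem (ι (ℤ.+ 2)) a₀)) (a₀≤t (proj₁ at-K)))
      where
      at-K = upper (a₀ - ι (ℤ.+ 2)) (0<-diff 2<a₀)
      lem : ∀ p q → p + (q - p) ≡ q
      lem = solve-∀ ℚ-ring

    not-above : ¬ (ℤ.+ 2 ℤ.* N ℤ.< b)
    not-above p = refute (large-eigenvalue A A herm 1ℚ trivial x (ι-large A p))
      where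
      trivial : ∀ u v → ιM A u v ≡ (1ℚ * re (ιM A u v)) +i (1ℚ * im (ιM A u v))
      trivial u v = sym (cong₂ _+i_ (*-identityˡ (re (ιM A u v))) (*-identityˡ (im (ιM A u v))))
      refute : (∃[ μ ] ∃[ a₀ ] ι (ℤ.+ 2) < a₀ × (∀ k → a₀ ≤ seq μ k) × IsEigenvalue A ((fromℚ 1ℚ ℝ′.* μ) +i fromℤ ℤ.0ℤ)) → ⊥
      refute (μ , a₀ , 2<a₀ , lower , is) = impossible (seq μ) 2<a₀ lower
        λ ε 0<ε → weaken (λ k → subst (_< ι (ℤ.+ 2) + ε) (*-identityˡ (seq μ k))) (proj₂ (proj₂ (eigen∈ ((fromℚ 1ℚ ℝ′.* μ) +i fromℤ ℤ.0ℤ) is)) ε 0<ε)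

    not-below : ¬ (ℤ.+ 2 ℤ.* N ℤ.< ℤ.- b)
    not-below p = refute (large-eigenvalue A minusA herm- (- 1ℚ) negated x (ι-large minusA (subst (ℤ.+ 2 ℤ.* N ℤ.<_) (sym B-minus) p)))
      where
      neg-neg : ∀ z → ι z ≡ - 1ℚ * ι (ℤ.- z)
      neg-neg z = trans (lem₁ (ι z)) (cong (- 1ℚ *_) (sym (ι-neg z)))
        where
        lem₁ : ∀ q → q ≡ - 1ℚ * (- q)
        lem₁ = solve-∀ ℚ-ring
      negated : ∀ u v → ιM A u v ≡ (- 1ℚ * re (ιM minusA u v)) +i (- 1ℚ * im (ιM minusA u v))
      negated u v = cong₂ _+i_ (neg-neg (re (A u v))) (neg-neg (im (A u v)))
      lem : ∀ m e t → m + ((- 1ℚ * m + e) - (- t)) ≡ t + e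
      lem = solve-∀ ℚ-ring
      refute : (∃[ μ ] ∃[ a₀ ] ι (ℤ.+ 2) < a₀ × (∀ k → a₀ ≤ seq μ k) × IsEigenvalue A ((fromℚ (- 1ℚ) ℝ′.* μ) +i fromℤ ℤ.0ℤ)) → ⊥
      refute (μ , a₀ , 2<a₀ , lower , is) = impossible (seq μ) 2<a₀ lower
        λ ε 0<ε → weaken (λ k q → <-by {seq μ k} {ι (ℤ.+ 2) + ε} ((- 1ℚ * seq μ k + ε) - ι (ℤ.- (ℤ.+ 2))) (0<-diff q)
          (trans (cong (λ z → seq μ k + ((- 1ℚ * seq μ k + ε) - z)) (ι-neg (ℤ.+ 2))) (lem (seq μ k) ε (ι (ℤ.+ 2))))) (proj₁ (proj₂ (eigen∈ ((fromℚ (- 1ℚ) ℝ′.* μ) +i fromℤ ℤ.0ℤ) is)) ε 0<ε)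

    plus : ℤ.0ℤ ℤ.≤ ℤ.+ 2 ℤ.* N ℤ.+ b
    plus = subst (ℤ.0ℤ ℤ.≤_) (cong (λ z → ℤ.+ 2 ℤ.* N ℤ.+ z) (ℤₚ.neg-involutive b)) (ℤₚ.i≤j⇒0≤j-i (ℤₚ.≮⇒≥ not-below))

    minus : ℤ.0ℤ ℤ.≤ ℤ.+ 2 ℤ.* N ℤ.- b
    minus = ℤₚ.i≤j⇒0≤j-i (ℤₚ.≮⇒≥ not-above)

module RationalForms where
  open InnerProduct
  open GaussianRationals
  open RationalArithmetic
  open LanczosRecurrence
  open NullSequences
  open LargeEigenvalues
  open EigenvalueBounds
  open import Data.Rational.Base
  open import Data.Rational.Properties
  import Data.Rational.Unnormalised.Base as ℚᵘ
  import Data.Rational.Unnormalised.Properties as ℚᵘₚ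
  import Data.Integer.Tactic.RingSolver as ℤ-Solver
  open import Tactic.RingSolver using (solve-∀)
  open Qi using (B; _∙_; star; dot; B-comm; B-single; B-⊕ʳ; B-cong; self-adjoint; _⊙_; ∙-⊙)

  clear-denominator : ∀ q → ι (↧ q) * q ≡ ι (↥ q)
  clear-denominator q@(mkℚ n d-1 _) = toℚᵘ-injective (ℚᵘₚ.≃-trans (toℚᵘ-homo-* (ι (↧ q)) q)
    (ℚᵘₚ.≃-trans (ℚᵘₚ.*-congʳ {toℚᵘ q} (toℚᵘ-fromℚᵘ (ℚᵘ.mkℚᵘ (ℤ.+ suc d-1) 0)))
      (ℚᵘₚ.≃-trans (ℚᵘ.*≡* (lem (ℤ.+ suc d-1) n)) (ℚᵘₚ.≃-sym (toℚᵘ-fromℚᵘ (ℚᵘ.mkℚᵘ n 0))))))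
    where
    lem : ∀ d n → d ℤ.* n ℤ.* ℤ.1ℤ ≡ n ℤ.* (ℤ.1ℤ ℤ.* d)
    lem = ℤ-Solver.solve-∀

  scale : ℚ → Adjoin-i ℚ → Adjoin-i ℚ
  scale c z = (c * re z) +i (c * im z)

  0<ι↧ : ∀ q → 0ℚ < ι (↧ q)
  0<ι↧ (mkℚ n d-1 _) = ι-mono-< {ℤ.+ 0} {ℤ.+ suc d-1} (ℤ.+<+ (s≤s z≤n))

  clear-denominators : ∀ {n} (z : Qi.Vec n) → ∃[ D ] 0ℚ < ι D × ∃ λ (x : Zi.Vec n) → ∀ u → ιi (x u) ≡ scale (ι D) (z u)
  clear-denominators {zero}  z = ℤ.+ 1 , positive⁻¹ 1ℚ , (λ ()) , λ ()
  clear-denominators {suc n} z with clear-denominators (z ∘ suc)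
  ... | D , 0<D , x , eq = E ℤ.* D , subst (0ℚ <_) (sym (ι-* E D)) (0<* 0<E 0<D) , y , ok
    where
    p q : ℚ
    p = re (z zero)
    q = im (z zero)
    E : ℤ
    E = ↧ p ℤ.* ↧ q
    0<E : 0ℚ < ι E
    0<E = subst (0ℚ <_) (sym (ι-* (↧ p) (↧ q))) (0<* (0<ι↧ p) (0<ι↧ q))
    y : Zi.Vec (suc n)
    y zero    = (↥ p ℤ.* (↧ q ℤ.* D)) +i (↥ q ℤ.* (↧ p ℤ.* D))
    y (suc u) = (E ℤ.* re (x u)) +i (E ℤ.* im (x u))
    lem : ∀ a b d p → (a * p) * (b * d) ≡ ((a * b) * d) * p
    lem = solve-∀ ℚ-ring
    lem′ : ∀ a b d q → (b * q) * (a * d) ≡ ((a * b) * d) * q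
    lem′ = solve-∀ ℚ-ring
    assoc′ : ∀ e d w → e * (d * w) ≡ (e * d) * w
    assoc′ = solve-∀ ℚ-ring
    ok : ∀ u → ιi (y u) ≡ scale (ι (E ℤ.* D)) (z u)
    ok zero = cong₂ _+i_
      (trans (trans (ι-* (↥ p) (↧ q ℤ.* D)) (cong₂ _*_ (sym (clear-denominator p)) (ι-* (↧ q) D)))
        (trans (lem (ι (↧ p)) (ι (↧ q)) (ι D) p) (cong (_* p) (sym (trans (ι-* E D) (cong (_* ι D) (ι-* (↧ p) (↧ q))))))))
      (trans (trans (ι-* (↥ q) (↧ p ℤ.* D)) (cong₂ _*_ (sym (clear-denominator q)) (ι-* (↧ p) D)))
        (trans (lem′ (ι (↧ p)) (ι (↧ q)) (ι D) q) (cong (_* q) (sym (trans (ι-* E D) (cong (_* ι D) (ι-* (↧ p) (↧ q))))))))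
    ok (suc u) = cong₂ _+i_
      (trans (ι-* E (re (x u))) (trans (cong (ι E *_) (cong re (eq u))) (trans (assoc′ (ι E) (ι D) (re (z (suc u)))) (cong (_* re (z (suc u))) (sym (ι-* E D))))))
      (trans (ι-* E (im (x u))) (trans (cong (ι E *_) (cong im (eq u))) (trans (assoc′ (ι E) (ι D) (im (z (suc u)))) (cong (_* im (z (suc u))) (sym (ι-* E D))))))

  psd-rational : ∀ {n} (A : Matrix n) → Psd± A → ∀ z →
    0ℚ ≤ ι (ℤ.+ 2) * B z z + B z (ιM A ∙ z) × 0ℚ ≤ ι (ℤ.+ 2) * B z z - B z (ιM A ∙ z)
  psd-rational A psd z with clear-denominators z
  ... | D , 0<D , x , eq = from-scaled (trans (ι-+ (ℤ.+ 2 ℤ.* Zi.B x x) b) (trans (cong₂ _+_ twice b≡) (lem (ι D) (ι (ℤ.+ 2)) (B z z) (B z (ιM A ∙ z))))) (proj₁ (psd x))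
                         , from-scaled (trans (ι-+ (ℤ.+ 2 ℤ.* Zi.B x x) (ℤ.- b)) (trans (cong₂ _+_ twice (trans (ι-neg b) (cong -_ b≡))) (lem′ (ι D) (ι (ℤ.+ 2)) (B z z) (B z (ιM A ∙ z))))) (proj₂ (psd x))
    where
    b = Zi.B x (A Zi.∙ x)
    scaled : ∀ (p q : Qi.Vec _) → B (ι D · p) (ι D · q) ≡ ι D * (ι D * B p q)
    scaled p q = trans (B-·ʳ (ι D · p) (ι D) q) (cong (ι D *_) (trans (B-comm (ι D · p) q) (trans (B-·ʳ q (ι D) p) (cong (ι D *_) (B-comm q p)))))
    N≡ : ι (Zi.B x x) ≡ ι D * (ι D * B z z)
    N≡ = trans (ι-B x x) (trans (B-cong eq eq) (scaled z z))
    twice : ι (ℤ.+ 2 ℤ.* Zi.B x x) ≡ ι (ℤ.+ 2) * (ι D * (ι D * B z z))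
    twice = trans (ι-* (ℤ.+ 2) (Zi.B x x)) (cong (ι (ℤ.+ 2) *_) N≡)
    b≡ : ι b ≡ ι D * (ι D * B z (ιM A ∙ z))
    b≡ = trans (ι-B x (A Zi.∙ x)) (trans (B-cong eq (λ u → trans (ι-∙ A x u) (trans (Qi.∙-cong (ιM A) eq u) (∙-· (ιM A) (ι D) z u)))) (scaled z (ιM A ∙ z)))
    lem : ∀ d t n b → t * (d * (d * n)) + d * (d * b) ≡ (d * d) * (t * n + b)
    lem = solve-∀ ℚ-ring
    lem′ : ∀ d t n b → t * (d * (d * n)) + - (d * (d * b)) ≡ (d * d) * (t * n - b)
    lem′ = solve-∀ ℚ-ring
    from-scaled : ∀ {f q} → ι f ≡ (ι D * ι D) * q → ℤ.0ℤ ℤ.≤ f → 0ℚ ≤ q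
    from-scaled {f} {q} e p = *-cancelˡ-≤-pos (ι D * ι D) {{positive (0<* 0<D 0<D)}}
      (subst₂ _≤_ (sym (*-zeroʳ (ι D * ι D))) e (ι-mono-≤ {ℤ.+ 0} {f} p))

  module _ where
    private
      square-< : ∀ {a ε} → 0ℚ < ε → a * a < ε * ε → ∣ a ∣ < ε
      square-< {a} {ε} 0<ε p with ∣ a ∣ <? ε
      ... | yes q = q
      ... | no ¬q = contradiction (subst (ε * ε ≤_) (trans (sym (∣p*q∣≡∣p∣*∣q∣ a a)) (0≤p⇒∣p∣≡p (0≤-square a)))
                      (≤-trans (*-monoʳ-≤-nonNeg ε {{nonNegative (<⇒≤ 0<ε)}} (≮⇒≥ ¬q)) (*-monoˡ-≤-nonNeg ∣ a ∣ {{∣-∣-nonNeg a}} (≮⇒≥ ¬q)))) (<⇒≱ p)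

    sqrt-Null : ∀ {x S : ℕ → ℚ} → (∀ k → x k * x k ≤ S k) → Null S → Null x
    sqrt-Null {x} {S} bound null ε 0<ε = weaken (λ k q → square-< 0<ε (≤-<-trans (bound k) (≤-<-trans (x≤∣x∣ (S k)) q))) (null (ε * ε) (0<* 0<ε 0<ε))

  eventually-bounded : ∀ {x} → IsCauchy x → ∃[ K ] 0ℚ < K × Eventually λ n → ∣ x n ∣ ≤ K
  eventually-bounded {x} c with c 1ℚ (positive⁻¹ 1ℚ)
  ... | N , h = ∣ x N ∣ + 1ℚ , subst (0ℚ <_) (+-comm 1ℚ ∣ x N ∣) (0<+≤ (positive⁻¹ 1ℚ) (0≤∣p∣ (x N))) , N , λ n p →
    ≤-trans (subst (λ z → ∣ z ∣ ≤ ∣ x N ∣ + ∣ x n - x N ∣) (lem (x n) (x N)) (∣p+q∣≤∣p∣+∣q∣ (x N) (x n - x N)))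
      (+-monoʳ-≤ ∣ x N ∣ (<⇒≤ (h n N p ℕₚ.≤-refl)))
    where
    lem : ∀ p q → q + (p - q) ≡ p
    lem = solve-∀ ℚ-ring

  bounded*Null : ∀ {x y} → IsCauchy x → Null y → Null λ k → x k * y k
  bounded*Null {x} {y} c null = go (eventually-bounded c)
    where
    go : (∃[ K ] 0ℚ < K × Eventually λ n → ∣ x n ∣ ≤ K) → Null λ k → x k * y k
    go (K , 0<K , bound) ε 0<ε = weaken step (both bound (Null-* {y} K null ε 0<ε))
      where
      open ≤-Reasoning
      step : ∀ k → ∣ x k ∣ ≤ K × ∣ K * y k ∣ < ε → ∣ x k * y k ∣ < ε
      step k (p , q) = begin-strict
        ∣ x k * y k ∣      ≡⟨ ∣p*q∣≡∣p∣*∣q∣ (x k) (y k) ⟩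
        ∣ x k ∣ * ∣ y k ∣  ≤⟨ *-monoʳ-≤-nonNeg ∣ y k ∣ {{∣-∣-nonNeg (y k)}} p ⟩
        K * ∣ y k ∣        ≡⟨ cong (_* ∣ y k ∣) (0≤p⇒∣p∣≡p (<⇒≤ 0<K)) ⟨
        ∣ K ∣ * ∣ y k ∣    ≡⟨ ∣p*q∣≡∣p∣*∣q∣ K (y k) ⟨
        ∣ K * y k ∣        <⟨ q ⟩
        ε                  ∎

  ¬BoundedBelow⇒< : ∀ {x} → IsCauchy x → ¬ BoundedBelow x → ∀ ε → 0ℚ < ε → Eventually λ n → x n < ε
  ¬BoundedBelow⇒< {x} c ¬below ε 0<ε with c (half (half ε)) (0<half (0<half 0<ε))
  ... | M , g with x M <? half ε
  ...   | no large = contradiction (half (half ε) , 0<half (0<half 0<ε) , M , above) ¬below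
    where
    lem : ∀ m n e → ½ * (½ * e) + ((m - ½ * e) + (½ * (½ * e) - (m - n))) ≡ n
    lem = solve-∀ ℚ-ring
    above : ∀ n → M ℕ.≤ n → half (half ε) ≤ x n
    above n p = ≤-by {half (half ε)} {x n} (d₁ + d₂) (0≤+ {d₁} {d₂} (0≤-diff {half ε} {x M} (≮⇒≥ large)) (0≤-diff {x M - x n} {half (half ε)} (<⇒≤ (≤-<-trans (x≤∣x∣ (x M - x n)) (g M n ℕₚ.≤-refl p))))) (lem (x M) (x n) ε)
      where
      d₁ d₂ : ℚ
      d₁ = x M - half ε
      d₂ = half (half ε) - (x M - x n)
  ...   | yes small = M , below
    where
    lem : ∀ m n e → n + ((½ * e - m) + ((½ * (½ * e) - (n - m)) + ½ * (½ * e))) ≡ e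
    lem = solve-∀ ℚ-ring
    below : ∀ n → M ℕ.≤ n → x n < ε
    below n p = <-by {x n} {ε} (d₁ + (d₂ + d₃)) (0<+≤ {d₁} {d₂ + d₃} (0<-diff {x M} {half ε} small)
        (0≤+ {d₂} {d₃} (0≤-diff {x n - x M} {half (half ε)} (<⇒≤ (≤-<-trans (x≤∣x∣ (x n - x M)) (g n M p ℕₚ.≤-refl)))) (<⇒≤ (0<half (0<half 0<ε))))) (lem (x M) (x n) ε)
      where
      d₁ d₂ d₃ : ℚ
      d₁ = half ε - x M
      d₂ = half (half ε) - (x n - x M)
      d₃ = half (half ε)

module RayleighQuotients where
  open InnerProduct
  open GaussianRationals
  open RationalArithmetic
  open LanczosRecurrence
  open NullSequences
  open LargeEigenvalues
  open EigenvalueBounds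
  open RationalForms
  open import Data.Rational.Base
  open import Data.Rational.Properties
  open import Tactic.RingSolver using (solve-∀)
  open Qi using (B; _∙_; star; dot; B-comm; B-cong; self-adjoint; _⊙_; ∙-⊙; ∙-cong)

  rot : ∀ {n} → Qi.Vec n → Qi.Vec n
  rot z u = (- im (z u)) +i re (z u)

  residual : ∀ {n} → Adjoin-i ℚ → Qi.Vec n → Qi.Vec n → Qi.Vec n
  residual m z y u = (re (y u) - (re m * re (z u) + - (im m * im (z u)))) +i (im (y u) - (re m * im (z u) + im m * re (z u)))

  B-residual : ∀ {n} m (z y : Qi.Vec n) → B z (residual m z y) ≡ B z y - re m * B z z
  B-residual {zero}  m z y = lem (re m)
    where
    lem : ∀ a → 0ℚ ≡ 0ℚ - a * 0ℚ
    lem = solve-∀ ℚ-ring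
  B-residual {suc n} m z y = trans (cong (dot (z zero) (residual m z y zero) +_) (B-residual m (z ∘ suc) (y ∘ suc)))
    (lem (re m) (im m) (re (z zero)) (im (z zero)) (re (y zero)) (im (y zero)) (B (z ∘ suc) (y ∘ suc)) (B (z ∘ suc) (z ∘ suc)))
    where
    lem : ∀ a b p q c d s t → (p * (c - (a * p + - (b * q))) + q * (d - (a * q + b * p))) + (s - a * t) ≡ ((p * c + q * d) + s) - a * ((p * p + q * q) + t)
    lem = solve-∀ ℚ-ring

  B-rot-residual : ∀ {n} m (z y : Qi.Vec n) → B (rot z) (residual m z y) ≡ B (rot z) y - im m * B z z
  B-rot-residual {zero}  m z y = lem (im m)
    where
    lem : ∀ a → 0ℚ ≡ 0ℚ - a * 0ℚ
    lem = solve-∀ ℚ-ring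
  B-rot-residual {suc n} m z y = trans (cong (dot (rot z zero) (residual m z y zero) +_) (B-rot-residual m (z ∘ suc) (y ∘ suc)))
    (lem (re m) (im m) (re (z zero)) (im (z zero)) (re (y zero)) (im (y zero)) (B (rot (z ∘ suc)) (y ∘ suc)) (B (z ∘ suc) (z ∘ suc)))
    where
    lem : ∀ a b p q c d s t → ((- q) * (c - (a * p + - (b * q))) + p * (d - (a * q + b * p))) + (s - b * t) ≡ (((- q) * c + p * d) + s) - b * ((p * p + q * q) + t)
    lem = solve-∀ ℚ-ring

  rot-≗ : ∀ {n} (z : Qi.Vec n) → rot z ≗ (0ℚ +i 1ℚ) ⊙ z
  rot-≗ z u = cong₂ _+i_ (lem (re (z u)) (im (z u))) (lem′ (re (z u)) (im (z u)))
    where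
    lem : ∀ p q → - q ≡ 0ℚ * p + - (1ℚ * q)
    lem = solve-∀ ℚ-ring
    lem′ : ∀ p q → p ≡ 0ℚ * q + 1ℚ * p
    lem′ = solve-∀ ℚ-ring

  B-rotʳ : ∀ {n} (z y : Qi.Vec n) → B z (rot y) ≡ - B (rot z) y
  B-rotʳ {zero}  z y = refl
  B-rotʳ {suc n} z y = trans (cong (dot (z zero) (rot y zero) +_) (B-rotʳ (z ∘ suc) (y ∘ suc)))
    (lem (re (z zero)) (im (z zero)) (re (y zero)) (im (y zero)) (B (rot (z ∘ suc)) (y ∘ suc)))
    where
    lem : ∀ p q c d s → (p * (- d) + q * c) + - s ≡ - (((- q) * c + p * d) + s)
    lem = solve-∀ ℚ-ring

  B-rot-Hermitian : ∀ {n} (M : Fin n → Fin n → Adjoin-i ℚ) → (∀ u v → M u v ≡ star (M v u)) → ∀ z → B (rot z) (M ∙ z) ≡ 0ℚ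
  B-rot-Hermitian M herm z = q≡-q (B (rot z) (M ∙ z)) (begin
    B (rot z) (M ∙ z)      ≡⟨ self-adjoint M herm (rot z) z ⟩
    B (M ∙ rot z) z        ≡⟨ B-cong {x = M ∙ rot z} {y = z} (λ u → trans (∙-cong M (rot-≗ z) u) (trans (∙-⊙ M (0ℚ +i 1ℚ) z u) (sym (rot-≗ (M ∙ z) u)))) (λ _ → refl) ⟩
    B (rot (M ∙ z)) z      ≡⟨ B-comm (rot (M ∙ z)) z ⟩
    B z (rot (M ∙ z))      ≡⟨ B-rotʳ z (M ∙ z) ⟩
    - B (rot z) (M ∙ z)    ∎)
    where
    open ≡-Reasoning
    q≡-q : ∀ q → q ≡ - q → q ≡ 0ℚ
    q≡-q q e = trans (lem q) (trans (cong (λ w → ½ * (q + w)) e) (lem′ q))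
      where
      lem : ∀ q → q ≡ ½ * (q + q)
      lem = solve-∀ ℚ-ring
      lem′ : ∀ q → ½ * (q + - q) ≡ 0ℚ
      lem′ = solve-∀ ℚ-ring

  dominated : ∀ {x S N : ℕ → ℚ} → (∀ k → 0ℚ ≤ S k) → BoundedBelow x → (∀ k → x k * S k ≤ N k) → Null N → Null S
  dominated {x} {S} {N} 0≤S (η , 0<η , below) bound null ε 0<ε = weaken step (both below (Null-* {N} (inv η) null ε 0<ε))
    where
    open ≤-Reasoning
    lem : ∀ s i e → s * (e * i) ≡ i * (e * s)
    lem = solve-∀ ℚ-ring
    step : ∀ k → η ≤ x k × ∣ inv η * N k ∣ < ε → ∣ S k ∣ < ε
    step k (p , q) = begin-strict
      ∣ S k ∣              ≡⟨ 0≤p⇒∣p∣≡p (0≤S k) ⟩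
      S k                  ≡⟨ *-identityʳ (S k) ⟨
      S k * 1ℚ             ≡⟨ cong (S k *_) (*-inv η (≢-sym (<⇒≢ 0<η))) ⟨
      S k * (η * inv η)    ≡⟨ lem (S k) (inv η) η ⟩
      inv η * (η * S k)    ≤⟨ *-monoˡ-≤-nonNeg (inv η) {{nonNegative (0≤inv η (<⇒≤ 0<η))}} (*-monoʳ-≤-nonNeg (S k) {{nonNegative (0≤S k)}} p) ⟩
      inv η * (x k * S k)  ≤⟨ *-monoˡ-≤-nonNeg (inv η) {{nonNegative (0≤inv η (<⇒≤ 0<η))}} (bound k) ⟩
      inv η * N k          ≤⟨ x≤∣x∣ (inv η * N k) ⟩
      ∣ inv η * N k ∣      <⟨ q ⟩
      ε                    ∎

  module _ {n} (A : Matrix n) (herm : Hermitian A) (psd : Psd± A) (μ : ℂ) (v : Fin n → ℂ)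
    (v≢0 : ¬ (∀ u → v u ℂ.≈ ℂ.0#)) (eig : ∀ u → ℂ.sum (λ k → ℂ.embed (A u k) ℂ.* v k) ℂ.≈ μ ℂ.* v u) where

    private
      M : Fin n → Fin n → Adjoin-i ℚ
      M = ιM A

      z : ℕ → Qi.Vec n
      z k u = at k (v u)

      e : ℕ → Qi.Vec n
      e k = residual (at k μ) (z k) (M ∙ z k)

      S h r s : ℕ → ℚ
      S k = B (z k) (z k)
      h k = B (z k) (M ∙ z k)
      r k = B (z k) (e k)
      s k = B (rot (z k)) (e k)

      τ σ : ℕ → ℚ
      τ = seq (re μ)
      σ = seq (im μ)

      two : ℚ
      two = ι (ℤ.+ 2)

      r≡ : ∀ k → r k ≡ h k - τ k * S k
      r≡ k = B-residual (at k μ) (z k) (M ∙ z k)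

      s≡ : ∀ k → s k ≡ 0ℚ - σ k * S k
      s≡ k = trans (B-rot-residual (at k μ) (z k) (M ∙ z k)) (cong (_- σ k * S k) (B-rot-Hermitian M (ιM-Hermitian A herm) (z k)))

      e-re-null : ∀ u → Null λ k → re (e k u)
      e-re-null u = Null-resp (λ k → cong (λ q → re q - (τ k * re (z k u) + - (σ k * im (z k u)))) (at-row A k v u)) (proj₁ (eig u))

      e-im-null : ∀ u → Null λ k → im (e k u)
      e-im-null u = Null-resp (λ k → cong (λ q → im q - (τ k * im (z k u) + σ k * re (z k u))) (at-row A k v u)) (proj₂ (eig u))

      neg-cauchy : ∀ (x : ℝ) → IsCauchy λ k → - seq x k
      neg-cauchy x = cauchy (ℝ′.- x)

      r-null : Null r
      r-null = Null-Σ (λ u k → dot (z k u) (e k u)) λ u →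
        Null-+ {λ k → re (z k u) * re (e k u)} {λ k → im (z k u) * im (e k u)}
          (bounded*Null {λ k → re (z k u)} (cauchy (re (v u))) (e-re-null u)) (bounded*Null {λ k → im (z k u)} (cauchy (im (v u))) (e-im-null u))

      s-null : Null s
      s-null = Null-Σ (λ u k → dot (rot (z k) u) (e k u)) λ u →
        Null-+ {λ k → - im (z k u) * re (e k u)} {λ k → re (z k u) * im (e k u)}
          (bounded*Null {λ k → - im (z k u)} (neg-cauchy (im (v u))) (e-re-null u)) (bounded*Null {λ k → re (z k u)} (cauchy (re (v u))) (e-im-null u))

      neg-null : ∀ {x} → Null x → Null λ k → - x k
      neg-null {x} p ε 0<ε = weaken (λ k → subst (_< ε) (sym (∣-p∣≡∣p∣ (x k)))) (p ε 0<ε)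

      0≤S : ∀ k → 0ℚ ≤ S k
      0≤S k = 0≤B (z k)

      component≤S : ∀ k u → re (z k u) * re (z k u) ≤ S k × im (z k u) * im (z k u) ≤ S k
      component≤S k u = ≤-trans (≤-by {a * a} {a * a + b * b} (b * b) (0≤-square b) refl) dot≤
                      , ≤-trans (≤-by {b * b} {a * a + b * b} (a * a) (0≤-square a) (+-comm (b * b) (a * a))) dot≤
        where
        a b : ℚ
        a = re (z k u)
        b = im (z k u)
        dot≤ : a * a + b * b ≤ S k
        dot≤ = term≤Σ (λ w → dot (z k w) (z k w)) (λ w → 0≤+ {re (z k w) * re (z k w)} {im (z k w) * im (z k w)} (0≤-square (re (z k w))) (0≤-square (im (z k w)))) u

      ¬S-null : ¬ Null S
      ¬S-null null = v≢0 λ u →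
          Null-resp (λ k → minus-0 (re (z k u))) (sqrt-Null {λ k → re (z k u)} (λ k → proj₁ (component≤S k u)) null)
        , Null-resp (λ k → minus-0 (im (z k u))) (sqrt-Null {λ k → im (z k u)} (λ k → proj₂ (component≤S k u)) null)
        where
        minus-0 : ∀ p → p ≡ p - 0ℚ
        minus-0 = solve-∀ ℚ-ring

      not-bounded : ∀ {x N : ℕ → ℚ} → (∀ k → x k * S k ≤ N k) → Null N → ¬ BoundedBelow x
      not-bounded {x} {N} bound null below = ¬S-null (dominated {x} {S} {N} 0≤S below bound null)

      re-upper : ∀ ε → 0ℚ < ε → Eventually λ k → τ k + - two < ε
      re-upper = ¬BoundedBelow⇒< (cauchy (re μ ℝ′.+ fromℚ (- two))) (not-bounded bound (neg-null {r} r-null))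
        where
        lem : ∀ t w s h → (t + - w) * s + (w * s - h) ≡ - (h - t * s)
        lem = solve-∀ ℚ-ring
        bound : ∀ k → (τ k + - two) * S k ≤ - r k
        bound k = ≤-by {(τ k + - two) * S k} { - r k} (two * S k - h k) (proj₂ (psd-rational A psd (z k))) (trans (lem (τ k) two (S k) (h k)) (cong -_ (sym (r≡ k))))

      re-lower : ∀ ε → 0ℚ < ε → Eventually λ k → - τ k + - two < ε
      re-lower = ¬BoundedBelow⇒< (cauchy ((ℝ′.- re μ) ℝ′.+ fromℚ (- two))) (not-bounded bound r-null)
        where
        lem : ∀ t w s h → (- t + - w) * s + (w * s + h) ≡ h - t * s
        lem = solve-∀ ℚ-ring
        bound : ∀ k → (- τ k + - two) * S k ≤ r k
        bound k = ≤-by {(- τ k + - two) * S k} {r k} (two * S k + h k) (proj₁ (psd-rational A psd (z k))) (trans (lem (τ k) two (S k) (h k)) (sym (r≡ k)))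

      im-upper : ∀ ε → 0ℚ < ε → Eventually λ k → σ k < ε
      im-upper = ¬BoundedBelow⇒< (cauchy (im μ)) (not-bounded (λ k → ≤-reflexive (trans (lem (σ k) (S k)) (cong -_ (sym (s≡ k))))) (neg-null {s} s-null))
        where
        lem : ∀ a b → a * b ≡ - (0ℚ - a * b)
        lem = solve-∀ ℚ-ring

      im-lower : ∀ ε → 0ℚ < ε → Eventually λ k → - σ k < ε
      im-lower = ¬BoundedBelow⇒< (neg-cauchy (im μ)) (not-bounded (λ k → ≤-reflexive (trans (lem (σ k) (S k)) (sym (s≡ k)))) s-null)
        where
        lem : ∀ a b → (- a) * b ≡ 0ℚ - a * b
        lem = solve-∀ ℚ-ring

    eigenvalue-in-range : μ ∈[-2,2]
    eigenvalue-in-range = real , lower , upper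
      where
      real : im μ ≃ℝ fromℤ ℤ.0ℤ
      real ε 0<ε = weaken step (both (im-upper ε 0<ε) (im-lower ε 0<ε))
        where
        lem : ∀ p → p ≡ p - 0ℚ
        lem = solve-∀ ℚ-ring
        double-neg : ∀ p → - (- p) ≡ p
        double-neg = solve-∀ ℚ-ring
        step : ∀ k → σ k < ε × - σ k < ε → ∣ σ k - 0ℚ ∣ < ε
        step k (p , q) = subst (λ w → ∣ w ∣ < ε) (lem (σ k)) (<∣∣ p (subst (- ε <_) (double-neg (σ k)) (neg-antimono-< q)))
      upper : re μ ≤ℝ fromℤ (ℤ.+ 2)
      upper ε 0<ε = weaken (λ k p → <-by {τ k} {two + ε} (ε - (τ k + - two)) (0<-diff {τ k + - two} {ε} p) (lem (τ k) two ε)) (re-upper ε 0<ε)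
        where
        lem : ∀ t w e → t + (e - (t + - w)) ≡ w + e
        lem = solve-∀ ℚ-ring
      lower : fromℤ (ℤ.- (ℤ.+ 2)) ≤ℝ re μ
      lower ε 0<ε = weaken (λ k p → subst (_< τ k + ε) (sym (ι-neg (ℤ.+ 2))) (<-by { - two} {τ k + ε} (ε - (- τ k + - two)) (0<-diff { - τ k + - two} {ε} p) (lem (τ k) two ε))) (re-lower ε 0<ε)
        where
        lem : ∀ t w e → - w + (e - (- t + - w)) ≡ t + e
        lem = solve-∀ ℚ-ring

  psd⇒cyclotomic : ∀ {n} (A : Matrix n) → Hermitian A → Psd± A → Cyclotomic A
  psd⇒cyclotomic A herm psd = herm , λ μ (v , v≢0 , eig) → eigenvalue-in-range A herm psd μ v v≢0 eig

module BorderedMatrices where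
  open InnerProduct
  open GaussianIntegers
  open import Data.Integer.Base using (+_; -[1+_]; _+_; _*_; -_; _-_; _≤_; _<_; 0ℤ; +≤+; +<+)
  open import Data.Integer.Properties
  open import Data.Integer.Tactic.RingSolver using (solve-∀)
  open Zi using (B; B-cong; B-comm; B-⊕ʳ; B-⊕ˡ; dot; _∙_; _⊕_; _⊙_; ∙-cong; ∙-⊕; ∙-⊙; self-adjoint; single; B-single)

  Vecℤ : ℕ → Set
  Vecℤ = Zi.Vec

  infix 8 ⊖_

  ⊖_ : ∀ {n} → Vecℤ n → Vecℤ n
  (⊖ x) u = ℤi.- x u

  ⊖M : ∀ {n} → Matrix n → Matrix n
  ⊖M A u v = ℤi.- A u v

  B-⊖ʳ : ∀ {n} (x y : Vecℤ n) → B x (⊖ y) ≡ - B x y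
  B-⊖ʳ {zero}  x y = refl
  B-⊖ʳ {suc n} x y = trans (cong (λ s → dot (x zero) (ℤi.- y zero) + s) (B-⊖ʳ (x ∘ suc) (y ∘ suc)))
    (lem (re (x zero)) (im (x zero)) (re (y zero)) (im (y zero)) (B (x ∘ suc) (y ∘ suc)))
    where
    lem : ∀ a b p q s → (a * (- p) + b * (- q)) + (- s) ≡ - ((a * p + b * q) + s)
    lem = solve-∀

  B-⊖ˡ : ∀ {n} (x y : Vecℤ n) → B (⊖ x) y ≡ - B x y
  B-⊖ˡ x y = trans (B-comm (⊖ x) y) (trans (B-⊖ʳ y x) (cong -_ (B-comm y x)))

  neg-row : ∀ {k} (f g : Fin k → ℤ[i]) → ℤi.sum (λ j → (ℤi.- f j) ℤi.* g j) ≡ ℤi.- ℤi.sum (λ j → f j ℤi.* g j)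
  neg-row {zero}  f g = refl
  neg-row {suc k} f g = trans (cong (((ℤi.- f zero) ℤi.* g zero) ℤi.+_) (neg-row (f ∘ suc) (g ∘ suc)))
    (cong₂ _+i_ (r (re (f zero)) (im (f zero)) (re (g zero)) (im (g zero)) (re (ℤi.sum λ j → f (suc j) ℤi.* g (suc j))))
                (i (re (f zero)) (im (f zero)) (re (g zero)) (im (g zero)) (im (ℤi.sum λ j → f (suc j) ℤi.* g (suc j)))))
    where
    r : ∀ a b p q s → ((- a) * p + - ((- b) * q)) + (- s) ≡ - ((a * p + - (b * q)) + s)
    r = solve-∀
    i : ∀ a b p q s → ((- a) * q + ((- b) * p)) + (- s) ≡ - ((a * q + (b * p)) + s)
    i = solve-∀

  ⊖M-∙ : ∀ {n} (A : Matrix n) x → ⊖M A ∙ x ≗ ⊖ (A ∙ x)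
  ⊖M-∙ A x u = neg-row (A u) x

  ∙-⊖ : ∀ {n} (A : Matrix n) x → A ∙ (⊖ x) ≗ ⊖ (A ∙ x)
  ∙-⊖ A x u = go (A u) x
    where
    go : ∀ {k} (f g : Fin k → ℤ[i]) → ℤi.sum (λ j → f j ℤi.* (ℤi.- g j)) ≡ ℤi.- ℤi.sum (λ j → f j ℤi.* g j)
    go {zero}  f g = refl
    go {suc k} f g = trans (cong ((f zero ℤi.* (ℤi.- g zero)) ℤi.+_) (go (f ∘ suc) (g ∘ suc)))
      (cong₂ _+i_ (r (re (f zero)) (im (f zero)) (re (g zero)) (im (g zero)) (re (ℤi.sum λ j → f (suc j) ℤi.* g (suc j))))
                  (i (re (f zero)) (im (f zero)) (re (g zero)) (im (g zero)) (im (ℤi.sum λ j → f (suc j) ℤi.* g (suc j)))))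
      where
      r : ∀ a b p q s → (a * (- p) + - (b * (- q))) + (- s) ≡ - ((a * p + - (b * q)) + s)
      r = solve-∀
      i : ∀ a b p q s → (a * (- q) + b * (- p)) + (- s) ≡ - ((a * q + b * p) + s)
      i = solve-∀

  Psd : ∀ {n} → Matrix n → Set
  Psd {n} A = ∀ (x : Vecℤ n) → 0ℤ ≤ + 2 * B x x + B x (A ∙ x)

  B-⊖M : ∀ {n} (A : Matrix n) x → B x (⊖M A ∙ x) ≡ - B x (A ∙ x)
  B-⊖M A x = trans (B-cong {x = x} (λ _ → refl) (⊖M-∙ A x)) (B-⊖ʳ x (A ∙ x))

  psd±⇒psd : ∀ {n} {A : Matrix n} → Psd± A → Psd A
  psd±⇒psd p x = proj₁ (p x)

  psd±⇒psd⊖ : ∀ {n} {A : Matrix n} → Psd± A → Psd (⊖M A)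
  psd±⇒psd⊖ {A = A} p x = subst (λ b → 0ℤ ≤ + 2 * B x x + b) (sym (B-⊖M A x)) (proj₂ (p x))

  psd⇒psd± : ∀ {n} {A : Matrix n} → Psd A → Psd (⊖M A) → Psd± A
  psd⇒psd± {A = A} p q x = p x , subst (λ b → 0ℤ ≤ + 2 * B x x + b) (B-⊖M A x) (q x)

  border : ∀ {n} → Matrix n → Vecℤ n → ℤ → Matrix (suc n)
  border A c d zero    zero    = d +i 0ℤ
  border A c d zero    (suc v) = conj (c v)
  border A c d (suc u) zero    = c u
  border A c d (suc u) (suc v) = A u v

  nrm : ℤ[i] → ℤ
  nrm z = dot z z

  0≤square : ∀ a → 0ℤ ≤ a * a
  0≤square (+ n)      = subst (0ℤ ≤_) (pos-* n n) (+≤+ z≤n)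
  0≤square (-[1+ n ]) = +≤+ z≤n

  0≤* : ∀ {a b} → 0ℤ ≤ a → 0ℤ ≤ b → 0ℤ ≤ a * b
  0≤* {+ m} {+ n} (+≤+ _) (+≤+ _) = subst (0ℤ ≤_) (pos-* m n) (+≤+ z≤n)

  0≤nrm : ∀ z → 0ℤ ≤ nrm z
  0≤nrm z = +-mono-≤ (0≤square (re z)) (0≤square (im z))

  cancel-factor : ∀ {a b} → 0ℤ < a → 0ℤ ≤ a * b → 0ℤ ≤ b
  cancel-factor {+ zero} (+<+ ()) p
  cancel-factor {a@(+ suc _)} {b} _ p = *-cancelˡ-≤-pos 0ℤ b a (subst (_≤ a * b) (sym (*-zeroʳ a)) p)

  module _ {n} (A : Matrix n) (c : Vecℤ n) (d : ℤ) where
    private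
      cross : ∀ {k} (t : ℤ[i]) (c x : Vecℤ k) → dot t (ℤi.sum λ j → conj (c j) ℤi.* x j) ≡ B x (λ u → c u ℤi.* t)
      cross {zero}  t c x = lem (re t) (im t)
        where
        lem : ∀ a b → a * 0ℤ + b * 0ℤ ≡ 0ℤ
        lem = solve-∀
      cross {suc k} t c x = trans (lem (re t) (im t) (re (c zero)) (im (c zero)) (re (x zero)) (im (x zero)) (re S) (im S))
        (cong (λ s → dot (x zero) (c zero ℤi.* t) + s) (cross t (c ∘ suc) (x ∘ suc)))
        where
        S = ℤi.sum λ j → conj (c (suc j)) ℤi.* x (suc j)
        lem : ∀ a b p q x y s t → a * ((p * x + - ((- q) * y)) + s) + b * ((p * y + (- q) * x) + t) ≡
              (x * (p * a + - (q * b)) + y * (p * b + q * a)) + (a * s + b * t)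
        lem = solve-∀

    -- The value at (t , x) of the quadratic form of the bordered matrix.
    form-border : ∀ t (x : Vecℤ n) (x′ : Vecℤ (suc n)) → x′ zero ≡ t → (∀ u → x′ (suc u) ≡ x u) →
      B x′ (border A c d ∙ x′) ≡ (d * nrm t + + 2 * B x (λ u → c u ℤi.* t)) + B x (A ∙ x)
    form-border t x x′ refl eq = begin
      dot t (((d +i 0ℤ) ℤi.* t) ℤi.+ ℤi.sum (λ j → conj (c j) ℤi.* x′ (suc j))) + B (x′ ∘ suc) (λ u → (c u ℤi.* t) ℤi.+ ℤi.sum (λ j → A u j ℤi.* x′ (suc j)))
        ≡⟨ cong₂ _+_ (trans (Zi.dot-⊞ʳ t ((d +i 0ℤ) ℤi.* t) (ℤi.sum λ j → conj (c j) ℤi.* x′ (suc j)))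
             (cong₂ _+_ (lem (re t) (im t) d) (trans (cross t c (x′ ∘ suc)) (B-cong {y = λ u → c u ℤi.* t} eq (λ _ → refl)))))
             (trans (B-⊕ʳ (x′ ∘ suc) (λ u → c u ℤi.* t) (A ∙ (x′ ∘ suc))) (cong₂ _+_ (B-cong {y = λ u → c u ℤi.* t} eq (λ _ → refl)) (B-cong eq (∙-cong A eq)))) ⟩
      (d * nrm t + b) + (b + B x (A ∙ x))
        ≡⟨ lem′ (d * nrm t) b (B x (A ∙ x)) ⟩
      (d * nrm t + + 2 * b) + B x (A ∙ x) ∎
      where
      open ≡-Reasoning
      b = B x (λ u → c u ℤi.* t)
      lem : ∀ p q d → p * (d * p + - (0ℤ * q)) + q * (d * q + 0ℤ * p) ≡ d * (p * p + q * q)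
      lem = solve-∀
      lem′ : ∀ a b c → (a + b) + (b + c) ≡ (a + + 2 * b) + c
      lem′ = solve-∀

  B-⊙⊙ : ∀ {n} s (x y : Vecℤ n) → B (s ⊙ x) (s ⊙ y) ≡ nrm s * B x y
  B-⊙⊙ {zero}  s x y = sym (*-zeroʳ (nrm s))
  B-⊙⊙ {suc n} s x y = trans (cong (λ z → dot (s ℤi.* x zero) (s ℤi.* y zero) + z) (B-⊙⊙ s (x ∘ suc) (y ∘ suc)))
    (lem (re s) (im s) (re (x zero)) (im (x zero)) (re (y zero)) (im (y zero)) (B (x ∘ suc) (y ∘ suc)))
    where
    lem : ∀ a b p q c d s → ((a * p + - (b * q)) * (a * c + - (b * d)) + (a * q + b * p) * (a * d + b * c)) + (a * a + b * b) * s ≡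
          (a * a + b * b) * ((p * c + q * d) + s)
    lem = solve-∀

  -- With z = s x + t (2 - A) y₀, the form of the bordered matrix at (t , x), multiplied by |s|², is the
  -- form of A at z plus a nonnegative multiple of |t|².
  psd-border : ∀ {n} (A : Matrix n) → Hermitian A → Psd A → (y₀ c : Vecℤ n) (s : ℤ[i]) (d : ℤ) → 0ℤ < nrm s →
    (∀ u → (+ 4 +i 0ℤ) ℤi.* y₀ u ℤi.+ (ℤi.- (A ∙ (A ∙ y₀)) u) ≡ s ℤi.* c u) →
    + 2 * B y₀ (s ⊙ c) - B (A ∙ y₀) (s ⊙ c) ≤ nrm s * (+ 2 + d) →
    Psd (border A c d)
  psd-border {n} A herm psd y₀ c s d 0<s Ky₀ enough x′ = cancel-factor 0<s (subst (0ℤ ≤_) (sym total)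
    (+-mono-≤ (psd z) (0≤* (0≤nrm t) (i≤j⇒0≤j-i enough))))
    where
    open ≡-Reasoning
    t = x′ zero
    x = x′ ∘ suc
    g = A ∙ y₀
    p : Vecℤ n
    p = (+ 2 +i 0ℤ) ⊙ y₀ ⊕ ⊖ g
    z : Vecℤ n
    z = s ⊙ x ⊕ t ⊙ p
    ct : Vecℤ n
    ct u = c u ℤi.* t
    w = s ⊙ c

    Ap : A ∙ p ≗ (+ 2 +i 0ℤ) ⊙ g ⊕ ⊖ (A ∙ g)
    Ap u = trans (∙-⊕ A ((+ 2 +i 0ℤ) ⊙ y₀) (⊖ g) u) (cong₂ ℤi._+_ (∙-⊙ A (+ 2 +i 0ℤ) y₀ u) (∙-⊖ A g u))

    2p+Ap : (+ 2 +i 0ℤ) ⊙ p ⊕ A ∙ p ≗ w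
    2p+Ap u = trans (cong (((+ 2 +i 0ℤ) ℤi.* p u) ℤi.+_) (Ap u)) (trans (lem (y₀ u) (g u) ((A ∙ g) u)) (Ky₀ u))
      where
      lem : ∀ y g h → ((+ 2 +i 0ℤ) ℤi.* (((+ 2 +i 0ℤ) ℤi.* y) ℤi.+ (ℤi.- g))) ℤi.+ (((+ 2 +i 0ℤ) ℤi.* g) ℤi.+ (ℤi.- h)) ≡ (+ 4 +i 0ℤ) ℤi.* y ℤi.+ (ℤi.- h)
      lem (a +i b) (e +i f) (k +i l) = cong₂ _+i_ (r a b e f k) (i a b e f l)
        where
        r : ∀ a b e f k → ((+ 2 * ((+ 2 * a + - (0ℤ * b)) + - e)) + - (0ℤ * ((+ 2 * b + 0ℤ * a) + - f))) + ((+ 2 * e + - (0ℤ * f)) + - k) ≡ (+ 4 * a + - (0ℤ * b)) + - k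
        r = solve-∀
        i : ∀ a b e f l → ((+ 2 * ((+ 2 * b + 0ℤ * a) + - f)) + 0ℤ * ((+ 2 * a + - (0ℤ * b)) + - e)) + ((+ 2 * f + 0ℤ * e) + - l) ≡ (+ 4 * b + 0ℤ * a) + - l
        i = solve-∀

    two : ∀ (a b : Vecℤ n) → B a ((+ 2 +i 0ℤ) ⊙ b) ≡ + 2 * B a b
    two a b = trans (B-cong {x = a} (λ _ → refl) (λ u → cong₂ _+i_ (r (re (b u)) (im (b u))) (i (re (b u)) (im (b u)))))
      (trans (B-⊕ʳ a b b) (d2 (B a b)))
      where
      r : ∀ p q → + 2 * p + - (0ℤ * q) ≡ p + p
      r = solve-∀
      i : ∀ p q → + 2 * q + 0ℤ * p ≡ q + q
      i = solve-∀
      d2 : ∀ p → p + p ≡ + 2 * p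
      d2 = solve-∀

    G : Vecℤ n → Vecℤ n → ℤ
    G a b = + 2 * B a b + B a (A ∙ b)

    G≡ : ∀ a b → G a b ≡ B a ((+ 2 +i 0ℤ) ⊙ b ⊕ A ∙ b)
    G≡ a b = sym (trans (B-⊕ʳ a ((+ 2 +i 0ℤ) ⊙ b) (A ∙ b)) (cong (_+ B a (A ∙ b)) (two a b)))

    G-scaled : ∀ r a b → G (r ⊙ a) (r ⊙ b) ≡ nrm r * G a b
    G-scaled r a b = trans (cong₂ (λ p q → + 2 * p + q) (B-⊙⊙ r a b) (trans (B-cong {x = r ⊙ a} (λ _ → refl) (∙-⊙ A r b)) (B-⊙⊙ r a (A ∙ b)))) (lem (nrm r) (B a b) (B a (A ∙ b)))
      where
      lem : ∀ r p q → + 2 * (r * p) + r * q ≡ r * (+ 2 * p + q)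
      lem = solve-∀

    G-p : ∀ r a → G a (r ⊙ p) ≡ B a (r ⊙ w)
    G-p r a = trans (G≡ a (r ⊙ p)) (B-cong {x = a} (λ _ → refl) λ u → trans (cong₂ ℤi._+_ (swap (+ 2 +i 0ℤ) r (p u)) (∙-⊙ A r p u)) (trans (sym (dist r ((+ 2 +i 0ℤ) ℤi.* p u) ((A ∙ p) u))) (cong (r ℤi.*_) (2p+Ap u))))
      where
      open import Algebra.Bundles using (CommutativeRing)
      module R = CommutativeRing Zi.gaussian
      swap : ∀ a b c → a ℤi.* (b ℤi.* c) ≡ b ℤi.* (a ℤi.* c)
      swap a b c = trans (sym (R.*-assoc a b c)) (trans (cong (ℤi._* c) (R.*-comm a b)) (R.*-assoc b a c))
      dist : ∀ a b c → a ℤi.* (b ℤi.+ c) ≡ (a ℤi.* b) ℤi.+ (a ℤi.* c)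
      dist = R.distribˡ

    G-sym : ∀ a b → G a b ≡ G b a
    G-sym a b = cong₂ (λ p q → + 2 * p + q) (B-comm a b) (trans (self-adjoint A herm a b) (B-comm (A ∙ a) b))

    G-⊕ʳ : ∀ a b e → G a (b ⊕ e) ≡ G a b + G a e
    G-⊕ʳ a b e = trans (cong₂ (λ p q → + 2 * p + q) (B-⊕ʳ a b e) (trans (B-cong {x = a} (λ _ → refl) (∙-⊕ A b e)) (B-⊕ʳ a (A ∙ b) (A ∙ e))))
      (lem (B a b) (B a e) (B a (A ∙ b)) (B a (A ∙ e)))
      where
      lem : ∀ p q r s → + 2 * (p + q) + (r + s) ≡ (+ 2 * p + r) + (+ 2 * q + s)
      lem = solve-∀

    Gsx : G (s ⊙ x) (t ⊙ p) ≡ nrm s * B x ct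
    Gsx = trans (G-p t (s ⊙ x)) (trans (B-cong {x = s ⊙ x} (λ _ → refl) (λ u → comm₃ t s (c u))) (B-⊙⊙ s x ct))
      where
      open import Algebra.Bundles using (CommutativeRing)
      module R = CommutativeRing Zi.gaussian
      comm₃ : ∀ a b c → a ℤi.* (b ℤi.* c) ≡ b ℤi.* (c ℤi.* a)
      comm₃ a b c = trans (R.*-comm a (b ℤi.* c)) (R.*-assoc b c a)

    Gpp : G p p ≡ + 2 * B y₀ w - B g w
    Gpp = trans (G≡ p p) (trans (B-cong {x = p} (λ _ → refl) 2p+Ap) (trans (B-⊕ˡ ((+ 2 +i 0ℤ) ⊙ y₀) (⊖ g) w)
      (cong₂ _+_ (trans (B-comm ((+ 2 +i 0ℤ) ⊙ y₀) w) (trans (two w y₀) (cong (+ 2 *_) (B-comm w y₀)))) (B-⊖ˡ g w))))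

    Gzz : G z z ≡ nrm s * G x x + + 2 * (nrm s * B x ct) + nrm t * (+ 2 * B y₀ w - B g w)
    Gzz = begin
      G z z
        ≡⟨ G-⊕ʳ z (s ⊙ x) (t ⊙ p) ⟩
      G z (s ⊙ x) + G z (t ⊙ p)
        ≡⟨ cong₂ _+_ (trans (G-sym z (s ⊙ x)) (G-⊕ʳ (s ⊙ x) (s ⊙ x) (t ⊙ p))) (trans (G-sym z (t ⊙ p)) (G-⊕ʳ (t ⊙ p) (s ⊙ x) (t ⊙ p))) ⟩
      (G (s ⊙ x) (s ⊙ x) + G (s ⊙ x) (t ⊙ p)) + (G (t ⊙ p) (s ⊙ x) + G (t ⊙ p) (t ⊙ p))
        ≡⟨ cong₂ (λ i j → (i + G (s ⊙ x) (t ⊙ p)) + (j + G (t ⊙ p) (t ⊙ p))) (G-scaled s x x) (G-sym (t ⊙ p) (s ⊙ x)) ⟩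
      (nrm s * G x x + G (s ⊙ x) (t ⊙ p)) + (G (s ⊙ x) (t ⊙ p) + G (t ⊙ p) (t ⊙ p))
        ≡⟨ cong₂ (λ i j → (nrm s * G x x + i) + (i + j)) Gsx (trans (G-scaled t p p) (cong (nrm t *_) Gpp)) ⟩
      (nrm s * G x x + nrm s * B x ct) + (nrm s * B x ct + nrm t * (+ 2 * B y₀ w - B g w))
        ≡⟨ lem (nrm s * G x x) (nrm s * B x ct) (nrm t * (+ 2 * B y₀ w - B g w)) ⟩
      nrm s * G x x + + 2 * (nrm s * B x ct) + nrm t * (+ 2 * B y₀ w - B g w) ∎
      where
      lem : ∀ a b c → (a + b) + (b + c) ≡ a + + 2 * b + c
      lem = solve-∀

    total : nrm s * (+ 2 * B x′ x′ + B x′ (border A c d ∙ x′)) ≡ G z z + nrm t * (nrm s * (+ 2 + d) - (+ 2 * B y₀ w - B g w))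
    total = begin
      nrm s * (+ 2 * (nrm t + B x x) + B x′ (border A c d ∙ x′))
        ≡⟨ cong (λ q → nrm s * (+ 2 * (nrm t + B x x) + q)) (form-border A c d t x x′ refl (λ _ → refl)) ⟩
      nrm s * (+ 2 * (nrm t + B x x) + ((d * nrm t + + 2 * B x ct) + B x (A ∙ x)))
        ≡⟨ lem (nrm s) (nrm t) (B x x) d (B x ct) (B x (A ∙ x)) (+ 2 * B y₀ w - B g w) ⟩
      (nrm s * (+ 2 * B x x + B x (A ∙ x)) + + 2 * (nrm s * B x ct) + nrm t * (+ 2 * B y₀ w - B g w)) + nrm t * (nrm s * (+ 2 + d) - (+ 2 * B y₀ w - B g w))
        ≡⟨ cong (_+ nrm t * (nrm s * (+ 2 + d) - (+ 2 * B y₀ w - B g w))) Gzz ⟨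
      G z z + nrm t * (nrm s * (+ 2 + d) - (+ 2 * B y₀ w - B g w)) ∎
      where
      lem : ∀ s t x d c a k → s * (+ 2 * (t + x) + ((d * t + + 2 * c) + a)) ≡ (s * (+ 2 * x + a) + + 2 * (s * c) + t * k) + t * (s * (+ 2 + d) - k)
      lem = solve-∀

module GaussianNorms where
  open InnerProduct
  open GaussianIntegers
  open BorderedMatrices
  open import Algebra.Bundles using (CommutativeRing)
  open import Data.Integer.Base using (+_; -[1+_]; 0ℤ; ∣_∣)
  open import Data.Integer.Tactic.RingSolver using (solve-∀)
  open import Data.Nat.Base using (_+_; _*_; _≤_)
  open import Data.Nat.Properties
  open import Data.Sum.Base using (map)
  open import Relation.Nullary.Decidable using (¬?; decidable-stable)
  import Algebra.Properties.Semiring.Sum as SemiringSum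
  open Zi using (single; single-self; single-other)
  open ℤi using () renaming (_+_ to _⊞_; _*_ to _⊠_; -_ to ⊟_; sum to Σi) public

  module Σℕ = SemiringSum +-*-semiring
  module Gi = CommutativeRing Zi.gaussian

  norm : ℤ[i] → ℕ
  norm z = ∣ re z ∣ * ∣ re z ∣ + ∣ im z ∣ * ∣ im z ∣

  nrm≡norm : ∀ z → nrm z ≡ + norm z
  nrm≡norm (a +i b) = cong₂ ℤ._+_ (sq a) (sq b)
    where
    sq : ∀ a → a ℤ.* a ≡ + (∣ a ∣ * ∣ a ∣)
    sq (+ n)      = sym (ℤₚ.pos-* n n)
    sq (-[1+ n ]) = refl

  norm-* : ∀ x y → norm (x ⊠ y) ≡ norm x * norm y
  norm-* x@(a +i b) y@(c +i d) = ℤₚ.+-injective (begin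
    + norm (x ⊠ y)          ≡⟨ nrm≡norm (x ⊠ y) ⟨
    nrm (x ⊠ y)             ≡⟨ lem a b c d ⟩
    nrm x ℤ.* nrm y         ≡⟨ cong₂ ℤ._*_ (nrm≡norm x) (nrm≡norm y) ⟩
    + norm x ℤ.* + norm y   ≡⟨ ℤₚ.pos-* (norm x) (norm y) ⟨
    + (norm x * norm y)     ∎)
    where
    open ≡-Reasoning
    lem : ∀ a b c d → (a ℤ.* c ℤ.+ ℤ.- (b ℤ.* d)) ℤ.* (a ℤ.* c ℤ.+ ℤ.- (b ℤ.* d)) ℤ.+ (a ℤ.* d ℤ.+ b ℤ.* c) ℤ.* (a ℤ.* d ℤ.+ b ℤ.* c)
        ≡ (a ℤ.* a ℤ.+ b ℤ.* b) ℤ.* (c ℤ.* c ℤ.+ d ℤ.* d)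
    lem = solve-∀

  norm-conj : ∀ z → norm (conj z) ≡ norm z
  norm-conj (a +i b) = cong (λ k → ∣ a ∣ * ∣ a ∣ + k * k) (ℤₚ.∣-i∣≡∣i∣ b)

  norm-⊟ : ∀ z → norm (⊟ z) ≡ norm z
  norm-⊟ (a +i b) = cong₂ (λ j k → j * j + k * k) (ℤₚ.∣-i∣≡∣i∣ a) (ℤₚ.∣-i∣≡∣i∣ b)

  ⊟-involutive : ∀ z → ⊟ (⊟ z) ≡ z
  ⊟-involutive (a +i b) = cong₂ _+i_ (ℤₚ.neg-involutive a) (ℤₚ.neg-involutive b)

  norm≡0 : ∀ {z} → norm z ≡ 0 → z ≡ 0ᵢ
  norm≡0 {a +i b} e = cong₂ _+i_ (ℤₚ.∣i∣≡0⇒i≡0 (square-0 (m+n≡0⇒m≡0 (∣ a ∣ * ∣ a ∣) e))) (ℤₚ.∣i∣≡0⇒i≡0 (square-0 (m+n≡0⇒n≡0 (∣ a ∣ * ∣ a ∣) e)))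
    where
    square-0 : ∀ {k} → k * k ≡ 0 → k ≡ 0
    square-0 {zero} _ = refl

  norm≢0 : ∀ {z} → z ≢ 0ᵢ → 1 ≤ norm z
  norm≢0 {z} z≢0 with norm z in e
  ... | zero  = contradiction (norm≡0 e) z≢0
  ... | suc _ = s≤s z≤n

  norm-hermitian : ∀ {n} {A : Matrix n} → Hermitian A → ∀ u v → norm (A u v) ≡ norm (A v u)
  norm-hermitian {A = A} herm u v = trans (cong norm (herm u v)) (norm-conj (A v u))

  real-diagonal : ∀ {n} {A : Matrix n} → Hermitian A → ∀ u → A u u ≡ re (A u u) +i 0ℤ
  real-diagonal {A = A} herm u = cong (re (A u u) +i_) (self-neg (im (A u u)) (cong im (herm u u)))
    where
    self-neg : ∀ z → z ≡ ℤ.- z → z ≡ 0ℤ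
    self-neg (+ zero)  _ = refl
    self-neg (+ suc _) ()
    self-neg -[1+ _ ]  ()

  z*conj : ∀ z → z ⊠ conj z ≡ (+ norm z) +i 0ℤ
  z*conj z@(a +i b) = cong₂ _+i_ (trans (r a b) (nrm≡norm z)) (i a b)
    where
    r : ∀ a b → a ℤ.* a ℤ.+ ℤ.- (b ℤ.* (ℤ.- b)) ≡ a ℤ.* a ℤ.+ b ℤ.* b
    r = solve-∀
    i : ∀ a b → a ℤ.* (ℤ.- b) ℤ.+ b ℤ.* a ≡ 0ℤ
    i = solve-∀

  conj-conj : ∀ z → conj (conj z) ≡ z
  conj-conj (a +i b) = cong (a +i_) (ℤₚ.neg-involutive b)

  conj-⊠ : ∀ x y → conj (x ⊠ y) ≡ conj x ⊠ conj y
  conj-⊠ (a +i b) (c +i d) = cong₂ _+i_ (r a b c d) (i a b c d)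
    where
    r : ∀ a b c d → a ℤ.* c ℤ.+ ℤ.- (b ℤ.* d) ≡ a ℤ.* c ℤ.+ ℤ.- ((ℤ.- b) ℤ.* (ℤ.- d))
    r = solve-∀
    i : ∀ a b c d → ℤ.- (a ℤ.* d ℤ.+ b ℤ.* c) ≡ a ℤ.* (ℤ.- d) ℤ.+ (ℤ.- b) ℤ.* c
    i = solve-∀

  conj-⊞ : ∀ x y → conj (x ⊞ y) ≡ conj x ⊞ conj y
  conj-⊞ (a +i b) (c +i d) = cong ((a ℤ.+ c) +i_) (ℤₚ.neg-distrib-+ b d)

  _≟ᵢ_ : (x y : ℤ[i]) → Dec (x ≡ y)
  (a +i b) ≟ᵢ (c +i d) with a ℤₚ.≟ c | b ℤₚ.≟ d
  ... | yes p | yes q = yes (cong₂ _+i_ p q)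
  ... | no ¬p | _     = no λ e → ¬p (cong re e)
  ... | _     | no ¬q = no λ e → ¬q (cong im e)

  ⊠-zero : ∀ {x y} → x ⊠ y ≡ 0ᵢ → x ≡ 0ᵢ ⊎ y ≡ 0ᵢ
  ⊠-zero {x} {y} e = map norm≡0 norm≡0 (m*n≡0⇒m≡0∨n≡0 (norm x) {norm y} norms)
    where
    norms : norm x * norm y ≡ 0
    norms = trans (sym (norm-* x y)) (cong norm e)

  ⊠-cancelˡ : ∀ {x y z} → x ≢ 0ᵢ → x ⊠ y ≡ x ⊠ z → y ≡ z
  ⊠-cancelˡ {x} {y} {z} x≢0 e = difference (⊠-zero {x} {y ⊞ ⊟ z} product)
    where
    open ≡-Reasoning
    product : x ⊠ (y ⊞ ⊟ z) ≡ 0ᵢ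
    product = begin
      x ⊠ (y ⊞ ⊟ z)          ≡⟨ Gi.distribˡ x y (⊟ z) ⟩
      (x ⊠ y) ⊞ (x ⊠ (⊟ z))  ≡⟨ cong (_⊞ (x ⊠ (⊟ z))) e ⟩
      (x ⊠ z) ⊞ (x ⊠ (⊟ z))  ≡⟨ Gi.distribˡ x z (⊟ z) ⟨
      x ⊠ (z ⊞ ⊟ z)          ≡⟨ cong (x ⊠_) (Gi.-‿inverseʳ z) ⟩
      x ⊠ 0ᵢ                 ≡⟨ Gi.zeroʳ x ⟩
      0ᵢ                     ∎
    difference : x ≡ 0ᵢ ⊎ y ⊞ ⊟ z ≡ 0ᵢ → y ≡ z
    difference (inj₁ p) = contradiction p x≢0
    difference (inj₂ p) = cong₂ _+i_ (ℤₚ.i-j≡0⇒i≡j (re y) (re z) (cong re p)) (ℤₚ.i-j≡0⇒i≡j (im y) (im z) (cong im p))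

  Support : ℕ → Set
  Support n = List (Fin n × ℤ[i])

  infix 8 ⟦_⟧

  ⟦_⟧ : ∀ {n} → Support n → Fin n → ℤ[i]
  ⟦ [] ⟧           k = 0ᵢ
  ⟦ (j , w) ∷ ws ⟧ k = single j w k ⊞ ⟦ ws ⟧ k

  lin : ∀ {n} → Support n → (Fin n → ℤ[i]) → ℤ[i]
  lin []             g = 0ᵢ
  lin ((j , w) ∷ ws) g = (w ⊠ g j) ⊞ lin ws g

  module ΣG = SemiringSum (CommutativeRing.semiring Zi.gaussian)

  sum-single : ∀ {n} (j : Fin n) w (g : Fin n → ℤ[i]) → Σi (λ k → single j w k ⊠ g k) ≡ w ⊠ g j
  sum-single {suc n} zero w g = trans (cong ((w ⊠ g zero) ⊞_) (trans (ΣG.sum-cong-≗ λ k → Gi.zeroˡ (g (suc k))) (ΣG.sum-replicate-zero n))) (Gi.+-identityʳ _)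
  sum-single {suc n} (suc j) w g = trans (cong₂ _⊞_ (Gi.zeroˡ (g zero)) (sum-single j w (g ∘ suc))) (Gi.+-identityˡ _)

  sum-support : ∀ {n} (ws : Support n) (g : Fin n → ℤ[i]) → Σi (λ k → ⟦ ws ⟧ k ⊠ g k) ≡ lin ws g
  sum-support {n} [] g = trans (ΣG.sum-cong-≗ λ k → Gi.zeroˡ (g k)) (ΣG.sum-replicate-zero n)
  sum-support ((j , w) ∷ ws) g = trans (ΣG.sum-cong-≗ λ k → Gi.distribʳ (g k) (single j w k) (⟦ ws ⟧ k))
    (trans (ΣG.∑-distrib-+ (λ k → single j w k ⊠ g k) (λ k → ⟦ ws ⟧ k ⊠ g k)) (cong₂ _⊞_ (sum-single j w g) (sum-support ws g)))

  row-sum : ∀ {n} {f : Fin n → ℤ[i]} ws → f ≗ ⟦ ws ⟧ → ∀ g → Σi (λ k → f k ⊠ g k) ≡ lin ws g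
  row-sum ws e g = trans (ΣG.sum-cong-≗ λ k → cong (_⊠ g k) (e k)) (sum-support ws g)

  erase : ∀ {n} → Fin n → (Fin n → ℤ[i]) → Fin n → ℤ[i]
  erase zero    f zero    = 0ᵢ
  erase zero    f (suc k) = f (suc k)
  erase (suc j) f zero    = f zero
  erase (suc j) f (suc k) = erase j (f ∘ suc) k

  erase-split : ∀ {n} (j : Fin n) f → f ≗ λ k → single j (f j) k ⊞ erase j f k
  erase-split zero    f zero    = sym (Gi.+-identityʳ _)
  erase-split zero    f (suc k) = sym (Gi.+-identityˡ _)
  erase-split (suc j) f zero    = sym (Gi.+-identityˡ _)
  erase-split (suc j) f (suc k) = erase-split j (f ∘ suc) k

  erase-self : ∀ {n} (j : Fin n) f → erase j f j ≡ 0ᵢ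
  erase-self zero    f = refl
  erase-self (suc j) f = erase-self j (f ∘ suc)

  erase-other : ∀ {n} (j k : Fin n) f → j ≢ k → erase j f k ≡ f k
  erase-other zero    zero    f ne = contradiction refl ne
  erase-other zero    (suc k) f ne = refl
  erase-other (suc j) zero    f ne = refl
  erase-other (suc j) (suc k) f ne = erase-other j k (f ∘ suc) (ne ∘ cong suc)

  total : ∀ {n} → (Fin n → ℤ[i]) → ℕ
  total f = Σℕ.sum (norm ∘ f)

  erase-total : ∀ {n} (j : Fin n) f → total f ≡ norm (f j) + total (erase j f)
  erase-total zero    f = refl
  erase-total (suc j) f = trans (cong (λ t → norm (f zero) + t) (erase-total j (f ∘ suc))) (lem (norm (f zero)) (norm (f (suc j))) (total (erase j (f ∘ suc))))
    where
    lem : ∀ a b c → a + (b + c) ≡ b + (a + c)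
    lem a b c = trans (sym (+-assoc a b c)) (trans (cong (_+ c) (+-comm a b)) (+-assoc b a c))

  total≡0 : ∀ {n} (f : Fin n → ℤ[i]) → total f ≡ 0 → ∀ k → f k ≡ 0ᵢ
  total≡0 f e zero    = norm≡0 (m+n≡0⇒m≡0 (norm (f zero)) e)
  total≡0 f e (suc k) = total≡0 (f ∘ suc) (m+n≡0⇒n≡0 (norm (f zero)) e) k

  total-cong : ∀ {n} {f g : Fin n → ℤ[i]} → f ≗ g → total f ≡ total g
  total-cong e = Σℕ.sum-cong-≗ λ k → cong norm (e k)

  weight : ∀ {n} → Support n → ℕ
  weight []             = 0
  weight ((j , w) ∷ ws) = norm w + weight ws

  infix 4 _∉_

  _∉_ : ∀ {n} → Fin n → Support n → Set
  k ∉ []             = ⊤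
  k ∉ ((j , w) ∷ ws) = k ≢ j × k ∉ ws

  Proper : ∀ {n} → Support n → Set
  Proper []             = ⊤
  Proper ((j , w) ∷ ws) = 1 ≤ norm w × j ∉ ws × Proper ws

  ⟦⟧-∉ : ∀ {n} (ws : Support n) k → k ∉ ws → ⟦ ws ⟧ k ≡ 0ᵢ
  ⟦⟧-∉ []             k _       = refl
  ⟦⟧-∉ ((j , w) ∷ ws) k (p , q) = cong₂ _⊞_ (single-other j k w (p ∘ sym)) (⟦⟧-∉ ws k q)

  ⟦⟧-head : ∀ {n} j w (ws : Support n) → j ∉ ws → ⟦ (j , w) ∷ ws ⟧ j ≡ w
  ⟦⟧-head j w ws p = trans (cong₂ _⊞_ (single-self j w) (⟦⟧-∉ ws j p)) (Gi.+-identityʳ w)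

  ⟦⟧-tail : ∀ {n} j w (ws : Support n) k → k ≢ j → ⟦ (j , w) ∷ ws ⟧ k ≡ ⟦ ws ⟧ k
  ⟦⟧-tail j w ws k p = trans (cong (_⊞ ⟦ ws ⟧ k) (single-other j k w (p ∘ sym))) (Gi.+-identityˡ _)

  nonzero-entry : ∀ {n} (g : Fin n → ℤ[i]) → total g ≢ 0 → ∃[ v ] g v ≢ 0ᵢ
  nonzero-entry {n} g ne = by (Finₚ.any? (λ v → ¬? (g v ≟ᵢ 0ᵢ)))
    where
    by : Dec (∃[ v ] g v ≢ 0ᵢ) → ∃[ v ] g v ≢ 0ᵢ
    by (yes p) = p
    by (no ¬p) = contradiction (trans (total-cong λ v → decidable-stable (g v ≟ᵢ 0ᵢ) λ nz → ¬p (v , nz)) (Σℕ.sum-replicate-zero n)) ne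

  private
    ∉-support : ∀ {n} (ws : Support n) → Proper ws → ∀ k → ⟦ ws ⟧ k ≡ 0ᵢ → k ∉ ws
    ∉-support [] p k e = tt
    ∉-support ((j , w) ∷ ws) (1≤w , j∉ , p) k e = k≢j , ∉-support ws p k (trans (sym (⟦⟧-tail j w ws k k≢j)) e)
      where
      k≢j : k ≢ j
      k≢j refl = contradiction 1≤w (subst (λ z → ¬ 1 ≤ norm z) (trans (sym e) (⟦⟧-head j w ws j∉)) λ ())

  SupportOf : ∀ {n} → (Fin n → ℤ[i]) → ℕ → Set
  SupportOf f m = ∃[ ws ] f ≗ ⟦ ws ⟧ × Proper ws × weight ws ≡ m

  private
    prepend : ∀ {n} (j : Fin n) f → f j ≢ 0ᵢ → ∀ m → SupportOf (erase j f) m →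
              ∃[ ws ] f ≗ ⟦ (j , f j) ∷ ws ⟧ × Proper ((j , f j) ∷ ws) × weight ws ≡ m
    prepend j f fj≢0 m (ws , eq , proper , wt) = ws , values , (norm≢0 fj≢0 , ∉-support ws proper j (trans (sym (eq j)) (erase-self j f)) , proper) , wt
      where
      values : f ≗ ⟦ (j , f j) ∷ ws ⟧
      values k = trans (erase-split j f k) (cong (single j (f j) k ⊞_) (eq k))

    support-fuel : ∀ {n} fuel m → m ≤ fuel → (f : Fin n → ℤ[i]) → total f ≡ m → SupportOf f m
    support-fuel fuel zero m≤ f e = [] , total≡0 f e , tt , refl
    support-fuel {n} (suc fuel) (suc m) m≤ f e = split (nonzero-entry f (λ z → contradiction (trans (sym e) z) λ ()))
      where
      split : (∃ λ k → f k ≢ 0ᵢ) → SupportOf f (suc m)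
      split (j , fj≢0) = assemble (prepend j f fj≢0 rest (support-fuel fuel rest bound (erase j f) refl))
        where
        rest : ℕ
        rest = total (erase j f)
        splits : norm (f j) + rest ≡ suc m
        splits = trans (sym (erase-total j f)) e
        bound : rest ≤ fuel
        bound = ≤-pred (≤-trans (+-monoˡ-≤ rest (norm≢0 fj≢0)) (≤-trans (≤-reflexive splits) m≤))
        assemble : (∃[ ws ] f ≗ ⟦ (j , f j) ∷ ws ⟧ × Proper ((j , f j) ∷ ws) × weight ws ≡ rest) → SupportOf f (suc m)
        assemble (ws , values , proper , wt) = (j , f j) ∷ ws , values , proper , trans (cong (λ t → norm (f j) + t) wt) splits

  support : ∀ {n} m (f : Fin n → ℤ[i]) → total f ≡ m → SupportOf f m
  support m f e = support-fuel m m ≤-refl f e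

  support-from : ∀ {n} (j : Fin n) (f : Fin n → ℤ[i]) → f j ≢ 0ᵢ → ∀ m → total f ≡ norm (f j) + m →
    ∃[ ws ] f ≗ ⟦ (j , f j) ∷ ws ⟧ × Proper ((j , f j) ∷ ws) × weight ws ≡ m
  support-from j f fj≢0 m e = prepend j f fj≢0 m (support m (erase j f) (+-cancelˡ-≡ (norm (f j)) (total (erase j f)) m (trans (sym (erase-total j f)) e)))

  norm≢3 : ∀ z → norm z ≢ 3
  norm≢3 (a +i b) = go ∣ a ∣ ∣ b ∣
    where
    go : ∀ m n → m * m + n * n ≢ 3
    go zero          zero          ()
    go zero          (suc zero)    ()
    go zero          (suc (suc n)) e = contradiction (≤-trans (*-mono-≤ {2} {2 + n} (s≤s (s≤s z≤n)) (s≤s (s≤s z≤n))) (≤-reflexive e)) (<⇒≱ (s≤s (s≤s (s≤s (s≤s z≤n)))))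
    go (suc zero)    zero          ()
    go (suc zero)    (suc zero)    ()
    go (suc zero)    (suc (suc n)) e = contradiction (≤-trans (≤-trans (*-mono-≤ {2} {2 + n} (s≤s (s≤s z≤n)) (s≤s (s≤s z≤n))) (m≤n+m ((2 + n) * (2 + n)) 1)) (≤-reflexive e)) (<⇒≱ (s≤s (s≤s (s≤s (s≤s z≤n)))))
    go (suc (suc m)) n             e = contradiction (≤-trans (≤-trans (*-mono-≤ {2} {2 + m} (s≤s (s≤s z≤n)) (s≤s (s≤s z≤n))) (m≤m+n ((2 + m) * (2 + m)) (n * n))) (≤-reflexive e)) (<⇒≱ (s≤s (s≤s (s≤s (s≤s z≤n)))))

module UnextendableMatrices where
  open InnerProduct
  open GaussianIntegers
  open BorderedMatrices
  open GaussianNorms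
  open import Data.Integer.Base using (+_; -[1+_]; 0ℤ; 1ℤ; _+_; _*_; -_; _-_; _≤_; _<_; +≤+; -≤+; +<+)
  open import Data.Integer.Properties
  open import Data.Integer.Tactic.RingSolver using (solve-∀)
  open Zi using (B; B-cong; B-comm; B-⊕ʳ; B-⊕ˡ; dot; _∙_; _⊕_; _⊙_; ∙-cong; ∙-⊕; ∙-⊙; self-adjoint; single; B-single; ∙-single; single-self; single-other)

  record Core {n} (A : Matrix n) : Set where
    field
      herm  : Hermitian A
      conn  : Indecomposable A
      psd±  : Psd± A
      noext : ∀ (c : Vecℤ n) d u → c u ≢ 0ᵢ → ¬ Psd± (border A c d)

  Psd-cong : ∀ {n} {A C : Matrix n} → A ≐ C → Psd A → Psd C
  Psd-cong {A = A} {C} e p x = subst (λ b → 0ℤ ≤ + 2 * B x x + b)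
    (B-cong {x = x} (λ _ → refl) λ u → ΣG.sum-cong-≗ λ k → cong (_⊠ x k) (e u k)) (p x)

  border-⊖ : ∀ {n} (A : Matrix n) c d → border (⊖M A) (⊖ c) (- d) ≐ ⊖M (border A c d)
  border-⊖ A c d zero    zero    = refl
  border-⊖ A c d zero    (suc v) = refl
  border-⊖ A c d (suc u) zero    = refl
  border-⊖ A c d (suc u) (suc v) = refl

  ⊖M-⊖M : ∀ {n} (A : Matrix n) → ⊖M (⊖M A) ≐ A
  ⊖M-⊖M A u v = ⊟-involutive (A u v)

  Hermitian-⊖ : ∀ {n} {A : Matrix n} → Hermitian A → Hermitian (⊖M A)
  Hermitian-⊖ h u v = cong ⊟_ (h u v)

  K : ∀ {n} → Matrix n → Vecℤ n → Vecℤ n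
  K A y u = (+ 4 +i 0ℤ) ⊠ y u ⊞ ⊟ (A ∙ (A ∙ y)) u

  sq : ∀ {n} → Matrix n → Fin n → Fin n → ℤ[i]
  sq A u v = Σi λ k → A u k ⊠ A k v

  unit : ∀ {n} → Fin n → Vecℤ n
  unit u = single u +1ᵢ

  column : ∀ {n} (A : Matrix n) u → A ∙ unit u ≗ λ v → A v u
  column A u v = trans (∙-single A u +1ᵢ v) (Gi.*-identityʳ (A v u))

  A-A-unit : ∀ {n} (A : Matrix n) u v → (A ∙ (A ∙ unit u)) v ≡ sq A v u
  A-A-unit A u v = ∙-cong A (column A u) v

  B-self : ∀ {n} (y : Vecℤ n) → B y y ≡ + total y
  B-self {zero}  y = refl
  B-self {suc n} y = trans (cong₂ _+_ (nrm≡norm (y zero)) (B-self (y ∘ suc))) (sym (pos-+ (norm (y zero)) (total (y ∘ suc))))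

  B-unit : ∀ {n} u (y : Vecℤ n) → B (unit u) y ≡ re (y u)
  B-unit u y = trans (B-single u +1ᵢ y) (lem (re (y u)) (im (y u)))
    where
    lem : ∀ a b → 1ℤ * a + 0ℤ * b ≡ a
    lem = solve-∀

  sq-⊖ : ∀ {n} (A : Matrix n) u v → sq (⊖M A) u v ≡ sq A u v
  sq-⊖ A u v = ΣG.sum-cong-≗ λ k → cong₂ _+i_ (r (re (A u k)) (im (A u k)) (re (A k v)) (im (A k v))) (i (re (A u k)) (im (A u k)) (re (A k v)) (im (A k v)))
    where
    r : ∀ a b c d → (- a) * (- c) + - ((- b) * (- d)) ≡ a * c + - (b * d)
    r = solve-∀
    i : ∀ a b c d → (- a) * (- d) + (- b) * (- c) ≡ a * d + b * c
    i = solve-∀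

  module CoreFacts {n} {A : Matrix n} (core : Core A) where
    open Core core

    extend : ∀ (y₀ c : Vecℤ n) s d u → c u ≢ 0ᵢ → 0ℤ < nrm s → (∀ w → K A y₀ w ≡ s ⊠ c w) →
      + 2 * B y₀ (s ⊙ c) - B (A ∙ y₀) (s ⊙ c) ≤ nrm s * (+ 2 + d) →
      + 2 * B y₀ (s ⊙ c) + B (A ∙ y₀) (s ⊙ c) ≤ nrm s * (+ 2 - d) → ⊥
    extend y₀ c s d u cu≢0 0<s Ky₀ up low = noext c d u cu≢0 (psd⇒psd± {A = border A c d}
        (psd-border A herm (psd±⇒psd {A = A} psd±) y₀ c s d 0<s Ky₀ up)
        (Psd-cong {A = border (⊖M A) (⊖ c) (- d)} (border-⊖ A c d)
          (psd-border (⊖M A) (Hermitian-⊖ herm) (psd±⇒psd⊖ {A = A} psd±) y₀ (⊖ c) (⊟ s) (- d) (subst (0ℤ <_) (sym nrm-⊟) 0<s) Ky₀′ low′)))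
      where
      nrm-⊟ : nrm (⊟ s) ≡ nrm s
      nrm-⊟ = lem (re s) (im s)
        where
        lem : ∀ a b → (- a) * (- a) + (- b) * (- b) ≡ a * a + b * b
        lem = solve-∀
      signs : (⊟ s) ⊙ (⊖ c) ≗ s ⊙ c
      signs w = cong₂ _+i_ (r (re s) (im s) (re (c w)) (im (c w))) (i (re s) (im s) (re (c w)) (im (c w)))
        where
        r : ∀ a b c d → (- a) * (- c) + - ((- b) * (- d)) ≡ a * c + - (b * d)
        r = solve-∀
        i : ∀ a b c d → (- a) * (- d) + (- b) * (- c) ≡ a * d + b * c
        i = solve-∀
      AA : ⊖M A ∙ (⊖M A ∙ y₀) ≗ A ∙ (A ∙ y₀)
      AA w = trans (⊖M-∙ A (⊖M A ∙ y₀) w) (trans (cong ⊟_ (trans (∙-cong A (⊖M-∙ A y₀) w) (∙-⊖ A (A ∙ y₀) w)))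
        (cong₂ _+i_ (neg-involutive (re ((A ∙ (A ∙ y₀)) w))) (neg-involutive (im ((A ∙ (A ∙ y₀)) w)))))
      Ky₀′ : ∀ w → K (⊖M A) y₀ w ≡ (⊟ s) ⊠ (⊟ c w)
      Ky₀′ w = trans (cong (λ z → (+ 4 +i 0ℤ) ⊠ y₀ w ⊞ ⊟ z) (AA w)) (trans (Ky₀ w) (sym (signs w)))
      q≡ : B (⊖M A ∙ y₀) ((⊟ s) ⊙ (⊖ c)) ≡ - B (A ∙ y₀) (s ⊙ c)
      q≡ = trans (B-cong {y = (⊟ s) ⊙ (⊖ c)} (⊖M-∙ A y₀) signs) (B-⊖ˡ (A ∙ y₀) (s ⊙ c))
      low′ : + 2 * B y₀ ((⊟ s) ⊙ (⊖ c)) - B (⊖M A ∙ y₀) ((⊟ s) ⊙ (⊖ c)) ≤ nrm (⊟ s) * (+ 2 + - d)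
      low′ = subst₂ _≤_ (cong₂ (λ p q → + 2 * p + q) (sym (B-cong {x = y₀} (λ _ → refl) signs)) (sym (trans (cong -_ q≡) (neg-involutive (B (A ∙ y₀) (s ⊙ c)))))) (cong (_* (+ 2 - d)) (sym nrm-⊟)) low

    contraction : ∀ x → 0ℤ ≤ + 4 * B x x - B (A ∙ x) (A ∙ x)
    contraction x = cancel-factor {+ 4} (+<+ (s≤s z≤n)) (subst (0ℤ ≤_) eq (+-mono-≤ (proj₁ (psd± p)) (proj₂ (psd± p′))))
      where
      b c : Vecℤ n
      b = A ∙ x
      c = A ∙ b
      p p′ : Vecℤ n
      p  = x ⊕ x ⊕ ⊖ b
      p′ = x ⊕ x ⊕ b
      Ap : A ∙ p ≗ b ⊕ b ⊕ ⊖ c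
      Ap u = trans (∙-⊕ A (x ⊕ x) (⊖ b) u) (cong₂ _⊞_ (∙-⊕ A x x u) (∙-⊖ A b u))
      Ap′ : A ∙ p′ ≗ b ⊕ b ⊕ c
      Ap′ u = trans (∙-⊕ A (x ⊕ x) b u) (cong (_⊞ c u) (∙-⊕ A x x u))
      xc : B x c ≡ B b b
      xc = self-adjoint A herm x b
      expand : ∀ (y z w v : Vecℤ n) → B (y ⊕ y ⊕ z) (w ⊕ w ⊕ v) ≡ + 4 * B y w + + 2 * B y v + + 2 * B z w + B z v
      expand y z w v = trans (B-⊕ˡ (y ⊕ y) z (w ⊕ w ⊕ v)) (trans (cong₂ _+_ (trans (B-⊕ˡ y y (w ⊕ w ⊕ v)) (cong₂ _+_ (right y) (right y))) (right z))
        (lem (B y w) (B y v) (B z w) (B z v)))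
        where
        right : ∀ y → B y (w ⊕ w ⊕ v) ≡ (B y w + B y w) + B y v
        right y = trans (B-⊕ʳ y (w ⊕ w) v) (cong (_+ B y v) (B-⊕ʳ y w w))
        lem : ∀ p q r s → (((p + p) + q) + ((p + p) + q)) + ((r + r) + s) ≡ + 4 * p + + 2 * q + + 2 * r + s
        lem = solve-∀
      pp : B p p ≡ + 4 * B x x + + 2 * (- B x b) + + 2 * (- B x b) + B b b
      pp = trans (expand x (⊖ b) x (⊖ b)) (cong₂ _+_ (cong₂ (λ i j → + 4 * B x x + + 2 * i + + 2 * j) (B-⊖ʳ x b) (trans (B-⊖ˡ b x) (cong -_ (B-comm b x))))
        (trans (B-⊖ˡ b (⊖ b)) (trans (cong -_ (B-⊖ʳ b b)) (neg-involutive (B b b)))))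
      pAp : B p (A ∙ p) ≡ + 4 * B x b + + 2 * (- B b b) + + 2 * (- B b b) + B b c
      pAp = trans (B-cong {x = p} (λ _ → refl) Ap) (trans (expand x (⊖ b) b (⊖ c)) (cong₂ _+_ (cong₂ (λ i j → + 4 * B x b + + 2 * i + + 2 * j) (trans (B-⊖ʳ x c) (cong -_ xc)) (B-⊖ˡ b b))
        (trans (B-⊖ˡ b (⊖ c)) (trans (cong -_ (B-⊖ʳ b c)) (neg-involutive (B b c))))))
      pp′ : B p′ p′ ≡ + 4 * B x x + + 2 * B x b + + 2 * B x b + B b b
      pp′ = trans (expand x b x b) (cong (λ j → + 4 * B x x + + 2 * B x b + + 2 * j + B b b) (B-comm b x))
      pAp′ : B p′ (A ∙ p′) ≡ + 4 * B x b + + 2 * B b b + + 2 * B b b + B b c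
      pAp′ = trans (B-cong {x = p′} (λ _ → refl) Ap′) (trans (expand x b b c) (cong (λ i → + 4 * B x b + + 2 * i + + 2 * B b b + B b c) xc))
      eq : (+ 2 * B p p + B p (A ∙ p)) + (+ 2 * B p′ p′ - B p′ (A ∙ p′)) ≡ + 4 * (+ 4 * B x x - B b b)
      eq = trans (cong₂ _+_ (cong₂ (λ i j → + 2 * i + j) pp pAp) (cong₂ (λ i j → + 2 * i - j) pp′ pAp′)) (lem (B x x) (B x b) (B b b) (B b c))
        where
        lem : ∀ a h b c → (+ 2 * (+ 4 * a + + 2 * (- h) + + 2 * (- h) + b) + (+ 4 * h + + 2 * (- b) + + 2 * (- b) + c)) +
              (+ 2 * (+ 4 * a + + 2 * h + + 2 * h + b) - (+ 4 * h + + 2 * b + + 2 * b + c)) ≡ + 4 * (+ 4 * a - b)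
        lem = solve-∀

    norm-sym : ∀ u v → norm (A u v) ≡ norm (A v u)
    norm-sym = norm-hermitian herm

    deg : Fin n → ℕ
    deg u = total (A u)

    B-column : ∀ u → B (A ∙ unit u) (A ∙ unit u) ≡ + deg u
    B-column u = trans (B-cong (column A u) (column A u)) (trans (B-self (λ v → A v u)) (cong +_ (Σℕ.sum-cong-≗ λ v → norm-sym v u)))

    B-unit-unit : ∀ (u : Fin n) → B (unit u) (unit u) ≡ 1ℤ
    B-unit-unit u = trans (B-unit u (unit u)) (cong re (single-self u +1ᵢ))

    deg≤4 : ∀ u → deg u ℕ.≤ 4
    deg≤4 u = drop‿+≤+ {deg u} {4} (0≤i-j⇒j≤i {+ 4} {+ deg u} (subst (0ℤ ≤_) eq (contraction (unit u))))
      where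
      eq : + 4 * B (unit u) (unit u) - B (A ∙ unit u) (A ∙ unit u) ≡ + 4 - + deg u
      eq = trans (cong (λ i → + 4 * i - B (A ∙ unit u) (A ∙ unit u)) (B-unit-unit u)) (cong (λ j → + 4 - j) (B-column u))

    Full : Fin n → Set
    Full u = deg u ≡ 4

    -- The form 4|x|² - |Ax|² is nonnegative, so a vector on which it vanishes lies in its radical.
    K-full : ∀ u → Full u → ∀ w → K A (unit u) w ≡ 0ᵢ
    K-full u full w = cong₂ _+i_ (trans (sym (B-unit w k)) (orthogonal (unit w)))
                                 (trans (sym (B-i (im (k w)) (re (k w)))) (trans (sym (B-single w ℤi.i k)) (orthogonal (single w ℤi.i))))
      where
      k e : Vecℤ n
      k = K A (unit u)
      e = unit u
      B-i : ∀ b a → 0ℤ * a + 1ℤ * b ≡ b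
      B-i = solve-∀
      Q : Vecℤ n → ℤ
      Q x = + 4 * B x x - B (A ∙ x) (A ∙ x)
      Qe : Q e ≡ 0ℤ
      Qe = trans (cong (λ i → + 4 * i - B (A ∙ e) (A ∙ e)) (B-unit-unit u)) (cong (λ j → + 4 - j) (trans (B-column u) (cong +_ full)))
      polar : ∀ x → B x k ≡ + 4 * B x e - B (A ∙ x) (A ∙ e)
      polar x = trans (B-⊕ʳ x ((+ 4 +i 0ℤ) ⊙ e) (⊖ (A ∙ (A ∙ e)))) (cong₂ _+_ four (trans (B-⊖ʳ x (A ∙ (A ∙ e))) (cong -_ (self-adjoint A herm x (A ∙ e)))))
        where
        four : B x ((+ 4 +i 0ℤ) ⊙ e) ≡ + 4 * B x e
        four = scaleʳ x (+ 4) e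
          where
          scaleʳ : ∀ {m} (x : Vecℤ m) r y → B x ((r +i 0ℤ) ⊙ y) ≡ r * B x y
          scaleʳ {zero}  x r y = sym (*-zeroʳ r)
          scaleʳ {suc m} x r y = trans (cong (λ s → dot (x zero) ((r +i 0ℤ) ⊠ y zero) + s) (scaleʳ (x ∘ suc) r (y ∘ suc)))
            (lem (re (x zero)) (im (x zero)) (re (y zero)) (im (y zero)) r (B (x ∘ suc) (y ∘ suc)))
            where
            lem : ∀ a b c d r s → (a * (r * c + - (0ℤ * d)) + b * (r * d + 0ℤ * c)) + r * s ≡ r * ((a * c + b * d) + s)
            lem = solve-∀
      Q-sum : ∀ (m : ℤ) x → Q (x ⊕ (m +i 0ℤ) ⊙ e) ≡ Q x + + 2 * (m * B x k) + (m * m) * Q e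
      Q-sum m x = trans (cong₂ (λ i j → + 4 * i - j) (square x e) (trans (B-cong (dist) (dist)) (square (A ∙ x) (A ∙ e))))
        (trans (lem (B x x) (B x e) (B e e) (B (A ∙ x) (A ∙ x)) (B (A ∙ x) (A ∙ e)) (B (A ∙ e) (A ∙ e)) m) (cong (λ b → Q x + + 2 * (m * b) + (m * m) * Q e) (sym (polar x))))
        where
        dist : A ∙ (x ⊕ (m +i 0ℤ) ⊙ e) ≗ A ∙ x ⊕ (m +i 0ℤ) ⊙ (A ∙ e)
        dist v = trans (∙-⊕ A x ((m +i 0ℤ) ⊙ e) v) (cong ((A ∙ x) v ⊞_) (∙-⊙ A (m +i 0ℤ) e v))
        square : ∀ {k} (y z : Vecℤ k) → B (y ⊕ (m +i 0ℤ) ⊙ z) (y ⊕ (m +i 0ℤ) ⊙ z) ≡ B y y + + 2 * (m * B y z) + (m * m) * B z z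
        square {zero}  y z = lem0 m
          where
          lem0 : ∀ m → 0ℤ ≡ 0ℤ + + 2 * (m * 0ℤ) + (m * m) * 0ℤ
          lem0 = solve-∀
        square {suc k} y z = trans (cong (λ s → nrm (y zero ⊞ ((m +i 0ℤ) ⊠ z zero)) + s) (square (y ∘ suc) (z ∘ suc)))
          (lem1 (re (y zero)) (im (y zero)) (re (z zero)) (im (z zero)) m (B (y ∘ suc) (y ∘ suc)) (B (y ∘ suc) (z ∘ suc)) (B (z ∘ suc) (z ∘ suc)))
          where
          lem1 : ∀ a b c d m p q r → ((a + (m * c + - (0ℤ * d))) * (a + (m * c + - (0ℤ * d))) + (b + (m * d + 0ℤ * c)) * (b + (m * d + 0ℤ * c))) + (p + + 2 * (m * q) + (m * m) * r)
               ≡ ((a * a + b * b) + p) + + 2 * (m * ((a * c + b * d) + q)) + (m * m) * ((c * c + d * d) + r)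
          lem1 = solve-∀
        lem : ∀ a b c p q r m → + 4 * (a + + 2 * (m * b) + (m * m) * c) - (p + + 2 * (m * q) + (m * m) * r) ≡
              (+ 4 * a - p) + + 2 * (m * (+ 4 * b - q)) + (m * m) * (+ 4 * c - r)
        lem = solve-∀
      orthogonal : ∀ x → B x k ≡ 0ℤ
      orthogonal x = vanish (B x k) (Q x) λ m → subst (0ℤ ≤_) (trans (Q-sum m x) (trans (cong (λ q → Q x + + 2 * (m * B x k) + (m * m) * q) Qe) (lem (Q x) m (B x k)))) (contraction (x ⊕ (m +i 0ℤ) ⊙ e))
        where
        lem : ∀ q m b → q + + 2 * (m * b) + (m * m) * 0ℤ ≡ q + + 2 * (m * b)
        lem = solve-∀
        vanish : ∀ b q → (∀ m → 0ℤ ≤ q + + 2 * (m * b)) → b ≡ 0ℤ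
        vanish b q h = square-0 b (≤-antisym (cancel (h (- (b * (1ℤ + q)))) (h 0ℤ)) (0≤square b))
          where
          square-0 : ∀ b → b * b ≡ 0ℤ → b ≡ 0ℤ
          square-0 b e with i*j≡0⇒i≡0∨j≡0 b e
          ... | inj₁ p = p
          ... | inj₂ p = p
          lem1 : ∀ b q → q + + 2 * (- (b * (1ℤ + q)) * b) ≡ q - + 2 * ((1ℤ + q) * (b * b))
          lem1 = solve-∀
          lem2 : ∀ q b → q + + 2 * (0ℤ * b) ≡ q
          lem2 = solve-∀
          cancel : 0ℤ ≤ q + + 2 * (- (b * (1ℤ + q)) * b) → 0ℤ ≤ q + + 2 * (0ℤ * b) → b * b ≤ 0ℤ
          cancel p r = by-size (b * b) refl
            where
            0≤q : 0ℤ ≤ q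
            0≤q = subst (0ℤ ≤_) (lem2 q b) r
            le : + 2 * ((1ℤ + q) * (b * b)) ≤ q
            le = 0≤i-j⇒j≤i (subst (0ℤ ≤_) (lem1 b q) p)
            by-size : ∀ s → b * b ≡ s → s ≤ 0ℤ
            by-size (+ zero)    e = +≤+ z≤n
            by-size -[1+ m ]    e = -≤+
            by-size (+ suc m)   e = contradiction (≤-trans (subst (λ s → + 2 * ((1ℤ + q) * s) ≤ q) e le) ≤-refl) (<⇒≱ (big q m 0≤q))
              where
              lem3 : ∀ q m → + 2 * ((1ℤ + q) * (1ℤ + m)) ≡ q + (1ℤ + (1ℤ + (q + + 2 * ((1ℤ + q) * m))))
              lem3 = solve-∀
              big : ∀ q m → 0ℤ ≤ q → q < + 2 * ((1ℤ + q) * + suc m)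
              big q m 0≤q = subst (q <_) (sym (lem3 q (+ m))) (subst (_< q + (1ℤ + (1ℤ + (q + + 2 * ((1ℤ + q) * + m))))) (+-identityʳ q)
                (+-monoʳ-< q (+-mono-<-≤ {0ℤ} {1ℤ} (+<+ (s≤s z≤n)) (+-mono-≤ {0ℤ} {1ℤ} (+≤+ z≤n) (+-mono-≤ 0≤q (0≤* {+ 2} (+≤+ z≤n) (0≤* (+-mono-≤ {0ℤ} {1ℤ} (+≤+ z≤n) 0≤q) (+≤+ z≤n))))))))

module ParityArguments where
  open InnerProduct
  open GaussianIntegers
  open BorderedMatrices
  open GaussianNorms
  open UnextendableMatrices
  open import Data.Integer.Base using (+_; -[1+_]; 0ℤ; 1ℤ; _+_; _*_; -_; _-_; _≤_; _<_; +<+)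
  open import Data.Integer.Properties
  open import Data.Integer.Tactic.RingSolver using (solve-∀)
  open import Algebra.Bundles using (CommutativeRing)
  import Algebra.Properties.Semiring.Sum as SemiringSum
  open Zi using (B; B-cong; B-comm; B-⊕ʳ; B-⊕ˡ; dot; _∙_; _⊕_; _⊙_; ∙-cong; ∙-⊕; ∙-⊙; self-adjoint; single; B-single; ∙-single; single-self; single-other)

  module Σℤ = SemiringSum (CommutativeRing.semiring Zi.scalars)

  Even : ℤ[i] → Set
  Even z = ∃[ c ] z ≡ 1+i ⊠ c

  Even-⊞ : ∀ {x y} → Even x → Even y → Even (x ⊞ y)
  Even-⊞ {x} {y} (c , p) (d , q) = c ⊞ d , trans (cong₂ _⊞_ p q) (sym (Gi.distribˡ 1+i c d))

  Even-⊠ : ∀ {x} y → Even x → Even (y ⊠ x)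
  Even-⊠ {x} y (c , p) = y ⊠ c , trans (cong (y ⊠_) p) (trans (sym (Gi.*-assoc y 1+i c)) (trans (cong (_⊠ c) (Gi.*-comm y 1+i)) (Gi.*-assoc 1+i y c)))

  Even-conj : ∀ {x} → Even x → Even (conj x)
  Even-conj {x} (c , p) = ⊟ ℤi.i ⊠ conj c , trans (cong conj p) (trans (conj-⊠ 1+i c) (cong₂ _+i_ (r (re c) (- im c)) (i (re c) (- im c))))
    where
    r : ∀ a b → 1ℤ * a + - (- 1ℤ * b) ≡ 1ℤ * (- 0ℤ * a + - (- 1ℤ * b)) + - (1ℤ * (- 0ℤ * b + - 1ℤ * a))
    r = solve-∀
    i : ∀ a b → 1ℤ * b + - 1ℤ * a ≡ 1ℤ * (- 0ℤ * b + - 1ℤ * a) + 1ℤ * (- 0ℤ * a + - (- 1ℤ * b))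
    i = solve-∀

  private
    small : ∀ a b m → ℤ.∣ a ∣ ℕ.* ℤ.∣ a ∣ ℕ.+ b ≡ m → m ℕ.< 9 → ℤ.∣ a ∣ ℕ.≤ 2
    small a b m e m<9 with ℤ.∣ a ∣
    ... | zero              = z≤n
    ... | suc zero          = s≤s z≤n
    ... | suc (suc zero)    = s≤s (s≤s z≤n)
    ... | suc (suc (suc k)) = contradiction (ℕₚ.≤-trans (ℕₚ.≤-trans (ℕₚ.*-mono-≤ {3} {3 ℕ.+ k} (s≤s (s≤s (s≤s z≤n))) (s≤s (s≤s (s≤s z≤n)))) (ℕₚ.m≤m+n _ b)) (ℕₚ.≤-reflexive e)) (ℕₚ.<⇒≱ m<9)

  data Small : ℤ → Set where
    s₀  : Small 0ℤ
    s₁  : Small (+ 1)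
    s₂  : Small (+ 2)
    s₋₁ : Small -[1+ 0 ]
    s₋₂ : Small -[1+ 1 ]

  toSmall : ∀ a → ℤ.∣ a ∣ ℕ.≤ 2 → Small a
  toSmall (+ 0)                       _ = s₀
  toSmall (+ 1)                       _ = s₁
  toSmall (+ 2)                       _ = s₂
  toSmall (+ suc (suc (suc _)))       (s≤s (s≤s ()))
  toSmall -[1+ 0 ]                    _ = s₋₁
  toSmall -[1+ 1 ]                    _ = s₋₂
  toSmall -[1+ suc (suc _) ]          (s≤s (s≤s ()))

  components : ∀ z → norm z ℕ.< 9 → Small (re z) × Small (im z)
  components (a +i b) lt = toSmall a (small a (ℤ.∣ b ∣ ℕ.* ℤ.∣ b ∣) _ refl lt)
                         , toSmall b (small b (ℤ.∣ a ∣ ℕ.* ℤ.∣ a ∣) _ (ℕₚ.+-comm (ℤ.∣ b ∣ ℕ.* ℤ.∣ b ∣) (ℤ.∣ a ∣ ℕ.* ℤ.∣ a ∣)) lt)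

  data IsUnit : ℤ[i] → Set where
    u₁  : IsUnit (+ 1 +i 0ℤ)
    u₋₁ : IsUnit (-[1+ 0 ] +i 0ℤ)
    uᵢ  : IsUnit (0ℤ +i + 1)
    u₋ᵢ : IsUnit (0ℤ +i -[1+ 0 ])

  isUnit : ∀ z → norm z ≡ 1 → IsUnit z
  isUnit (a +i b) e with components (a +i b) (subst (ℕ._< 9) (sym e) (s≤s (s≤s z≤n)))
  isUnit (a +i b) e  | s₁  , s₀  = u₁
  isUnit (a +i b) e  | s₋₁ , s₀  = u₋₁
  isUnit (a +i b) e  | s₀  , s₁  = uᵢ
  isUnit (a +i b) e  | s₀  , s₋₁ = u₋ᵢ
  isUnit (a +i b) () | s₀  , s₀
  isUnit (a +i b) () | s₀  , s₂
  isUnit (a +i b) () | s₀  , s₋₂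
  isUnit (a +i b) () | s₁  , s₁
  isUnit (a +i b) () | s₁  , s₂
  isUnit (a +i b) () | s₁  , s₋₁
  isUnit (a +i b) () | s₁  , s₋₂
  isUnit (a +i b) () | s₋₁ , s₁
  isUnit (a +i b) () | s₋₁ , s₂
  isUnit (a +i b) () | s₋₁ , s₋₁
  isUnit (a +i b) () | s₋₁ , s₋₂
  isUnit (a +i b) () | s₂  , s₀
  isUnit (a +i b) () | s₂  , s₁
  isUnit (a +i b) () | s₂  , s₂
  isUnit (a +i b) () | s₂  , s₋₁
  isUnit (a +i b) () | s₂  , s₋₂
  isUnit (a +i b) () | s₋₂ , s₀
  isUnit (a +i b) () | s₋₂ , s₁
  isUnit (a +i b) () | s₋₂ , s₂
  isUnit (a +i b) () | s₋₂ , s₋₁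
  isUnit (a +i b) () | s₋₂ , s₋₂

  even-of-norm : ∀ z → norm z ≢ 1 → norm z ℕ.≤ 4 → Even z
  even-of-norm z ≢1 ≤4 = go z (norm z) refl ≢1 ≤4
    where
    at : ∀ {a b} → Small a → Small b → norm (a +i b) ≢ 1 → norm (a +i b) ℕ.≤ 4 → Even (a +i b)
    at s₀  s₀  _ _ = 0ℤ +i 0ℤ , refl
    at s₀  s₂  _ _ = + 1 +i + 1 , refl
    at s₀  s₋₂ _ _ = -[1+ 0 ] +i -[1+ 0 ] , refl
    at s₂  s₀  _ _ = + 1 +i -[1+ 0 ] , refl
    at s₋₂ s₀  _ _ = -[1+ 0 ] +i + 1 , refl
    at s₁  s₁  _ _ = + 1 +i 0ℤ , refl
    at s₁  s₋₁ _ _ = 0ℤ +i -[1+ 0 ] , refl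
    at s₋₁ s₁  _ _ = 0ℤ +i + 1 , refl
    at s₋₁ s₋₁ _ _ = -[1+ 0 ] +i 0ℤ , refl
    at s₀  s₁  ne _ = contradiction refl ne
    at s₀  s₋₁ ne _ = contradiction refl ne
    at s₁  s₀  ne _ = contradiction refl ne
    at s₋₁ s₀  ne _ = contradiction refl ne
    at s₁  s₂  _ (s≤s (s≤s (s≤s (s≤s ()))))
    at s₁  s₋₂ _ (s≤s (s≤s (s≤s (s≤s ()))))
    at s₋₁ s₂  _ (s≤s (s≤s (s≤s (s≤s ()))))
    at s₋₁ s₋₂ _ (s≤s (s≤s (s≤s (s≤s ()))))
    at s₂  s₁  _ (s≤s (s≤s (s≤s (s≤s ()))))
    at s₂  s₋₁ _ (s≤s (s≤s (s≤s (s≤s ()))))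
    at s₂  s₂  _ (s≤s (s≤s (s≤s (s≤s ()))))
    at s₂  s₋₂ _ (s≤s (s≤s (s≤s (s≤s ()))))
    at s₋₂ s₁  _ (s≤s (s≤s (s≤s (s≤s ()))))
    at s₋₂ s₋₁ _ (s≤s (s≤s (s≤s (s≤s ()))))
    at s₋₂ s₂  _ (s≤s (s≤s (s≤s (s≤s ()))))
    at s₋₂ s₋₂ _ (s≤s (s≤s (s≤s (s≤s ()))))
    go : ∀ z m → norm z ≡ m → norm z ≢ 1 → norm z ℕ.≤ 4 → Even z
    go z m e ne le = at (proj₁ c) (proj₂ c) ne le
      where c = components z (ℕₚ.≤-trans (s≤s le) (s≤s (s≤s (s≤s (s≤s (s≤s z≤n))))))

  unit+unit : ∀ x y → norm x ≡ 1 → norm y ≡ 1 → Even (x ⊞ y)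
  unit+unit x y p q = go (isUnit x p) (isUnit y q)
    where
    go : ∀ {x y} → IsUnit x → IsUnit y → Even (x ⊞ y)
    go u₁  u₁  = + 1 +i -[1+ 0 ] , refl
    go u₁  u₋₁ = 0ℤ +i 0ℤ , refl
    go u₁  uᵢ  = + 1 +i 0ℤ , refl
    go u₁  u₋ᵢ = 0ℤ +i -[1+ 0 ] , refl
    go u₋₁ u₁  = 0ℤ +i 0ℤ , refl
    go u₋₁ u₋₁ = -[1+ 0 ] +i + 1 , refl
    go u₋₁ uᵢ  = 0ℤ +i + 1 , refl
    go u₋₁ u₋ᵢ = -[1+ 0 ] +i 0ℤ , refl
    go uᵢ  u₁  = + 1 +i 0ℤ , refl
    go uᵢ  u₋₁ = 0ℤ +i + 1 , refl
    go uᵢ  uᵢ  = + 1 +i + 1 , refl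
    go uᵢ  u₋ᵢ = 0ℤ +i 0ℤ , refl
    go u₋ᵢ u₁  = 0ℤ +i -[1+ 0 ] , refl
    go u₋ᵢ u₋₁ = -[1+ 0 ] +i 0ℤ , refl
    go u₋ᵢ uᵢ  = 0ℤ +i 0ℤ , refl
    go u₋ᵢ u₋ᵢ = -[1+ 0 ] +i -[1+ 0 ] , refl

  -- Units are odd, so three of them cannot cancel.
  three-units : ∀ x y z → norm x ≡ 1 → norm y ≡ 1 → norm z ≡ 1 → x ⊞ (y ⊞ z) ≢ 0ᵢ
  three-units x y z p q r e = odd (re c) (im c) (subst (λ w → norm w ≡ 1) (proj₂ ev) (trans (cong norm minus) (trans (norm-⊟ x) p)))
    where
    ev = unit+unit y z q r
    c = proj₁ ev
    minus : y ⊞ z ≡ ⊟ x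
    minus = cong₂ _+i_ (solve-for (re x) (re (y ⊞ z)) (cong re e)) (solve-for (im x) (im (y ⊞ z)) (cong im e))
      where
      lem : ∀ a b → b ≡ (a + b) + - a
      lem = solve-∀
      solve-for : ∀ a b → a + b ≡ 0ℤ → b ≡ - a
      solve-for a b e = trans (lem a b) (trans (cong (_+ - a) e) (+-identityˡ (- a)))
    odd : ∀ a b → norm (1+i ⊠ (a +i b)) ≢ 1
    odd a b e = two∤1 (norm (a +i b)) (trans (sym (norm-* 1+i (a +i b))) e)
      where
      two∤1 : ∀ k → 2 ℕ.* k ≢ 1
      two∤1 zero    ()
      two∤1 (suc k) eq = contradiction (trans (sym eq) (cong suc (ℕₚ.+-suc k (k ℕ.+ 0)))) λ ()

  module Extensions {n} {A : Matrix n} (core : Core A) where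
    open Core core
    open CoreFacts core public

    private
      extend′ : ∀ (y₀ c : Vecℤ n) s d u N q → c u ≢ 0ᵢ → 0ℤ < nrm s → (∀ w → K A y₀ w ≡ s ⊠ c w) →
        B y₀ (s ⊙ c) ≡ N → B (A ∙ y₀) (s ⊙ c) ≡ q → + 2 * N - q ≤ nrm s * (+ 2 + d) → + 2 * N + q ≤ nrm s * (+ 2 - d) → ⊥
      extend′ y₀ c s d u N q cu 0<s Ky₀ eN eq up low = extend y₀ c s d u cu 0<s Ky₀
        (subst₂ (λ N q → + 2 * N - q ≤ nrm s * (+ 2 + d)) (sym eN) (sym eq) up)
        (subst₂ (λ N q → + 2 * N + q ≤ nrm s * (+ 2 - d)) (sym eN) (sym eq) low)

      unit-other : ∀ {u w : Fin n} → u ≢ w → unit u w ≡ 0ᵢ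
      unit-other {u} {w} ne = single-other u w +1ᵢ ne

    K-unit : ∀ u w → K A (unit u) w ≡ (+ 4 +i 0ℤ) ⊠ unit u w ⊞ ⊟ sq A w u
    K-unit u w = cong (λ z → (+ 4 +i 0ℤ) ⊠ unit u w ⊞ ⊟ z) (A-A-unit A u w)

    sq-diagonal : ∀ u → sq A u u ≡ + deg u +i 0ℤ
    sq-diagonal u = trans (ΣG.sum-cong-≗ λ k → trans (cong (A u k ⊠_) (herm k u)) (z*conj (A u k))) (go (λ k → norm (A u k)))
      where
      go : ∀ {m} (f : Fin m → ℕ) → Σi (λ k → + f k +i 0ℤ) ≡ + Σℕ.sum f +i 0ℤ
      go {zero}  f = refl
      go {suc m} f = trans (cong ((+ f zero +i 0ℤ) ⊞_) (go (f ∘ suc))) refl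

    sq-conj : ∀ u w → sq A u w ≡ conj (sq A w u)
    sq-conj u w = trans (ΣG.sum-cong-≗ λ k → trans (cong₂ _⊠_ (herm u k) (herm k w)) (trans (sym (conj-⊠ (A k u) (A w k))) (cong conj (Gi.*-comm (A k u) (A w k))))) (sym (conj-sum (λ k → A w k ⊠ A k u)))
      where
      conj-sum : ∀ {m} (f : Fin m → ℤ[i]) → conj (Σi f) ≡ Σi (conj ∘ f)
      conj-sum {zero}  f = refl
      conj-sum {suc m} f = trans (conj-⊞ (f zero) (Σi (f ∘ suc))) (cong (conj (f zero) ⊞_) (conj-sum (f ∘ suc)))

    full-sq : ∀ {u w} → Full u → u ≢ w → sq A w u ≡ 0ᵢ
    full-sq {u} {w} full ne = ⊟-zero (sq A w u) (trans (sym (trans (K-unit u w) (trans (cong (λ z → (+ 4 +i 0ℤ) ⊠ z ⊞ ⊟ sq A w u) (unit-other ne)) (Gi.+-identityˡ (⊟ sq A w u))))) (K-full u full w))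
      where
      ⊟-zero : ∀ z → ⊟ z ≡ 0ᵢ → z ≡ 0ᵢ
      ⊟-zero (a +i b) e = cong₂ _+i_ (neg-injective (cong re e)) (neg-injective (cong im e))

    full-sq′ : ∀ {u w} → Full u → u ≢ w → sq A u w ≡ 0ᵢ
    full-sq′ {u} {w} full ne = trans (sq-conj u w) (cong conj (full-sq full ne))

    K-diagonal : ∀ u → K A (unit u) u ≡ (+ 4 - + deg u) +i 0ℤ
    K-diagonal u = trans (K-unit u u) (trans (cong₂ (λ z w → (+ 4 +i 0ℤ) ⊠ z ⊞ ⊟ w) (single-self u +1ᵢ) (sq-diagonal u)) refl)

    not-three : ∀ u → deg u ≢ 3
    not-three u three = with-q (B (A ∙ unit u) (+1ᵢ ⊙ c)) refl
      where
      c : Vecℤ n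
      c = K A (unit u)
      cu : c u ≡ +1ᵢ
      cu = trans (K-diagonal u) (cong (λ d → (+ 4 - + d) +i 0ℤ) three)
      cu≢0 : c u ≢ 0ᵢ
      cu≢0 e = one≢0 (trans (sym cu) e)
        where
        one≢0 : +1ᵢ ≢ 0ᵢ
        one≢0 ()
      lem : ∀ q → + 2 * 1ℤ - q ≡ 1ℤ * (+ 2 + - q)
      lem = solve-∀
      lem′ : ∀ q → + 2 * 1ℤ + q ≡ 1ℤ * (+ 2 - - q)
      lem′ = solve-∀
      N≡1 : B (unit u) (+1ᵢ ⊙ c) ≡ 1ℤ
      N≡1 = trans (B-unit u (+1ᵢ ⊙ c)) (cong re (trans (Gi.*-identityˡ (c u)) cu))
      Kc : ∀ w → K A (unit u) w ≡ +1ᵢ ⊠ c w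
      Kc w = sym (Gi.*-identityˡ (c w))
      with-q : ∀ q → B (A ∙ unit u) (+1ᵢ ⊙ c) ≡ q → ⊥
      with-q q e = extend′ (unit u) c +1ᵢ (- q) u 1ℤ q cu≢0 (+<+ (s≤s z≤n)) Kc N≡1 e (≤-reflexive (lem q)) (≤-reflexive (lem′ q))

    -- Maximality, applied to the new column (4 - A²) e_v / (1 + i).
    even-column : ∀ v → deg v ≡ 2 → (∀ k → A k v ≢ 0ᵢ → Full k) → (∀ w → Even (sq A v w)) → ⊥
    even-column v two nbrs even = extend′ (unit v) c 1+i 0ℤ v (+ 2) 0ℤ cv≢0 (+<+ (s≤s z≤n)) Kc N≡2 q≡0 ≤-refl ≤-refl
      where
      Kv : K A (unit v) v ≡ + 2 +i 0ℤ
      Kv = trans (K-diagonal v) (cong (λ d → (+ 4 - + d) +i 0ℤ) two)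
      four-even : ∀ z → Even ((+ 4 +i 0ℤ) ⊠ z)
      four-even z = subst Even (Gi.*-comm z (+ 4 +i 0ℤ)) (Even-⊠ {+ 4 +i 0ℤ} z (+ 2 +i -[1+ 1 ] , refl))
      minus-even : ∀ z → Even z → Even (⊟ z)
      minus-even z e = subst Even (lem z) (Even-⊠ {z} (⊟ +1ᵢ) e)
        where
        lem : ∀ z → ⊟ +1ᵢ ⊠ z ≡ ⊟ z
        lem (a +i b) = cong₂ _+i_ (r a b) (r′ a b)
          where
          r : ∀ a b → - 1ℤ * a + - (- 0ℤ * b) ≡ - a
          r = solve-∀
          r′ : ∀ a b → - 1ℤ * b + - 0ℤ * a ≡ - b
          r′ = solve-∀
      sq-even : ∀ w → Even (sq A w v)
      sq-even w = subst Even (sym (sq-conj w v)) (Even-conj {sq A v w} (even w))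
      evenK : ∀ w → Even (K A (unit v) w)
      evenK w = subst Even (sym (K-unit v w)) (Even-⊞ {(+ 4 +i 0ℤ) ⊠ unit v w} {⊟ sq A w v} (four-even (unit v w)) (minus-even (sq A w v) (sq-even w)))
      c : Vecℤ n
      c w = proj₁ (evenK w)
      Kc : ∀ w → K A (unit v) w ≡ 1+i ⊠ c w
      Kc w = proj₂ (evenK w)
      cv≢0 : c v ≢ 0ᵢ
      cv≢0 e = two≢0 (trans (sym Kv) (trans (Kc v) (trans (cong (1+i ⊠_) e) (Gi.zeroʳ 1+i))))
        where
        two≢0 : + 2 +i 0ℤ ≢ 0ᵢ
        two≢0 ()
      dot-0ˡ : ∀ {x} y → x ≡ 0ᵢ → dot x y ≡ 0ℤ
      dot-0ˡ y refl = refl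
      dot-0ʳ : ∀ x {y} → y ≡ 0ᵢ → dot x y ≡ 0ℤ
      dot-0ʳ (a +i b) refl = lem a b
        where
        lem : ∀ a b → a * 0ℤ + b * 0ℤ ≡ 0ℤ
        lem = solve-∀
      Kk : ∀ k → Full k → K A (unit v) k ≡ 0ᵢ
      Kk k full = trans (K-unit v k) (cong₂ (λ z w → (+ 4 +i 0ℤ) ⊠ z ⊞ ⊟ w) (unit-other v≢k) (full-sq′ full (v≢k ∘ sym)))
        where
        v≢k : v ≢ k
        v≢k refl = four≢two (trans (sym full) two)
          where
          four≢two : 4 ≢ 2
          four≢two ()
      term : ∀ k → Dec (A k v ≡ 0ᵢ) → dot (A k v) (K A (unit v) k) ≡ 0ℤ
      term k (yes z) = dot-0ˡ (K A (unit v) k) z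
      term k (no nz) = dot-0ʳ (A k v) (Kk k (nbrs k nz))
      q≡0 : B (A ∙ unit v) (1+i ⊙ c) ≡ 0ℤ
      q≡0 = begin
        B (A ∙ unit v) (1+i ⊙ c)                          ≡⟨ B-cong {x = A ∙ unit v} {y = 1+i ⊙ c} (column A v) (λ w → sym (Kc w)) ⟩
        B (λ k → A k v) (K A (unit v))                    ≡⟨ Σℤ.sum-cong-≗ (λ k → term k (A k v ≟ᵢ 0ᵢ)) ⟩
        Σℤ.sum {n} (λ _ → 0ℤ)                             ≡⟨ Σℤ.sum-replicate-zero n ⟩
        0ℤ                                                ∎
        where open ≡-Reasoning
      N≡2 : B (unit v) (1+i ⊙ c) ≡ + 2
      N≡2 = trans (B-unit v (1+i ⊙ c)) (cong re (trans (sym (Kc v)) Kv))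

module DegreeTwo where
  open InnerProduct
  open GaussianIntegers
  open BorderedMatrices
  open GaussianNorms
  open UnextendableMatrices
  open ParityArguments
  open import Data.Integer.Base using (+_; -[1+_]; 0ℤ; 1ℤ; _+_; _*_; -_; _-_; _≤_; _<_; +≤+; +<+)
  open import Data.Integer.Properties
  open import Data.Integer.Tactic.RingSolver using (solve-∀)
  open Zi using (B; B-cong; B-comm; B-⊕ʳ; B-⊕ˡ; dot; _∙_; _⊕_; _⊙_; ∙-cong; ∙-⊕; ∙-⊙; self-adjoint; single; B-single; ∙-single; single-self; single-other)

  unit-conj : ∀ z → norm z ≡ 1 → z ⊠ conj z ≡ +1ᵢ
  unit-conj z e = trans (z*conj z) (cong (λ m → + m +i 0ℤ) e)

  ⊟-unique : ∀ x y → x ⊞ y ≡ 0ᵢ → y ≡ ⊟ x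
  ⊟-unique x y e = cong₂ _+i_ (solve-for (re x) (re y) (cong re e)) (solve-for (im x) (im y) (cong im e))
    where
    lem : ∀ a b → b ≡ (a + b) + - a
    lem = solve-∀
    solve-for : ∀ a b → a + b ≡ 0ℤ → b ≡ - a
    solve-for a b e = trans (lem a b) (trans (cong (_+ - a) e) (+-identityˡ (- a)))

  ⊟-⊠ : ∀ x y → (⊟ x) ⊠ y ≡ ⊟ (x ⊠ y)
  ⊟-⊠ (a +i b) (c +i d) = cong₂ _+i_ (r a b c d) (i a b c d)
    where
    r : ∀ a b c d → - a * c + - (- b * d) ≡ - (a * c + - (b * d))
    r = solve-∀
    i : ∀ a b c d → - a * d + - b * c ≡ - (a * d + b * c)
    i = solve-∀

  ⊠-⊟ : ∀ x y → x ⊠ (⊟ y) ≡ ⊟ (x ⊠ y)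
  ⊠-⊟ x y = trans (Gi.*-comm x (⊟ y)) (trans (⊟-⊠ y x) (cong ⊟_ (Gi.*-comm y x)))

  two-support : ∀ {n} → Vecℤ n → Fin n → Fin n → Set
  two-support f u z = ∀ w → w ≢ u → w ≢ z → f w ≡ 0ᵢ

  Σℕ-mono : ∀ {m} {f g : Fin m → ℕ} → (∀ k → f k ℕ.≤ g k) → Σℕ.sum f ℕ.≤ Σℕ.sum g
  Σℕ-mono {zero}  p = z≤n
  Σℕ-mono {suc m} p = ℕₚ.+-mono-≤ (p zero) (Σℕ-mono (p ∘ suc))

  Σℕ-tight : ∀ {m} {f g : Fin m → ℕ} → (∀ k → f k ℕ.≤ g k) → Σℕ.sum g ℕ.≤ Σℕ.sum f → ∀ k → f k ≡ g k
  Σℕ-tight {suc m} {f} {g} p q zero = ℕₚ.≤-antisym (p zero) (ℕₚ.+-cancelʳ-≤ (Σℕ.sum (f ∘ suc)) (g zero) (f zero) (ℕₚ.≤-trans (ℕₚ.+-monoʳ-≤ (g zero) (Σℕ-mono (p ∘ suc))) q))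
  Σℕ-tight {suc m} {f} {g} p q (suc k) = Σℕ-tight (p ∘ suc) (ℕₚ.+-cancelˡ-≤ (f zero) (Σℕ.sum (g ∘ suc)) (Σℕ.sum (f ∘ suc)) (ℕₚ.≤-trans (ℕₚ.+-monoˡ-≤ (Σℕ.sum (g ∘ suc)) (p zero)) q)) k

  two-values : ∀ {n} (f : Vecℤ n) u z → u ≢ z → two-support f u z → f ≗ ⟦ (u , f u) ∷ (z , f z) ∷ [] ⟧
  two-values f u z u≢z two k = by (k Finₚ.≟ u) (k Finₚ.≟ z)
    where
    ws : Support _
    ws = (z , f z) ∷ []
    by : Dec (k ≡ u) → Dec (k ≡ z) → f k ≡ ⟦ (u , f u) ∷ ws ⟧ k
    by (yes refl) _          = sym (⟦⟧-head u (f u) ws (u≢z , tt))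
    by (no k≢u)   (yes refl) = sym (trans (⟦⟧-tail u (f u) ws z k≢u) (⟦⟧-head z (f z) [] tt))
    by (no k≢u)   (no k≢z)   = trans (two k k≢u k≢z) (sym (⟦⟧-∉ ((u , f u) ∷ ws) k (k≢u , k≢z , tt)))

  two-sum : ∀ {n} (f : Vecℤ n) u z → u ≢ z → two-support f u z → ∀ g → Σi (λ k → f k ⊠ g k) ≡ (f u ⊠ g u) ⊞ (f z ⊠ g z)
  two-sum f u z u≢z two g = trans (row-sum ((u , f u) ∷ (z , f z) ∷ []) (two-values f u z u≢z two) g) (cong ((f u ⊠ g u) ⊞_) (Gi.+-identityʳ (f z ⊠ g z)))

  module Cases {n} {A : Matrix n} (core : Core A) where
    open Core core
    open Extensions core public

    parallel-rows : ∀ v u x → norm (A v u) ≡ 1 → norm (A v x) ≡ 1 → u ≢ x → two-support (A v) u x → deg v ≡ 2 →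
      Full u → (∀ w → norm (A u w) ℕ.≤ norm (A x w)) → ⊥
    parallel-rows v u x nu nx u≢x two dv full bound = even-column v dv nbrs even
      where
      same : ∀ w → norm (A u w) ≡ norm (A x w)
      same = Σℕ-tight {n} {λ w → norm (A u w)} {λ w → norm (A x w)} bound (ℕₚ.≤-trans (deg≤4 x) (ℕₚ.≤-reflexive (sym full)))
      full-x : Full x
      full-x = trans (sym (Σℕ.sum-cong-≗ {n} {λ w → norm (A u w)} {λ w → norm (A x w)} same)) full
      nbrs : ∀ k → A k v ≢ 0ᵢ → Full k
      nbrs k nz = by (k Finₚ.≟ u) (k Finₚ.≟ x)
        where
        by : Dec (k ≡ u) → Dec (k ≡ x) → Full k
        by (yes k≡u) _         = subst Full (sym k≡u) full
        by (no _)    (yes k≡x) = subst Full (sym k≡x) full-x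
        by (no k≢u)  (no k≢x)  = ⊥-elim (nz (trans (herm k v) (cong conj (two k k≢u k≢x))))
      row : ∀ w → sq A v w ≡ (A v u ⊠ A u w) ⊞ (A v x ⊠ A x w)
      row w = two-sum (A v) u x u≢x two (λ k → A k w)
      norm≤4 : ∀ u w → norm (A u w) ℕ.≤ 4
      norm≤4 u w = ℕₚ.≤-trans (ℕₚ.≤-trans (ℕₚ.m≤m+n (norm (A u w)) (total (erase w (A u)))) (ℕₚ.≤-reflexive (sym (erase-total w (A u))))) (deg≤4 u)
      even : ∀ w → Even (sq A v w)
      even w = subst Even (sym (row w)) (by-parity (norm (A u w) ℕₚ.≟ 1))
        where
        by-parity : Dec (norm (A u w) ≡ 1) → Even ((A v u ⊠ A u w) ⊞ (A v x ⊠ A x w))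
        by-parity (yes one) = unit+unit (A v u ⊠ A u w) (A v x ⊠ A x w)
          (trans (norm-* (A v u) (A u w)) (cong₂ ℕ._*_ nu one)) (trans (norm-* (A v x) (A x w)) (cong₂ ℕ._*_ nx (trans (sym (same w)) one)))
        by-parity (no ≢1) = Even-⊞ {A v u ⊠ A u w} {A v x ⊠ A x w}
          (Even-⊠ {A u w} (A v u) (even-of-norm (A u w) ≢1 (norm≤4 u w)))
          (Even-⊠ {A x w} (A v x) (even-of-norm (A x w) (λ e → ≢1 (trans (same w) e)) (norm≤4 x w)))

    private
      pair : ∀ (p r : Fin n) → ℤ[i] → Vecℤ n
      pair p r τ = unit p ⊕ τ ⊙ unit r

      pair-p : ∀ {p r} τ → p ≢ r → pair p r τ p ≡ +1ᵢ
      pair-p {p} {r} τ p≢r = trans (cong₂ (λ a b → a ⊞ (τ ⊠ b)) (single-self p +1ᵢ) (single-other r p +1ᵢ (p≢r ∘ sym))) (cong (+1ᵢ ⊞_) (Gi.zeroʳ τ))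

      pair-r : ∀ {p r} τ → p ≢ r → pair p r τ r ≡ τ
      pair-r {p} {r} τ p≢r = trans (cong₂ (λ a b → a ⊞ (τ ⊠ b)) (single-other p r +1ᵢ p≢r) (single-self r +1ᵢ)) (trans (Gi.+-identityˡ (τ ⊠ +1ᵢ)) (Gi.*-identityʳ τ))

      pair-other : ∀ {p r} τ w → p ≢ w → r ≢ w → pair p r τ w ≡ 0ᵢ
      pair-other {p} {r} τ w p≢w r≢w = trans (cong₂ (λ a b → a ⊞ (τ ⊠ b)) (single-other p w +1ᵢ p≢w) (single-other r w +1ᵢ r≢w)) (trans (Gi.+-identityˡ (τ ⊠ 0ᵢ)) (Gi.zeroʳ τ))

      A-pair : ∀ p r τ → A ∙ pair p r τ ≗ λ w → A w p ⊞ (τ ⊠ A w r)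
      A-pair p r τ w = trans (∙-⊕ A (unit p) (τ ⊙ unit r) w) (cong₂ _⊞_ (column A p w) (trans (∙-⊙ A τ (unit r) w) (cong (τ ⊠_) (column A r w))))

      B-pair : ∀ p r τ (y : Vecℤ n) → B (pair p r τ) y ≡ re (y p) + dot τ (y r)
      B-pair p r τ y = trans (B-⊕ˡ (unit p) (τ ⊙ unit r) y) (cong₂ _+_ (B-unit p y)
        (trans (B-cong {y = y} scaled (λ _ → refl)) (B-single r τ y)))
        where
        scaled : τ ⊙ unit r ≗ single r τ
        scaled w = by (r Finₚ.≟ w)
          where
          by : Dec (r ≡ w) → τ ⊠ unit r w ≡ single r τ w
          by (yes refl) = trans (cong (τ ⊠_) (single-self r +1ᵢ)) (trans (Gi.*-identityʳ τ) (sym (single-self r τ)))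
          by (no r≢w) = trans (cong (τ ⊠_) (single-other r w +1ᵢ r≢w)) (trans (Gi.zeroʳ τ) (sym (single-other r w τ r≢w)))

      extend-by : ∀ (y₀ c : Vecℤ n) s u N q → c u ≢ 0ᵢ → 0ℤ < nrm s → (∀ w → K A y₀ w ≡ s ⊠ c w) →
        B y₀ (s ⊙ c) ≡ N → B (A ∙ y₀) (s ⊙ c) ≡ q → + 2 * N - q ≤ nrm s * (+ 2 + 0ℤ) → + 2 * N + q ≤ nrm s * (+ 2 - 0ℤ) → ⊥
      extend-by y₀ c s u N q cu 0<s Ky₀ eN eq up low = extend y₀ c s 0ℤ u cu 0<s Ky₀
        (subst₂ (λ N q → + 2 * N - q ≤ nrm s * (+ 2 + 0ℤ)) (sym eN) (sym eq) up)
        (subst₂ (λ N q → + 2 * N + q ≤ nrm s * (+ 2 - 0ℤ)) (sym eN) (sym eq) low)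

    -- The new column is (4 - A²)(e_p + τ e_r) / 3.
    eigenpair : ∀ p r τ λ′ → p ≢ r → norm τ ≡ 1 → λ′ * λ′ ≡ 1ℤ → λ′ ≤ 1ℤ → -[1+ 0 ] ≤ λ′ →
      (∀ w → A w p ⊞ (τ ⊠ A w r) ≡ (λ′ +i 0ℤ) ⊠ pair p r τ w) → ⊥
    eigenpair p r τ λ′ p≢r nτ sq1 λ≤1 -1≤λ eig = extend-by y y (+ 3 +i 0ℤ) p (+ 6) (+ 6 * λ′) yp≢0 (+<+ (s≤s z≤n)) Ky N≡ q≡
        (up λ′ -1≤λ) (low λ′ λ≤1)
      where
      y : Vecℤ n
      y = pair p r τ
      Ay : A ∙ y ≗ (λ′ +i 0ℤ) ⊙ y
      Ay w = trans (A-pair p r τ w) (eig w)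
      yp≢0 : y p ≢ 0ᵢ
      yp≢0 e = one≢0 (trans (sym (pair-p τ p≢r)) e)
        where
        one≢0 : +1ᵢ ≢ 0ᵢ
        one≢0 ()
      Ky : ∀ w → K A y w ≡ (+ 3 +i 0ℤ) ⊠ y w
      Ky w = trans (cong (λ z → (+ 4 +i 0ℤ) ⊠ y w ⊞ ⊟ z) (trans (∙-cong A Ay w) (trans (∙-⊙ A (λ′ +i 0ℤ) y w) (cong ((λ′ +i 0ℤ) ⊠_) (Ay w))))) (lem (y w))
        where
        lem : ∀ z → (+ 4 +i 0ℤ) ⊠ z ⊞ ⊟ ((λ′ +i 0ℤ) ⊠ ((λ′ +i 0ℤ) ⊠ z)) ≡ (+ 3 +i 0ℤ) ⊠ z
        lem (a +i b) = cong₂ _+i_ (trans (r₁ λ′ a b) (trans (cong (λ s → + 4 * a - s * a) sq1) (r₂ a b))) (trans (i₁ λ′ a b) (trans (cong (λ s → + 4 * b - s * b) sq1) (i₂ a b)))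
          where
          r₁ : ∀ l a b → (+ 4 * a + - (0ℤ * b)) + - (l * (l * a + - (0ℤ * b)) + - (0ℤ * (l * b + 0ℤ * a))) ≡ + 4 * a - (l * l) * a
          r₁ = solve-∀
          r₂ : ∀ a b → + 4 * a - 1ℤ * a ≡ + 3 * a + - (0ℤ * b)
          r₂ = solve-∀
          i₁ : ∀ l a b → (+ 4 * b + 0ℤ * a) + - (l * (l * b + 0ℤ * a) + 0ℤ * (l * a + - (0ℤ * b))) ≡ + 4 * b - (l * l) * b
          i₁ = solve-∀
          i₂ : ∀ a b → + 4 * b - 1ℤ * b ≡ + 3 * b + 0ℤ * a
          i₂ = solve-∀
      dotτ : dot τ τ ≡ 1ℤ
      dotτ = trans (nrm≡norm τ) (cong +_ nτ)
      real-scale : ∀ l (x z : Vecℤ n) → B x ((l +i 0ℤ) ⊙ z) ≡ l * B x z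
      real-scale l x z = trans (Σℤ.sum-cong-≗ λ k → lem l (re (x k)) (im (x k)) (re (z k)) (im (z k))) (sym (Σℤ.*-distribˡ-sum l (λ k → dot (x k) (z k))))
        where
        lem : ∀ l a b c d → a * (l * c + - (0ℤ * d)) + b * (l * d + 0ℤ * c) ≡ l * (a * c + b * d)
        lem = solve-∀
      yy : B y y ≡ + 2
      yy = trans (B-pair p r τ y) (cong₂ _+_ (cong re (pair-p τ p≢r)) (trans (cong (dot τ) (pair-r τ p≢r)) dotτ))
      N≡ : B y ((+ 3 +i 0ℤ) ⊙ y) ≡ + 6
      N≡ = trans (real-scale (+ 3) y y) (cong (+ 3 *_) yy)
      q≡ : B (A ∙ y) ((+ 3 +i 0ℤ) ⊙ y) ≡ + 6 * λ′
      q≡ = trans (real-scale (+ 3) (A ∙ y) y) (trans (cong (+ 3 *_) (trans (B-cong {y = y} Ay (λ _ → refl)) (trans (B-comm ((λ′ +i 0ℤ) ⊙ y) y) (trans (real-scale λ′ y y) (cong (λ′ *_) yy))))) (lem λ′))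
        where
        lem : ∀ l → + 3 * (l * + 2) ≡ + 6 * l
        lem = solve-∀
      up : ∀ l → -[1+ 0 ] ≤ l → + 2 * + 6 - + 6 * l ≤ + 9 * (+ 2 + 0ℤ)
      up l p = 0≤i-j⇒j≤i (subst (0ℤ ≤_) (lem l) (0≤* {+ 6} (+≤+ z≤n) (i≤j⇒0≤j-i p)))
        where
        lem : ∀ l → + 6 * (l - -[1+ 0 ]) ≡ + 9 * (+ 2 + 0ℤ) - (+ 2 * + 6 - + 6 * l)
        lem = solve-∀
      low : ∀ l → l ≤ 1ℤ → + 2 * + 6 + + 6 * l ≤ + 9 * (+ 2 - 0ℤ)
      low l p = 0≤i-j⇒j≤i (subst (0ℤ ≤_) (lem l) (0≤* {+ 6} (+≤+ z≤n) (i≤j⇒0≤j-i p)))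
        where
        lem : ∀ l → + 6 * (1ℤ - l) ≡ + 9 * (+ 2 - 0ℤ) - (+ 2 * + 6 + + 6 * l)
        lem = solve-∀

    -- The new column is (4 - A²)(e_p + τ e_r) / 2; here A (e_p + τ e_r) is a multiple of e_u.
    cancelling-pair : ∀ u p r → p ≢ r → p ≢ u → r ≢ u → A u u ≡ 0ᵢ → norm (A u p) ≡ 1 → norm (A u r) ≡ 1 →
      (∀ w → w ≢ u → (A u p ⊠ A p w) ⊞ (A u r ⊠ A r w) ≡ 0ᵢ) → ⊥
    cancelling-pair u p r p≢r p≢u r≢u uu np nr cancel = extend-by y c (+ 2 +i 0ℤ) p (+ 4) 0ℤ cp≢0 (+<+ (s≤s z≤n)) Ky N≡ q≡ ≤-refl ≤-refl
      where
      open ≡-Reasoning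
      τ θ : ℤ[i]
      τ = A u p ⊠ conj (A u r)
      θ = A u p
      y : Vecℤ n
      y = pair p r τ
      two : ℤ[i]
      two = + 2 +i 0ℤ
      assoc₄ : ∀ a b c → (a ⊠ b) ⊠ c ≡ a ⊠ (b ⊠ c)
      assoc₄ a b c = Gi.*-assoc a b c
      nτ : norm τ ≡ 1
      nτ = trans (norm-* (A u p) (conj (A u r))) (cong₂ ℕ._*_ np (trans (norm-conj (A u r)) nr))
      τ-ur : τ ⊠ A u r ≡ θ
      τ-ur = trans (assoc₄ (A u p) (conj (A u r)) (A u r)) (trans (cong (A u p ⊠_) (trans (Gi.*-comm (conj (A u r)) (A u r)) (unit-conj (A u r) nr))) (Gi.*-identityʳ (A u p)))
      at-u : A u p ⊞ (τ ⊠ A u r) ≡ two ⊠ θ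
      at-u = trans (cong (A u p ⊞_) τ-ur) (double θ)
        where
        double : ∀ z → z ⊞ z ≡ two ⊠ z
        double (a +i b) = cong₂ _+i_ (d a b) (d′ a b)
          where
          d : ∀ a b → a + a ≡ + 2 * a + - (0ℤ * b)
          d = solve-∀
          d′ : ∀ a b → b + b ≡ + 2 * b + 0ℤ * a
          d′ = solve-∀
      conj-cancel : ∀ w → w ≢ u → (conj (A u p) ⊠ A w p) ⊞ (conj (A u r) ⊠ A w r) ≡ 0ᵢ
      conj-cancel w w≢u = begin
        (conj (A u p) ⊠ A w p) ⊞ (conj (A u r) ⊠ A w r)
          ≡⟨ cong₂ (λ a b → (conj (A u p) ⊠ a) ⊞ (conj (A u r) ⊠ b)) (herm w p) (herm w r) ⟩
        (conj (A u p) ⊠ conj (A p w)) ⊞ (conj (A u r) ⊠ conj (A r w))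
          ≡⟨ cong₂ _⊞_ (conj-⊠ (A u p) (A p w)) (conj-⊠ (A u r) (A r w)) ⟨
        conj (A u p ⊠ A p w) ⊞ conj (A u r ⊠ A r w)
          ≡⟨ conj-⊞ (A u p ⊠ A p w) (A u r ⊠ A r w) ⟨
        conj ((A u p ⊠ A p w) ⊞ (A u r ⊠ A r w))
          ≡⟨ cong conj (cancel w w≢u) ⟩
        0ᵢ ∎
      at-other : ∀ w → w ≢ u → A w p ⊞ (τ ⊠ A w r) ≡ 0ᵢ
      at-other w w≢u = begin
        A w p ⊞ (τ ⊠ A w r)
          ≡⟨ cong₂ _⊞_ (trans (sym (Gi.*-identityˡ (A w p))) (trans (cong (_⊠ A w p) (sym (unit-conj (A u p) np))) (assoc₄ (A u p) (conj (A u p)) (A w p)))) (assoc₄ (A u p) (conj (A u r)) (A w r)) ⟩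
        (A u p ⊠ (conj (A u p) ⊠ A w p)) ⊞ (A u p ⊠ (conj (A u r) ⊠ A w r))
          ≡⟨ Gi.distribˡ (A u p) (conj (A u p) ⊠ A w p) (conj (A u r) ⊠ A w r) ⟨
        A u p ⊠ ((conj (A u p) ⊠ A w p) ⊞ (conj (A u r) ⊠ A w r))
          ≡⟨ cong (A u p ⊠_) (conj-cancel w w≢u) ⟩
        A u p ⊠ 0ᵢ
          ≡⟨ Gi.zeroʳ (A u p) ⟩
        0ᵢ ∎
      Ay : A ∙ y ≗ single u (two ⊠ θ)
      Ay w = trans (A-pair p r τ w) (by (u Finₚ.≟ w))
        where
        by : Dec (u ≡ w) → A w p ⊞ (τ ⊠ A w r) ≡ single u (two ⊠ θ) w
        by (yes refl) = trans at-u (sym (single-self u (two ⊠ θ)))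
        by (no u≢w) = trans (at-other w (u≢w ∘ sym)) (sym (single-other u w (two ⊠ θ) u≢w))
      c : Vecℤ n
      c w = (two ⊠ y w) ⊞ ⊟ (A w u ⊠ θ)
      Ky : ∀ w → K A y w ≡ two ⊠ c w
      Ky w = trans (cong (λ z → (+ 4 +i 0ℤ) ⊠ y w ⊞ ⊟ z) (trans (∙-cong A Ay w) (∙-single A u (two ⊠ θ) w))) (lem (y w) (A w u) θ)
        where
        lem : ∀ y a t → (+ 4 +i 0ℤ) ⊠ y ⊞ ⊟ (a ⊠ (two ⊠ t)) ≡ two ⊠ ((two ⊠ y) ⊞ ⊟ (a ⊠ t))
        lem (y +i y′) (a +i b) (t +i t′) = cong₂ _+i_ (r₁ y y′ a b t t′) (i₁ y y′ a b t t′)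
          where
          r₁ : ∀ y y′ a b t t′ → (+ 4 * y + - (0ℤ * y′)) + - (a * (+ 2 * t + - (0ℤ * t′)) + - (b * (+ 2 * t′ + 0ℤ * t))) ≡
               + 2 * ((+ 2 * y + - (0ℤ * y′)) + - (a * t + - (b * t′))) + - (0ℤ * ((+ 2 * y′ + 0ℤ * y) + - (a * t′ + b * t)))
          r₁ = solve-∀
          i₁ : ∀ y y′ a b t t′ → (+ 4 * y′ + 0ℤ * y) + - (a * (+ 2 * t′ + 0ℤ * t) + b * (+ 2 * t + - (0ℤ * t′))) ≡
               + 2 * ((+ 2 * y′ + 0ℤ * y) + - (a * t′ + b * t)) + 0ℤ * ((+ 2 * y + - (0ℤ * y′)) + - (a * t + - (b * t′)))
          i₁ = solve-∀
      pu-θ : A p u ⊠ θ ≡ +1ᵢ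
      pu-θ = trans (cong (_⊠ A u p) (herm p u)) (trans (Gi.*-comm (conj (A u p)) (A u p)) (unit-conj (A u p) np))
      ru-θ : A r u ⊠ θ ≡ τ
      ru-θ = trans (cong (_⊠ A u p) (herm r u)) (Gi.*-comm (conj (A u r)) (A u p))
      cp : c p ≡ +1ᵢ
      cp = cong₂ (λ a b → (two ⊠ a) ⊞ ⊟ b) (pair-p τ p≢r) pu-θ
      cr : c r ≡ τ
      cr = trans (cong₂ (λ a b → (two ⊠ a) ⊞ ⊟ b) (pair-r τ p≢r) ru-θ) (lem τ)
        where
        lem : ∀ z → (two ⊠ z) ⊞ ⊟ z ≡ z
        lem (a +i b) = cong₂ _+i_ (r₁ a b) (i₁ a b)
          where
          r₁ : ∀ a b → (+ 2 * a + - (0ℤ * b)) + - a ≡ a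
          r₁ = solve-∀
          i₁ : ∀ a b → (+ 2 * b + 0ℤ * a) + - b ≡ b
          i₁ = solve-∀
      cu : c u ≡ 0ᵢ
      cu = cong₂ (λ a b → (two ⊠ a) ⊞ ⊟ b) (pair-other τ u p≢u r≢u) (trans (cong (_⊠ θ) uu) (Gi.zeroˡ θ))
      cp≢0 : c p ≢ 0ᵢ
      cp≢0 e = one≢0 (trans (sym cp) e)
        where
        one≢0 : +1ᵢ ≢ 0ᵢ
        one≢0 ()
      N≡ : B y (two ⊙ c) ≡ + 4
      N≡ = trans (B-pair p r τ (two ⊙ c)) (cong₂ _+_ (cong (λ z → re (two ⊠ z)) cp) (trans (cong (λ z → dot τ (two ⊠ z)) cr) (trans (lem (re τ) (im τ)) (cong (+ 2 *_) (trans (nrm≡norm τ) (cong +_ nτ))))))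
        where
        lem : ∀ a b → a * (+ 2 * a + - (0ℤ * b)) + b * (+ 2 * b + 0ℤ * a) ≡ + 2 * (a * a + b * b)
        lem = solve-∀
      q≡ : B (A ∙ y) (two ⊙ c) ≡ 0ℤ
      q≡ = trans (B-cong {y = two ⊙ c} Ay (λ _ → refl)) (trans (B-single u (two ⊠ θ) (two ⊙ c)) (trans (cong (λ z → dot (two ⊠ θ) (two ⊠ z)) cu) (lem (re (two ⊠ θ)) (im (two ⊠ θ)))))
        where
        lem : ∀ a b → a * 0ℤ + b * 0ℤ ≡ 0ℤ
        lem = solve-∀

module LowDegreeVertices where
  open InnerProduct
  open GaussianIntegers
  open BorderedMatrices
  open GaussianNorms
  open UnextendableMatrices
  open ParityArguments
  open DegreeTwo
  open import Data.Integer.Base using (+_)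
  open import Data.Nat.Base using (_+_; _≤_)
  open import Data.Nat.Properties

  Keys : ℕ → Set
  Keys n = List (Fin n)

  NotIn : ∀ {n} → Fin n → Keys n → Set
  NotIn k []       = ⊤
  NotIn k (j ∷ js) = k ≢ j × NotIn k js

  Distinct : ∀ {n} → Keys n → Set
  Distinct []       = ⊤
  Distinct (j ∷ js) = NotIn j js × Distinct js

  restrict : ∀ {n} → (Fin n → ℤ[i]) → Keys n → Support n
  restrict f []       = []
  restrict f (j ∷ js) = (j , f j) ∷ restrict f js

  restrict-erase : ∀ {n} j (f : Fin n → ℤ[i]) js → NotIn j js → restrict (erase j f) js ≡ restrict f js
  restrict-erase j f []       _       = refl
  restrict-erase j f (k ∷ ks) (p , q) = cong₂ _∷_ (cong (k ,_) (erase-other j k f p)) (restrict-erase j f ks q)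

  supported : ∀ {n} (f : Fin n → ℤ[i]) ks → Distinct ks → (∀ w → NotIn w ks → f w ≡ 0ᵢ) → f ≗ ⟦ restrict f ks ⟧
  supported f []       _       z k = z k tt
  supported f (j ∷ js) (p , q) z k = trans (erase-split j f k) (cong (Zi.single j (f j) k ⊞_)
    (trans (supported (erase j f) js q z′ k) (cong (λ ws → ⟦ ws ⟧ k) (restrict-erase j f js p))))
    where
    z′ : ∀ w → NotIn w js → erase j f w ≡ 0ᵢ
    z′ w w∉ = by (j Finₚ.≟ w)
      where
      by : Dec (j ≡ w) → erase j f w ≡ 0ᵢ
      by (yes refl) = erase-self j f
      by (no j≢w)   = trans (erase-other j w f j≢w) (z w (j≢w ∘ sym , w∉))

  sum-over : ∀ {n} (f : Fin n → ℤ[i]) ks → Distinct ks → (∀ w → NotIn w ks → f w ≡ 0ᵢ) → ∀ g → Σi (λ k → f k ⊠ g k) ≡ lin (restrict f ks) g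
  sum-over f ks d z = row-sum (restrict f ks) (supported f ks d z)

  norm-zero : ∀ {z} → z ≡ 0ᵢ → norm z ≡ 0
  norm-zero refl = refl

  norm⇒≢0 : ∀ {z m} → norm z ≡ suc m → z ≢ 0ᵢ
  norm⇒≢0 e z≡0 = 0≢1+n (trans (sym (norm-zero z≡0)) e)

  ≤norm⇒≢0 : ∀ {z} → 1 ≤ norm z → z ≢ 0ᵢ
  ≤norm⇒≢0 {z} p e = contradiction (subst (1 ≤_) (norm-zero e) p) λ ()

  sum-norms : ∀ x y → x ⊞ y ≡ 0ᵢ → norm x ≡ norm y
  sum-norms x y e = trans (sym (norm-⊟ x)) (cong norm (sym (⊟-unique x y e)))

  module LowDegree {n} {A : Matrix n} (core : Core A) where
    open Core core
    open Cases core public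

    A-zero : ∀ {u v} → A u v ≡ 0ᵢ → A v u ≡ 0ᵢ
    A-zero {u} {v} e = trans (herm v u) (cong conj e)

    A-nonzero : ∀ {u v} → A u v ≢ 0ᵢ → A v u ≢ 0ᵢ
    A-nonzero ne e = ne (A-zero e)

    Low : Fin n → Set
    Low v = deg v ≤ 2

    data LowView (v u : Fin n) : Set where
      leaf : (∀ w → w ≢ u → A v w ≡ 0ᵢ) → LowView v u
      two  : ∀ z → u ≢ z → norm (A v z) ≡ 1 → two-support (A v) u z → deg v ≡ 2 → LowView v u

    private
      one : ∀ a b c → 1 ≤ a → 1 ≤ b → a + (b + c) ≤ 2 → a ≡ 1 × b ≡ 1 × c ≡ 0
      one (suc zero)    (suc zero)    zero    _ _ _ = refl , refl , refl
      one (suc zero)    (suc zero)    (suc c) _ _ (s≤s (s≤s ()))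
      one (suc zero)    (suc (suc b)) c       _ _ (s≤s (s≤s ()))
      one (suc (suc a)) (suc b)       c       _ _ (s≤s (s≤s p)) = contradiction (≤-trans (m≤n+m (suc (b + c)) a) p) λ ()

      empty-weight : ∀ {m} (ws : Support m) → Proper ws → weight ws ≡ 0 → ws ≡ []
      empty-weight []             _       _ = refl
      empty-weight ((j , w) ∷ ws) (p , _) e = contradiction (subst (1 ≤_) (m+n≡0⇒m≡0 (norm w) e) p) λ ()

    heavy-absurd : ∀ u v → Full u → norm (A v u) ≡ 2 → (∀ w → w ≢ u → A v w ≡ 0ᵢ) → deg v ≡ 2 → ⊥
    heavy-absurd u v full n₂ z dv = even-column v dv nbrs even
      where
      nbrs : ∀ k → A k v ≢ 0ᵢ → Full k
      nbrs k nz = by (k Finₚ.≟ u)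
        where
        by : Dec (k ≡ u) → Full k
        by (yes e) = subst Full (sym e) full
        by (no ne) = ⊥-elim (nz (A-zero (z k ne)))
      row : ∀ w → sq A v w ≡ A v u ⊠ A u w
      row w = trans (sum-over (A v) (u ∷ []) (tt , tt) (λ k (ne , _) → z k ne) (λ k → A k w)) (Gi.+-identityʳ (A v u ⊠ A u w))
      even : ∀ w → Even (sq A v w)
      even w = subst Even (sym (trans (row w) (Gi.*-comm (A v u) (A u w)))) (Even-⊠ {A v u} (A u w) (even-of-norm (A v u) (λ e → 1≢2 (trans (sym e) n₂)) (≤-trans (≤-reflexive n₂) (s≤s (s≤s z≤n)))))
        where
        1≢2 : 1 ≢ 2
        1≢2 ()

    low-view : ∀ u v → Full u → Low v → A v u ≢ 0ᵢ → norm (A v u) ≡ 1 × LowView v u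
    low-view u v full low nz = go (support-from u (A v) nz (total (erase u (A v))) (erase-total u (A v)))
      where
      go : (∃[ ws ] A v ≗ ⟦ (u , A v u) ∷ ws ⟧ × Proper ((u , A v u) ∷ ws) × weight ws ≡ total (erase u (A v))) → norm (A v u) ≡ 1 × LowView v u
      go ([] , values , (1≤ , _) , wt) = by (norm (A v u)) refl 1≤ (≤-trans (≤-reflexive deg-norm) low)
        where
        z : ∀ w → w ≢ u → A v w ≡ 0ᵢ
        z w ne = trans (values w) (⟦⟧-∉ ((u , A v u) ∷ []) w (ne , tt))
        deg-norm : norm (A v u) ≡ deg v
        deg-norm = sym (trans (erase-total u (A v)) (trans (cong (λ t → norm (A v u) + t) (sym wt)) (+-identityʳ (norm (A v u)))))
        by : ∀ m → norm (A v u) ≡ m → 1 ≤ m → norm (A v u) ≤ 2 → norm (A v u) ≡ 1 × LowView v u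
        by (suc zero)          e _ _ = e , leaf z
        by (suc (suc zero))    e _ _ = ⊥-elim (heavy-absurd u v full e z (trans (sym deg-norm) e))
        by (suc (suc (suc m))) e _ p = contradiction (subst (_≤ 2) e p) λ { (s≤s (s≤s ())) }
      go ((x , w) ∷ ws , values , (1≤ , (u≢x , u∉) , 1≤w , x∉ , proper) , wt) = proj₁ ones , two x u≢x (trans (cong norm Avx) (proj₁ (proj₂ ones))) supp dv
        where
        deg-split : norm (A v u) + (norm w + weight ws) ≡ deg v
        deg-split = sym (trans (erase-total u (A v)) (cong (λ t → norm (A v u) + t) (sym wt)))
        ones : norm (A v u) ≡ 1 × norm w ≡ 1 × weight ws ≡ 0
        ones = one (norm (A v u)) (norm w) (weight ws) 1≤ 1≤w (≤-trans (≤-reflexive deg-split) low)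
        ws≡[] : ws ≡ []
        ws≡[] = empty-weight ws proper (proj₂ (proj₂ ones))
        Avx : A v x ≡ w
        Avx = trans (values x) (trans (⟦⟧-tail u (A v u) ((x , w) ∷ ws) x (u≢x ∘ sym)) (⟦⟧-head x w ws x∉))
        supp : two-support (A v) u x
        supp k k≢u k≢x = trans (values k) (⟦⟧-∉ ((u , A v u) ∷ (x , w) ∷ ws) k (k≢u , k≢x , subst (k ∉_) (sym ws≡[]) tt))
        dv : deg v ≡ 2
        dv = trans (sym deg-split) (cong₂ _+_ (proj₁ ones) (cong₂ _+_ (proj₁ (proj₂ ones)) (proj₂ (proj₂ ones))))

    full-or-low : ∀ v → Full v ⊎ Low v
    full-or-low v = by (deg v) refl (deg≤4 v)
      where
      by : ∀ m → deg v ≡ m → m ≤ 4 → Full v ⊎ Low v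
      by 0 e _ = inj₂ (subst (_≤ 2) (sym e) z≤n)
      by 1 e _ = inj₂ (subst (_≤ 2) (sym e) (s≤s z≤n))
      by 2 e _ = inj₂ (subst (_≤ 2) (sym e) (s≤s (s≤s z≤n)))
      by 3 e _ = ⊥-elim (not-three v e)
      by 4 e _ = inj₁ e
      by (suc (suc (suc (suc (suc m))))) e (s≤s (s≤s (s≤s (s≤s ()))))

    full-not-low : ∀ {v} → Full v → ¬ Low v
    full-not-low full low = contradiction (subst (_≤ 2) full low) λ { (s≤s (s≤s ())) }

    full≢low : ∀ {u v} → Full u → Low v → u ≢ v
    full≢low full low refl = full-not-low full low

    record Units (u v a b c : Fin n) : Set where
      field
        v≢a : v ≢ a
        v≢b : v ≢ b
        v≢c : v ≢ c
        a≢b : a ≢ b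
        a≢c : a ≢ c
        b≢c : b ≢ c
        norm-v : norm (A u v) ≡ 1
        norm-a : norm (A u a) ≡ 1
        norm-b : norm (A u b) ≡ 1
        norm-c : norm (A u c) ≡ 1
        rest : ∀ w → w ≢ v → w ≢ a → w ≢ b → w ≢ c → A u w ≡ 0ᵢ

      sum : ∀ g → Σi (λ k → A u k ⊠ g k) ≡ (A u v ⊠ g v) ⊞ ((A u a ⊠ g a) ⊞ ((A u b ⊠ g b) ⊞ (A u c ⊠ g c)))
      sum g = trans (sum-over (A u) (v ∷ a ∷ b ∷ c ∷ []) ((v≢a , v≢b , v≢c , tt) , (a≢b , a≢c , tt) , (b≢c , tt) , tt , tt)
          (λ w (p , q , r , s , _) → rest w p q r s) g)
        (cong (λ z → (A u v ⊠ g v) ⊞ ((A u a ⊠ g a) ⊞ ((A u b ⊠ g b) ⊞ z))) (Gi.+-identityʳ (A u c ⊠ g c)))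

    data FullView (u v : Fin n) : Set where
      units : ∀ a b c → Units u v a b c → FullView u v
      heavy : ∀ p k → v ≢ p → v ≢ k → p ≢ k → norm (A u v) ≡ 1 → norm (A u p) ≡ 2 → norm (A u k) ≡ 1 →
              (∀ w → w ≢ v → w ≢ p → w ≢ k → A u w ≡ 0ᵢ) → FullView u v

    private
      not-4≤3 : ∀ {s} → 4 ≤ s → s ≢ 3
      not-4≤3 (s≤s (s≤s (s≤s ()))) refl

    full-view : ∀ u v → Full u → norm (A u v) ≡ 1 → FullView u v
    full-view u v full nv = go (support-from v (A u) (norm⇒≢0 nv) 3 (trans full (cong (_+ 3) (sym nv))))
      where
      go : (∃[ ws ] A u ≗ ⟦ (v , A u v) ∷ ws ⟧ × Proper ((v , A u v) ∷ ws) × weight ws ≡ 3) → FullView u v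
      go ([] , _ , _ , ())
      go ((a , w) ∷ [] , values , proper , wt) = ⊥-elim (norm≢3 w (trans (sym (+-identityʳ (norm w))) wt))
      go ((a , w) ∷ (b , w′) ∷ [] , values , (_ , (v≢a , v≢b , _) , 1≤w , (a≢b , _) , 1≤w′ , _) , wt) = by (norm w) (norm w′) refl refl 1≤w 1≤w′ (trans (cong (λ t → norm w + t) (sym (+-identityʳ (norm w′)))) wt)
        where
        Aa : A u a ≡ w
        Aa = trans (values a) (trans (⟦⟧-tail v (A u v) ((a , w) ∷ (b , w′) ∷ []) a (v≢a ∘ sym)) (⟦⟧-head a w ((b , w′) ∷ []) (a≢b , tt)))
        Ab : A u b ≡ w′
        Ab = trans (values b) (trans (⟦⟧-tail v (A u v) ((a , w) ∷ (b , w′) ∷ []) b (v≢b ∘ sym)) (trans (⟦⟧-tail a w ((b , w′) ∷ []) b (a≢b ∘ sym)) (⟦⟧-head b w′ [] tt)))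
        z : ∀ k → k ≢ v → k ≢ a → k ≢ b → A u k ≡ 0ᵢ
        z k p q r = trans (values k) (⟦⟧-∉ ((v , A u v) ∷ (a , w) ∷ (b , w′) ∷ []) k (p , q , r , tt))
        by : ∀ m m′ → norm w ≡ m → norm w′ ≡ m′ → 1 ≤ m → 1 ≤ m′ → norm w + norm w′ ≡ 3 → FullView u v
        by (suc zero) m′ e e′ _ _ s = heavy b a v≢b v≢a (a≢b ∘ sym) nv (trans (cong norm Ab) (suc-injective (trans (cong (_+ norm w′) (sym e)) s))) (trans (cong norm Aa) e) (λ k p q r → z k p r q)
        by (suc (suc zero)) m′ e e′ _ _ s = heavy a b v≢a v≢b a≢b nv (trans (cong norm Aa) e) (trans (cong norm Ab) (suc-injective (suc-injective (trans (cong (_+ norm w′) (sym e)) s)))) z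
        by (suc (suc (suc m))) m′ e e′ _ 1≤m′ s = ⊥-elim (not-4≤3 (+-mono-≤ {3} {suc (suc (suc m))} {1} {m′} (s≤s (s≤s (s≤s z≤n))) 1≤m′) (trans (cong₂ _+_ (sym e) (sym e′)) s))
      go ((a , w) ∷ (b , w′) ∷ (c , w″) ∷ ws , values , (_ , (v≢a , v≢b , v≢c , v∉) , 1≤w , (a≢b , a≢c , a∉) , 1≤w′ , (b≢c , b∉) , 1≤w″ , c∉ , proper) , wt) =
        units a b c record { v≢a = v≢a ; v≢b = v≢b ; v≢c = v≢c ; a≢b = a≢b ; a≢c = a≢c ; b≢c = b≢c ; norm-v = nv
          ; norm-a = trans (cong norm Aa) (proj₁ ones) ; norm-b = trans (cong norm Ab) (proj₁ (proj₂ ones)) ; norm-c = trans (cong norm Ac) (proj₁ (proj₂ (proj₂ ones))) ; rest = z }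
        where
        four : ∀ i j k l → 1 ≤ i → 1 ≤ j → 1 ≤ k → i + (j + (k + l)) ≡ 3 → i ≡ 1 × j ≡ 1 × k ≡ 1 × l ≡ 0
        four (suc zero) (suc zero) (suc zero) zero _ _ _ _ = refl , refl , refl , refl
        four (suc zero) (suc zero) (suc zero) (suc l) _ _ _ ()
        four (suc zero) (suc zero) (suc (suc k)) l _ _ _ ()
        four (suc zero) (suc (suc j)) k l _ _ 1≤k e = ⊥-elim (not-4≤3 (s≤s (s≤s (s≤s (≤-trans 1≤k (≤-trans (m≤m+n k l) (m≤n+m (k + l) j)))))) e)
        four (suc (suc i)) j k l _ 1≤j 1≤k e = ⊥-elim (not-4≤3 (s≤s (s≤s (≤-trans (+-mono-≤ {1} {j} {1} {k + l} 1≤j (≤-trans 1≤k (m≤m+n k l))) (m≤n+m (j + (k + l)) i)))) e)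
        ones : norm w ≡ 1 × norm w′ ≡ 1 × norm w″ ≡ 1 × weight ws ≡ 0
        ones = four (norm w) (norm w′) (norm w″) (weight ws) 1≤w 1≤w′ 1≤w″ wt
        ws≡[] : ws ≡ []
        ws≡[] = empty-weight ws proper (proj₂ (proj₂ (proj₂ ones)))
        t₁ t₂ t₃ : Support n
        t₃ = (c , w″) ∷ ws
        t₂ = (b , w′) ∷ t₃
        t₁ = (a , w) ∷ t₂
        Aa : A u a ≡ w
        Aa = trans (values a) (trans (⟦⟧-tail v (A u v) t₁ a (v≢a ∘ sym)) (⟦⟧-head a w t₂ (a≢b , a≢c , a∉)))
        Ab : A u b ≡ w′
        Ab = trans (values b) (trans (⟦⟧-tail v (A u v) t₁ b (v≢b ∘ sym)) (trans (⟦⟧-tail a w t₂ b (a≢b ∘ sym)) (⟦⟧-head b w′ t₃ (b≢c , b∉))))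
        Ac : A u c ≡ w″
        Ac = trans (values c) (trans (⟦⟧-tail v (A u v) t₁ c (v≢c ∘ sym)) (trans (⟦⟧-tail a w t₂ c (a≢c ∘ sym)) (trans (⟦⟧-tail b w′ t₃ c (b≢c ∘ sym)) (⟦⟧-head c w″ ws c∉))))
        z : ∀ k → k ≢ v → k ≢ a → k ≢ b → k ≢ c → A u k ≡ 0ᵢ
        z k p q r s = trans (values k) (⟦⟧-∉ ((v , A u v) ∷ t₁) k (p , q , r , s , subst (k ∉_) (sym ws≡[]) tt))

module LowNeighbours where
  open InnerProduct
  open GaussianIntegers
  open BorderedMatrices
  open GaussianNorms
  open UnextendableMatrices
  open ParityArguments
  open DegreeTwo
  open LowDegreeVertices
  open import Data.Integer.Base using (+_; -[1+_]; 0ℤ; -≤+)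
  open import Data.Nat.Properties using (≤-refl; *-identityˡ)

  ⊠≢0 : ∀ {x y} → x ≢ 0ᵢ → y ≢ 0ᵢ → x ⊠ y ≢ 0ᵢ
  ⊠≢0 {x} {y} p q e = by (⊠-zero {x} {y} e)
    where
    by : x ≡ 0ᵢ ⊎ y ≡ 0ᵢ → ⊥
    by (inj₁ e) = p e
    by (inj₂ e) = q e

  drop-zero : ∀ x {y z} → y ≡ 0ᵢ → (x ⊠ y) ⊞ z ≡ z
  drop-zero x {y} {z} refl = trans (cong (_⊞ z) (Gi.zeroʳ x)) (Gi.+-identityˡ z)

  drop-zeroʳ : ∀ x y {z} → z ≡ 0ᵢ → x ⊞ (y ⊠ z) ≡ x
  drop-zeroʳ x y refl = trans (cong (x ⊞_) (Gi.zeroʳ y)) (Gi.+-identityʳ x)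

  norm-unit-⊠ : ∀ x y → norm x ≡ 1 → norm (x ⊠ y) ≡ norm y
  norm-unit-⊠ x y e = trans (norm-* x y) (trans (cong (ℕ._* norm y) e) (*-identityˡ (norm y)))

  unit-cancel : ∀ x y z → norm x ≡ 1 → x ⊠ y ≡ z → y ≡ conj x ⊠ z
  unit-cancel x y z e p = sym (begin
    conj x ⊠ z         ≡⟨ cong (conj x ⊠_) p ⟨
    conj x ⊠ (x ⊠ y)   ≡⟨ Gi.*-assoc (conj x) x y ⟨
    (conj x ⊠ x) ⊠ y   ≡⟨ cong (_⊠ y) (trans (Gi.*-comm (conj x) x) (unit-conj x e)) ⟩
    +1ᵢ ⊠ y            ≡⟨ Gi.*-identityˡ y ⟩
    y                  ∎)
    where open ≡-Reasoning

  module Configurations {n} {A : Matrix n} (core : Core A) where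
    open Core core
    open LowDegree core public

    hit-or-miss : ∀ {k u} → LowView k u → ∀ x → u ≢ x → A k x ≡ 0ᵢ ⊎ (norm (A k x) ≡ 1 × two-support (A k) u x)
    hit-or-miss (leaf z)             x u≢x = inj₁ (z x (u≢x ∘ sym))
    hit-or-miss {k} {u} (two z u≢z nz supp _) x u≢x = by (x Finₚ.≟ z)
      where
      by : Dec (x ≡ z) → A k x ≡ 0ᵢ ⊎ (norm (A k x) ≡ 1 × two-support (A k) u x)
      by (yes refl) = inj₂ (nz , supp)
      by (no x≢z)   = inj₁ (supp x (u≢x ∘ sym) x≢z)

    hit : ∀ {k u} → LowView k u → ∀ x → u ≢ x → A k x ≢ 0ᵢ → norm (A k x) ≡ 1 × two-support (A k) u x
    hit {k} {u} view x u≢x nz = by (hit-or-miss view x u≢x)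
      where
      by : A k x ≡ 0ᵢ ⊎ (norm (A k x) ≡ 1 × two-support (A k) u x) → norm (A k x) ≡ 1 × two-support (A k) u x
      by (inj₁ e) = ⊥-elim (nz e)
      by (inj₂ p) = p

    swap-ab : ∀ {u v a b c} → Units u v a b c → Units u v b a c
    swap-ab U = record { v≢a = v≢b ; v≢b = v≢a ; v≢c = v≢c ; a≢b = a≢b ∘ sym ; a≢c = b≢c ; b≢c = a≢c
      ; norm-v = norm-v ; norm-a = norm-b ; norm-b = norm-a ; norm-c = norm-c ; rest = λ w p q r s → rest w p r q s }
      where open Units U

    swap-bc : ∀ {u v a b c} → Units u v a b c → Units u v a c b
    swap-bc U = record { v≢a = v≢a ; v≢b = v≢c ; v≢c = v≢b ; a≢b = a≢c ; a≢c = a≢b ; b≢c = b≢c ∘ sym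
      ; norm-v = norm-v ; norm-a = norm-a ; norm-b = norm-c ; norm-c = norm-b ; rest = λ w p q r s → rest w p q s r }
      where open Units U

    norm-swap : ∀ {u v m} → norm (A u v) ≡ m → norm (A v u) ≡ m
    norm-swap {u} {v} e = trans (norm-sym v u) e

    cancel-at : ∀ u p r x → p ≢ r → p ≢ u → r ≢ u → A u u ≡ 0ᵢ → norm (A u p) ≡ 1 → norm (A u r) ≡ 1 →
      two-support (A p) u x → two-support (A r) u x → (A u p ⊠ A p x) ⊞ (A u r ⊠ A r x) ≡ 0ᵢ → ⊥
    cancel-at u p r x p≢r p≢u r≢u uu np nr sp sr e = cancelling-pair u p r p≢r p≢u r≢u uu np nr λ w w≢u → by w w≢u (w Finₚ.≟ x)
      where
      by : ∀ w → w ≢ u → Dec (w ≡ x) → (A u p ⊠ A p w) ⊞ (A u r ⊠ A r w) ≡ 0ᵢ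
      by w w≢u (yes refl) = e
      by w w≢u (no w≢x)   = trans (drop-zero (A u p) (sp w w≢u w≢x)) (trans (cong (A u r ⊠_) (sr w w≢u w≢x)) (Gi.zeroʳ (A u r)))

    leaf-absurd : ∀ u v → Full u → Low v → norm (A u v) ≡ 1 → (∀ w → w ≢ u → A v w ≡ 0ᵢ) → ⊥
    leaf-absurd u v full low nv z = by-view (full-view u v full nv)
      where
      u≢v = full≢low full low
      row : ∀ w → sq A v w ≡ A v u ⊠ A u w
      row w = trans (sum-over (A v) (u ∷ []) (tt , tt) (λ k (ne , _) → z k ne) (λ k → A k w)) (Gi.+-identityʳ (A v u ⊠ A u w))
      vu≢0 : A v u ≢ 0ᵢ
      vu≢0 = A-nonzero (norm⇒≢0 nv)
      uu : A u u ≡ 0ᵢ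
      uu = by (⊠-zero {A v u} {A u u} (trans (sym (row u)) (full-sq full u≢v)))
        where
        by : A v u ≡ 0ᵢ ⊎ A u u ≡ 0ᵢ → A u u ≡ 0ᵢ
        by (inj₁ e) = ⊥-elim (vu≢0 e)
        by (inj₂ e) = e
      nbr-low : ∀ k → v ≢ k → A u k ≢ 0ᵢ → Low k
      nbr-low k v≢k nz = by (full-or-low k)
        where
        by : Full k ⊎ Low k → Low k
        by (inj₁ f) = ⊥-elim (⊠≢0 {A v u} {A u k} vu≢0 nz (trans (sym (row k)) (full-sq f (v≢k ∘ sym))))
        by (inj₂ l) = l
      by-view : FullView u v → ⊥
      by-view (heavy p k v≢p v≢k p≢k _ np nk _) = 2≢1 (trans (sym (norm-swap np)) (proj₁ (low-view u p full (nbr-low p v≢p (norm⇒≢0 np)) (A-nonzero (norm⇒≢0 np)))))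
        where
        2≢1 : 2 ≢ 1
        2≢1 ()
      by-view (units a b c U) = by-a (view a v≢a (norm⇒≢0 norm-a)) refl
        where
        open Units U
        lo : ∀ k → v ≢ k → A u k ≢ 0ᵢ → Low k
        lo = nbr-low
        view : ∀ k → v ≢ k → A u k ≢ 0ᵢ → LowView k u
        view k v≢k nz = proj₂ (low-view u k full (lo k v≢k nz) (A-nonzero nz))
        ≢u : ∀ k → A u k ≢ 0ᵢ → k ≢ u
        ≢u k nz refl = nz uu
        by-a : LowView a u → A u u ≡ A u u → ⊥
        by-a (leaf za) _ = cancelling-pair u v a v≢a (u≢v ∘ sym) (≢u a (norm⇒≢0 norm-a)) uu nv norm-a
          λ w w≢u → trans (drop-zero (A u v) (z w w≢u)) (trans (cong (A u a ⊠_) (za w w≢u)) (Gi.zeroʳ (A u a)))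
        by-a (two x u≢x nx supp _) _ = by-bc (hit-or-miss (view b v≢b (norm⇒≢0 norm-b)) x u≢x) (hit-or-miss (view c v≢c (norm⇒≢0 norm-c)) x u≢x)
          where
          total-x : (A u a ⊠ A a x) ⊞ ((A u b ⊠ A b x) ⊞ (A u c ⊠ A c x)) ≡ 0ᵢ
          total-x = trans (sym (drop-zero (A u v) (z x (u≢x ∘ sym)))) (trans (sym (sum (λ k → A k x))) (full-sq′ full u≢x))
          nb : ∀ k → norm (A u k) ≡ 1 → norm (A k x) ≡ 1 → norm (A u k ⊠ A k x) ≡ 1
          nb k p q = trans (norm-unit-⊠ (A u k) (A k x) p) q
          by-bc : A b x ≡ 0ᵢ ⊎ (norm (A b x) ≡ 1 × two-support (A b) u x) → A c x ≡ 0ᵢ ⊎ (norm (A c x) ≡ 1 × two-support (A c) u x) → ⊥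
          by-bc (inj₁ eb) (inj₁ ec) = norm⇒≢0 (nb a norm-a nx) (trans (sym (drop-zeroʳ (A u a ⊠ A a x) (A u b) eb)) (trans (cong ((A u a ⊠ A a x) ⊞_) (sym (drop-zeroʳ (A u b ⊠ A b x) (A u c) ec))) total-x))
          by-bc (inj₁ eb) (inj₂ (nc , sc)) = cancel-at u a c x a≢c (≢u a (norm⇒≢0 norm-a)) (≢u c (norm⇒≢0 norm-c)) uu norm-a norm-c supp sc
            (trans (cong ((A u a ⊠ A a x) ⊞_) (sym (drop-zero (A u b) eb))) total-x)
          by-bc (inj₂ (nb′ , sb)) (inj₁ ec) = cancel-at u a b x a≢b (≢u a (norm⇒≢0 norm-a)) (≢u b (norm⇒≢0 norm-b)) uu norm-a norm-b supp sb
            (trans (cong ((A u a ⊠ A a x) ⊞_) (sym (drop-zeroʳ (A u b ⊠ A b x) (A u c) ec))) total-x)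
          by-bc (inj₂ (nb′ , _)) (inj₂ (nc , _)) = three-units (A u a ⊠ A a x) (A u b ⊠ A b x) (A u c ⊠ A c x) (nb a norm-a nx) (nb b norm-b nb′) (nb c norm-c nc) total-x

    data UnitCharge : ℤ → Set where
      plus  : UnitCharge (+ 1)
      minus : UnitCharge -[1+ 0 ]

    unit-charge : ∀ u → norm (A u u) ≡ 1 → ∃[ l ] UnitCharge l × A u u ≡ l +i 0ℤ
    unit-charge u e = by (A u u) (isUnit (A u u) e) (cong im (real-diagonal herm u))
      where
      by : ∀ z → IsUnit z → im z ≡ 0ℤ → ∃[ l ] UnitCharge l × z ≡ l +i 0ℤ
      by _ u₁  _ = + 1 , plus , refl
      by _ u₋₁ _ = -[1+ 0 ] , minus , refl
      by _ uᵢ  ()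
      by _ u₋ᵢ ()

    negated : ∀ u → norm (A u u) ≡ 1 → ∃[ l ] UnitCharge l × ⊟ (A u u) ≡ l +i 0ℤ
    negated u e = by (unit-charge u e)
      where
      by : (∃[ l ] UnitCharge l × A u u ≡ l +i 0ℤ) → ∃[ l ] UnitCharge l × ⊟ (A u u) ≡ l +i 0ℤ
      by (_ , plus  , p) = -[1+ 0 ] , minus , cong ⊟_ p
      by (_ , minus , p) = + 1 , plus , cong ⊟_ p

    low-eigenpair : ∀ u p r τ l → p ≢ r → u ≢ p → u ≢ r → norm τ ≡ 1 → UnitCharge l → A u p ⊞ (τ ⊠ A u r) ≡ 0ᵢ →
      (∀ w → w ≢ u → w ≢ p → w ≢ r → A p w ≡ 0ᵢ) → (∀ w → w ≢ u → w ≢ p → w ≢ r → A r w ≡ 0ᵢ) →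
      A p p ⊞ (τ ⊠ A p r) ≡ l +i 0ℤ → A r p ⊞ (τ ⊠ A r r) ≡ τ ⊠ (l +i 0ℤ) → ⊥
    low-eigenpair u p r τ l p≢r u≢p u≢r nτ charge at-u zp zr at-p at-r = by-charge charge
      where
      eig : ∀ w → A w p ⊞ (τ ⊠ A w r) ≡ (l +i 0ℤ) ⊠ (unit p w ⊞ (τ ⊠ unit r w))
      eig w = by (w Finₚ.≟ u) (w Finₚ.≟ p) (w Finₚ.≟ r)
        where
        vanish : p ≢ w → r ≢ w → (l +i 0ℤ) ⊠ (unit p w ⊞ (τ ⊠ unit r w)) ≡ 0ᵢ
        vanish p≢w r≢w = trans (cong₂ (λ a b → (l +i 0ℤ) ⊠ (a ⊞ (τ ⊠ b))) (Zi.single-other p w +1ᵢ p≢w) (Zi.single-other r w +1ᵢ r≢w))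
          (trans (cong (λ z → (l +i 0ℤ) ⊠ (0ᵢ ⊞ z)) (Gi.zeroʳ τ)) (Gi.zeroʳ (l +i 0ℤ)))
        by : Dec (w ≡ u) → Dec (w ≡ p) → Dec (w ≡ r) → A w p ⊞ (τ ⊠ A w r) ≡ (l +i 0ℤ) ⊠ (unit p w ⊞ (τ ⊠ unit r w))
        by (yes refl) _ _ = trans at-u (sym (vanish (u≢p ∘ sym) (u≢r ∘ sym)))
        by (no _) (yes refl) _ = trans at-p (sym (trans (cong₂ (λ a b → (l +i 0ℤ) ⊠ (a ⊞ (τ ⊠ b))) (Zi.single-self p +1ᵢ) (Zi.single-other r p +1ᵢ (p≢r ∘ sym)))
          (trans (cong (λ z → (l +i 0ℤ) ⊠ (+1ᵢ ⊞ z)) (Gi.zeroʳ τ)) (Gi.*-identityʳ (l +i 0ℤ)))))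
        by (no _) (no _) (yes refl) = trans at-r (trans (Gi.*-comm τ (l +i 0ℤ)) (sym (trans (cong₂ (λ a b → (l +i 0ℤ) ⊠ (a ⊞ (τ ⊠ b))) (Zi.single-other p r +1ᵢ p≢r) (Zi.single-self r +1ᵢ))
          (cong ((l +i 0ℤ) ⊠_) (trans (Gi.+-identityˡ (τ ⊠ +1ᵢ)) (Gi.*-identityʳ τ))))))
        by (no w≢u) (no w≢p) (no w≢r) = trans (cong₂ (λ a b → a ⊞ (τ ⊠ b)) (A-zero (zp w w≢u w≢p w≢r)) (A-zero (zr w w≢u w≢p w≢r)))
          (trans (trans (cong (0ᵢ ⊞_) (Gi.zeroʳ τ)) refl) (sym (vanish (w≢p ∘ sym) (w≢r ∘ sym))))
      by-charge : UnitCharge l → ⊥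
      by-charge plus  = eigenpair p r τ (+ 1) p≢r nτ refl ℤₚ.≤-refl -≤+ eig
      by-charge minus = eigenpair p r τ -[1+ 0 ] p≢r nτ refl -≤+ ℤₚ.≤-refl eig

    minus-unit : ∀ u p r → norm (A u p) ≡ 1 → norm (A u r) ≡ 1 → ∃[ τ ] norm τ ≡ 1 × A u p ⊞ (τ ⊠ A u r) ≡ 0ᵢ × τ ≡ ⊟ (A u p ⊠ conj (A u r))
    minus-unit u p r np nr = τ , nτ , at-u , refl
      where
      τ : ℤ[i]
      τ = ⊟ (A u p ⊠ conj (A u r))
      nτ : norm τ ≡ 1
      nτ = trans (norm-⊟ (A u p ⊠ conj (A u r))) (trans (norm-unit-⊠ (A u p) (conj (A u r)) np) (trans (norm-conj (A u r)) nr))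
      at-u : A u p ⊞ (τ ⊠ A u r) ≡ 0ᵢ
      at-u = trans (cong (A u p ⊞_) (trans (⊟-⊠ (A u p ⊠ conj (A u r)) (A u r)) (cong ⊟_ (trans (Gi.*-assoc (A u p) (conj (A u r)) (A u r))
        (trans (cong (A u p ⊠_) (trans (Gi.*-comm (conj (A u r)) (A u r)) (unit-conj (A u r) nr))) (Gi.*-identityʳ (A u p))))))) (Gi.-‿inverseʳ (A u p))

    τ-relation : ∀ u p r τ z → norm (A u r) ≡ 1 → τ ≡ ⊟ (A u p ⊠ conj (A u r)) → A u p ⊠ z ≡ ⊟ (A u u ⊠ A u r) → τ ⊠ z ≡ A u u
    τ-relation u p r τ z nr refl e = begin
      ⊟ (A u p ⊠ conj (A u r)) ⊠ z        ≡⟨ ⊟-⊠ (A u p ⊠ conj (A u r)) z ⟩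
      ⊟ ((A u p ⊠ conj (A u r)) ⊠ z)      ≡⟨ cong ⊟_ (trans (cong (_⊠ z) (Gi.*-comm (A u p) (conj (A u r)))) (trans (Gi.*-assoc (conj (A u r)) (A u p) z) (cong (conj (A u r) ⊠_) e))) ⟩
      ⊟ (conj (A u r) ⊠ ⊟ (A u u ⊠ A u r)) ≡⟨ cong ⊟_ (⊠-⊟ (conj (A u r)) (A u u ⊠ A u r)) ⟩
      ⊟ (⊟ (conj (A u r) ⊠ (A u u ⊠ A u r))) ≡⟨ ⊟-involutive (conj (A u r) ⊠ (A u u ⊠ A u r)) ⟩
      conj (A u r) ⊠ (A u u ⊠ A u r)      ≡⟨ trans (cong (conj (A u r) ⊠_) (Gi.*-comm (A u u) (A u r))) (trans (sym (Gi.*-assoc (conj (A u r)) (A u r) (A u u))) (cong (_⊠ A u u) (trans (Gi.*-comm (conj (A u r)) (A u r)) (unit-conj (A u r) nr)))) ⟩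
      +1ᵢ ⊠ A u u                         ≡⟨ Gi.*-identityˡ (A u u) ⟩
      A u u                               ∎
      where
      open ≡-Reasoning
    τ-relation′ : ∀ u p r τ z → norm (A u r) ≡ 1 → τ ≡ ⊟ (A u p ⊠ conj (A u r)) → A u r ⊠ z ≡ ⊟ (A u u ⊠ A u p) → z ≡ τ ⊠ A u u
    τ-relation′ u p r τ z nr refl e = begin
      z                                       ≡⟨ unit-cancel (A u r) z (⊟ (A u u ⊠ A u p)) nr e ⟩
      conj (A u r) ⊠ ⊟ (A u u ⊠ A u p)        ≡⟨ ⊠-⊟ (conj (A u r)) (A u u ⊠ A u p) ⟩
      ⊟ (conj (A u r) ⊠ (A u u ⊠ A u p))      ≡⟨ cong ⊟_ (trans (Gi.*-comm (conj (A u r)) (A u u ⊠ A u p)) (trans (Gi.*-assoc (A u u) (A u p) (conj (A u r))) (Gi.*-comm (A u u) (A u p ⊠ conj (A u r))))) ⟩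
      ⊟ ((A u p ⊠ conj (A u r)) ⊠ A u u)      ≡⟨ ⊟-⊠ (A u p ⊠ conj (A u r)) (A u u) ⟨
      ⊟ (A u p ⊠ conj (A u r)) ⊠ A u u        ∎
      where open ≡-Reasoning

    charged-absurd : ∀ u v → Full u → norm (A u v) ≡ 1 → norm (A v v) ≡ 1 → u ≢ v → two-support (A v) u v → ⊥
    charged-absurd u v full nv nvv u≢v supp = by-view (full-view u v full nv)
      where
      row : ∀ w → sq A v w ≡ (A v u ⊠ A u w) ⊞ (A v v ⊠ A v w)
      row w = two-sum (A v) u v u≢v supp (λ k → A k w)
      nvu : norm (A v u) ≡ 1
      nvu = norm-swap nv
      nuu : norm (A u u) ≡ 1
      nuu = trans (sym (norm-unit-⊠ (A v u) (A u u) nvu)) (trans (sum-norms (A v u ⊠ A u u) (A v v ⊠ A v u) (trans (sym (row u)) (full-sq full u≢v)))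
        (trans (norm-unit-⊠ (A v v) (A v u) nvv) nvu))
      low-nbr : ∀ k → k ≢ u → k ≢ v → A u k ≢ 0ᵢ → Low k
      low-nbr k k≢u k≢v nz = by (full-or-low k)
        where
        by : Full k ⊎ Low k → Low k
        by (inj₁ f) = ⊥-elim (⊠≢0 {A v u} {A u k} (norm⇒≢0 nvu) nz (trans (sym (drop-zeroʳ (A v u ⊠ A u k) (A v v) (supp k k≢u k≢v))) (trans (sym (row k)) (full-sq f k≢v))))
        by (inj₂ l) = l
      view : ∀ k → k ≢ u → k ≢ v → A u k ≢ 0ᵢ → norm (A k u) ≡ 1 × LowView k u
      view k k≢u k≢v nz = low-view u k full (low-nbr k k≢u k≢v nz) (A-nonzero nz)
      by-pair : ∀ k₁ k₂ → Units u v u k₁ k₂ → ⊥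
      by-pair k₁ k₂ U = by-adjacent (A k₁ k₂ ≟ᵢ 0ᵢ)
        where
        open Units U renaming (a≢b to u≢k₁; a≢c to u≢k₂; b≢c to k₁≢k₂; v≢b to v≢k₁; v≢c to v≢k₂; norm-b to n₁; norm-c to n₂)
        view₁ : LowView k₁ u
        view₁ = proj₂ (view k₁ (u≢k₁ ∘ sym) (v≢k₁ ∘ sym) (norm⇒≢0 n₁))
        view₂ : LowView k₂ u
        view₂ = proj₂ (view k₂ (u≢k₂ ∘ sym) (v≢k₂ ∘ sym) (norm⇒≢0 n₂))
        eq : ∀ k → u ≢ k → v ≢ k → (A u u ⊠ A u k) ⊞ ((A u k₁ ⊠ A k₁ k) ⊞ (A u k₂ ⊠ A k₂ k)) ≡ 0ᵢ
        eq k u≢k v≢k = trans (sym (drop-zero (A u v) (supp k (u≢k ∘ sym) (v≢k ∘ sym)))) (trans (sym (sum (λ j → A j k))) (full-sq′ full u≢k))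
        τ-data = minus-unit u k₁ k₂ n₁ n₂
        τ : ℤ[i]
        τ = proj₁ τ-data
        nτ : norm τ ≡ 1
        nτ = proj₁ (proj₂ τ-data)
        at-u : A u k₁ ⊞ (τ ⊠ A u k₂) ≡ 0ᵢ
        at-u = proj₁ (proj₂ (proj₂ τ-data))
        τ≡ = proj₂ (proj₂ (proj₂ τ-data))
        by-adjacent : Dec (A k₁ k₂ ≡ 0ᵢ) → ⊥
        by-adjacent (yes z) = by-charge (negated u nuu)
          where
          z′ : A k₂ k₁ ≡ 0ᵢ
          z′ = A-zero z
          loop₁ : A k₁ k₁ ≡ ⊟ (A u u)
          loop₁ = ⊠-cancelˡ {A u k₁} {A k₁ k₁} {⊟ (A u u)} (norm⇒≢0 n₁) (trans (⊟-unique (A u u ⊠ A u k₁) (A u k₁ ⊠ A k₁ k₁)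
            (trans (cong ((A u u ⊠ A u k₁) ⊞_) (sym (drop-zeroʳ (A u k₁ ⊠ A k₁ k₁) (A u k₂) z′))) (eq k₁ u≢k₁ v≢k₁))) (trans (cong ⊟_ (Gi.*-comm (A u u) (A u k₁))) (sym (⊠-⊟ (A u k₁) (A u u)))))
          loop₂ : A k₂ k₂ ≡ ⊟ (A u u)
          loop₂ = ⊠-cancelˡ {A u k₂} {A k₂ k₂} {⊟ (A u u)} (norm⇒≢0 n₂) (trans (⊟-unique (A u u ⊠ A u k₂) (A u k₂ ⊠ A k₂ k₂)
            (trans (cong ((A u u ⊠ A u k₂) ⊞_) (sym (drop-zero (A u k₁) z))) (eq k₂ u≢k₂ v≢k₂))) (trans (cong ⊟_ (Gi.*-comm (A u u) (A u k₂))) (sym (⊠-⊟ (A u k₂) (A u u)))))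
          loop≢0 : ∀ {k} → A k k ≡ ⊟ (A u u) → A k k ≢ 0ᵢ
          loop≢0 {k} e = norm⇒≢0 (trans (cong norm e) (trans (norm-⊟ (A u u)) nuu))
          supp₁ : two-support (A k₁) u k₁
          supp₁ = proj₂ (hit view₁ k₁ u≢k₁ (loop≢0 loop₁))
          supp₂ : two-support (A k₂) u k₂
          supp₂ = proj₂ (hit view₂ k₂ u≢k₂ (loop≢0 loop₂))
          by-charge : (∃[ l ] UnitCharge l × ⊟ (A u u) ≡ l +i 0ℤ) → ⊥
          by-charge (l , charge , e) = low-eigenpair u k₁ k₂ τ l k₁≢k₂ u≢k₁ u≢k₂ nτ charge at-u (λ w p q r → supp₁ w p q) (λ w p q r → supp₂ w p r)
            (trans (drop-zeroʳ (A k₁ k₁) τ z) (trans loop₁ e)) (trans (cong (_⊞ (τ ⊠ A k₂ k₂)) z′) (trans (Gi.+-identityˡ (τ ⊠ A k₂ k₂)) (cong (τ ⊠_) (trans loop₂ e))))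
        by-adjacent (no nz) = by-charge (unit-charge u nuu)
          where
          supp₁ : two-support (A k₁) u k₂
          supp₁ = proj₂ (hit view₁ k₂ u≢k₂ nz)
          supp₂ : two-support (A k₂) u k₁
          supp₂ = proj₂ (hit view₂ k₁ u≢k₁ (A-nonzero nz))
          loop₁ : A k₁ k₁ ≡ 0ᵢ
          loop₁ = supp₁ k₁ (u≢k₁ ∘ sym) k₁≢k₂
          loop₂ : A k₂ k₂ ≡ 0ᵢ
          loop₂ = supp₂ k₂ (u≢k₂ ∘ sym) (k₁≢k₂ ∘ sym)
          r₁ : A u k₂ ⊠ A k₂ k₁ ≡ ⊟ (A u u ⊠ A u k₁)
          r₁ = ⊟-unique (A u u ⊠ A u k₁) (A u k₂ ⊠ A k₂ k₁) (trans (cong ((A u u ⊠ A u k₁) ⊞_) (sym (drop-zero (A u k₁) loop₁))) (eq k₁ u≢k₁ v≢k₁))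
          r₂ : A u k₁ ⊠ A k₁ k₂ ≡ ⊟ (A u u ⊠ A u k₂)
          r₂ = ⊟-unique (A u u ⊠ A u k₂) (A u k₁ ⊠ A k₁ k₂) (trans (cong ((A u u ⊠ A u k₂) ⊞_) (sym (drop-zeroʳ (A u k₁ ⊠ A k₁ k₂) (A u k₂) loop₂))) (eq k₂ u≢k₂ v≢k₂))
          by-charge : (∃[ l ] UnitCharge l × A u u ≡ l +i 0ℤ) → ⊥
          by-charge (l , charge , e) = low-eigenpair u k₁ k₂ τ l k₁≢k₂ u≢k₁ u≢k₂ nτ charge at-u (λ w p q r → supp₁ w p r) (λ w p q r → supp₂ w p q)
            (trans (cong (_⊞ (τ ⊠ A k₁ k₂)) loop₁) (trans (Gi.+-identityˡ (τ ⊠ A k₁ k₂)) (trans (τ-relation u k₁ k₂ τ (A k₁ k₂) n₂ τ≡ r₂) e)))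
            (trans (drop-zeroʳ (A k₂ k₁) τ loop₂) (trans (τ-relation′ u k₁ k₂ τ (A k₂ k₁) n₂ τ≡ r₁) (cong (τ ⊠_) e)))
      by-view : FullView u v → ⊥
      by-view (heavy p k v≢p v≢k p≢k _ np nk _) = 2≢1 (trans (sym (norm-swap np)) (proj₁ (view p p≢u (v≢p ∘ sym) (norm⇒≢0 np))))
        where
        2≢1 : 2 ≢ 1
        2≢1 ()
        p≢u : p ≢ u
        p≢u refl = 2≢1 (trans (sym np) nuu)
      by-view (units a b c U) = find (u Finₚ.≟ a) (u Finₚ.≟ b) (u Finₚ.≟ c)
        where
        find : Dec (u ≡ a) → Dec (u ≡ b) → Dec (u ≡ c) → ⊥
        find (yes e) _ _ = by-pair b c (subst (λ a → Units u v a b c) (sym e) U)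
        find (no _) (yes e) _ = by-pair a c (swap-ab (subst (λ b → Units u v a b c) (sym e) U))
        find (no _) (no _) (yes e) = by-pair a b (swap-ab (swap-bc (subst (λ c → Units u v a b c) (sym e) U)))
        find (no p) (no q) (no r) = norm⇒≢0 nuu (Units.rest U u u≢v p q r)

module MixedNeighbours where
  open BorderedMatrices
  open GaussianNorms
  open UnextendableMatrices
  open ParityArguments
  open DegreeTwo
  open LowDegreeVertices
  open LowNeighbours
  open import Data.Integer.Base using (0ℤ)
  open import Data.Nat.Base using (_≤_)
  open import Data.Nat.Properties using (≤-trans; ≤-reflexive; *-identityˡ)

  module Mixed {n} {A : Matrix n} (core : Core A) where
    open Core core
    open Configurations core public

    triangle-absurd : ∀ u v x → Full u → norm (A u v) ≡ 1 → u ≢ v → v ≢ x → u ≢ x → norm (A v x) ≡ 1 → two-support (A v) u x → deg v ≡ 2 → A x u ≢ 0ᵢ → ⊥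
    triangle-absurd u v x full nv u≢v v≢x u≢x nvx supp dv xu≢0 = by-view (full-view u v full nv)
      where
      row : ∀ w → sq A v w ≡ (A v u ⊠ A u w) ⊞ (A v x ⊠ A x w)
      row w = two-sum (A v) u x u≢x supp (λ k → A k w)
      nvu : norm (A v u) ≡ 1
      nvu = norm-swap nv
      E₁ : (A v u ⊠ A u u) ⊞ (A v x ⊠ A x u) ≡ 0ᵢ
      E₁ = trans (sym (row u)) (full-sq full u≢v)
      same : norm (A u u) ≡ norm (A x u)
      same = trans (sym (norm-unit-⊠ (A v u) (A u u) nvu)) (trans (sum-norms (A v u ⊠ A u u) (A v x ⊠ A x u) E₁) (norm-unit-⊠ (A v x) (A x u) nvx))
      ux≢0 : A u x ≢ 0ᵢ
      ux≢0 = A-nonzero xu≢0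
      uu≢0 : A u u ≢ 0ᵢ
      uu≢0 e = ≤norm⇒≢0 (subst (1 ≤_) (sym same) (norm≢0 xu≢0)) e
      by-third : ∀ k → Units u v u x k → ⊥
      by-third k U = by-loop (A x x ≟ᵢ 0ᵢ)
        where
        open Units U renaming (norm-a to nuu; norm-b to nux; norm-c to nuk)
        loop-x : A u v ⊠ A v x ≡ ⊟ (A u u ⊠ A u x)
        loop-x = trans (unit-cancel (A v u) (A u v ⊠ A v x) (A v x) nvu (trans (sym (Gi.*-assoc (A v u) (A u v) (A v x))) (trans (cong (_⊠ A v x) (trans (cong (A v u ⊠_) (herm u v)) (unit-conj (A v u) nvu))) (Gi.*-identityˡ (A v x)))))
          (trans (cong₂ _⊠_ (sym (herm u v)) refl) (⊠-cancelˡ {A x u} {A u v ⊠ A v x} {⊟ (A u u ⊠ A u x)} xu≢0 step))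
          where
          open ≡-Reasoning
          nxu : norm (A x u) ≡ 1
          nxu = norm-swap nux
          E₂ : A v x ⊠ A x u ≡ ⊟ (A v u ⊠ A u u)
          E₂ = ⊟-unique (A v u ⊠ A u u) (A v x ⊠ A x u) E₁
          step : A x u ⊠ (A u v ⊠ A v x) ≡ A x u ⊠ ⊟ (A u u ⊠ A u x)
          step = begin
            A x u ⊠ (A u v ⊠ A v x)             ≡⟨ trans (Gi.*-comm (A x u) (A u v ⊠ A v x)) (Gi.*-assoc (A u v) (A v x) (A x u)) ⟩
            A u v ⊠ (A v x ⊠ A x u)             ≡⟨ cong (A u v ⊠_) E₂ ⟩
            A u v ⊠ ⊟ (A v u ⊠ A u u)           ≡⟨ ⊠-⊟ (A u v) (A v u ⊠ A u u) ⟩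
            ⊟ (A u v ⊠ (A v u ⊠ A u u))         ≡⟨ cong ⊟_ (trans (sym (Gi.*-assoc (A u v) (A v u) (A u u))) (trans (cong (_⊠ A u u) (trans (cong (A u v ⊠_) (herm v u)) (unit-conj (A u v) nv))) (Gi.*-identityˡ (A u u)))) ⟩
            ⊟ (A u u)                           ≡⟨ cong ⊟_ (trans (cong (A u u ⊠_) (trans (cong (A x u ⊠_) (herm u x)) (unit-conj (A x u) nxu))) (Gi.*-identityʳ (A u u))) ⟨
            ⊟ (A u u ⊠ (A x u ⊠ A u x))         ≡⟨ cong ⊟_ (trans (sym (Gi.*-assoc (A u u) (A x u) (A u x))) (trans (cong (_⊠ A u x) (Gi.*-comm (A u u) (A x u))) (Gi.*-assoc (A x u) (A u u) (A u x)))) ⟩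
            ⊟ (A x u ⊠ (A u u ⊠ A u x))         ≡⟨ ⊠-⊟ (A x u) (A u u ⊠ A u x) ⟨
            A x u ⊠ ⊟ (A u u ⊠ A u x)           ∎
        E₃ : (A u x ⊠ A x x) ⊞ (A u k ⊠ A k x) ≡ 0ᵢ
        E₃ = begin
          r                                    ≡⟨ Gi.+-identityˡ r ⟨
          0ᵢ ⊞ r                               ≡⟨ cong (_⊞ r) (Gi.-‿inverseˡ (A u u ⊠ A u x)) ⟨
          (⊟ (A u u ⊠ A u x) ⊞ (A u u ⊠ A u x)) ⊞ r ≡⟨ cong (λ z → (z ⊞ (A u u ⊠ A u x)) ⊞ r) loop-x ⟨
          ((A u v ⊠ A v x) ⊞ (A u u ⊠ A u x)) ⊞ r ≡⟨ Gi.+-assoc (A u v ⊠ A v x) (A u u ⊠ A u x) r ⟩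
          (A u v ⊠ A v x) ⊞ ((A u u ⊠ A u x) ⊞ r) ≡⟨ sum (λ j → A j x) ⟨
          sq A u x                             ≡⟨ full-sq′ full u≢x ⟩
          0ᵢ                                   ∎
          where
          open ≡-Reasoning
          r = (A u x ⊠ A x x) ⊞ (A u k ⊠ A k x)
        by-loop : Dec (A x x ≡ 0ᵢ) → ⊥
        by-loop (no xx≢0) = parallel-rows v u x nvu nvx u≢x supp dv full λ w → bound w (w Finₚ.≟ v) (w Finₚ.≟ u) (w Finₚ.≟ x) (w Finₚ.≟ k)
          where
          xk≢0 : A x k ≢ 0ᵢ
          xk≢0 e = ⊠≢0 {A u x} {A x x} ux≢0 xx≢0 (trans (sym (drop-zeroʳ (A u x ⊠ A x x) (A u k) (A-zero e))) E₃)
          bound : ∀ w → Dec (w ≡ v) → Dec (w ≡ u) → Dec (w ≡ x) → Dec (w ≡ k) → norm (A u w) ≤ norm (A x w)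
          bound w (yes refl) _ _ _ = ≤-reflexive (trans nv (sym (norm-swap nvx)))
          bound w (no _) (yes refl) _ _ = ≤-reflexive same
          bound w (no _) (no _) (yes refl) _ = ≤-trans (≤-reflexive nux) (norm≢0 xx≢0)
          bound w (no _) (no _) (no _) (yes refl) = ≤-trans (≤-reflexive nuk) (norm≢0 xk≢0)
          bound w (no p) (no q) (no r) (no s) = ≤-trans (≤-reflexive (norm-zero (rest w p q r s))) z≤n
        by-loop (yes xx) = by-charge (unit-charge u nuu)
          where
          low-x : Low x
          low-x = by (full-or-low x)
            where
            by : Full x ⊎ Low x → Low x
            by (inj₁ f) = ⊥-elim (⊠≢0 {A v u} {A u x} (norm⇒≢0 nvu) ux≢0 (trans (sym (drop-zeroʳ (A v u ⊠ A u x) (A v x) xx)) (trans (sym (row x)) (full-sq f (v≢x ∘ sym)))))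
            by (inj₂ l) = l
          supp-x : two-support (A x) u v
          supp-x = proj₂ (hit (proj₂ (low-view u x full low-x xu≢0)) v u≢v (A-nonzero (norm⇒≢0 nvx)))
          vv : A v v ≡ 0ᵢ
          vv = supp v (u≢v ∘ sym) v≢x
          τ-data = minus-unit u v x nv nux
          τ : ℤ[i]
          τ = proj₁ τ-data
          τ≡ = proj₂ (proj₂ (proj₂ τ-data))
          r₂ : A u x ⊠ A x v ≡ ⊟ (A u u ⊠ A u v)
          r₂ = begin
            A u x ⊠ A x v                        ≡⟨ cong₂ _⊠_ (herm u x) (herm x v) ⟩
            conj (A x u) ⊠ conj (A v x)          ≡⟨ trans (Gi.*-comm (conj (A x u)) (conj (A v x))) (sym (conj-⊠ (A v x) (A x u))) ⟩
            conj (A v x ⊠ A x u)                 ≡⟨ cong conj (⊟-unique (A v u ⊠ A u u) (A v x ⊠ A x u) E₁) ⟩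
            ⊟ conj (A v u ⊠ A u u)               ≡⟨ cong ⊟_ (conj-⊠ (A v u) (A u u)) ⟩
            ⊟ (conj (A v u) ⊠ conj (A u u))      ≡⟨ cong ⊟_ (cong₂ _⊠_ (herm u v) (herm u u)) ⟨
            ⊟ (A u v ⊠ A u u)                    ≡⟨ cong ⊟_ (Gi.*-comm (A u v) (A u u)) ⟩
            ⊟ (A u u ⊠ A u v)                    ∎
            where open ≡-Reasoning
          by-charge : (∃[ l ] UnitCharge l × A u u ≡ l +i 0ℤ) → ⊥
          by-charge (l , charge , e) = low-eigenpair u v x τ l v≢x u≢v u≢x (proj₁ (proj₂ τ-data)) charge (proj₁ (proj₂ (proj₂ τ-data)))
            (λ w p q r → supp w p r) (λ w p q r → supp-x w p q)
            (trans (cong (_⊞ (τ ⊠ A v x)) vv) (trans (Gi.+-identityˡ (τ ⊠ A v x)) (trans (τ-relation u v x τ (A v x) nux τ≡ loop-x) e)))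
            (trans (drop-zeroʳ (A x v) τ xx) (trans (τ-relation′ u v x τ (A x v) nux τ≡ r₂) (cong (τ ⊠_) e)))
      by-view : FullView u v → ⊥
      by-view (heavy p k v≢p v≢k p≢k _ np nk rest) = locate (u Finₚ.≟ p) (u Finₚ.≟ k) (x Finₚ.≟ p) (x Finₚ.≟ k)
        where
        nux : norm (A u x) ≡ norm (A u u)
        nux = trans (norm-sym u x) (sym same)
        2≢1 : 2 ≢ 1
        2≢1 ()
        locate : Dec (u ≡ p) → Dec (u ≡ k) → Dec (x ≡ p) → Dec (x ≡ k) → ⊥
        locate (no p) (no q) _ _ = uu≢0 (rest u u≢v p q)
        locate _ _ (no p) (no q) = ux≢0 (rest x (v≢x ∘ sym) p q)
        locate (yes refl) _ (yes refl) _ = u≢x refl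
        locate (yes refl) _ (no _) (yes refl) = 2≢1 (trans (sym np) (trans (sym nux) nk))
        locate (no _) (yes refl) (yes refl) _ = 2≢1 (trans (sym np) (trans nux nk))
        locate (no _) (yes refl) (no _) (yes refl) = u≢x refl
      by-view (units a b c U) = locate (u Finₚ.≟ a) (u Finₚ.≟ b) (u Finₚ.≟ c)
        where
        second : ∀ b c → Units u v u b c → ⊥
        second b c U = by (x Finₚ.≟ b) (x Finₚ.≟ c)
          where
          by : Dec (x ≡ b) → Dec (x ≡ c) → ⊥
          by (yes e) _ = by-third c (subst (λ b → Units u v u b c) (sym e) U)
          by (no _) (yes e) = by-third b (swap-bc (subst (λ c → Units u v u b c) (sym e) U))
          by (no p) (no q) = ux≢0 (Units.rest U x (v≢x ∘ sym) (u≢x ∘ sym) p q)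
        locate : Dec (u ≡ a) → Dec (u ≡ b) → Dec (u ≡ c) → ⊥
        locate (yes e) _ _ = second b c (subst (λ a → Units u v a b c) (sym e) U)
        locate (no _) (yes e) _ = second a c (swap-ab (subst (λ b → Units u v a b c) (sym e) U))
        locate (no _) (no _) (yes e) = second a b (swap-ab (swap-bc (subst (λ c → Units u v a b c) (sym e) U)))
        locate (no p) (no q) (no r) = uu≢0 (Units.rest U u u≢v p q r)

    record Cfg (u v : Fin n) : Set where
      field
        x a b c : Fin n
        nbrs   : Units u v a b c
        uu     : A u u ≡ 0ᵢ
        full-a : Full a
        low-b  : Low b
        low-c  : Low c
        u≢x    : u ≢ x
        ux     : A u x ≡ 0ᵢ
        v≢x    : v ≢ x
        norm-x : norm (A v x) ≡ 1
        supp   : two-support (A v) u x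
        ax     : norm (A a x) ≡ 1
        bx     : A b x ≡ 0ᵢ
        cx     : A c x ≡ 0ᵢ

    square-cfg : ∀ u v x → Full u → Low v → norm (A u v) ≡ 1 → u ≢ v → v ≢ x → u ≢ x → norm (A v x) ≡ 1 → two-support (A v) u x → deg v ≡ 2 → A x u ≡ 0ᵢ → Cfg u v
    square-cfg u v x full low-v nv u≢v v≢x u≢x nvx supp dv xu = by-view (full-view u v full nv)
      where
      row : ∀ w → sq A v w ≡ (A v u ⊠ A u w) ⊞ (A v x ⊠ A x w)
      row w = two-sum (A v) u x u≢x supp (λ k → A k w)
      nvu : norm (A v u) ≡ 1
      nvu = norm-swap nv
      uu : A u u ≡ 0ᵢ
      uu = by (⊠-zero {A v u} {A u u} (trans (sym (drop-zeroʳ (A v u ⊠ A u u) (A v x) xu)) (trans (sym (row u)) (full-sq full u≢v))))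
        where
        by : A v u ≡ 0ᵢ ⊎ A u u ≡ 0ᵢ → A u u ≡ 0ᵢ
        by (inj₁ e) = ⊥-elim (norm⇒≢0 nvu e)
        by (inj₂ e) = e
      full-norm : ∀ k → v ≢ k → Full k → norm (A k x) ≡ norm (A u k)
      full-norm k v≢k f = trans (norm-sym k x) (trans (sym (norm-unit-⊠ (A v x) (A x k) nvx)) (trans (sym (sum-norms (A v u ⊠ A u k) (A v x ⊠ A x k) (trans (sym (row k)) (full-sq f (v≢k ∘ sym))))) (norm-unit-⊠ (A v u) (A u k) nvu)))
      b-norm : norm (A u v ⊠ A v x) ≡ 1
      b-norm = trans (norm-unit-⊠ (A u v) (A v x) nv) nvx
      ≢u : ∀ k → A u k ≢ 0ᵢ → k ≢ u
      ≢u k nz refl = nz uu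
      by-view : FullView u v → Cfg u v
      by-view (heavy p k v≢p v≢k p≢k _ np nk rest) = ⊥-elim (parallel-rows v u x nvu nvx u≢x supp dv full λ w → bound w (w Finₚ.≟ v) (w Finₚ.≟ p) (w Finₚ.≟ k))
        where
        full-p : Full p
        full-p = by (full-or-low p)
          where
          2≢1 : 2 ≢ 1
          2≢1 ()
          by : Full p ⊎ Low p → Full p
          by (inj₁ f) = f
          by (inj₂ l) = ⊥-elim (2≢1 (trans (sym (norm-swap np)) (proj₁ (low-view u p full l (A-nonzero (norm⇒≢0 np))))))
        npx : norm (A p x) ≡ 2
        npx = trans (full-norm p v≢p full-p) np
        total-x : (A u v ⊠ A v x) ⊞ ((A u p ⊠ A p x) ⊞ (A u k ⊠ A k x)) ≡ 0ᵢ
        total-x = trans (sym (trans (sum-over (A u) (v ∷ p ∷ k ∷ []) ((v≢p , v≢k , tt) , (p≢k , tt) , tt , tt) (λ w (p , q , r , _) → rest w p q r) (λ j → A j x))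
          (cong (λ z → (A u v ⊠ A v x) ⊞ ((A u p ⊠ A p x) ⊞ z)) (Gi.+-identityʳ (A u k ⊠ A k x))))) (full-sq′ full u≢x)
        kx≢0 : A k x ≢ 0ᵢ
        kx≢0 e = 1≢4 (trans (sym b-norm) (trans (sum-norms (A u v ⊠ A v x) (A u p ⊠ A p x) (trans (cong ((A u v ⊠ A v x) ⊞_) (sym (drop-zeroʳ (A u p ⊠ A p x) (A u k) e))) total-x))
          (trans (norm-* (A u p) (A p x)) (cong₂ ℕ._*_ np npx))))
          where
          1≢4 : 1 ≢ 4
          1≢4 ()
        bound : ∀ w → Dec (w ≡ v) → Dec (w ≡ p) → Dec (w ≡ k) → norm (A u w) ≤ norm (A x w)
        bound w (yes refl) _ _ = ≤-reflexive (trans nv (sym (norm-swap nvx)))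
        bound w (no _) (yes refl) _ = ≤-reflexive (trans np (sym (norm-swap npx)))
        bound w (no _) (no _) (yes refl) = ≤-trans (≤-reflexive nk) (norm≢0 (A-nonzero kx≢0))
        bound w (no p) (no q) (no r) = ≤-trans (≤-reflexive (norm-zero (rest w p q r))) z≤n
      by-view (units a b c U) = decide (status a (Units.v≢a U) (Units.norm-a U)) (status b (Units.v≢b U) (Units.norm-b U)) (status c (Units.v≢c U) (Units.norm-c U))
        where
        Status : Fin n → Set
        Status k = A k x ≡ 0ᵢ ⊎ norm (A k x) ≡ 1
        status : ∀ k → v ≢ k → norm (A u k) ≡ 1 → Status k
        status k v≢k nk = by (full-or-low k)
          where
          by′ : A k x ≡ 0ᵢ ⊎ (norm (A k x) ≡ 1 × two-support (A k) u x) → Status k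
          by′ (inj₁ e) = inj₁ e
          by′ (inj₂ (e , _)) = inj₂ e
          by : Full k ⊎ Low k → Status k
          by (inj₁ f) = inj₂ (trans (full-norm k v≢k f) nk)
          by (inj₂ l) = by′ (hit-or-miss (proj₂ (low-view u k full l (A-nonzero (norm⇒≢0 nk)))) x u≢x)
        bv : ℤ[i]
        bv = A u v ⊠ A v x
        bn : ∀ k → norm (A u k) ≡ 1 → norm (A k x) ≡ 1 → norm (A u k ⊠ A k x) ≡ 1
        bn k p q = trans (norm-unit-⊠ (A u k) (A k x) p) q
        one-hit : ∀ a b c → Units u v a b c → norm (A a x) ≡ 1 → A b x ≡ 0ᵢ → A c x ≡ 0ᵢ → Cfg u v
        one-hit a b c U na eb ec = record { x = x ; a = a ; b = b ; c = c ; nbrs = U ; uu = uu ; full-a = full-a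
            ; low-b = missed-low b v≢b norm-b eb ; low-c = missed-low c v≢c norm-c ec ; u≢x = u≢x ; ux = A-zero xu ; v≢x = v≢x ; norm-x = nvx ; supp = supp
            ; ax = na ; bx = eb ; cx = ec }
          where
          open Units U
          missed-low : ∀ k → v ≢ k → norm (A u k) ≡ 1 → A k x ≡ 0ᵢ → Low k
          missed-low k v≢k nk e = by (full-or-low k)
            where
            by : Full k ⊎ Low k → Low k
            by (inj₁ f) = ⊥-elim (norm⇒≢0 (trans (full-norm k v≢k f) nk) e)
            by (inj₂ l) = l
          relation : bv ⊞ (A u a ⊠ A a x) ≡ 0ᵢ
          relation = trans (cong (bv ⊞_) (sym (trans (cong ((A u a ⊠ A a x) ⊞_) (drop-zero (A u b) eb)) (drop-zeroʳ (A u a ⊠ A a x) (A u c) ec)))) (trans (sym (sum (λ j → A j x))) (full-sq′ full u≢x))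
          full-a : Full a
          full-a = by (full-or-low a)
            where
            by : Full a ⊎ Low a → Full a
            by (inj₁ f) = f
            by (inj₂ l) = ⊥-elim (cancel-at u v a x v≢a (u≢v ∘ sym) (≢u a (norm⇒≢0 norm-a)) uu nv norm-a supp
              (proj₂ (hit (proj₂ (low-view u a full l (A-nonzero (norm⇒≢0 norm-a)))) x u≢x (norm⇒≢0 na))) relation)
        two-hits : ∀ a b c → Units u v a b c → norm (A a x) ≡ 1 → norm (A b x) ≡ 1 → A c x ≡ 0ᵢ → ⊥
        two-hits a b c U na nb ec = three-units bv (A u a ⊠ A a x) (A u b ⊠ A b x) b-norm (bn a norm-a na) (bn b norm-b nb)
            (trans (cong (λ z → bv ⊞ ((A u a ⊠ A a x) ⊞ z)) (sym (drop-zeroʳ (A u b ⊠ A b x) (A u c) ec))) (trans (sym (sum (λ j → A j x))) (full-sq′ full u≢x)))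
          where open Units U
        decide : Status a → Status b → Status c → Cfg u v
        decide (inj₁ ea) (inj₁ eb) (inj₁ ec) = ⊥-elim (norm⇒≢0 b-norm (trans (sym (trans (sum (λ j → A j x)) (trans (cong (bv ⊞_) (trans (drop-zero (A u a) ea) (trans (drop-zero (A u b) eb) (trans (cong (A u c ⊠_) ec) (Gi.zeroʳ (A u c)))))) (Gi.+-identityʳ bv)))) (full-sq′ full u≢x)))
          where open Units U
        decide (inj₂ na) (inj₁ eb) (inj₁ ec) = one-hit a b c U na eb ec
        decide (inj₁ ea) (inj₂ nb) (inj₁ ec) = one-hit b a c (swap-ab U) nb ea ec
        decide (inj₁ ea) (inj₁ eb) (inj₂ nc) = one-hit c a b (swap-ab (swap-bc U)) nc ea eb
        decide (inj₂ na) (inj₂ nb) (inj₁ ec) = ⊥-elim (two-hits a b c U na nb ec)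
        decide (inj₂ na) (inj₁ eb) (inj₂ nc) = ⊥-elim (two-hits a c b (swap-bc U) na nc eb)
        decide (inj₁ ea) (inj₂ nb) (inj₂ nc) = ⊥-elim (two-hits b c a (swap-bc (swap-ab U)) nb nc ea)
        decide (inj₂ na) (inj₂ nb) (inj₂ nc) = ⊥-elim (parallel-rows v u x nvu nvx u≢x supp dv full λ w → bound w (w Finₚ.≟ v) (w Finₚ.≟ a) (w Finₚ.≟ b) (w Finₚ.≟ c))
          where
          open Units U
          bound : ∀ w → Dec (w ≡ v) → Dec (w ≡ a) → Dec (w ≡ b) → Dec (w ≡ c) → norm (A u w) ≤ norm (A x w)
          bound w (yes refl) _ _ _ = ≤-reflexive (trans nv (sym (norm-swap nvx)))
          bound w (no _) (yes refl) _ _ = ≤-reflexive (trans norm-a (sym (norm-swap na)))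
          bound w (no _) (no _) (yes refl) _ = ≤-reflexive (trans norm-b (sym (norm-swap nb)))
          bound w (no _) (no _) (no _) (yes refl) = ≤-reflexive (trans norm-c (sym (norm-swap nc)))
          bound w (no p) (no q) (no r) (no s) = ≤-trans (≤-reflexive (norm-zero (rest w p q r s))) z≤n

    configuration : ∀ u v → Full u → Low v → A u v ≢ 0ᵢ → Cfg u v
    configuration u v full low nz = by-view (proj₂ lv)
      where
      lv = low-view u v full low (A-nonzero nz)
      nv : norm (A u v) ≡ 1
      nv = norm-swap (proj₁ lv)
      u≢v = full≢low full low
      by-view : LowView v u → Cfg u v
      by-view (leaf z) = ⊥-elim (leaf-absurd u v full low nv z)
      by-view (two x u≢x nx supp dv) = by-loop (v Finₚ.≟ x)
        where
        by-chord : v ≢ x → Dec (A x u ≡ 0ᵢ) → Cfg u v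
        by-chord v≢x (yes e)  = square-cfg u v x full low nv u≢v v≢x u≢x nx supp dv e
        by-chord v≢x (no ne) = ⊥-elim (triangle-absurd u v x full nv u≢v v≢x u≢x nx supp dv ne)
        by-loop : Dec (v ≡ x) → Cfg u v
        by-loop (yes e) = ⊥-elim (charged-absurd u v full nv (subst (λ x → norm (A v x) ≡ 1) (sym e) nx) u≢v (subst (two-support (A v) u) (sym e) supp))
        by-loop (no v≢x) = by-chord v≢x (A x u ≟ᵢ 0ᵢ)

module TwinVertices where
  open InnerProduct
  open GaussianIntegers
  open BorderedMatrices
  open GaussianNorms
  open UnextendableMatrices
  open ParityArguments
  open DegreeTwo
  open LowDegreeVertices
  open LowNeighbours
  open MixedNeighbours
  open import Data.Integer.Base using (+_; -[1+_]; 0ℤ; 1ℤ; +≤+)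
  open import Data.Integer.Tactic.RingSolver using (solve-∀)
  open import Data.Nat.Base using (_≤_)
  open import Data.Nat.Properties using (≤-trans; ≤-reflexive; ≤-refl)
  open import Relation.Binary.Construct.Closure.ReflexiveTransitive using (Star; ε; _◅_)
  open Zi using (B; B-cong; B-comm; B-⊕ʳ; B-⊕ˡ; dot; _∙_; _⊕_; _⊙_; ∙-cong; ∙-⊕; self-adjoint; single; B-single; ∙-single; single-self; single-other)

  Σ-nonneg : ∀ {m} (f : Fin m → ℤ) → (∀ k → 0ℤ ℤ.≤ f k) → 0ℤ ℤ.≤ Σℤ.sum f
  Σ-nonneg {zero}  f p = ℤₚ.≤-refl
  Σ-nonneg {suc m} f p = ℤₚ.+-mono-≤ (p zero) (Σ-nonneg (f ∘ suc) (p ∘ suc))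

  term≤Σ : ∀ {m} (f : Fin m → ℤ) → (∀ k → 0ℤ ℤ.≤ f k) → ∀ k → f k ℤ.≤ Σℤ.sum f
  term≤Σ {suc m} f p zero = subst (ℤ._≤ f zero ℤ.+ Σℤ.sum (f ∘ suc)) (ℤₚ.+-identityʳ (f zero)) (ℤₚ.+-monoʳ-≤ (f zero) (Σ-nonneg (f ∘ suc) (p ∘ suc)))
  term≤Σ {suc m} f p (suc k) = ℤₚ.≤-trans (term≤Σ (f ∘ suc) (p ∘ suc) k) (subst (ℤ._≤ f zero ℤ.+ Σℤ.sum (f ∘ suc)) (ℤₚ.+-identityˡ (Σℤ.sum (f ∘ suc))) (ℤₚ.+-monoˡ-≤ (Σℤ.sum (f ∘ suc)) (p zero)))

  Core-⊖ : ∀ {n} {A : Matrix n} → Core A → Core (⊖M A)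
  Core-⊖ {n} {A} core = record
    { herm  = Hermitian-⊖ herm
    ; conn  = λ u v → path (conn u v)
    ; psd±  = psd⇒psd± {A = ⊖M A} (psd±⇒psd⊖ {A = A} psd±) (Psd-cong {A = A} (λ u v → sym (⊖M-⊖M A u v)) (psd±⇒psd {A = A} psd±))
    ; noext = λ c d u cu p → noext (⊖ c) (ℤ.- d) u (λ e → cu (⊟-zero (c u) e))
        (psd⇒psd± {A = border A (⊖ c) (ℤ.- d)}
          (Psd-cong {A = ⊖M (border (⊖M A) c d)} (flip c d) (psd±⇒psd⊖ {A = border (⊖M A) c d} p))
          (Psd-cong {A = border (⊖M A) c d} (flip′ c d) (psd±⇒psd {A = border (⊖M A) c d} p)))
    }
    where
    open Core core
    ⊟-zero : ∀ z → ⊟ z ≡ 0ᵢ → z ≡ 0ᵢ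
    ⊟-zero (a +i b) e = cong₂ _+i_ (ℤₚ.neg-injective (cong re e)) (ℤₚ.neg-injective (cong im e))
    path : ∀ {u v} → Star (Adjacent A) u v → Star (Adjacent (⊖M A)) u v
    path ε = ε
    path {u} ((ne , nz) ◅ p) = (ne , λ e → nz (⊟-zero _ e)) ◅ path p
    flip : ∀ c d → ⊖M (border (⊖M A) c d) ≐ border A (⊖ c) (ℤ.- d)
    flip c d zero    zero    = refl
    flip c d zero    (suc v) = refl
    flip c d (suc u) zero    = refl
    flip c d (suc u) (suc v) = ⊟-involutive (A u v)
    flip′ : ∀ c d → border (⊖M A) c d ≐ ⊖M (border A (⊖ c) (ℤ.- d))
    flip′ c d zero    zero    = cong (_+i 0ℤ) (sym (ℤₚ.neg-involutive d))
    flip′ c d zero    (suc v) = sym (⊟-involutive (conj (c v)))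
    flip′ c d (suc u) zero    = sym (⊟-involutive (c u))
    flip′ c d (suc u) (suc v) = refl

  -- If all vertices have degree at most 2, then 4|z|² - 2⟨z, Az⟩ is bounded below by the sum of
  -- |A_uk|²(|z_u|² + |z_k|²) - 2 Re(z̄_u A_uk z_k) over all u, k, whose terms are nonnegative.
  module _ {n} (A : Matrix n) (herm : Hermitian A) (low : ∀ u → total (A u) ≤ 2) (a : Fin n) (charge : A a a ≡ -[1+ 0 ] +i 0ℤ) where
    private
      edge : ∀ x y c → 0ℤ ℤ.≤ nrm c ℤ.* (nrm x ℤ.+ nrm y) ℤ.- + 2 ℤ.* dot x (c ⊠ y)
      edge x y c = by (c ≟ᵢ 0ᵢ)
        where
        zero-case : ∀ a b p q → 0ℤ ℤ.* ((a ℤ.* a ℤ.+ b ℤ.* b) ℤ.+ (p ℤ.* p ℤ.+ q ℤ.* q)) ℤ.- + 2 ℤ.* (a ℤ.* (0ℤ ℤ.* p ℤ.+ ℤ.- (0ℤ ℤ.* q)) ℤ.+ b ℤ.* (0ℤ ℤ.* q ℤ.+ 0ℤ ℤ.* p)) ≡ 0ℤ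
        zero-case = solve-∀
        lem : ∀ a b p q s t → (s ℤ.* s ℤ.+ t ℤ.* t) ℤ.* ((a ℤ.* a ℤ.+ b ℤ.* b) ℤ.+ (p ℤ.* p ℤ.+ q ℤ.* q)) ℤ.- + 2 ℤ.* (a ℤ.* (s ℤ.* p ℤ.+ ℤ.- (t ℤ.* q)) ℤ.+ b ℤ.* (s ℤ.* q ℤ.+ t ℤ.* p)) ≡
          ((a ℤ.- (s ℤ.* p ℤ.+ ℤ.- (t ℤ.* q))) ℤ.* (a ℤ.- (s ℤ.* p ℤ.+ ℤ.- (t ℤ.* q))) ℤ.+ (b ℤ.- (s ℤ.* q ℤ.+ t ℤ.* p)) ℤ.* (b ℤ.- (s ℤ.* q ℤ.+ t ℤ.* p))) ℤ.+ ((s ℤ.* s ℤ.+ t ℤ.* t) ℤ.- 1ℤ) ℤ.* (a ℤ.* a ℤ.+ b ℤ.* b)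
        lem = solve-∀
        by : Dec (c ≡ 0ᵢ) → 0ℤ ℤ.≤ nrm c ℤ.* (nrm x ℤ.+ nrm y) ℤ.- + 2 ℤ.* dot x (c ⊠ y)
        by (yes e) = ℤₚ.≤-reflexive (sym (trans (cong (λ c → nrm c ℤ.* (nrm x ℤ.+ nrm y) ℤ.- + 2 ℤ.* dot x (c ⊠ y)) e) (zero-case (re x) (im x) (re y) (im y))))
        by (no ne) = subst (0ℤ ℤ.≤_) (sym (lem (re x) (im x) (re y) (im y) (re c) (im c))) (ℤₚ.+-mono-≤ (0≤nrm (x ⊞ ⊟ (c ⊠ y)))
          (0≤* (ℤₚ.i≤j⇒0≤j-i (subst (1ℤ ℤ.≤_) (sym (nrm≡norm c)) (+≤+ (norm≢0 ne)))) (0≤nrm x)))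

      nrm-sym : ∀ u k → nrm (A u k) ≡ nrm (A k u)
      nrm-sym u k = trans (nrm≡norm (A u k)) (trans (cong +_ (trans (cong norm (herm u k)) (norm-conj (A k u)))) (sym (nrm≡norm (A k u))))

      degree-sum : ∀ u → Σℤ.sum (λ k → nrm (A u k)) ≡ + total (A u)
      degree-sum u = trans refl (B-self (A u))

    low-form : ∀ z → 0ℤ ℤ.≤ (+ 2 ℤ.* B z z ℤ.- B z (A ∙ z)) ℤ.- + 2 ℤ.* nrm (z a)
    low-form z = cancel-factor {+ 2} (ℤ.+<+ (s≤s z≤n)) (subst (0ℤ ℤ.≤_) final (ℤₚ.+-mono-≤ (ℤₚ.i≤j⇒0≤j-i at-a) (ℤₚ.i≤j⇒0≤j-i degrees)))
      where
      p q f : Fin n → Fin n → ℤ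
      p u k = nrm (A u k) ℤ.* nrm (z u)
      q u k = dot (z u) (A u k ⊠ z k)
      f u k = nrm (A u k) ℤ.* (nrm (z u) ℤ.+ nrm (z k)) ℤ.- + 2 ℤ.* q u k
      total-f : ℤ
      total-f = Σℤ.sum λ u → Σℤ.sum (f u)
      D : ℤ
      D = Σℤ.sum λ u → Σℤ.sum (p u)
      f-split : ∀ u k → f u k ≡ (p u k ℤ.+ p k u) ℤ.+ (ℤ.- (+ 2)) ℤ.* q u k
      f-split u k = trans (lem (nrm (A u k)) (nrm (z u)) (nrm (z k)) (q u k)) (cong (λ m → (p u k ℤ.+ m ℤ.* nrm (z k)) ℤ.+ (ℤ.- (+ 2)) ℤ.* q u k) (nrm-sym u k))
        where
        lem : ∀ c x y q → c ℤ.* (x ℤ.+ y) ℤ.- + 2 ℤ.* q ≡ (c ℤ.* x ℤ.+ c ℤ.* y) ℤ.+ (ℤ.- (+ 2)) ℤ.* q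
        lem = solve-∀
      Bz : Σℤ.sum (λ u → Σℤ.sum (q u)) ≡ B z (A ∙ z)
      Bz = Σℤ.sum-cong-≗ λ u → sym (Zi.dot-sumʳ (z u) (λ k → A u k ⊠ z k))
      f-total : total-f ≡ (D ℤ.+ D) ℤ.+ (ℤ.- (+ 2)) ℤ.* B z (A ∙ z)
      f-total = begin
        total-f
          ≡⟨ Σℤ.sum-cong-≗ (λ u → trans (Σℤ.sum-cong-≗ (f-split u)) (trans (Σℤ.∑-distrib-+ (λ k → p u k ℤ.+ p k u) (λ k → (ℤ.- (+ 2)) ℤ.* q u k))
               (cong₂ ℤ._+_ (Σℤ.∑-distrib-+ (p u) (λ k → p k u)) (sym (Σℤ.*-distribˡ-sum (ℤ.- (+ 2)) (q u)))))) ⟩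
        Σℤ.sum (λ u → (Σℤ.sum (p u) ℤ.+ Σℤ.sum (λ k → p k u)) ℤ.+ (ℤ.- (+ 2)) ℤ.* Σℤ.sum (q u))
          ≡⟨ Σℤ.∑-distrib-+ (λ u → Σℤ.sum (p u) ℤ.+ Σℤ.sum (λ k → p k u)) (λ u → (ℤ.- (+ 2)) ℤ.* Σℤ.sum (q u)) ⟩
        Σℤ.sum (λ u → Σℤ.sum (p u) ℤ.+ Σℤ.sum (λ k → p k u)) ℤ.+ Σℤ.sum (λ u → (ℤ.- (+ 2)) ℤ.* Σℤ.sum (q u))
          ≡⟨ cong₂ ℤ._+_ (trans (Σℤ.∑-distrib-+ (λ u → Σℤ.sum (p u)) (λ u → Σℤ.sum λ k → p k u)) (cong (λ t → D ℤ.+ t) (Σℤ.∑-comm (λ u k → p k u))))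
               (trans (sym (Σℤ.*-distribˡ-sum (ℤ.- (+ 2)) (λ u → Σℤ.sum (q u)))) (cong ((ℤ.- (+ 2)) ℤ.*_) Bz)) ⟩
        (D ℤ.+ D) ℤ.+ (ℤ.- (+ 2)) ℤ.* B z (A ∙ z) ∎
        where open ≡-Reasoning
      0≤f : ∀ u k → 0ℤ ℤ.≤ f u k
      0≤f u k = edge (z u) (z k) (A u k)
      at-a : + 4 ℤ.* nrm (z a) ℤ.≤ total-f
      at-a = ℤₚ.≤-trans (ℤₚ.≤-reflexive (sym faa)) (ℤₚ.≤-trans (term≤Σ (f a) (0≤f a) a) (term≤Σ (λ u → Σℤ.sum (f u)) (λ u → Σ-nonneg (f u) (0≤f u)) a))
        where
        lem : ∀ x y → 1ℤ ℤ.* ((x ℤ.* x ℤ.+ y ℤ.* y) ℤ.+ (x ℤ.* x ℤ.+ y ℤ.* y)) ℤ.- + 2 ℤ.* (x ℤ.* (-[1+ 0 ] ℤ.* x ℤ.+ ℤ.- (0ℤ ℤ.* y)) ℤ.+ y ℤ.* (-[1+ 0 ] ℤ.* y ℤ.+ 0ℤ ℤ.* x)) ≡ + 4 ℤ.* (x ℤ.* x ℤ.+ y ℤ.* y)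
        lem = solve-∀
        faa : f a a ≡ + 4 ℤ.* nrm (z a)
        faa = trans (cong (λ c → nrm c ℤ.* (nrm (z a) ℤ.+ nrm (z a)) ℤ.- + 2 ℤ.* dot (z a) (c ⊠ z a)) charge) (lem (re (z a)) (im (z a)))
      degrees : D ℤ.+ D ℤ.≤ + 4 ℤ.* B z z
      degrees = subst (D ℤ.+ D ℤ.≤_) (trans (sym (ℤₚ.*-distribʳ-+ (B z z) (+ 2) (+ 2))) refl) (ℤₚ.+-mono-≤ D≤ D≤)
        where
        per-row : ∀ u → Σℤ.sum (p u) ≡ + total (A u) ℤ.* nrm (z u)
        per-row u = trans (sym (Σℤ.*-distribʳ-sum (nrm (z u)) (λ k → nrm (A u k)))) (cong (ℤ._* nrm (z u)) (degree-sum u))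
        Σ-mono : ∀ {m} {g h : Fin m → ℤ} → (∀ k → g k ℤ.≤ h k) → Σℤ.sum g ℤ.≤ Σℤ.sum h
        Σ-mono {zero}  _ = ℤₚ.≤-refl
        Σ-mono {suc m} p = ℤₚ.+-mono-≤ (p zero) (Σ-mono (p ∘ suc))
        D≤ : D ℤ.≤ + 2 ℤ.* B z z
        D≤ = subst (D ℤ.≤_) (sym (Σℤ.*-distribˡ-sum (+ 2) (λ u → nrm (z u))))
          (Σ-mono {n} {λ u → Σℤ.sum (p u)} {λ u → + 2 ℤ.* nrm (z u)} λ u → subst (ℤ._≤ + 2 ℤ.* nrm (z u)) (sym (per-row u)) (ℤₚ.*-monoʳ-≤-nonNeg (nrm (z u)) {{ℤ.nonNegative (0≤nrm (z u))}} (+≤+ (low u))))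
      final : (total-f ℤ.- + 4 ℤ.* nrm (z a)) ℤ.+ (+ 4 ℤ.* B z z ℤ.- (D ℤ.+ D)) ≡ + 2 ℤ.* ((+ 2 ℤ.* B z z ℤ.- B z (A ∙ z)) ℤ.- + 2 ℤ.* nrm (z a))
      final = trans (cong (λ t → (t ℤ.- + 4 ℤ.* nrm (z a)) ℤ.+ (+ 4 ℤ.* B z z ℤ.- (D ℤ.+ D))) f-total) (lem D (B z z) (B z (A ∙ z)) (nrm (z a)))
        where
        lem : ∀ d b h z → (((d ℤ.+ d) ℤ.+ (ℤ.- (+ 2)) ℤ.* h) ℤ.- + 4 ℤ.* z) ℤ.+ (+ 4 ℤ.* b ℤ.- (d ℤ.+ d)) ≡ + 2 ℤ.* ((+ 2 ℤ.* b ℤ.- h) ℤ.- + 2 ℤ.* z)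
        lem = solve-∀

    -- Doubling the charged vertex a.
    twin : Vecℤ n
    twin = (λ w → A w a) ⊕ single a (+ 2 +i 0ℤ)

    psd±-twin : Psd± A → Psd± (border A twin -[1+ 0 ])
    psd±-twin psd x′ = subst (0ℤ ℤ.≤_) plus (proj₁ (psd z)) , subst (0ℤ ℤ.≤_) minus (ℤₚ.+-mono-≤ (low-form z) (0≤* {+ 2} (+≤+ z≤n) (0≤nrm (x a ⊞ ⊟ t))))
      where
      open ≡-Reasoning
      t = x′ zero
      x = x′ ∘ suc
      T z : Vecℤ n
      T = single a t
      z = x ⊕ T
      X S : ℤ
      X = dot (x a) t
      S = B x (λ u → A u a ⊠ t)
      BxT : B x T ≡ X
      BxT = trans (B-comm x T) (trans (B-single a t x) (Zi.dot-comm t (x a)))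
      AT : A ∙ T ≗ λ u → A u a ⊠ t
      AT = ∙-single A a t
      BTT : B T T ≡ nrm t
      BTT = trans (B-single a t T) (cong (dot t) (single-self a t))
      BTAT : B T (A ∙ T) ≡ ℤ.- nrm t
      BTAT = trans (B-single a t (A ∙ T)) (trans (cong (dot t) (trans (AT a) (cong (_⊠ t) charge))) (lem (re t) (im t)))
        where
        lem : ∀ p q → p ℤ.* (-[1+ 0 ] ℤ.* p ℤ.+ ℤ.- (0ℤ ℤ.* q)) ℤ.+ q ℤ.* (-[1+ 0 ] ℤ.* q ℤ.+ 0ℤ ℤ.* p) ≡ ℤ.- (p ℤ.* p ℤ.+ q ℤ.* q)
        lem = solve-∀
      BxAT : B x (A ∙ T) ≡ S
      BxAT = B-cong {x = x} (λ _ → refl) AT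
      Bzz : B z z ≡ B x x ℤ.+ + 2 ℤ.* X ℤ.+ nrm t
      Bzz = begin
        B z z                                           ≡⟨ trans (B-⊕ˡ x T z) (cong₂ ℤ._+_ (B-⊕ʳ x x T) (B-⊕ʳ T x T)) ⟩
        (B x x ℤ.+ B x T) ℤ.+ (B T x ℤ.+ B T T)         ≡⟨ cong₂ (λ i j → (B x x ℤ.+ i) ℤ.+ j) BxT (cong₂ ℤ._+_ (trans (B-comm T x) BxT) BTT) ⟩
        (B x x ℤ.+ X) ℤ.+ (X ℤ.+ nrm t)                 ≡⟨ lem (B x x) X (nrm t) ⟩
        B x x ℤ.+ + 2 ℤ.* X ℤ.+ nrm t                   ∎
        where
        lem : ∀ a b c → (a ℤ.+ b) ℤ.+ (b ℤ.+ c) ≡ a ℤ.+ + 2 ℤ.* b ℤ.+ c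
        lem = solve-∀
      BzAz : B z (A ∙ z) ≡ B x (A ∙ x) ℤ.+ + 2 ℤ.* S ℤ.- nrm t
      BzAz = begin
        B z (A ∙ z)
          ≡⟨ trans (B-cong {x = z} (λ _ → refl) (∙-⊕ A x T)) (trans (B-⊕ˡ x T (A ∙ x ⊕ A ∙ T)) (cong₂ ℤ._+_ (B-⊕ʳ x (A ∙ x) (A ∙ T)) (B-⊕ʳ T (A ∙ x) (A ∙ T)))) ⟩
        (B x (A ∙ x) ℤ.+ B x (A ∙ T)) ℤ.+ (B T (A ∙ x) ℤ.+ B T (A ∙ T))
          ≡⟨ cong₂ (λ i j → (B x (A ∙ x) ℤ.+ i) ℤ.+ j) BxAT (cong₂ ℤ._+_ (trans (self-adjoint A herm T x) (trans (B-comm (A ∙ T) x) BxAT)) BTAT) ⟩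
        (B x (A ∙ x) ℤ.+ S) ℤ.+ (S ℤ.+ ℤ.- nrm t)
          ≡⟨ lem (B x (A ∙ x)) S (nrm t) ⟩
        B x (A ∙ x) ℤ.+ + 2 ℤ.* S ℤ.- nrm t ∎
        where
        lem : ∀ a b c → (a ℤ.+ b) ℤ.+ (b ℤ.+ ℤ.- c) ≡ a ℤ.+ + 2 ℤ.* b ℤ.- c
        lem = solve-∀
      B-twin : B x (λ u → twin u ⊠ t) ≡ S ℤ.+ + 2 ℤ.* X
      B-twin = begin
        B x (λ u → twin u ⊠ t)
          ≡⟨ B-cong {x = x} (λ _ → refl) (λ u → Gi.distribʳ t (A u a) (single a (+ 2 +i 0ℤ) u)) ⟩
        B x ((λ u → A u a ⊠ t) ⊕ (λ u → single a (+ 2 +i 0ℤ) u ⊠ t))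
          ≡⟨ B-⊕ʳ x (λ u → A u a ⊠ t) (λ u → single a (+ 2 +i 0ℤ) u ⊠ t) ⟩
        S ℤ.+ B x (λ u → single a (+ 2 +i 0ℤ) u ⊠ t)
          ≡⟨ cong (λ s → S ℤ.+ s) (trans (B-cong {x = x} (λ _ → refl) two-T) (trans (B-⊕ʳ x T T) (trans (cong₂ ℤ._+_ BxT BxT) (lem X)))) ⟩
        S ℤ.+ + 2 ℤ.* X ∎
        where
        lem : ∀ a → a ℤ.+ a ≡ + 2 ℤ.* a
        lem = solve-∀
        two-T : ∀ u → single a (+ 2 +i 0ℤ) u ⊠ t ≡ (T ⊕ T) u
        two-T u = by (a Finₚ.≟ u)
          where
          d : ∀ p q → + 2 ℤ.* p ℤ.+ ℤ.- (0ℤ ℤ.* q) ≡ p ℤ.+ p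
          d = solve-∀
          d′ : ∀ p q → + 2 ℤ.* q ℤ.+ 0ℤ ℤ.* p ≡ q ℤ.+ q
          d′ = solve-∀
          by : Dec (a ≡ u) → single a (+ 2 +i 0ℤ) u ⊠ t ≡ (T ⊕ T) u
          by (yes refl) = trans (cong (_⊠ t) (single-self a (+ 2 +i 0ℤ))) (trans (cong₂ _+i_ (d (re t) (im t)) (d′ (re t) (im t))) (sym (cong₂ _⊞_ (single-self a t) (single-self a t))))
          by (no ne) = trans (cong (_⊠ t) (single-other a u (+ 2 +i 0ℤ) ne)) (trans (Gi.zeroˡ t) (sym (cong₂ _⊞_ (single-other a u t ne) (single-other a u t ne))))
      form : B x′ (border A twin -[1+ 0 ] ∙ x′) ≡ (-[1+ 0 ] ℤ.* nrm t ℤ.+ + 2 ℤ.* (S ℤ.+ + 2 ℤ.* X)) ℤ.+ B x (A ∙ x)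
      form = trans (form-border A twin -[1+ 0 ] t x x′ refl (λ _ → refl)) (cong (λ s → (-[1+ 0 ] ℤ.* nrm t ℤ.+ + 2 ℤ.* s) ℤ.+ B x (A ∙ x)) B-twin)
      plus : + 2 ℤ.* B z z ℤ.+ B z (A ∙ z) ≡ + 2 ℤ.* (nrm t ℤ.+ B x x) ℤ.+ B x′ (border A twin -[1+ 0 ] ∙ x′)
      plus = trans (cong₂ (λ i j → + 2 ℤ.* i ℤ.+ j) Bzz BzAz) (trans (lem (B x x) X (nrm t) (B x (A ∙ x)) S) (cong (λ s → + 2 ℤ.* (nrm t ℤ.+ B x x) ℤ.+ s) (sym form)))
        where
        lem : ∀ a x t h s → + 2 ℤ.* (a ℤ.+ + 2 ℤ.* x ℤ.+ t) ℤ.+ (h ℤ.+ + 2 ℤ.* s ℤ.- t) ≡ + 2 ℤ.* (t ℤ.+ a) ℤ.+ ((-[1+ 0 ] ℤ.* t ℤ.+ + 2 ℤ.* (s ℤ.+ + 2 ℤ.* x)) ℤ.+ h)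
        lem = solve-∀
      za : nrm (z a) ≡ nrm (x a) ℤ.+ + 2 ℤ.* X ℤ.+ nrm t
      za = trans (cong (λ w → nrm (x a ⊞ w)) (single-self a t)) (lem (re (x a)) (im (x a)) (re t) (im t))
        where
        lem : ∀ a b p q → (a ℤ.+ p) ℤ.* (a ℤ.+ p) ℤ.+ (b ℤ.+ q) ℤ.* (b ℤ.+ q) ≡ (a ℤ.* a ℤ.+ b ℤ.* b) ℤ.+ + 2 ℤ.* (a ℤ.* p ℤ.+ b ℤ.* q) ℤ.+ (p ℤ.* p ℤ.+ q ℤ.* q)
        lem = solve-∀
      x-t : nrm (x a ⊞ ⊟ t) ≡ nrm (x a) ℤ.- + 2 ℤ.* X ℤ.+ nrm t
      x-t = lem (re (x a)) (im (x a)) (re t) (im t)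
        where
        lem : ∀ a b p q → (a ℤ.+ ℤ.- p) ℤ.* (a ℤ.+ ℤ.- p) ℤ.+ (b ℤ.+ ℤ.- q) ℤ.* (b ℤ.+ ℤ.- q) ≡ (a ℤ.* a ℤ.+ b ℤ.* b) ℤ.- + 2 ℤ.* (a ℤ.* p ℤ.+ b ℤ.* q) ℤ.+ (p ℤ.* p ℤ.+ q ℤ.* q)
        lem = solve-∀
      minus : ((+ 2 ℤ.* B z z ℤ.- B z (A ∙ z)) ℤ.- + 2 ℤ.* nrm (z a)) ℤ.+ + 2 ℤ.* nrm (x a ⊞ ⊟ t) ≡ + 2 ℤ.* (nrm t ℤ.+ B x x) ℤ.- B x′ (border A twin -[1+ 0 ] ∙ x′)
      minus = trans (cong₂ ℤ._+_ (cong₂ ℤ._-_ (cong₂ (λ i j → + 2 ℤ.* i ℤ.- j) Bzz BzAz) (cong (+ 2 ℤ.*_) za)) (cong (+ 2 ℤ.*_) x-t))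
        (trans (lem (B x x) X (nrm t) (B x (A ∙ x)) S (nrm (x a))) (cong (λ s → + 2 ℤ.* (nrm t ℤ.+ B x x) ℤ.- s) (sym form)))
        where
        lem : ∀ a x t h s m → ((+ 2 ℤ.* (a ℤ.+ + 2 ℤ.* x ℤ.+ t) ℤ.- (h ℤ.+ + 2 ℤ.* s ℤ.- t)) ℤ.- + 2 ℤ.* (m ℤ.+ + 2 ℤ.* x ℤ.+ t)) ℤ.+ + 2 ℤ.* (m ℤ.- + 2 ℤ.* x ℤ.+ t) ≡
          + 2 ℤ.* (t ℤ.+ a) ℤ.- ((-[1+ 0 ] ℤ.* t ℤ.+ + 2 ℤ.* (s ℤ.+ + 2 ℤ.* x)) ℤ.+ h)
        lem = solve-∀

    twin-nonzero : twin a ≢ 0ᵢ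
    twin-nonzero e = one≢0 (trans (sym (cong₂ _⊞_ charge (single-self a (+ 2 +i 0ℤ)))) e)
      where
      one≢0 : +1ᵢ ≢ 0ᵢ
      one≢0 ()

module EqualDegrees where
  open BorderedMatrices
  open GaussianNorms
  open UnextendableMatrices
  open ParityArguments
  open DegreeTwo
  open LowDegreeVertices
  open LowNeighbours
  open MixedNeighbours
  open TwinVertices
  open import Data.Integer.Base using (+_; -[1+_]; 0ℤ)
  open import Data.Nat.Base using (_≤_)
  open import Data.Nat.Properties using (≤-trans; ≤-reflexive; m≤m+n)
  open import Relation.Binary.Construct.Closure.ReflexiveTransitive using (Star; ε; _◅_)

  module AllFull {n} {A : Matrix n} (core : Core A) where
    open Core core
    open Mixed core public

    -- The vertices satisfying Reach turn out to form a connected component without charges.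
    Good : Fin n → Set
    Good u = Full u × ∃[ v ] Low v × A u v ≢ 0ᵢ

    data Reach (w : Fin n) : Set where
      good : Good w → Reach w
      low  : ∀ u → Good u → A u w ≢ 0ᵢ → Low w → Reach w
      hub  : ∀ u → Good u → A u w ≢ 0ᵢ → Full w → Reach w

    private
      module C {u v} (cfg : Cfg u v) where
        open Cfg cfg public
        open Units nbrs public

      hub-joins : ∀ {u v} (full : Full u) (low-v : Low v) (cfg : Cfg u v) → ∀ k → Low k → A u k ≢ 0ᵢ →
        ∃[ x ] u ≢ x × k ≢ x × norm (A k x) ≡ 1 × two-support (A k) u x × norm (A (Cfg.a cfg) x) ≡ 1 × A u x ≡ 0ᵢ
      hub-joins {u} {v} full low-v cfg k low-k nz = x , u≢x , v≢x , norm-x , supp , subst (λ a → norm (A a x) ≡ 1) same-hub ax , ux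
        where
        cfg′ : Cfg u k
        cfg′ = configuration u k full low-k nz
        open C cfg′
        same-hub : a ≡ Cfg.a cfg
        same-hub = by (a Finₚ.≟ v) (a Finₚ.≟ Cfg.a cfg) (a Finₚ.≟ Cfg.b cfg) (a Finₚ.≟ Cfg.c cfg)
          where
          by : Dec (a ≡ v) → Dec (a ≡ Cfg.a cfg) → Dec (a ≡ Cfg.b cfg) → Dec (a ≡ Cfg.c cfg) → a ≡ Cfg.a cfg
          by (yes e) _ _ _ = ⊥-elim (full≢low full-a low-v e)
          by (no _) (yes e) _ _ = e
          by (no _) (no _) (yes e) _ = ⊥-elim (full≢low full-a (Cfg.low-b cfg) e)
          by (no _) (no _) (no _) (yes e) = ⊥-elim (full≢low full-a (Cfg.low-c cfg) e)
          by (no p) (no q) (no r) (no s) = ⊥-elim (norm⇒≢0 norm-a (Units.rest (Cfg.nbrs cfg) a p q r s))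

      low-uncharged : ∀ {u k} → Good u → Low k → A u k ≢ 0ᵢ → A k k ≡ 0ᵢ
      low-uncharged {u} {k} (full , _) low-k nz = supp k (λ e → full≢low full low-k (sym e)) v≢x
        where open C (configuration u k full low-k nz)

      full-is-hub : ∀ {u v w} → Full u → Low v → (cfg : Cfg u v) → Full w → A u w ≢ 0ᵢ → w ≡ Cfg.a cfg
      full-is-hub {u} {v} {w} full low-v cfg full-w nz = by (w Finₚ.≟ v) (w Finₚ.≟ a) (w Finₚ.≟ b) (w Finₚ.≟ c)
        where
        open C cfg
        by : Dec (w ≡ v) → Dec (w ≡ a) → Dec (w ≡ b) → Dec (w ≡ c) → w ≡ a
        by (yes e) _ _ _ = ⊥-elim (full≢low full-w low-v e)
        by (no _) (yes e) _ _ = e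
        by (no _) (no _) (yes e) _ = ⊥-elim (full≢low full-w low-b e)
        by (no _) (no _) (no _) (yes e) = ⊥-elim (full≢low full-w low-c e)
        by (no p) (no q) (no r) (no s) = ⊥-elim (nz (rest w p q r s))

      module Hub {u v} (full : Full u) (low-v : Low v) (nz : A u v ≢ 0ᵢ) where
        cfg : Cfg u v
        cfg = configuration u v full low-v nz
        open C cfg public
        joins-b = hub-joins full low-v cfg b low-b (norm⇒≢0 norm-b)
        joins-c = hub-joins full low-v cfg c low-c (norm⇒≢0 norm-c)
        x₂ x₃ : Fin n
        x₂ = proj₁ joins-b
        x₃ = proj₁ joins-c
        au : norm (A a u) ≡ 1
        au = norm-swap norm-a
        ax₂ : norm (A a x₂) ≡ 1
        ax₂ = proj₁ (proj₂ (proj₂ (proj₂ (proj₂ (proj₂ joins-b)))))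
        ax₃ : norm (A a x₃) ≡ 1
        ax₃ = proj₁ (proj₂ (proj₂ (proj₂ (proj₂ (proj₂ joins-c)))))
        bx₂ : norm (A b x₂) ≡ 1
        bx₂ = proj₁ (proj₂ (proj₂ (proj₂ joins-b)))
        cx₃ : norm (A c x₃) ≡ 1
        cx₃ = proj₁ (proj₂ (proj₂ (proj₂ joins-c)))
        u≢x₂ : u ≢ x₂
        u≢x₂ = proj₁ (proj₂ joins-b)
        u≢x₃ : u ≢ x₃
        u≢x₃ = proj₁ (proj₂ joins-c)
        x≢x₂ : x ≢ x₂
        x≢x₂ e = norm⇒≢0 bx₂ (subst (λ z → A b z ≡ 0ᵢ) e bx)
        x≢x₃ : x ≢ x₃
        x≢x₃ e = norm⇒≢0 cx₃ (subst (λ z → A c z ≡ 0ᵢ) e cx)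
        x₂≢x₃ : x₂ ≢ x₃
        x₂≢x₃ e = norm⇒≢0 cx₃ (subst (λ z → A c z ≡ 0ᵢ) e cx₂)
          where
          cfg-b : Cfg u b
          cfg-b = configuration u b full low-b (norm⇒≢0 norm-b)
          -- c is one of the two low neighbours missed by the configuration at b
          cx₂ : A c x₂ ≡ 0ᵢ
          cx₂ = by (c Finₚ.≟ b) (c Finₚ.≟ Cfg.a cfg-b) (c Finₚ.≟ Cfg.b cfg-b) (c Finₚ.≟ Cfg.c cfg-b)
            where
            by : Dec (c ≡ b) → Dec (c ≡ Cfg.a cfg-b) → Dec (c ≡ Cfg.b cfg-b) → Dec (c ≡ Cfg.c cfg-b) → A c x₂ ≡ 0ᵢ
            by (yes e) _ _ _ = ⊥-elim (b≢c (sym e))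
            by (no _) (yes e) _ _ = ⊥-elim (full≢low (Cfg.full-a cfg-b) low-c (sym e))
            by (no _) (no _) (yes e) _ = trans (cong (λ k → A k x₂) e) (Cfg.bx cfg-b)
            by (no _) (no _) (no _) (yes e) = trans (cong (λ k → A k x₂) e) (Cfg.cx cfg-b)
            by (no p) (no q) (no r) (no s) = ⊥-elim (norm⇒≢0 norm-c (Units.rest (Cfg.nbrs cfg-b) c p q r s))
        hub-rest : ∀ w → w ≢ u → w ≢ x → w ≢ x₂ → w ≢ x₃ → A a w ≡ 0ᵢ
        hub-rest w p q r s = trans (sym erased) (total≡0 residual residual-0 w)
          where
          f₁ f₂ f₃ residual : Fin n → ℤ[i]
          f₁ = erase u (A a)
          f₂ = erase x f₁
          f₃ = erase x₂ f₂
          residual = erase x₃ f₃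
          at-x : f₁ x ≡ A a x
          at-x = erase-other u x (A a) u≢x
          at-x₂ : f₂ x₂ ≡ A a x₂
          at-x₂ = trans (erase-other x x₂ f₁ x≢x₂) (erase-other u x₂ (A a) u≢x₂)
          at-x₃ : f₃ x₃ ≡ A a x₃
          at-x₃ = trans (erase-other x₂ x₃ f₂ x₂≢x₃) (trans (erase-other x x₃ f₁ x≢x₃) (erase-other u x₃ (A a) u≢x₃))
          residual-0 : total residual ≡ 0
          residual-0 = cancel (total residual) (trans (sym full-a) (trans (erase-total u (A a)) (cong₂ ℕ._+_ au (trans (erase-total x f₁) (cong₂ ℕ._+_ (trans (cong norm at-x) ax)
            (trans (erase-total x₂ f₂) (cong₂ ℕ._+_ (trans (cong norm at-x₂) ax₂) (trans (erase-total x₃ f₃) (cong (ℕ._+ total residual) (trans (cong norm at-x₃) ax₃))))))))))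
            where
            cancel : ∀ m → 4 ≡ 1 ℕ.+ (1 ℕ.+ (1 ℕ.+ (1 ℕ.+ m))) → m ≡ 0
            cancel zero _ = refl
            cancel (suc m) ()
          erased : residual w ≡ A a w
          erased = trans (erase-other x₃ w f₃ (s ∘ sym)) (trans (erase-other x₂ w f₂ (r ∘ sym)) (trans (erase-other x w f₁ (q ∘ sym)) (erase-other u w (A a) (p ∘ sym))))
        hub-uncharged : A a a ≡ 0ᵢ
        hub-uncharged = hub-rest a (λ e → norm⇒≢0 au (trans (cong (λ z → A a z) (sym e)) (trans (cong (λ z → A z a) e) (trans (cong (λ z → A u z) e) uu))))
          (λ e → norm⇒≢0 norm-a (trans (cong (λ z → A u z) e) ux)) (λ e → norm⇒≢0 norm-a (trans (cong (λ z → A u z) e) ux₂)) (λ e → norm⇒≢0 norm-a (trans (cong (λ z → A u z) e) ux₃))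
          where
          ux₂ : A u x₂ ≡ 0ᵢ
          ux₂ = proj₂ (proj₂ (proj₂ (proj₂ (proj₂ (proj₂ joins-b)))))
          ux₃ : A u x₃ ≡ 0ᵢ
          ux₃ = proj₂ (proj₂ (proj₂ (proj₂ (proj₂ (proj₂ joins-c)))))

    uncharged : ∀ {w} → Reach w → A w w ≡ 0ᵢ
    uncharged (good (full , v , low-v , nz)) = Cfg.uu (configuration _ v full low-v nz)
    uncharged (low u g nz l) = low-uncharged g l nz
    uncharged {w} (hub u (full , v , low-v , nz) nzw full-w) = subst (λ z → A z z ≡ 0ᵢ) (sym (full-is-hub full low-v cfg full-w nzw)) hub-uncharged
      where open Hub full low-v nz

    step : ∀ {w z} → Reach w → A w z ≢ 0ᵢ → Reach z
    step {w} {z} (good g) nz = by (full-or-low z)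
      where
      by : Full z ⊎ Low z → Reach z
      by (inj₁ f) = hub w g nz f
      by (inj₂ l) = low w g nz l
    step {w} {z} (low u g@(full , _) uw low-w) nz = by (z Finₚ.≟ u) (z Finₚ.≟ x)
      where
      open C (configuration u w full low-w uw)
      second : Full x ⊎ Low x → Reach x
      second (inj₁ f) = good (f , w , low-w , A-nonzero (norm⇒≢0 norm-x))
      second (inj₂ l) = low a (full-a , x , l , norm⇒≢0 ax) (norm⇒≢0 ax) l
      by : Dec (z ≡ u) → Dec (z ≡ x) → Reach z
      by (yes e) _ = subst Reach (sym e) (good g)
      by (no _) (yes e) = subst Reach (sym e) (second (full-or-low x))
      by (no p) (no q) = ⊥-elim (nz (supp z p q))
    step {w} {z} (hub u g@(full , v , low-v , uv) uw full-w) nz = by (z Finₚ.≟ u) (z Finₚ.≟ x) (z Finₚ.≟ x₂) (z Finₚ.≟ x₃)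
      where
      open Hub full low-v uv
      w≡a : w ≡ a
      w≡a = full-is-hub full low-v cfg full-w uw
      second : ∀ k x → Low k → norm (A k x) ≡ 1 → norm (A a x) ≡ 1 → Full x ⊎ Low x → Reach x
      second k x low-k kx ax (inj₁ f) = good (f , k , low-k , A-nonzero (norm⇒≢0 kx))
      second k x low-k kx ax (inj₂ l) = low a (full-a , x , l , norm⇒≢0 ax) (norm⇒≢0 ax) l
      by : Dec (z ≡ u) → Dec (z ≡ x) → Dec (z ≡ x₂) → Dec (z ≡ x₃) → Reach z
      by (yes e) _ _ _ = subst Reach (sym e) (good g)
      by (no _) (yes e) _ _ = subst Reach (sym e) (second v x low-v norm-x ax (full-or-low x))
      by (no _) (no _) (yes e) _ = subst Reach (sym e) (second b x₂ low-b bx₂ ax₂ (full-or-low x₂))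
      by (no _) (no _) (no _) (yes e) = subst Reach (sym e) (second c x₃ low-c cx₃ ax₃ (full-or-low x₃))
      by (no p) (no q) (no r) (no s) = ⊥-elim (nz (trans (cong (λ k → A k z) w≡a) (hub-rest z p q r s)))

    reach-all : ∀ {w z} → Star (Adjacent A) w z → Reach w → Reach z
    reach-all ε              r = r
    reach-all ((_ , nz) ◅ p) r = reach-all p (step r nz)

    no-good : ∀ {q} → A q q ≢ 0ᵢ → ∀ u → ¬ Good u
    no-good {q} charged u g = charged (uncharged (reach-all (conn u q) (good g)))

    full-spreads : ∀ {q} → A q q ≢ 0ᵢ → ∀ {w z} → Star (Adjacent A) w z → Full w → Full z
    full-spreads charged ε f = f
    full-spreads charged {w} (_◅_ {j = k} (_ , nz) p) f = full-spreads charged p (by (full-or-low k))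
      where
      by : Full k ⊎ Low k → Full k
      by (inj₁ f′) = f′
      by (inj₂ l)  = ⊥-elim (no-good charged w (f , k , l , nz))

  private
    charge-size : ∀ {n} {A : Matrix n} q → A q q ≢ 0ᵢ → total (A q) ≤ 2 → norm (A q q) ≡ 2 ⊎ norm (A q q) ≡ 1
    charge-size {A = A} q nz l = by (norm (A q q)) refl (norm≢0 nz) (≤-trans (≤-trans (m≤m+n (norm (A q q)) (total (erase q (A q)))) (≤-reflexive (sym (erase-total q (A q))))) l)
      where
      by : ∀ m → norm (A q q) ≡ m → 1 ≤ m → m ≤ 2 → norm (A q q) ≡ 2 ⊎ norm (A q q) ≡ 1
      by 1 e _ _ = inj₂ e
      by 2 e _ _ = inj₁ e
      by (suc (suc (suc m))) e _ (s≤s (s≤s ()))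

  low-negative : ∀ {n} {A : Matrix n} (core : Core A) → (∀ u → total (A u) ≤ 2) → ∀ q → A q q ≡ -[1+ 0 ] +i 0ℤ → ⊥
  low-negative {A = A} core all-low q charge = noext (twin A herm all-low q charge) -[1+ 0 ] q (twin-nonzero A herm all-low q charge) (psd±-twin A herm all-low q charge psd±)
    where open Core core

  all-full : ∀ {n} {A : Matrix n} (core : Core A) → ∀ q → A q q ≢ 0ᵢ → ∀ w → total (A w) ≡ 4
  all-full {n} {A} core q charged w = by (full-or-low w)
    where
    open Core core
    open AllFull core
    by : Full w ⊎ Low w → Full w
    by (inj₁ f) = f
    by (inj₂ l) = ⊥-elim (by-charge (charge-size {A = A} q charged (all-low q)))
      where
      all-low : ∀ u → Low u
      all-low u = low-or (full-or-low u)
        where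
        low-or : Full u ⊎ Low u → Low u
        low-or (inj₁ f) = ⊥-elim (full-not-low (full-spreads charged (conn u w) f) l)
        low-or (inj₂ l) = l
      not-two : ∀ z → im z ≡ 0ℤ → norm z ≢ 2
      not-two z e n₂ = real (proj₁ (components z (subst (ℕ._< 9) (sym n₂) (s≤s (s≤s (s≤s z≤n)))))) (trans (cong (λ b → ℤ.∣ re z ∣ ℕ.* ℤ.∣ re z ∣ ℕ.+ ℤ.∣ b ∣ ℕ.* ℤ.∣ b ∣) (sym e)) n₂)
        where
        real : ∀ {a} → Small a → ℤ.∣ a ∣ ℕ.* ℤ.∣ a ∣ ℕ.+ 0 ≢ 2
        real s₀ ()
        real s₁ ()
        real s₂ ()
        real s₋₁ ()
        real s₋₂ ()
      by-charge : norm (A q q) ≡ 2 ⊎ norm (A q q) ≡ 1 → ⊥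
      by-charge (inj₁ n₂) = not-two (A q q) (cong im (real-diagonal herm q)) n₂
      by-charge (inj₂ one) = by-sign (unit-charge q one)
        where
        by-sign : (∃[ l ] UnitCharge l × A q q ≡ l +i 0ℤ) → ⊥
        by-sign (_ , minus , e) = low-negative core all-low q e
        by-sign (_ , plus  , e) = low-negative (Core-⊖ core) (λ u → subst (_≤ 2) (sym (total-⊖ u)) (all-low u)) q (cong ⊟_ e)
          where
          total-⊖ : ∀ u → total (⊖M A u) ≡ total (A u)
          total-⊖ u = Σℕ.sum-cong-≗ λ k → norm-⊟ (A u k)

module MaximalMatrices where
  open EigenvalueBounds
  open RayleighQuotients
  open BorderedMatrices
  open GaussianNorms
  open UnextendableMatrices
  open import Relation.Binary.Construct.Closure.ReflexiveTransitive using (Star; ε; _◅_; _◅◅_)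

  border-Hermitian : ∀ {n} {A : Matrix n} → Hermitian A → ∀ c d → Hermitian (border A c d)
  border-Hermitian herm c d zero    zero    = refl
  border-Hermitian herm c d zero    (suc v) = refl
  border-Hermitian herm c d (suc u) zero    = sym (conj-conj (c u))
  border-Hermitian herm c d (suc u) (suc v) = herm u v

  border-indecomposable : ∀ {n} {A : Matrix n} → Indecomposable A → ∀ c d u → c u ≢ 0ᵢ → Indecomposable (border A c d)
  border-indecomposable {n} {A} conn c d u cu≢0 = path
    where
    suc-inj : ∀ {v w : Fin n} → Fin.suc v ≡ suc w → v ≡ w
    suc-inj refl = refl
    lift : ∀ {v w} → Star (Adjacent A) v w → Star (Adjacent (border A c d)) (suc v) (suc w)
    lift ε               = ε
    lift ((ne , nz) ◅ p) = ((λ e → ne (suc-inj e)) , nz) ◅ lift p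
    to-zero : Adjacent (border A c d) (suc u) zero
    to-zero = (λ ()) , cu≢0
    from-zero : Adjacent (border A c d) zero (suc u)
    from-zero = (λ ()) , λ e → cu≢0 (trans (sym (conj-conj (c u))) (cong conj e))
    path : ∀ v w → Star (Adjacent (border A c d)) v w
    path zero    zero    = ε
    path zero    (suc w) = from-zero ◅ lift (conn u w)
    path (suc v) zero    = lift (conn v u) ◅◅ (to-zero ◅ ε)
    path (suc v) (suc w) = lift (conn v w)

  maximal⇒core : ∀ {n} (A : Matrix n) → MaximalIndecomposableCyclotomic A → Core A
  maximal⇒core {n} A (conn , cyc , maximal) = record
    { herm = proj₁ cyc
    ; conn = conn
    ; psd± = cyclotomic⇒psd A cyc
    ; noext = λ c d u cu≢0 psd → maximal (border A c d) (border-indecomposable conn c d u cu≢0)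
        (psd⇒cyclotomic (border A c d) (border-Hermitian (proj₁ cyc) c d) psd) (ℕₚ.n<1+n n) (suc , s≤s , λ u v → refl) }

module MonomialEquivalence where
  open InnerProduct
  open GaussianIntegers
  open BorderedMatrices
  open GaussianNorms
  open UnextendableMatrices
  open DegreeTwo using (unit-conj)
  open import Data.Bool.Base using (if_then_else_)
  open import Data.Integer.Base using (+_)
  open import Data.Sign.Base as Sign using (Sign)
  open import Relation.Binary.Construct.Closure.ReflexiveTransitive using (Star; ε; _◅_)
  open import Relation.Nullary.Decidable using (dec-true; dec-false; isYes≗does)
  open Zi using (single; single-self; single-other)

  Injective : ∀ {m n} → (Fin m → Fin n) → Set
  Injective f = ∀ a b → f a ≡ f b → a ≡ b

  Closed : ∀ {m n} → Matrix n → (Fin m → Fin n) → Set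
  Closed A f = ∀ a v → A (f a) v ≢ 0ᵢ → ∃[ b ] f b ≡ v

  surjective : ∀ {m n} {A : Matrix n} → Indecomposable A → (f : Fin (suc m) → Fin n) → Closed A f → ∀ v → ∃[ a ] f a ≡ v
  surjective {A = A} conn f closed v = follow (conn (f zero) v) (zero , refl)
    where
    follow : ∀ {u v} → Star (Adjacent A) u v → ∃[ a ] f a ≡ u → ∃[ a ] f a ≡ v
    follow ε                            p       = p
    follow {u} (_◅_ {j = w} (_ , nz) q) (a , e) = follow q (closed a w (λ z → nz (trans (cong (λ t → A t w) (sym e)) z)))

  𝟙-same : ∀ {n} (u : Fin n) → 𝟙 u u ≡ +1ᵢ
  𝟙-same u = cong (λ b → if b then +1ᵢ else 0ᵢ) (trans (isYes≗does (u Finₚ.≟ u)) (dec-true (u Finₚ.≟ u) refl))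

  𝟙-other : ∀ {n} {u v : Fin n} → u ≢ v → 𝟙 u v ≡ 0ᵢ
  𝟙-other {u = u} {v} ne = cong (λ b → if b then +1ᵢ else 0ᵢ) (trans (isYes≗does (u Finₚ.≟ v)) (dec-false (u Finₚ.≟ v) ne))

  module Monomial {n} (f g : Fin n → Fin n) (fg : ∀ u → f (g u) ≡ u) (gf : ∀ a → g (f a) ≡ a) (ζ : Fin n → ℤ[i]) (nζ : ∀ a → norm (ζ a) ≡ 1) where
    Q : Matrix n
    Q u w = single (g u) (ζ (g u)) w

    conj-single : ∀ {n} (a : Fin n) z w → conj (single a z w) ≡ single a (conj z) w
    conj-single zero    z zero    = refl
    conj-single zero    z (suc w) = refl
    conj-single (suc a) z zero    = refl
    conj-single (suc a) z (suc w) = conj-single a z w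

    Q-row : ∀ u (h : Fin n → ℤ[i]) → Σi (λ k → Q u k ⊠ h k) ≡ ζ (g u) ⊠ h (g u)
    Q-row u h = sum-single (g u) (ζ (g u)) h

    Q-rowᴴ : ∀ (h : Fin n → ℤ[i]) v → Σi (λ k → h k ⊠ (Q *ᴴ) k v) ≡ h (g v) ⊠ conj (ζ (g v))
    Q-rowᴴ h v = trans (ΣG.sum-cong-≗ λ k → trans (Gi.*-comm (h k) (conj (Q v k))) (cong (_⊠ h k) (conj-single (g v) (ζ (g v)) k)))
      (trans (sum-single (g v) (conj (ζ (g v))) h) (Gi.*-comm (conj (ζ (g v))) (h (g v))))

    QTQ : ∀ T u v → (Q ⊗ T ⊗ Q *ᴴ) u v ≡ (ζ (g u) ⊠ T (g u) (g v)) ⊠ conj (ζ (g v))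
    QTQ T u v = trans (Q-rowᴴ ((Q ⊗ T) u) v) (cong (_⊠ conj (ζ (g v))) (Q-row u (λ k → T k (g v))))

    g-inj : ∀ {u v} → g u ≡ g v → u ≡ v
    g-inj {u} {v} e = trans (sym (fg u)) (trans (cong f e) (fg v))

    unitary : Unitary Q
    unitary = left , right
      where
      left : Q ⊗ Q *ᴴ ≐ 𝟙
      left u v = trans (Q-row u (λ k → (Q *ᴴ) k v)) (by (u Finₚ.≟ v))
        where
        by : Dec (u ≡ v) → ζ (g u) ⊠ conj (single (g v) (ζ (g v)) (g u)) ≡ 𝟙 u v
        by (yes refl) = trans (cong (λ z → ζ (g u) ⊠ conj z) (single-self (g u) (ζ (g u)))) (trans (unit-conj (ζ (g u)) (nζ (g u))) (sym (𝟙-same u)))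
        by (no u≢v)   = trans (cong (λ z → ζ (g u) ⊠ conj z) (single-other (g v) (g u) (ζ (g v)) (u≢v ∘ g-inj ∘ sym))) (trans (Gi.zeroʳ (ζ (g u))) (sym (𝟙-other u≢v)))
      column-Q : ∀ u k → conj (Q k u) ≡ single (f u) (conj (ζ u)) k
      column-Q u k = by (f u Finₚ.≟ k)
        where
        by : Dec (f u ≡ k) → conj (single (g k) (ζ (g k)) u) ≡ single (f u) (conj (ζ u)) k
        by (yes refl) = trans (cong conj (trans (cong (λ a → single a (ζ a) u) (gf u)) (single-self u (ζ u)))) (sym (single-self (f u) (conj (ζ u))))
        by (no ne)    = trans (cong conj (single-other (g k) u (ζ (g k)) (λ e → ne (trans (cong f (sym e)) (fg k))))) (sym (single-other (f u) k (conj (ζ u)) ne))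
      right : Q *ᴴ ⊗ Q ≐ 𝟙
      right u v = trans (ΣG.sum-cong-≗ λ k → cong (_⊠ Q k v) (column-Q u k)) (trans (sum-single (f u) (conj (ζ u)) (λ k → Q k v))
        (trans (cong (λ a → conj (ζ u) ⊠ single a (ζ a) v) (gf u)) (by (u Finₚ.≟ v))))
        where
        by : Dec (u ≡ v) → conj (ζ u) ⊠ single u (ζ u) v ≡ 𝟙 u v
        by (yes refl) = trans (cong (conj (ζ u) ⊠_) (single-self u (ζ u))) (trans (Gi.*-comm (conj (ζ u)) (ζ u)) (trans (unit-conj (ζ u) (nζ u)) (sym (𝟙-same u))))
        by (no u≢v)   = trans (cong (conj (ζ u) ⊠_) (single-other u v (ζ u) u≢v)) (trans (Gi.zeroʳ (conj (ζ u))) (sym (𝟙-other u≢v)))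

  Equivalent : ∀ {n} → Matrix n → Set
  Equivalent {n} A = ∃[ B ] IsListed {n} B × A ∼ B

  record Realises {m n} (A : Matrix n) (T : Matrix m) : Set where
    field
      f         : Fin m → Fin n
      injective : Injective f
      closed    : Closed A f
      ζ         : Fin m → ℤ[i]
      norm-ζ    : ∀ a → norm (ζ a) ≡ 1
      s         : Sign
      σ         : Automorphism
      entries   : ∀ a b → A (f a) (f b) ≡ signed s (apply σ ((ζ a ⊠ T a b) ⊠ conj (ζ b)))

  realises⇒equivalent : ∀ {m n} {A : Matrix n} {T : Matrix (suc m)} → Indecomposable A → IsListed T → Realises A T → Equivalent A
  realises⇒equivalent {m} {n} {A} {T} conn listed R = by-size (ℕₚ.≤-antisym (Finₚ.injective⇒≤ {f = f} (λ {a} {b} → injective a b)) (Finₚ.injective⇒≤ {f = g} g-injective)) R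
    where
    open Realises R
    g : Fin n → Fin (suc m)
    g v = proj₁ (surjective conn f closed v)
    fg : ∀ v → f (g v) ≡ v
    fg v = proj₂ (surjective conn f closed v)
    g-injective : ∀ {u v} → g u ≡ g v → u ≡ v
    g-injective {u} {v} e = trans (sym (fg u)) (trans (cong f e) (fg v))
    by-size : suc m ≡ n → Realises A T → Equivalent A
    by-size refl R′ = T , listed , Q , R.s , R.σ , unitary , λ u v → trans (cong₂ A (sym (fg′ u)) (sym (fg′ v)))
        (trans (R.entries (g′ u) (g′ v)) (cong (λ z → signed R.s (apply R.σ z)) (sym (QTQ T u v))))
      where
      module R = Realises R′
      g′ : Fin (suc m) → Fin (suc m)
      g′ v = proj₁ (surjective conn R.f R.closed v)
      fg′ : ∀ v → R.f (g′ v) ≡ v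
      fg′ v = proj₂ (surjective conn R.f R.closed v)
      open Monomial R.f g′ fg′ (λ a → R.injective (g′ (R.f a)) a (fg′ (R.f a))) R.ζ R.norm-ζ

  Equivalent-⊖ : ∀ {n} {A : Matrix n} → Equivalent (⊖M A) → Equivalent A
  Equivalent-⊖ {A = A} (B , listed , Q , s , σ , unitary , e) = B , listed , Q , Sign.opposite s , σ , unitary ,
    λ u v → trans (sym (⊖M-⊖M A u v)) (trans (cong ⊟_ (e u v)) (negate s (apply σ ((Q ⊗ B ⊗ Q *ᴴ) u v))))
    where
    negate : ∀ s z → ⊟ (signed s z) ≡ signed (Sign.opposite s) z
    negate Sign.+ z = refl
    negate Sign.- z = ⊟-involutive z

module OrthogonalRows where
  open InnerProduct
  open GaussianIntegers
  open BorderedMatrices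
  open GaussianNorms
  open UnextendableMatrices
  open ParityArguments
  open import Data.Integer.Base using (+_; 0ℤ; _+_; _*_; -_; _-_)
  open import Data.Integer.Tactic.RingSolver using (solve-∀)
  open Zi using (B; single)

  record Saturated {n} (A : Matrix n) : Set where
    field
      herm : Hermitian A
      conn : Indecomposable A
      full : ∀ u → total (A u) ≡ 4
      orth : ∀ {u w} → u ≢ w → sq A u w ≡ 0ᵢ

  total-⊖ : ∀ {n} (f : Fin n → ℤ[i]) → total (⊖ f) ≡ total f
  total-⊖ f = Σℕ.sum-cong-≗ λ k → norm-⊟ (f k)

  sum-erase : ∀ {n} (j : Fin n) f g → Σi (λ k → f k ⊠ g k) ≡ (f j ⊠ g j) ⊞ Σi (λ k → erase j f k ⊠ g k)
  sum-erase j f g = trans (ΣG.sum-cong-≗ λ k → trans (cong (_⊠ g k) (erase-split j f k)) (Gi.distribʳ (g k) (single j (f j) k) (erase j f k)))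
    (trans (ΣG.∑-distrib-+ (λ k → single j (f j) k ⊠ g k) (λ k → erase j f k ⊠ g k)) (cong (_⊞ Σi (λ k → erase j f k ⊠ g k)) (sum-single j (f j) g)))

  erase₂ : ∀ {n} → Fin n → Fin n → (Fin n → ℤ[i]) → Fin n → ℤ[i]
  erase₂ p q f = erase q (erase p f)

  module _ {n} {p q : Fin n} (p≢q : p ≢ q) where
    erase₂-total : ∀ f → total f ≡ norm (f p) ℕ.+ (norm (f q) ℕ.+ total (erase₂ p q f))
    erase₂-total f = trans (erase-total p f) (cong (norm (f p) ℕ.+_) (trans (erase-total q (erase p f)) (cong (λ z → norm z ℕ.+ total (erase₂ p q f)) (erase-other p q f p≢q))))

    erase₂-other : ∀ f k → k ≢ p → k ≢ q → erase₂ p q f k ≡ f k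
    erase₂-other f k k≢p k≢q = trans (erase-other q k (erase p f) (k≢q ∘ sym)) (erase-other p k f (k≢p ∘ sym))

    erase₂-fst : ∀ f → erase₂ p q f p ≡ 0ᵢ
    erase₂-fst f = trans (erase-other q p (erase p f) (p≢q ∘ sym)) (erase-self p f)

    erase₂-snd : ∀ f → erase₂ p q f q ≡ 0ᵢ
    erase₂-snd f = erase-self q (erase p f)

    erase₂-sum : ∀ f g → Σi (λ k → f k ⊠ g k) ≡ (f p ⊠ g p) ⊞ ((f q ⊠ g q) ⊞ Σi (λ k → erase₂ p q f k ⊠ g k))
    erase₂-sum f g = trans (sum-erase p f g) (cong ((f p ⊠ g p) ⊞_) (trans (sum-erase q (erase p f) g)
      (cong (λ z → (z ⊠ g q) ⊞ Σi (λ k → erase₂ p q f k ⊠ g k)) (erase-other p q f p≢q))))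

    exhausted : ∀ f → total f ≡ norm (f p) ℕ.+ norm (f q) → ∀ k → k ≢ p → k ≢ q → f k ≡ 0ᵢ
    exhausted f e k k≢p k≢q = trans (sym (erase₂-other f k k≢p k≢q)) (total≡0 (erase₂ p q f) (ℕₚ.+-cancelˡ-≡ (norm (f p) ℕ.+ norm (f q)) (total (erase₂ p q f)) 0
      (trans (ℕₚ.+-assoc (norm (f p)) (norm (f q)) (total (erase₂ p q f))) (trans (sym (erase₂-total f)) (trans e (sym (ℕₚ.+-identityʳ (norm (f p) ℕ.+ norm (f q)))))))) k)

  private
    distance : ∀ {n} (f g : Fin n → ℤ[i]) ω → let S = Σi (λ k → f k ⊠ conj (g k)) in
      B (λ k → f k ⊞ ⊟ (ω ⊠ g k)) (λ k → f k ⊞ ⊟ (ω ⊠ g k)) ≡ B f f + nrm ω * B g g - + 2 * (re ω * re S + im ω * im S)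
    distance {zero}  f g (p +i q) = lem p q
      where
      lem : ∀ p q → 0ℤ ≡ 0ℤ + (p * p + q * q) * 0ℤ - + 2 * (p * 0ℤ + q * 0ℤ)
      lem = solve-∀
    distance {suc n} f g ω = trans (cong (λ s → nrm (f zero ⊞ ⊟ (ω ⊠ g zero)) + s) (distance (f ∘ suc) (g ∘ suc) ω))
      (lem (re (f zero)) (im (f zero)) (re (g zero)) (im (g zero)) (re ω) (im ω) (B (f ∘ suc) (f ∘ suc)) (B (g ∘ suc) (g ∘ suc))
        (re (Σi (λ k → f (suc k) ⊠ conj (g (suc k))))) (im (Σi (λ k → f (suc k) ⊠ conj (g (suc k))))))
      where
      lem : ∀ a b c d p q F G x y →
        ((a + - (p * c + - (q * d))) * (a + - (p * c + - (q * d))) + (b + - (p * d + q * c)) * (b + - (p * d + q * c)))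
          + (F + (p * p + q * q) * G - + 2 * (p * x + q * y))
        ≡ ((a * a + b * b) + F) + (p * p + q * q) * ((c * c + d * d) + G)
          - + 2 * (p * ((a * c + - (b * - d)) + x) + q * ((a * - d + b * c) + y))
      lem = solve-∀

  cauchy-schwarz-equality : ∀ {n} (f g : Fin n → ℤ[i]) ω → total f ≡ 2 → total g ≡ 2 → norm ω ≡ 1 →
    Σi (λ k → f k ⊠ conj (g k)) ≡ ω ⊞ ω → ∀ k → f k ≡ ω ⊠ g k
  cauchy-schwarz-equality {n} f g ω tf tg nω S≡ k = ⊟-cancel (f k) (ω ⊠ g k) (total≡0 d (ℤₚ.+-injective (trans (sym (B-self d)) B≡0)) k)
    where
    d : Fin n → ℤ[i]
    d k = f k ⊞ ⊟ (ω ⊠ g k)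
    lem : ∀ p q → + 2 + (p * p + q * q) * + 2 - + 2 * (p * (p + p) + q * (q + q)) ≡ + 2 - + 2 * (p * p + q * q)
    lem = solve-∀
    B≡0 : B d d ≡ 0ℤ
    B≡0 = trans (distance f g ω) (trans (cong₂ (λ x y → x + nrm ω * y - + 2 * (re ω * re (Σi (λ k → f k ⊠ conj (g k))) + im ω * im (Σi (λ k → f k ⊠ conj (g k)))))
        (trans (B-self f) (cong +_ tf)) (trans (B-self g) (cong +_ tg)))
      (trans (cong (λ S → + 2 + nrm ω * + 2 - + 2 * (re ω * re S + im ω * im S)) S≡)
      (trans (lem (re ω) (im ω)) (cong (λ z → + 2 - + 2 * z) (trans (nrm≡norm ω) (cong +_ nω))))))
    ⊟-cancel : ∀ x y → x ⊞ ⊟ y ≡ 0ᵢ → x ≡ y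
    ⊟-cancel x y e = cong₂ _+i_ (ℤₚ.i-j≡0⇒i≡j (re x) (re y) (cong re e)) (ℤₚ.i-j≡0⇒i≡j (im x) (im y) (cong im e))

  module SaturatedFacts {n} {A : Matrix n} (sat : Saturated A) where
    open Saturated sat

    norm-sym : ∀ u v → norm (A u v) ≡ norm (A v u)
    norm-sym = norm-hermitian herm

    zero-sym : ∀ {u v} → A u v ≡ 0ᵢ → A v u ≡ 0ᵢ
    zero-sym {u} {v} e = trans (herm v u) (cong conj e)

    diagonal : ∀ u → A u u ≡ re (A u u) +i 0ℤ
    diagonal = real-diagonal herm

    Saturated-⊖ : Saturated (⊖M A)
    Saturated-⊖ = record
      { herm = Hermitian-⊖ herm
      ; conn = λ u v → conn-⊖ (conn u v)
      ; full = λ u → trans (total-⊖ (A u)) (full u)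
      ; orth = λ {u} {w} ne → trans (sq-⊖ A u w) (orth ne) }
      where
      open import Relation.Binary.Construct.Closure.ReflexiveTransitive using (Star; ε; _◅_)
      conn-⊖ : ∀ {u v} → Star (Adjacent A) u v → Star (Adjacent (⊖M A)) u v
      conn-⊖ ε = ε
      conn-⊖ (_◅_ {i = u} {j = v} (ne , nz) p) = (ne , λ e → nz (trans (sym (⊖M-⊖M A u v)) (cong ⊟_ e))) ◅ conn-⊖ p

    -- Rows a and b agree up to a unit away from p and q: they are orthogonal and p, q account for half of each.
    residual : ∀ a b p q → a ≢ b → p ≢ q → ∀ ω → norm ω ≡ 1 → norm (A a p) ≡ 1 → norm (A a q) ≡ 1 → norm (A b p) ≡ 1 → norm (A b q) ≡ 1 →
      A b p ⊠ A p a ≡ ⊟ ω → A b q ⊠ A q a ≡ ⊟ ω → ∀ k → erase₂ p q (A b) k ≡ ω ⊠ erase₂ p q (A a) k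
    residual a b p q a≢b p≢q ω nω ap aq bp bq ep eq = cauchy-schwarz-equality (erase₂ p q (A b)) (erase₂ p q (A a)) ω (half b bp bq) (half a ap aq) nω
      (trans (ΣG.sum-cong-≗ λ k → term k (k Finₚ.≟ p) (k Finₚ.≟ q)) (trans (balance ω _ (trans (sym (trans (erase₂-sum p≢q (A b) (λ k → A k a)) (cong₂ (λ x y → x ⊞ (y ⊞ R)) ep eq))) (orth (a≢b ∘ sym)))) refl))
      where
      R : ℤ[i]
      R = Σi (λ k → erase₂ p q (A b) k ⊠ A k a)
      half : ∀ u → norm (A u p) ≡ 1 → norm (A u q) ≡ 1 → total (erase₂ p q (A u)) ≡ 2
      half u up uq = ℕₚ.+-cancelˡ-≡ 2 _ 2 (trans (cong₂ (λ x y → x ℕ.+ (y ℕ.+ total (erase₂ p q (A u)))) (sym up) (sym uq)) (trans (sym (erase₂-total p≢q (A u))) (full u)))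
      zero-term : ∀ {x} y z → x ≡ 0ᵢ → x ⊠ y ≡ x ⊠ z
      zero-term y z refl = trans (Gi.zeroˡ y) (sym (Gi.zeroˡ z))
      term : ∀ k → Dec (k ≡ p) → Dec (k ≡ q) → erase₂ p q (A b) k ⊠ conj (erase₂ p q (A a) k) ≡ erase₂ p q (A b) k ⊠ A k a
      term k (yes refl) _          = zero-term (conj (erase₂ p q (A a) k)) (A k a) (erase₂-fst p≢q (A b))
      term k (no _)     (yes refl) = zero-term (conj (erase₂ p q (A a) k)) (A k a) (erase₂-snd p≢q (A b))
      term k (no ¬p)    (no ¬q)    = cong (erase₂ p q (A b) k ⊠_) (trans (cong conj (erase₂-other p≢q (A a) k ¬p ¬q)) (sym (herm k a)))
      balance : ∀ ω R → ⊟ ω ⊞ (⊟ ω ⊞ R) ≡ 0ᵢ → R ≡ ω ⊞ ω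
      balance ω R e = cong₂ _+i_ (solve-for (re ω) (re R) (cong re e)) (solve-for (im ω) (im R) (cong im e))
        where
        lem : ∀ a b → b ≡ (- a + (- a + b)) + (a + a)
        lem = solve-∀
        solve-for : ∀ a b → - a + (- a + b) ≡ 0ℤ → b ≡ a + a
        solve-for a b e = trans (lem a b) (trans (cong (_+ (a + a)) e) (ℤₚ.+-identityˡ (a + a)))

module LadderStrips where
  open InnerProduct
  open BorderedMatrices
  open GaussianNorms
  open UnextendableMatrices
  open ParityArguments
  open DegreeTwo using (unit-conj; ⊟-⊠; ⊠-⊟)
  open LowNeighbours using (norm-unit-⊠)
  open MonomialEquivalence
  open OrthogonalRows
  open import Data.Fin.Base using (remQuot; combine)
  open import Data.Fin.Patterns using (0F; 1F)
  open import Data.Integer.Base using (+_; -[1+_]; 0ℤ; 1ℤ; _+_; _*_; -_; _-_)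
  open import Data.Integer.Tactic.RingSolver using (solve-∀)
  open import Relation.Nullary.Decidable using (decidable-stable)

  ⊠-swap : ∀ a t b → conj ((a ⊠ (t +i 0ℤ)) ⊠ conj b) ≡ (b ⊠ (t +i 0ℤ)) ⊠ conj a
  ⊠-swap (a +i b) t (c +i d) = cong₂ _+i_ (r a b c d t) (i a b c d t)
    where
    r : ∀ a b c d t → (a * t + - (b * 0ℤ)) * c + - ((a * 0ℤ + b * t) * - d) ≡ (c * t + - (d * 0ℤ)) * a + - ((c * 0ℤ + d * t) * - b)
    r = solve-∀
    i : ∀ a b c d t → - ((a * t + - (b * 0ℤ)) * - d + (a * 0ℤ + b * t) * c) ≡ (c * t + - (d * 0ℤ)) * - b + (c * 0ℤ + d * t) * a
    i = solve-∀

  conj-gauge : ∀ a t b → conj ((a ⊠ t) ⊠ conj b) ≡ (b ⊠ conj t) ⊠ conj a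
  conj-gauge a t b = begin
    conj ((a ⊠ t) ⊠ conj b)           ≡⟨ conj-⊠ (a ⊠ t) (conj b) ⟩
    conj (a ⊠ t) ⊠ conj (conj b)      ≡⟨ cong₂ _⊠_ (conj-⊠ a t) (conj-conj b) ⟩
    (conj a ⊠ conj t) ⊠ b             ≡⟨ Gi.*-comm (conj a ⊠ conj t) b ⟩
    b ⊠ (conj a ⊠ conj t)             ≡⟨ cong (b ⊠_) (Gi.*-comm (conj a) (conj t)) ⟩
    b ⊠ (conj t ⊠ conj a)             ≡⟨ Gi.*-assoc b (conj t) (conj a) ⟨
    (b ⊠ conj t) ⊠ conj a             ∎
    where open ≡-Reasoning

  diagonal-gauge : ∀ z d → norm z ≡ 1 → (z ⊠ d) ⊠ conj z ≡ d
  diagonal-gauge z d e = trans (cong (_⊠ conj z) (Gi.*-comm z d)) (trans (Gi.*-assoc d z (conj z)) (trans (cong (d ⊠_) (unit-conj z e)) (Gi.*-identityʳ d)))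

  remQuot-injective : ∀ {k} (u v : Fin (k ℕ.* 2)) → remQuot {k} 2 u ≡ remQuot 2 v → u ≡ v
  remQuot-injective {k} u v e = trans (sym (Finₚ.combine-remQuot {k} 2 u)) (trans (cong (λ x → combine (proj₁ x) (proj₂ x)) e) (Finₚ.combine-remQuot {k} 2 v))

  sgn : Fin 2 → ℤ[i]
  sgn 0F = +1ᵢ
  sgn 1F = -1ᵢ

  module _ {n} {A : Matrix n} (sat : Saturated A) where
    open Saturated sat
    open SaturatedFacts sat

    -- Columns are added at the front, so that the column of C₂ₖ⁺⁺ , C₂ₖ⁺⁻ , C₂ₖ₊₁ built first is the last one.
    -- Outside the strip, h is the common row of the two front vertices in the gauge ζ.
    record Strip (k : ℕ) : Set where
      field
        f         : LadderVertex (suc k) → Fin n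
        injective : ∀ x y → f x ≡ f y → x ≡ y
        ζ         : LadderVertex (suc k) → ℤ[i]
        norm-ζ    : ∀ x → norm (ζ x) ≡ 1
        table     : ∀ x y → A (f x) (f y) ≡ (ζ x ⊠ (ladder x y ⊞ lastRung +1ᵢ -1ᵢ x y)) ⊠ conj (ζ y)
        closed    : ∀ j r v → A (f (suc j , r)) v ≢ 0ᵢ → ∃[ x ] f x ≡ v
        h         : Fin n → ℤ[i]
        h-inside  : ∀ x → h (f x) ≡ 0ᵢ
        h-outside : ∀ r v → (∀ x → f x ≢ v) → A (f (zero , r)) v ≡ ζ (zero , r) ⊠ h v
        h-total   : total h ≡ 2
        h-orth    : ∀ v → (∀ x → f x ≢ v) → Σi (λ w → h w ⊠ A w v) ≡ 0ᵢ

    module StripFacts {k} (strip : Strip k) where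
      open Strip strip public

      inside? : ∀ v → (∃[ x ] f x ≡ v) ⊎ (∀ x → f x ≢ v)
      inside? v = by (Finₚ.any? (λ u → f (remQuot 2 u) Finₚ.≟ v))
        where
        by : Dec (∃[ u ] f (remQuot 2 u) ≡ v) → (∃[ x ] f x ≡ v) ⊎ (∀ x → f x ≢ v)
        by (yes (u , e)) = inj₁ (remQuot 2 u , e)
        by (no ne)       = inj₂ λ (j , r) e → ne (combine j r , trans (cong f (Finₚ.remQuot-combine j r)) e)

      X : Fin 2 → Fin n
      X r = f (zero , r)

      X≢ : X 0F ≢ X 1F
      X≢ e with injective (zero , 0F) (zero , 1F) e
      ... | ()

      support⇒outside : ∀ {v} → h v ≢ 0ᵢ → ∀ x → f x ≢ v
      support⇒outside nz x refl = nz (h-inside x)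

      deep : ∀ j r v → (∀ x → f x ≢ v) → A v (f (suc j , r)) ≡ 0ᵢ
      deep j r v out = zero-sym (decidable-stable (A (f (suc j , r)) v ≟ᵢ 0ᵢ) λ nz → contradiction (proj₂ (closed j r v nz)) (out (proj₁ (closed j r v nz))))

      norm-X : ∀ v r → (∀ x → f x ≢ v) → norm (A v (X r)) ≡ norm (h v)
      norm-X v r out = trans (norm-sym v (X r)) (trans (cong norm (h-outside r v out)) (norm-unit-⊠ (ζ (zero , r)) (h v) (norm-ζ (zero , r))))

      size : suc k ℕ.* 2 ℕ.≤ n
      size = Finₚ.injective⇒≤ {f = f ∘ remQuot 2} (λ {u} {v} e → remQuot-injective {suc k} u v (injective (remQuot 2 u) (remQuot 2 v) e))

    module Start {u x : Fin n} (u≢x : u ≢ x) (uu : A u u ≡ +1ᵢ) (xx : A x x ≡ +1ᵢ) (ux : norm (A u x) ≡ 1) where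
      xu : norm (A x u) ≡ 1
      xu = trans (norm-sym x u) ux
      f : LadderVertex 1 → Fin n
      f (zero , 0F) = u
      f (zero , 1F) = x
      injective : ∀ y z → f y ≡ f z → y ≡ z
      injective (zero , 0F) (zero , 0F) _ = refl
      injective (zero , 0F) (zero , 1F) e = contradiction e u≢x
      injective (zero , 1F) (zero , 0F) e = contradiction (sym e) u≢x
      injective (zero , 1F) (zero , 1F) _ = refl
      ω : ℤ[i]
      ω = ⊟ A x u
      nω : norm ω ≡ 1
      nω = trans (norm-⊟ (A x u)) xu
      ζ : LadderVertex 1 → ℤ[i]
      ζ (zero , 0F) = +1ᵢ
      ζ (zero , 1F) = ω
      norm-ζ : ∀ y → norm (ζ y) ≡ 1
      norm-ζ (zero , 0F) = refl
      norm-ζ (zero , 1F) = nω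
      off : ∀ z → z ≡ (⊟ z ⊠ -1ᵢ) ⊠ conj +1ᵢ
      off (a +i b) = cong₂ _+i_ (r a b) (i a b)
        where
        r : ∀ a b → a ≡ (- a * - 1ℤ + - (- b * - 0ℤ)) * 1ℤ + - ((- a * - 0ℤ + - b * - 1ℤ) * - 0ℤ)
        r = solve-∀
        i : ∀ a b → b ≡ (- a * - 1ℤ + - (- b * - 0ℤ)) * - 0ℤ + (- a * - 0ℤ + - b * - 1ℤ) * 1ℤ
        i = solve-∀
      unit-square : ∀ z → norm z ≡ 1 → +1ᵢ ≡ (z ⊠ +1ᵢ) ⊠ conj z
      unit-square z e = sym (trans (cong (_⊠ conj z) (Gi.*-identityʳ z)) (unit-conj z e))
      table : ∀ y z → A (f y) (f z) ≡ (ζ y ⊠ (ladder y z ⊞ lastRung +1ᵢ -1ᵢ y z)) ⊠ conj (ζ z)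
      table (zero , 0F) (zero , 0F) = uu
      table (zero , 0F) (zero , 1F) = trans (herm u x) (trans (cong conj (off (A x u))) (⊠-swap (⊟ A x u) -[1+ 0 ] +1ᵢ))
      table (zero , 1F) (zero , 0F) = off (A x u)
      table (zero , 1F) (zero , 1F) = trans xx (unit-square ω nω)
      h : Fin n → ℤ[i]
      h = erase₂ u x (A u)
      h-inside : ∀ y → h (f y) ≡ 0ᵢ
      h-inside (zero , 0F) = erase₂-fst u≢x (A u)
      h-inside (zero , 1F) = erase₂-snd u≢x (A u)
      agree : ∀ v → erase₂ u x (A x) v ≡ ω ⊠ h v
      agree = residual u x u x u≢x u≢x ω nω (cong norm uu) ux xu (cong norm xx)
        (trans (cong (A x u ⊠_) uu) (trans (Gi.*-identityʳ (A x u)) (sym (⊟-involutive (A x u)))))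
        (trans (cong (_⊠ A x u) xx) (trans (Gi.*-identityˡ (A x u)) (sym (⊟-involutive (A x u)))))
      module _ (v : Fin n) (out : ∀ y → f y ≢ v) where
        v≢u : v ≢ u
        v≢u = out (zero , 0F) ∘ sym
        v≢x : v ≢ x
        v≢x = out (zero , 1F) ∘ sym
        h-outside : ∀ r → A (f (zero , r)) v ≡ ζ (zero , r) ⊠ h v
        h-outside 0F = trans (sym (erase₂-other u≢x (A u) v v≢u v≢x)) (sym (Gi.*-identityˡ (h v)))
        h-outside 1F = trans (sym (erase₂-other u≢x (A x) v v≢u v≢x)) (agree v)
        h-orth : Σi (λ w → h w ⊠ A w v) ≡ 0ᵢ
        h-orth = trans (sym (Gi.+-identityˡ S)) (trans (cong (_⊞ S) (sym cancel)) (trans (Gi.+-assoc (A u u ⊠ A u v) (A u x ⊠ A x v) S)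
            (trans (sym (erase₂-sum u≢x (A u) (λ w → A w v))) (orth (v≢u ∘ sym)))))
          where
          S : ℤ[i]
          S = Σi (λ w → h w ⊠ A w v)
          first : A u u ⊠ A u v ≡ h v
          first = trans (cong (_⊠ A u v) uu) (trans (Gi.*-identityˡ (A u v)) (trans (h-outside 0F) (Gi.*-identityˡ (h v))))
          second : A u x ⊠ A x v ≡ ⊟ h v
          second = trans (cong (A u x ⊠_) (h-outside 1F)) (trans (sym (Gi.*-assoc (A u x) ω (h v)))
            (trans (cong (_⊠ h v) (trans (⊠-⊟ (A u x) (A x u)) (cong ⊟_ (trans (cong (A u x ⊠_) (herm x u)) (unit-conj (A u x) ux)))))
            (trans (⊟-⊠ +1ᵢ (h v)) (cong ⊟_ (Gi.*-identityˡ (h v))))))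
          cancel : (A u u ⊠ A u v) ⊞ (A u x ⊠ A x v) ≡ 0ᵢ
          cancel = trans (cong₂ _⊞_ first second) (Gi.-‿inverseʳ (h v))
      h-total : total h ≡ 2
      h-total = ℕₚ.+-cancelˡ-≡ 2 (total h) 2 (trans (cong₂ (λ y z → y ℕ.+ (z ℕ.+ total h)) (sym (cong norm uu)) (sym ux)) (trans (sym (erase₂-total u≢x (A u))) (full u)))
      strip : Strip 0
      strip = record { f = f ; injective = injective ; ζ = ζ ; norm-ζ = norm-ζ ; table = table ; closed = λ () ; h = h ; h-inside = h-inside
        ; h-outside = λ r v out → h-outside v out r ; h-total = h-total ; h-orth = h-orth }

module LadderGrowth where
  open InnerProduct
  open BorderedMatrices
  open GaussianNorms
  open UnextendableMatrices
  open ParityArguments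
  open DegreeTwo using (unit-conj; ⊟-unique; ⊟-⊠; ⊠-⊟)
  open LowDegreeVertices using (norm⇒≢0)
  open LowNeighbours using (norm-unit-⊠; unit-cancel; drop-zero)
  open MonomialEquivalence
  open OrthogonalRows
  open LadderStrips
  open import Data.Bool.Base using (if_then_else_; true; false; _∧_)
  open import Data.Bool.Properties using (∧-zeroʳ)
  open import Data.Fin.Patterns using (0F; 1F)
  open import Data.Integer.Base using (+_; 0ℤ; 1ℤ; _+_; _*_; -_; _-_)
  open import Data.Integer.Tactic.RingSolver using (solve-∀)

  private
    signs : ∀ r w z → z ⊠ w ≡ (z ⊠ (sgn r ⊞ 0ᵢ)) ⊠ conj (sgn r ⊠ conj w)
    signs 0F (a +i b) (c +i d) = cong₂ _+i_ (re₁ a b c d) (im₁ a b c d)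
      where
      re₁ : ∀ a b c d → c * a + - (d * b) ≡ (c * (1ℤ + 0ℤ) + - (d * (0ℤ + 0ℤ))) * (1ℤ * a + - (0ℤ * - b)) + - ((c * (0ℤ + 0ℤ) + d * (1ℤ + 0ℤ)) * - (1ℤ * - b + 0ℤ * a))
      re₁ = solve-∀
      im₁ : ∀ a b c d → c * b + d * a ≡ (c * (1ℤ + 0ℤ) + - (d * (0ℤ + 0ℤ))) * - (1ℤ * - b + 0ℤ * a) + (c * (0ℤ + 0ℤ) + d * (1ℤ + 0ℤ)) * (1ℤ * a + - (0ℤ * - b))
      im₁ = solve-∀
    signs 1F (a +i b) (c +i d) = cong₂ _+i_ (re₁ a b c d) (im₁ a b c d)
      where
      re₁ : ∀ a b c d → c * a + - (d * b) ≡ (c * (- 1ℤ + 0ℤ) + - (d * (- 0ℤ + 0ℤ))) * (- 1ℤ * a + - (- 0ℤ * - b)) + - ((c * (- 0ℤ + 0ℤ) + d * (- 1ℤ + 0ℤ)) * - (- 1ℤ * - b + - 0ℤ * a))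
      re₁ = solve-∀
      im₁ : ∀ a b c d → c * b + d * a ≡ (c * (- 1ℤ + 0ℤ) + - (d * (- 0ℤ + 0ℤ))) * - (- 1ℤ * - b + - 0ℤ * a) + (c * (- 0ℤ + 0ℤ) + d * (- 1ℤ + 0ℤ)) * (- 1ℤ * a + - (- 0ℤ * - b))
      im₁ = solve-∀

    norm-sgn : ∀ r w → norm w ≡ 1 → norm (sgn r ⊠ conj w) ≡ 1
    norm-sgn 0F w e = trans (norm-unit-⊠ +1ᵢ (conj w) refl) (trans (norm-conj w) e)
    norm-sgn 1F w e = trans (norm-unit-⊠ -1ᵢ (conj w) refl) (trans (norm-conj w) e)

    through : ∀ a s b → norm s ≡ 1 → ((a ⊠ (-1ᵢ ⊞ 0ᵢ)) ⊠ conj s) ⊠ ((s ⊠ (+1ᵢ ⊞ 0ᵢ)) ⊠ b) ≡ ⊟ (a ⊠ b)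
    through a s b e = begin
      ((a ⊠ -1ᵢ) ⊠ conj s) ⊠ ((s ⊠ +1ᵢ) ⊠ b)   ≡⟨ cong (λ t → ((a ⊠ -1ᵢ) ⊠ conj s) ⊠ (t ⊠ b)) (Gi.*-identityʳ s) ⟩
      ((a ⊠ -1ᵢ) ⊠ conj s) ⊠ (s ⊠ b)           ≡⟨ Gi.*-assoc (a ⊠ -1ᵢ) (conj s) (s ⊠ b) ⟩
      (a ⊠ -1ᵢ) ⊠ (conj s ⊠ (s ⊠ b))           ≡⟨ cong ((a ⊠ -1ᵢ) ⊠_) (Gi.*-assoc (conj s) s b) ⟨
      (a ⊠ -1ᵢ) ⊠ ((conj s ⊠ s) ⊠ b)           ≡⟨ cong (λ t → (a ⊠ -1ᵢ) ⊠ (t ⊠ b)) (trans (Gi.*-comm (conj s) s) (unit-conj s e)) ⟩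
      (a ⊠ -1ᵢ) ⊠ (+1ᵢ ⊠ b)                    ≡⟨ cong₂ _⊠_ (trans (⊠-⊟ a +1ᵢ) (cong ⊟_ (Gi.*-identityʳ a))) (Gi.*-identityˡ b) ⟩
      (⊟ a) ⊠ b                                ≡⟨ ⊟-⊠ a b ⟩
      ⊟ (a ⊠ b)                                ∎
      where open ≡-Reasoning

    -- w₁ x + w₂ y = 0 with units w₁ , w₂ , in the gauge of the new column.
    cancel-gauge : ∀ w₁ w₂ x y → norm w₂ ≡ 1 → (w₁ ⊠ x) ⊞ (w₂ ⊠ y) ≡ 0ᵢ → y ≡ ((sgn 1F ⊠ conj w₂) ⊠ x) ⊠ conj (sgn 0F ⊠ conj w₁)
    cancel-gauge w₁ w₂ x y n₂ e = trans (unit-cancel w₂ y (⊟ (w₁ ⊠ x)) n₂ (⊟-unique (w₁ ⊠ x) (w₂ ⊠ y) e)) (lem w₁ (conj w₂) x)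
      where
      lem : ∀ w c x → c ⊠ (⊟ (w ⊠ x)) ≡ ((-1ᵢ ⊠ c) ⊠ x) ⊠ conj (+1ᵢ ⊠ conj w)
      lem (a +i b) (c +i d) (x +i y) = cong₂ _+i_ (r a b c d x y) (i a b c d x y)
        where
        r : ∀ a b c d x y → c * - (a * x + - (b * y)) + - (d * - (a * y + b * x)) ≡
            ((- 1ℤ * c + - (- 0ℤ * d)) * x + - ((- 1ℤ * d + - 0ℤ * c) * y)) * (1ℤ * a + - (0ℤ * - b)) + - (((- 1ℤ * c + - (- 0ℤ * d)) * y + (- 1ℤ * d + - 0ℤ * c) * x) * - (1ℤ * - b + 0ℤ * a))
        r = solve-∀
        i : ∀ a b c d x y → c * - (a * y + b * x) + d * - (a * x + - (b * y)) ≡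
            ((- 1ℤ * c + - (- 0ℤ * d)) * x + - ((- 1ℤ * d + - 0ℤ * c) * y)) * - (1ℤ * - b + 0ℤ * a) + ((- 1ℤ * c + - (- 0ℤ * d)) * y + (- 1ℤ * d + - 0ℤ * c) * x) * (1ℤ * a + - (0ℤ * - b))
        i = solve-∀

    vanishing : ∀ a b → 0ᵢ ≡ (a ⊠ 0ᵢ) ⊠ b
    vanishing a b = sym (trans (cong (_⊠ b) (Gi.zeroʳ a)) (Gi.zeroˡ b))

    halves : ∀ x r → x ℕ.+ (x ℕ.+ r) ≡ 2 → x ℕ.≤ 1
    halves zero          r e = z≤n
    halves (suc zero)    r e = s≤s z≤n
    halves (suc (suc x)) r e = contradiction (ℕₚ.m+n≡0⇒n≡0 x (ℕₚ.suc-injective (ℕₚ.suc-injective e))) λ ()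

    if-∧-false : ∀ b (z w : ℤ[i]) → (if b ∧ false then z else w) ≡ w
    if-∧-false b z w = cong (λ c → if c then z else w) (∧-zeroʳ b)

  closing : (d : ℤ[i]) → ∀ {k} → LadderVertex k → LadderVertex k → ℤ[i]
  closing d x y = (ladder x y ⊞ firstRung d d x y) ⊞ lastRung +1ᵢ -1ᵢ x y

  private
    closing-deep : ∀ d {k} j r l s → closing d {suc (suc k)} (suc j , r) (suc l , s) ≡ ladder (j , r) (l , s) ⊞ lastRung +1ᵢ -1ᵢ (j , r) (l , s)
    closing-deep d {k} j r l s = cong (_⊞ lastRung {suc k} +1ᵢ -1ᵢ (j , r) (l , s)) (Gi.+-identityʳ (ladder {suc k} (j , r) (l , s)))

    closing-corner : ∀ d {k} r s → closing d {suc (suc k)} (zero , r) (zero , s) ≡ d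
    closing-corner d r s = trans (Gi.+-identityʳ (0ᵢ ⊞ rung d d r s)) (trans (Gi.+-identityˡ (rung d d r s)) (same r s))
      where
      same : ∀ r s → rung d d r s ≡ d
      same 0F 0F = refl
      same 0F 1F = refl
      same 1F 0F = refl
      same 1F 1F = refl

    closing-side : ∀ d {k} r s → closing d {suc (suc k)} (suc zero , s) (zero , r) ≡ sgn r ⊞ 0ᵢ
    closing-side d {k} 0F s = cong ((+1ᵢ ⊞ 0ᵢ) ⊞_) (if-∧-false (isLast {suc (suc k)} (suc zero)) (rung +1ᵢ -1ᵢ s 0F) 0ᵢ)
    closing-side d {k} 1F s = cong ((-1ᵢ ⊞ 0ᵢ) ⊞_) (if-∧-false (isLast {suc (suc k)} (suc zero)) (rung +1ᵢ -1ᵢ s 1F) 0ᵢ)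

    closing-side′ : ∀ d {k} r s → closing d {suc (suc k)} (zero , r) (suc zero , s) ≡ sgn r ⊞ 0ᵢ
    closing-side′ d 0F s = refl
    closing-side′ d 1F s = refl

    closing-far : ∀ d {k} j r s → closing d {suc (suc k)} (suc (suc j) , s) (zero , r) ≡ 0ᵢ
    closing-far d {k} j r s = cong ((0ᵢ ⊞ 0ᵢ) ⊞_) (if-∧-false (isLast {suc (suc k)} (suc (suc j))) (rung +1ᵢ -1ᵢ s r) 0ᵢ)

  module NextColumn {n} {A : Matrix n} (sat : Saturated A) {k} (strip : Strip sat k) (κ : Fin 2 → Fin n)
                    (κ≢ : κ 0F ≢ κ 1F) (nκ : ∀ r → norm (Strip.h strip (κ r)) ≡ 1) where
    open Saturated sat
    open SaturatedFacts sat
    open StripFacts sat strip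

    out : ∀ r x → f x ≢ κ r
    out r = support⇒outside (norm⇒≢0 (nκ r))

    h-other : ∀ v → v ≢ κ 0F → v ≢ κ 1F → h v ≡ 0ᵢ
    h-other = exhausted κ≢ h (trans h-total (cong₂ ℕ._+_ (sym (nκ 0F)) (sym (nκ 1F))))

    ξ : Fin 2 → ℤ[i]
    ξ r = sgn r ⊠ conj (h (κ r))

    nξ : ∀ r → norm (ξ r) ≡ 1
    nξ r = norm-sgn r (h (κ r)) (nκ r)

    d : ℤ[i]
    d = A (κ 0F) (κ 0F)

    relation : ∀ r → (h (κ 0F) ⊠ A (κ 0F) (κ r)) ⊞ (h (κ 1F) ⊠ A (κ 1F) (κ r)) ≡ 0ᵢ
    relation r = trans (sym (trans (erase₂-sum κ≢ h (λ w → A w (κ r))) (cong (λ z → (h (κ 0F) ⊠ A (κ 0F) (κ r)) ⊞ z)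
        (trans (cong ((h (κ 1F) ⊠ A (κ 1F) (κ r)) ⊞_) rest) (Gi.+-identityʳ (h (κ 1F) ⊠ A (κ 1F) (κ r))))))) (h-orth (κ r) (out r))
      where
      z : ∀ w → erase₂ (κ 0F) (κ 1F) h w ≡ 0ᵢ
      z = total≡0 (erase₂ (κ 0F) (κ 1F) h) (ℕₚ.+-cancelˡ-≡ 2 (total (erase₂ (κ 0F) (κ 1F) h)) 0
        (trans (cong₂ (λ x y → x ℕ.+ (y ℕ.+ total (erase₂ (κ 0F) (κ 1F) h))) (sym (nκ 0F)) (sym (nκ 1F))) (trans (sym (erase₂-total κ≢ h)) h-total)))
      rest : Σi (λ w → erase₂ (κ 0F) (κ 1F) h w ⊠ A w (κ r)) ≡ 0ᵢ
      rest = trans (ΣG.sum-cong-≗ λ w → trans (cong (_⊠ A w (κ r)) (z w)) (Gi.zeroˡ (A w (κ r)))) (ΣG.sum-replicate-zero n)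

    d-real : d ≡ re d +i 0ℤ
    d-real = diagonal (κ 0F)

    below : A (κ 1F) (κ 0F) ≡ (ξ 1F ⊠ d) ⊠ conj (ξ 0F)
    below = cancel-gauge (h (κ 0F)) (h (κ 1F)) d (A (κ 1F) (κ 0F)) (nκ 1F) (relation 0F)

    swap-real : ∀ {z} a b t → z ≡ (a ⊠ t) ⊠ conj b → t ≡ re t +i 0ℤ → conj z ≡ (b ⊠ t) ⊠ conj a
    swap-real a b t e real = trans (cong conj (trans e (cong (λ t → (a ⊠ t) ⊠ conj b) real))) (trans (⊠-swap a (re t) b) (cong (λ t → (b ⊠ t) ⊠ conj a) (sym real)))

    above : A (κ 0F) (κ 1F) ≡ (ξ 0F ⊠ d) ⊠ conj (ξ 1F)
    above = trans (herm (κ 0F) (κ 1F)) (swap-real (ξ 1F) (ξ 0F) d below d-real)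

    diagonal₁ : A (κ 1F) (κ 1F) ≡ d
    diagonal₁ = trans (unit-cancel (h (κ 1F)) (A (κ 1F) (κ 1F)) _ (nκ 1F) (trans (⊟-unique (h (κ 0F) ⊠ A (κ 0F) (κ 1F)) _ (relation 1F)) (cong (λ z → ⊟ (h (κ 0F) ⊠ z)) above)))
        (lem (h (κ 0F)) (h (κ 1F)) (nκ 0F) (nκ 1F))
      where
      ring-lem : ∀ w v d → conj v ⊠ (⊟ (w ⊠ (((+1ᵢ ⊠ conj w) ⊠ d) ⊠ conj (-1ᵢ ⊠ conj v)))) ≡ ((w ⊠ conj w) ⊠ (v ⊠ conj v)) ⊠ d
      ring-lem w v d = begin
        conj v ⊠ (⊟ (w ⊠ (((+1ᵢ ⊠ conj w) ⊠ d) ⊠ conj (-1ᵢ ⊠ conj v))))  ≡⟨ cong₂ (λ p q → conj v ⊠ (⊟ (w ⊠ ((p ⊠ d) ⊠ q)))) (Gi.*-identityˡ (conj w)) (flip v) ⟩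
        conj v ⊠ (⊟ (w ⊠ ((conj w ⊠ d) ⊠ (⊟ v))))                        ≡⟨ cong (λ z → conj v ⊠ (⊟ z)) (trans (cong (w ⊠_) (⊠-⊟ (conj w ⊠ d) v)) (⊠-⊟ w ((conj w ⊠ d) ⊠ v))) ⟩
        conj v ⊠ (⊟ (⊟ (w ⊠ ((conj w ⊠ d) ⊠ v))))                        ≡⟨ cong (conj v ⊠_) (⊟-involutive (w ⊠ ((conj w ⊠ d) ⊠ v))) ⟩
        conj v ⊠ (w ⊠ ((conj w ⊠ d) ⊠ v))                                ≡⟨ Gi.*-comm (conj v) _ ⟩
        (w ⊠ ((conj w ⊠ d) ⊠ v)) ⊠ conj v                                ≡⟨ cong (_⊠ conj v) (Gi.*-assoc w (conj w ⊠ d) v) ⟨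
        ((w ⊠ (conj w ⊠ d)) ⊠ v) ⊠ conj v                                ≡⟨ Gi.*-assoc (w ⊠ (conj w ⊠ d)) v (conj v) ⟩
        (w ⊠ (conj w ⊠ d)) ⊠ (v ⊠ conj v)                                ≡⟨ cong (_⊠ (v ⊠ conj v)) (Gi.*-assoc w (conj w) d) ⟨
        ((w ⊠ conj w) ⊠ d) ⊠ (v ⊠ conj v)                                ≡⟨ Gi.*-assoc (w ⊠ conj w) d (v ⊠ conj v) ⟩
        (w ⊠ conj w) ⊠ (d ⊠ (v ⊠ conj v))                                ≡⟨ cong ((w ⊠ conj w) ⊠_) (Gi.*-comm d (v ⊠ conj v)) ⟩
        (w ⊠ conj w) ⊠ ((v ⊠ conj v) ⊠ d)                                ≡⟨ Gi.*-assoc (w ⊠ conj w) (v ⊠ conj v) d ⟨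
        ((w ⊠ conj w) ⊠ (v ⊠ conj v)) ⊠ d                                ∎
        where
        open ≡-Reasoning
        flip : ∀ v → conj (-1ᵢ ⊠ conj v) ≡ ⊟ v
        flip (a +i b) = cong₂ _+i_ (r a b) (i a b)
          where
          r : ∀ a b → - 1ℤ * a + - (- 0ℤ * - b) ≡ - a
          r = solve-∀
          i : ∀ a b → - (- 1ℤ * - b + - 0ℤ * a) ≡ - b
          i = solve-∀
      lem : ∀ w v → norm w ≡ 1 → norm v ≡ 1 → conj v ⊠ (⊟ (w ⊠ (((+1ᵢ ⊠ conj w) ⊠ d) ⊠ conj (-1ᵢ ⊠ conj v)))) ≡ d
      lem w v p q = trans (ring-lem w v d) (trans (cong₂ (λ x y → (x ⊠ y) ⊠ d) (unit-conj w p) (unit-conj v q)) (Gi.*-identityˡ d))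

    f⁺ : LadderVertex (suc (suc k)) → Fin n
    f⁺ (zero  , r) = κ r
    f⁺ (suc j , r) = f (j , r)

    κ-injective : ∀ r s → κ r ≡ κ s → r ≡ s
    κ-injective 0F 0F _ = refl
    κ-injective 0F 1F e = contradiction e κ≢
    κ-injective 1F 0F e = contradiction (sym e) κ≢
    κ-injective 1F 1F _ = refl

    f⁺-injective : ∀ x y → f⁺ x ≡ f⁺ y → x ≡ y
    f⁺-injective (zero  , r) (zero  , s) e = cong (zero ,_) (κ-injective r s e)
    f⁺-injective (zero  , r) (suc l , s) e = contradiction (sym e) (out r (l , s))
    f⁺-injective (suc j , r) (zero  , s) e = contradiction e (out s (j , r))
    f⁺-injective (suc j , r) (suc l , s) e = cong (λ x → suc (proj₁ x) , proj₂ x) (injective (j , r) (l , s) e)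

    ζ⁺ : LadderVertex (suc (suc k)) → ℤ[i]
    ζ⁺ (zero  , r) = ξ r
    ζ⁺ (suc j , r) = ζ (j , r)

    norm-ζ⁺ : ∀ x → norm (ζ⁺ x) ≡ 1
    norm-ζ⁺ (zero  , r) = nξ r
    norm-ζ⁺ (suc j , r) = norm-ζ (j , r)

    corner : ∀ r s → A (κ r) (κ s) ≡ (ξ r ⊠ d) ⊠ conj (ξ s)
    corner 0F 0F = sym (diagonal-gauge (ξ 0F) d (nξ 0F))
    corner 0F 1F = above
    corner 1F 0F = below
    corner 1F 1F = trans diagonal₁ (sym (diagonal-gauge (ξ 1F) d (nξ 1F)))

    side : ∀ r s → A (X s) (κ r) ≡ (ζ (zero , s) ⊠ (sgn r ⊞ 0ᵢ)) ⊠ conj (ξ r)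
    side r s = trans (h-outside s (κ r) (out r)) (signs r (h (κ r)) (ζ (zero , s)))

    side′ : ∀ r s → A (κ r) (X s) ≡ (ξ r ⊠ (sgn r ⊞ 0ᵢ)) ⊠ conj (ζ (zero , s))
    side′ r s = trans (herm (κ r) (X s)) (swap-real (ζ (zero , s)) (ξ r) (sgn r ⊞ 0ᵢ) (side r s) (real r))
      where
      real : ∀ r → sgn r ⊞ 0ᵢ ≡ re (sgn r ⊞ 0ᵢ) +i 0ℤ
      real 0F = refl
      real 1F = refl

    via : ∀ {z} x y t → z ≡ (ζ⁺ x ⊠ t) ⊠ conj (ζ⁺ y) → closing d x y ≡ t → z ≡ (ζ⁺ x ⊠ closing d x y) ⊠ conj (ζ⁺ y)
    via x y t e p = trans e (cong (λ t → (ζ⁺ x ⊠ t) ⊠ conj (ζ⁺ y)) (sym p))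

    table⁺ : ∀ x y → A (f⁺ x) (f⁺ y) ≡ (ζ⁺ x ⊠ closing d x y) ⊠ conj (ζ⁺ y)
    table⁺ (zero  , r) (zero  , s) = via (zero , r) (zero , s) d (corner r s) (closing-corner d {k} r s)
    table⁺ (zero  , r) (suc zero , s) = via (zero , r) (suc zero , s) (sgn r ⊞ 0ᵢ) (side′ r s) (closing-side′ d {k} r s)
    table⁺ (zero  , r) (suc (suc l) , s) = trans (deep l s (κ r) (out r)) (vanishing (ξ r) (conj (ζ (suc l , s))))
    table⁺ (suc zero , r) (zero , s) = via (suc zero , r) (zero , s) (sgn s ⊞ 0ᵢ) (side s r) (closing-side d {k} s r)
    table⁺ (suc (suc j) , r) (zero , s) = via (suc (suc j) , r) (zero , s) 0ᵢ (trans (zero-sym (deep j r (κ s) (out s))) (vanishing (ζ (suc j , r)) (conj (ξ s)))) (closing-far d {k} j s r)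
    table⁺ (suc j , r) (suc l , s) = via (suc j , r) (suc l , s) (ladder (j , r) (l , s) ⊞ lastRung +1ᵢ -1ᵢ (j , r) (l , s)) (table (j , r) (l , s)) (closing-deep d {k} j r l s)

    closed-front : ∀ r v → A (X r) v ≢ 0ᵢ → ∃[ x ] f⁺ x ≡ v
    closed-front r v nz = by (inside? v) (v Finₚ.≟ κ 0F) (v Finₚ.≟ κ 1F)
      where
      by : (∃[ x ] f x ≡ v) ⊎ (∀ x → f x ≢ v) → Dec (v ≡ κ 0F) → Dec (v ≡ κ 1F) → ∃[ x ] f⁺ x ≡ v
      by (inj₁ ((j , s) , e)) _ _    = (suc j , s) , e
      by (inj₂ _) (yes e) _          = (zero , 0F) , sym e
      by (inj₂ _) (no _)  (yes e)    = (zero , 1F) , sym e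
      by (inj₂ o) (no p)  (no q)     = contradiction (trans (h-outside r v o) (trans (cong (ζ (zero , r) ⊠_) (h-other v p q)) (Gi.zeroʳ (ζ (zero , r))))) nz

    closed⁺ : ∀ j r v → A (f⁺ (suc j , r)) v ≢ 0ᵢ → ∃[ x ] f⁺ x ≡ v
    closed⁺ zero    r v nz = closed-front r v nz
    closed⁺ (suc j) r v nz = by (closed j r v nz)
      where
      by : (∃[ x ] f x ≡ v) → ∃[ x ] f⁺ x ≡ v
      by ((j , s) , e) = (suc j , s) , e

    norm-κX : ∀ r s → norm (A (κ r) (X s)) ≡ 1
    norm-κX r s = trans (norm-X (κ r) s (out r)) (nκ r)

    g : Fin 2 → Fin n → ℤ[i]
    g r = erase₂ (X 0F) (X 1F) (A (κ r))

    g-total : ∀ r → total (g r) ≡ 2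
    g-total r = ℕₚ.+-cancelˡ-≡ 2 (total (g r)) 2 (trans (cong₂ (λ y z → y ℕ.+ (z ℕ.+ total (g r))) (sym (norm-κX r 0F)) (sym (norm-κX r 1F))) (trans (sym (erase₂-total X≢ (A (κ r)))) (full (κ r))))

    g-other : ∀ r v → (∀ x → f x ≢ v) → g r v ≡ A (κ r) v
    g-other r v o = erase₂-other X≢ (A (κ r)) v (o (zero , 0F) ∘ sym) (o (zero , 1F) ∘ sym)

    norm-corner : ∀ r s → norm (A (κ r) (κ s)) ≡ norm d
    norm-corner r s = trans (cong norm (corner r s)) (trans (norm-* (ξ r ⊠ d) (conj (ξ s))) (trans (cong₂ ℕ._*_ (norm-unit-⊠ (ξ r) d (nξ r)) (trans (norm-conj (ξ s)) (nξ s))) (ℕₚ.*-identityʳ (norm d))))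

    g-split : ∀ r → norm d ℕ.+ (norm d ℕ.+ total (erase₂ (κ 0F) (κ 1F) (g r))) ≡ 2
    g-split r = trans (sym (trans (erase₂-total κ≢ (g r)) (cong₂ (λ y z → y ℕ.+ (z ℕ.+ total (erase₂ (κ 0F) (κ 1F) (g r)))) (at 0F) (at 1F)))) (g-total r)
      where
      at : ∀ s → norm (g r (κ s)) ≡ norm d
      at s = trans (cong norm (g-other r (κ s) (out s))) (norm-corner r s)

    norm-d : norm d ℕ.≤ 1
    norm-d = halves (norm d) (total (erase₂ (κ 0F) (κ 1F) (g 0F))) (g-split 0F)

    module Open (d≡0 : d ≡ 0ᵢ) where
      h⁺ : Fin n → ℤ[i]
      h⁺ v = conj (ξ 0F) ⊠ g 0F v

      g-zero : ∀ {v} → g 0F v ≡ 0ᵢ → h⁺ v ≡ 0ᵢ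
      g-zero e = trans (cong (conj (ξ 0F) ⊠_) e) (Gi.zeroʳ (conj (ξ 0F)))

      norm-conj-ξ : norm (conj (ξ 0F)) ≡ 1
      norm-conj-ξ = trans (norm-conj (ξ 0F)) (nξ 0F)

      h⁺-inside : ∀ x → h⁺ (f⁺ x) ≡ 0ᵢ
      h⁺-inside (zero , r) = g-zero (trans (g-other 0F (κ r) (out r)) (trans (corner 0F r) (trans (cong (λ z → (ξ 0F ⊠ z) ⊠ conj (ξ r)) d≡0) (sym (vanishing (ξ 0F) (conj (ξ r)))))))
      h⁺-inside (suc zero , 0F) = g-zero (erase₂-fst X≢ (A (κ 0F)))
      h⁺-inside (suc zero , 1F) = g-zero (erase₂-snd X≢ (A (κ 0F)))
      h⁺-inside (suc (suc j) , r) = g-zero (trans (erase₂-other X≢ (A (κ 0F)) (f (suc j , r)) (λ e → apart 0F (injective (suc j , r) (zero , 0F) e)) (λ e → apart 1F (injective (suc j , r) (zero , 1F) e))) (deep j r (κ 0F) (out 0F)))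
        where
        apart : ∀ s → _≢_ {A = LadderVertex (suc k)} (suc j , r) (zero , s)
        apart s ()

      ω : ℤ[i]
      ω = ξ 1F ⊠ conj (ξ 0F)

      agree : ∀ v → g 1F v ≡ ω ⊠ g 0F v
      agree = residual (κ 0F) (κ 1F) (X 0F) (X 1F) κ≢ X≢ ω (trans (norm-unit-⊠ (ξ 1F) (conj (ξ 0F)) (nξ 1F)) norm-conj-ξ)
          (norm-κX 0F 0F) (norm-κX 0F 1F) (norm-κX 1F 0F) (norm-κX 1F 1F) (path 0F) (path 1F)
        where
        path : ∀ s → A (κ 1F) (X s) ⊠ A (X s) (κ 0F) ≡ ⊟ ω
        path s = trans (cong₂ _⊠_ (side′ 1F s) (side 0F s)) (through (ξ 1F) (ζ (zero , s)) (conj (ξ 0F)) (norm-ζ (zero , s)))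

      module _ (v : Fin n) (o : ∀ x → f⁺ x ≢ v) where
        o′ : ∀ x → f x ≢ v
        o′ (j , r) = o (suc j , r)

        h⁺-outside : ∀ r → A (κ r) v ≡ ξ r ⊠ h⁺ v
        h⁺-outside 0F = trans (sym (g-other 0F v o′)) (sym (trans (sym (Gi.*-assoc (ξ 0F) (conj (ξ 0F)) (g 0F v))) (trans (cong (_⊠ g 0F v) (unit-conj (ξ 0F) (nξ 0F))) (Gi.*-identityˡ (g 0F v)))))
        h⁺-outside 1F = trans (sym (g-other 1F v o′)) (trans (agree v) (Gi.*-assoc (ξ 1F) (conj (ξ 0F)) (g 0F v)))

        Xv : ∀ r → A (X r) v ≡ 0ᵢ
        Xv r = trans (h-outside r v o′) (trans (cong (ζ (zero , r) ⊠_) (h-other v (o (zero , 0F) ∘ sym) (o (zero , 1F) ∘ sym))) (Gi.zeroʳ (ζ (zero , r))))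

        g-orth : Σi (λ w → g 0F w ⊠ A w v) ≡ 0ᵢ
        g-orth = trans (sym (trans (erase₂-sum X≢ (A (κ 0F)) (λ w → A w v)) (trans (drop-zero (A (κ 0F) (X 0F)) (Xv 0F)) (drop-zero (A (κ 0F) (X 1F)) (Xv 1F))))) (orth (o (zero , 0F)))

        h⁺-orth : Σi (λ w → h⁺ w ⊠ A w v) ≡ 0ᵢ
        h⁺-orth = trans (ΣG.sum-cong-≗ λ w → Gi.*-assoc (conj (ξ 0F)) (g 0F w) (A w v))
          (trans (sym (ΣG.*-distribˡ-sum (conj (ξ 0F)) (λ w → g 0F w ⊠ A w v))) (trans (cong (conj (ξ 0F) ⊠_) g-orth) (Gi.zeroʳ (conj (ξ 0F)))))

      table-open : ∀ x y → A (f⁺ x) (f⁺ y) ≡ (ζ⁺ x ⊠ (ladder x y ⊞ lastRung +1ᵢ -1ᵢ x y)) ⊠ conj (ζ⁺ y)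
      table-open x y = trans (table⁺ x y) (cong (λ t → (ζ⁺ x ⊠ (t ⊞ lastRung +1ᵢ -1ᵢ x y)) ⊠ conj (ζ⁺ y))
          (trans (cong (λ z → ladder x y ⊞ z) (trans (cong (λ z → firstRung z z x y) d≡0) (blank x y))) (Gi.+-identityʳ (ladder x y))))
        where
        blank-rung : ∀ r s → rung 0ᵢ 0ᵢ r s ≡ 0ᵢ
        blank-rung 0F 0F = refl
        blank-rung 0F 1F = refl
        blank-rung 1F 0F = refl
        blank-rung 1F 1F = refl
        blank : ∀ x y → firstRung {suc (suc k)} 0ᵢ 0ᵢ x y ≡ 0ᵢ
        blank (j , r) (l , s) = by (isFirst j ∧ isFirst l)
          where
          by : ∀ b → (if b then rung 0ᵢ 0ᵢ r s else 0ᵢ) ≡ 0ᵢ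
          by true  = blank-rung r s
          by false = refl

      strip⁺ : Strip sat (suc k)
      strip⁺ = record { f = f⁺ ; injective = f⁺-injective ; ζ = ζ⁺ ; norm-ζ = norm-ζ⁺ ; table = table-open ; closed = closed⁺ ; h = h⁺ ; h-inside = h⁺-inside
        ; h-outside = λ r v o → h⁺-outside v o r
        ; h-total = trans (Σℕ.sum-cong-≗ λ v → norm-unit-⊠ (conj (ξ 0F)) (g 0F v) norm-conj-ξ) (g-total 0F)
        ; h-orth = h⁺-orth }

module LadderEnds where
  open BorderedMatrices
  open GaussianNorms
  open UnextendableMatrices
  open ParityArguments
  open DegreeTwo using (⊟-⊠; ⊠-⊟)
  open LowDegreeVertices using (norm⇒≢0)
  open MonomialEquivalence
  open OrthogonalRows
  open LadderStrips
  open LadderGrowth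
  open import Data.Bool.Base using (if_then_else_; true; false; _∧_)
  open import Data.Fin.Base using (remQuot; combine)
  open import Data.Fin.Patterns using (0F; 1F)
  open import Data.Integer.Base using (+_; 0ℤ; _+_; _*_; -_; _-_)
  open import Data.Sign.Base as Sign using (Sign)

  flip : Fin 2 → Fin 2
  flip 0F = 1F
  flip 1F = 0F

  flip-flip : ∀ r → flip (flip r) ≡ r
  flip-flip 0F = refl
  flip-flip 1F = refl

  turn : ∀ {k} → LadderVertex k → LadderVertex k
  turn (j , r) = j , flip r

  turn-turn : ∀ {k} (x : LadderVertex k) → turn (turn x) ≡ x
  turn-turn (j , r) = cong (j ,_) (flip-flip r)

  private
    if-⊟ : ∀ b {x x′ y y′} → x′ ≡ ⊟ x → y′ ≡ ⊟ y → (if b then x′ else y′) ≡ ⊟ (if b then x else y)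
    if-⊟ true  p q = p
    if-⊟ false p q = q

  ladder-turn : ∀ {k} (x y : LadderVertex k) → ladder (turn x) (turn y) ≡ ⊟ ladder x y
  ladder-turn (j , 0F) (l , 0F) = if-⊟ (Fin.toℕ l ℕ.≡ᵇ suc (Fin.toℕ j)) refl (if-⊟ (Fin.toℕ j ℕ.≡ᵇ suc (Fin.toℕ l)) refl refl)
  ladder-turn (j , 0F) (l , 1F) = if-⊟ (Fin.toℕ l ℕ.≡ᵇ suc (Fin.toℕ j)) refl (if-⊟ (Fin.toℕ j ℕ.≡ᵇ suc (Fin.toℕ l)) refl refl)
  ladder-turn (j , 1F) (l , 0F) = if-⊟ (Fin.toℕ l ℕ.≡ᵇ suc (Fin.toℕ j)) refl (if-⊟ (Fin.toℕ j ℕ.≡ᵇ suc (Fin.toℕ l)) refl refl)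
  ladder-turn (j , 1F) (l , 1F) = if-⊟ (Fin.toℕ l ℕ.≡ᵇ suc (Fin.toℕ j)) refl (if-⊟ (Fin.toℕ j ℕ.≡ᵇ suc (Fin.toℕ l)) refl refl)

  rung-turn : ∀ {c w c′ w′} → c′ ≡ ⊟ c → w′ ≡ ⊟ w → ∀ r s → rung c′ w′ (flip r) (flip s) ≡ ⊟ rung c w r s
  rung-turn p q 0F 0F = p
  rung-turn p q 0F 1F = q
  rung-turn p q 1F 0F = q
  rung-turn p q 1F 1F = p

  closing-turn : ∀ {k} (x y : LadderVertex k) → closing -1ᵢ (turn x) (turn y) ≡ ⊟ ((ladder x y ⊞ firstRung +1ᵢ +1ᵢ x y) ⊞ lastRung -1ᵢ +1ᵢ x y)
  closing-turn x@(j , r) y@(l , s) = trans (cong₂ _⊞_ (cong₂ _⊞_ (ladder-turn x y) (if-⊟ (isFirst j ∧ isFirst l) (rung-turn refl refl r s) refl)) (if-⊟ (isLast j ∧ isLast l) (rung-turn refl refl r s) refl))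
    (trans (cong (_⊞ (⊟ (lastRung -1ᵢ +1ᵢ x y))) (⊟-⊞ (ladder x y) (firstRung +1ᵢ +1ᵢ x y))) (⊟-⊞ (ladder x y ⊞ firstRung +1ᵢ +1ᵢ x y) (lastRung -1ᵢ +1ᵢ x y)))
    where
    ⊟-⊞ : ∀ x y → (⊟ x) ⊞ (⊟ y) ≡ ⊟ (x ⊞ y)
    ⊟-⊞ (a +i b) (c +i d) = cong₂ _+i_ (sym (ℤₚ.neg-distrib-+ a c)) (sym (ℤₚ.neg-distrib-+ b d))

  norm-two : ∀ z → norm z ≡ 2 → ∃[ c ] norm c ≡ 1 × z ≡ 1+i ⊠ c
  norm-two z e = by (even-of-norm z (λ e₁ → 2≢1 (trans (sym e) e₁)) (ℕₚ.≤-trans (ℕₚ.≤-reflexive e) (s≤s (s≤s z≤n))))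
    where
    2≢1 : 2 ≢ 1
    2≢1 ()
    by : Even z → ∃[ c ] norm c ≡ 1 × z ≡ 1+i ⊠ c
    by (c , p) = c , ℕₚ.*-cancelˡ-≡ (norm c) 1 2 (trans (sym (norm-* 1+i c)) (trans (cong norm (sym p)) e)) , p

  module _ {n} {A : Matrix n} (sat : Saturated A) where
    open Saturated sat
    open SaturatedFacts sat

    from-table : ∀ {m} (T : LadderVertex m → LadderVertex m → ℤ[i]) (f : LadderVertex m → Fin n) → (∀ x y → f x ≡ f y → x ≡ y) →
      (∀ x v → A (f x) v ≢ 0ᵢ → ∃[ y ] f y ≡ v) → ∀ ζ → (∀ x → norm (ζ x) ≡ 1) → ∀ s → (∀ x y → A (f x) (f y) ≡ signed s ((ζ x ⊠ T x y) ⊠ conj (ζ y))) →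
      Realises A (λ u v → T (remQuot 2 u) (remQuot 2 v))
    from-table {m} T f inj cl ζ nζ s entries = record
      { f = f ∘ remQuot 2
      ; injective = λ u v e → remQuot-injective {m} u v (inj (remQuot 2 u) (remQuot 2 v) e)
      ; closed = λ u v nz → index v (cl (remQuot 2 u) v nz)
      ; ζ = ζ ∘ remQuot 2 ; norm-ζ = λ u → nζ (remQuot 2 u) ; s = s ; σ = identity
      ; entries = λ u v → entries (remQuot 2 u) (remQuot 2 v) }
      where
      index : ∀ v → (∃[ y ] f y ≡ v) → ∃[ u ] f (remQuot {m} 2 u) ≡ v
      index v ((j , r) , e) = combine j r , trans (cong f (Finₚ.remQuot-combine j r)) e

    module Even-end {k} (strip : Strip sat k) (κ : Fin 2 → Fin n) (κ≢ : κ 0F ≢ κ 1F) (nκ : ∀ r → norm (Strip.h strip (κ r)) ≡ 1) where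
      open NextColumn sat strip κ κ≢ nκ
      open StripFacts sat strip using (inside?; X)

      module _ (nd : norm d ≡ 1) where
        g-rest : ∀ r → total (erase₂ (κ 0F) (κ 1F) (g r)) ≡ 0
        g-rest r = ℕₚ.+-cancelˡ-≡ 2 (total (erase₂ (κ 0F) (κ 1F) (g r))) 0 (trans (cong (λ m → m ℕ.+ (m ℕ.+ total (erase₂ (κ 0F) (κ 1F) (g r)))) (sym nd)) (g-split r))

        closed-all : ∀ x v → A (f⁺ x) v ≢ 0ᵢ → ∃[ y ] f⁺ y ≡ v
        closed-all (suc j , r) v nz = closed⁺ j r v nz
        closed-all (zero  , r) v nz = by (inside? v) (v Finₚ.≟ κ 0F) (v Finₚ.≟ κ 1F)
          where
          by : (∃[ x ] Strip.f strip x ≡ v) ⊎ (∀ x → Strip.f strip x ≢ v) → Dec (v ≡ κ 0F) → Dec (v ≡ κ 1F) → ∃[ y ] f⁺ y ≡ v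
          by (inj₁ ((j , s) , e)) _ _ = (suc j , s) , e
          by (inj₂ _) (yes e) _       = (zero , 0F) , sym e
          by (inj₂ _) (no _) (yes e)  = (zero , 1F) , sym e
          by (inj₂ o) (no p) (no q)   = contradiction (trans (sym (g-other r v o)) (trans (sym (erase₂-other κ≢ (g r) v p q)) (total≡0 (erase₂ (κ 0F) (κ 1F) (g r)) (g-rest r) v))) nz

        finish-even : Equivalent A
        finish-even = by d refl (isUnit d nd) (cong im d-real)
          where
          by : ∀ z → d ≡ z → IsUnit z → im z ≡ 0ℤ → Equivalent A
          by _ e u₁  _ = realises⇒equivalent conn (C⁺⁺ (suc (suc k)) (s≤s (s≤s z≤n)))
            (from-table (closing +1ᵢ) f⁺ f⁺-injective closed-all ζ⁺ norm-ζ⁺ Sign.+ λ x y → trans (table⁺ x y) (cong (λ z → (ζ⁺ x ⊠ closing z x y) ⊠ conj (ζ⁺ y)) e))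
          by _ e u₋₁ _ = realises⇒equivalent conn (C⁺⁻ (suc (suc k)) (s≤s (s≤s z≤n)))
            (from-table T (f⁺ ∘ turn) (λ x y p → trans (sym (turn-turn x)) (trans (cong turn (f⁺-injective (turn x) (turn y) p)) (turn-turn y)))
              closed-turn (ζ⁺ ∘ turn) (norm-ζ⁺ ∘ turn) Sign.- entries)
            where
            T : LadderVertex (suc (suc k)) → LadderVertex (suc (suc k)) → ℤ[i]
            T x y = (ladder x y ⊞ firstRung +1ᵢ +1ᵢ x y) ⊞ lastRung -1ᵢ +1ᵢ x y
            closed-turn : ∀ x v → A (f⁺ (turn x)) v ≢ 0ᵢ → ∃[ y ] f⁺ (turn y) ≡ v
            closed-turn x v nz = unturn (closed-all (turn x) v nz)
              where
              unturn : (∃[ y ] f⁺ y ≡ v) → ∃[ y ] f⁺ (turn y) ≡ v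
              unturn (y , e) = turn y , trans (cong f⁺ (turn-turn y)) e
            entries : ∀ x y → A (f⁺ (turn x)) (f⁺ (turn y)) ≡ ⊟ ((ζ⁺ (turn x) ⊠ T x y) ⊠ conj (ζ⁺ (turn y)))
            entries x y = trans (table⁺ (turn x) (turn y)) (trans (cong (λ z → (ζ⁺ (turn x) ⊠ z) ⊠ conj (ζ⁺ (turn y))) (trans (cong (λ z → closing z (turn x) (turn y)) e) (closing-turn x y)))
              (trans (cong (_⊠ conj (ζ⁺ (turn y))) (⊠-⊟ (ζ⁺ (turn x)) (T x y))) (⊟-⊠ (ζ⁺ (turn x) ⊠ T x y) (conj (ζ⁺ (turn y))))))
          by _ _ uᵢ  ()
          by _ _ u₋ᵢ ()

      next : Equivalent A ⊎ Strip sat (suc k)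
      next = by (norm d) refl norm-d
        where
        by : ∀ m → norm d ≡ m → m ℕ.≤ 1 → Equivalent A ⊎ Strip sat (suc k)
        by zero          e _ = inj₂ (Open.strip⁺ (norm≡0 e))
        by (suc zero)    e _ = inj₁ (finish-even e)
        by (suc (suc _)) _ (s≤s ())

    module Odd-end {k} (strip : Strip sat k) (z : Fin n) (nz : norm (Strip.h strip z) ≡ 2) where
      open StripFacts sat strip

      out : ∀ x → f x ≢ z
      out = support⇒outside (norm⇒≢0 nz)

      h-other : ∀ v → v ≢ z → h v ≡ 0ᵢ
      h-other v v≢z = trans (sym (erase-other z v h (v≢z ∘ sym))) (total≡0 (erase z h) (ℕₚ.+-cancelˡ-≡ 2 (total (erase z h)) 0
        (trans (cong (ℕ._+ total (erase z h)) (sym nz)) (trans (sym (erase-total z h)) h-total))) v)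

      z-other : ∀ v → v ≢ X 0F → v ≢ X 1F → A z v ≡ 0ᵢ
      z-other = exhausted X≢ (A z) (trans (full z) (sym (cong₂ ℕ._+_ (trans (norm-X z 0F out) nz) (trans (norm-X z 1F out) nz))))

      module _ (c : ℤ[i]) (nc : norm c ≡ 1) (hz : h z ≡ 1+i ⊠ c) where
        toP : LadderVertex (suc k) → ℤ[i]
        toP (j , _) = if isFirst j then 1+i else 0ᵢ

        F : Fin (suc (suc k ℕ.* 2)) → Fin n
        F zero    = z
        F (suc u) = f (remQuot 2 u)

        F-injective : Injective F
        F-injective zero    zero    _ = refl
        F-injective zero    (suc v) e = contradiction (sym e) (out (remQuot 2 v))
        F-injective (suc u) zero    e = contradiction e (out (remQuot 2 u))
        F-injective (suc u) (suc v) e = cong suc (remQuot-injective {suc k} u v (injective (remQuot 2 u) (remQuot 2 v) e))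

        index : ∀ {v} → (∃[ x ] f x ≡ v) → ∃[ u ] F u ≡ v
        index ((j , r) , e) = suc (combine j r) , trans (cong f (Finₚ.remQuot-combine j r)) e

        closed-at : ∀ x v → A (f x) v ≢ 0ᵢ → ∃[ u ] F u ≡ v
        closed-at (suc j , r) v ne = index (closed j r v ne)
        closed-at (zero  , r) v ne = by (inside? v) (v Finₚ.≟ z)
          where
          by : (∃[ x ] f x ≡ v) ⊎ (∀ x → f x ≢ v) → Dec (v ≡ z) → ∃[ u ] F u ≡ v
          by (inj₁ p) _       = index p
          by (inj₂ _) (yes e) = zero , sym e
          by (inj₂ o) (no p)  = contradiction (trans (h-outside r v o) (trans (cong (ζ (zero , r) ⊠_) (h-other v p)) (Gi.zeroʳ (ζ (zero , r))))) ne

        F-closed : Closed A F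
        F-closed (suc u) v ne = closed-at (remQuot 2 u) v ne
        F-closed zero    v ne = by (v Finₚ.≟ X 0F) (v Finₚ.≟ X 1F)
          where
          by : Dec (v ≡ X 0F) → Dec (v ≡ X 1F) → ∃[ u ] F u ≡ v
          by (yes e) _       = index ((zero , 0F) , sym e)
          by (no _) (yes e)  = index ((zero , 1F) , sym e)
          by (no p) (no q)   = contradiction (z-other v p q) ne

        ζF : Fin (suc (suc k ℕ.* 2)) → ℤ[i]
        ζF zero    = conj c
        ζF (suc u) = ζ (remQuot 2 u)

        to-z : ∀ x → A (f x) z ≡ (ζ x ⊠ toP x) ⊠ conj (conj c)
        to-z (zero  , r) = trans (h-outside r z out) (trans (cong (ζ (zero , r) ⊠_) hz) (trans (sym (Gi.*-assoc (ζ (zero , r)) 1+i c)) (cong ((ζ (zero , r) ⊠ 1+i) ⊠_) (sym (conj-conj c)))))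
        to-z (suc j , r) = trans (zero-sym (deep j r z out)) (sym (trans (cong (_⊠ conj (conj c)) (Gi.zeroʳ (ζ (suc j , r)))) (Gi.zeroˡ (conj (conj c)))))

        from-z : ∀ x → A z (f x) ≡ (conj c ⊠ conj (toP x)) ⊠ conj (ζ x)
        from-z x = trans (herm z (f x)) (trans (cong conj (to-z x)) (conj-gauge (ζ x) (toP x) (conj c)))

        entries : ∀ u v → A (F u) (F v) ≡ (ζF u ⊠ C₂ₖ₊₁ (suc k) u v) ⊠ conj (ζF v)
        entries zero    zero    = trans (z-other z (out (zero , 0F) ∘ sym) (out (zero , 1F) ∘ sym)) (sym (trans (cong (_⊠ conj (conj c)) (Gi.zeroʳ (conj c))) (Gi.zeroˡ (conj (conj c)))))
        entries (suc u) zero    = to-z (remQuot 2 u)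
        entries zero    (suc v) = from-z (remQuot 2 v)
        entries (suc u) (suc v) = table (remQuot 2 u) (remQuot 2 v)

        finish-odd : Equivalent A
        finish-odd = realises⇒equivalent conn (Cᵒᵈᵈ (suc k) (s≤s z≤n)) (record
          { f = F ; injective = F-injective ; closed = F-closed ; ζ = ζF ; norm-ζ = norm-ζF ; s = Sign.+ ; σ = identity ; entries = entries })
          where
          norm-ζF : ∀ u → norm (ζF u) ≡ 1
          norm-ζF zero    = trans (norm-conj c) nc
          norm-ζF (suc u) = norm-ζ (remQuot 2 u)

    step : ∀ {k} → Strip sat k → Equivalent A ⊎ Strip sat (suc k)
    step {k} strip = by (support 2 h h-total)
      where
      open Strip strip
      by : SupportOf h 2 → Equivalent A ⊎ Strip sat (suc k)
      by ([] , _ , _ , ())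
      by ((z , w) ∷ [] , e , (_ , _) , wt) = inj₁ (finish (norm-two (h z) nz))
        where
        nz : norm (h z) ≡ 2
        nz = trans (cong norm (trans (e z) (⟦⟧-head z w [] tt))) (trans (sym (ℕₚ.+-identityʳ (norm w))) wt)
        finish : (∃[ c ] norm c ≡ 1 × h z ≡ 1+i ⊠ c) → Equivalent A
        finish (c , nc , hz) = Odd-end.finish-odd strip z nz c nc hz
      by ((p , x) ∷ (q , y) ∷ ws , e , (1≤x , (p≢q , p∉) , 1≤y , q∉ , _) , wt) = Even-end.next strip κ p≢q nκ
        where
        ones : ∀ a b c → 1 ℕ.≤ a → 1 ℕ.≤ b → a ℕ.+ (b ℕ.+ c) ≡ 2 → a ≡ 1 × b ≡ 1
        ones (suc zero)    (suc zero)    _ _ _ _ = refl , refl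
        ones (suc zero)    (suc (suc b)) _ _ _ ()
        ones (suc (suc a)) (suc b)       c _ _ e = contradiction (ℕₚ.m+n≡0⇒n≡0 a (ℕₚ.suc-injective (ℕₚ.suc-injective e))) λ ()
        κ : Fin 2 → Fin n
        κ 0F = p
        κ 1F = q
        nκ : ∀ r → norm (h (κ r)) ≡ 1
        nκ 0F = trans (cong norm (trans (e p) (⟦⟧-head p x ((q , y) ∷ ws) (p≢q , p∉)))) (proj₁ (ones (norm x) (norm y) (weight ws) 1≤x 1≤y wt))
        nκ 1F = trans (cong norm (trans (e q) (trans (⟦⟧-tail p x ((q , y) ∷ ws) q (p≢q ∘ sym)) (⟦⟧-head q y ws q∉)))) (proj₂ (ones (norm x) (norm y) (weight ws) 1≤x 1≤y wt))

    grow : ∀ fuel {k} → k ℕ.+ fuel ≡ n → Strip sat k → Equivalent A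
    grow zero       {k} e strip = contradiction (subst (λ m → suc k ℕ.* 2 ℕ.≤ m) (trans (sym e) (ℕₚ.+-identityʳ k)) (StripFacts.size sat strip))
      (ℕₚ.<⇒≱ (ℕₚ.≤-trans (ℕₚ.m≤m*n (suc k) 2) ℕₚ.≤-refl))
    grow (suc fuel) {k} e strip = by (step strip)
      where
      by : Equivalent A ⊎ Strip sat (suc k) → Equivalent A
      by (inj₁ done)   = done
      by (inj₂ strip′) = grow fuel (trans (sym (ℕₚ.+-suc k fuel)) e) strip′

    rung⇒equivalent : ∀ {u x} → u ≢ x → A u u ≡ +1ᵢ → A x x ≡ +1ᵢ → norm (A u x) ≡ 1 → Equivalent A
    rung⇒equivalent u≢x uu xx ux = grow n refl (Start.strip sat u≢x uu xx ux)

module TableSearch where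
  open BorderedMatrices using (border)
  open GaussianNorms
  open UnextendableMatrices using (sq)
  open import Data.Bool.Base using (Bool; true; false; _∧_; _∨_; not; if_then_else_)
  open import Data.Fin.Patterns using (0F; 1F; 2F; 3F; 4F; 5F; 6F; 7F)
  open import Data.Integer.Base using (+_; -[1+_])
  open import Data.Maybe.Base using (Maybe; just; nothing; maybe)
  open import Data.Nat.Base using (_≤ᵇ_; _≡ᵇ_; _∸_)
  open import Data.Sign.Base as Sign using (Sign)
  open import Data.Vec.Base using (Vec; []; _∷_; lookup)
  open import Relation.Nullary.Decidable using (⌊_⌋)

  infixr 4 _⇒_

  _⇒_ : Bool → Bool → Bool
  p ⇒ q = not p ∨ q

  every some : ∀ {m} → (Fin m → Bool) → Bool
  every {zero}  p = true
  every {suc m} p = p zero ∧ every (p ∘ suc)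
  some {zero}  p = false
  some {suc m} p = p zero ∨ some (p ∘ suc)

  all any : ∀ {X : Set} → (X → Bool) → List X → Bool
  all p []       = true
  all p (x ∷ xs) = p x ∧ all p xs
  any p []       = false
  any p (x ∷ xs) = p x ∨ any p xs

  last : ∀ {m} → (Fin m → Bool) → Maybe (Fin m)
  last {zero}  p = nothing
  last {suc m} p = maybe (just ∘ suc) (if p zero then just zero else nothing) (last (p ∘ suc))

  equal : ℤ[i] → ℤ[i] → Bool
  equal x y = norm (x ⊞ ⊟ y) ≡ᵇ 0

  -i : ℤ[i]
  -i = ⊟ ℤi.i

  -- The Gaussian integers of norm at most 4, and representatives of the nonzero ones up to units.
  small representatives : List ℤ[i]
  small = 0ᵢ ∷ (+ 1 +i + 0) ∷ (+ 0 +i + 1) ∷ (-[1+ 0 ] +i + 0) ∷ (+ 0 +i -[1+ 0 ])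
    ∷ (+ 1 +i + 1) ∷ (-[1+ 0 ] +i + 1) ∷ (-[1+ 0 ] +i -[1+ 0 ]) ∷ (+ 1 +i -[1+ 0 ])
    ∷ (+ 2 +i + 0) ∷ (+ 0 +i + 2) ∷ (-[1+ 1 ] +i + 0) ∷ (+ 0 +i -[1+ 1 ]) ∷ []
  representatives = (+ 1 +i + 0) ∷ (+ 1 +i + 1) ∷ (+ 2 +i + 0) ∷ []

  charges : List ℤ
  charges = + 0 ∷ + 1 ∷ -[1+ 0 ] ∷ + 2 ∷ -[1+ 1 ] ∷ []

  cons : ∀ {m} {X : Set} → X → (Fin m → X) → Fin (suc m) → X
  cons x c zero    = x
  cons x c (suc b) = c b

  columns : ∀ {m} → (Fin m → List ℤ[i]) → (Fin m → ℕ) → ℕ → ((Fin m → ℤ[i]) → ℕ → Bool) → Bool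
  columns {zero}  options room left k = k (λ ()) left
  columns {suc m} options room left k =
    all (λ z → (norm z ≤ᵇ room zero) ∧ (norm z ≤ᵇ left) ⇒ columns (options ∘ suc) (room ∘ suc) (left ∸ norm z) (λ c → k (cons z c))) (options zero)

  complete : ∀ {m} → Matrix m → Fin m → Bool
  complete B a = total (B a) ≡ᵇ 4

  valid : ∀ {m} → Matrix m → Bool
  valid B = every λ a → complete B a ⇒ every λ b → ⌊ a Finₚ.≟ b ⌋ ∨ (norm (sq B a b) ≡ᵇ 0)

  isRung : ∀ {m} → Matrix m → Fin m → Fin m → Bool
  isRung B a b = not ⌊ a Finₚ.≟ b ⌋ ∧ ((norm (B a b) ≡ᵇ 1) ∧ ((norm (B a a) ≡ᵇ 1) ∧ equal (B a a) (B b b)))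

  record Certificate (m : ℕ) : Set where
    constructor certificate
    field
      {T}    : Matrix (suc m)
      listed : IsListed T
      s      : Sign
      π      : Vec (Fin (suc m)) (suc m)
      ζ      : Vec ℤ[i] (suc m)

  module _ {m} (B : Matrix (suc m)) (C : Certificate m) where
    open Certificate C

    certifiesEntry : Fin (suc m) → Fin (suc m) → Bool
    certifiesEntry a b = equal (B (lookup π a) (lookup π b)) (signed s ((lookup ζ a ⊠ T a b) ⊠ conj (lookup ζ b)))
      ∧ (⌊ lookup π a Finₚ.≟ lookup π b ⌋ ⇒ ⌊ a Finₚ.≟ b ⌋)

    hits : Fin (suc m) → Fin (suc m) → Bool
    hits a b = ⌊ lookup π b Finₚ.≟ a ⌋

    certifiesRow : Fin (suc m) → Bool
    certifiesRow a = every (certifiesEntry a) ∧ ((norm (lookup ζ a) ≡ᵇ 1) ∧ some (hits a))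

    certifies : Bool
    certifies = every certifiesRow

  certificates : ∀ m → List (Certificate m)
  certificates 3 =
      certificate S4† Sign.+ (3F ∷ 2F ∷ 1F ∷ 0F ∷ []) (+1ᵢ ∷ +1ᵢ ∷ -i ∷ -1ᵢ ∷ [])
    ∷ certificate S4† Sign.+ (3F ∷ 0F ∷ 1F ∷ 2F ∷ []) (+1ᵢ ∷ +1ᵢ ∷ -i ∷ -1ᵢ ∷ [])
    ∷ certificate S4† Sign.+ (3F ∷ 1F ∷ 0F ∷ 2F ∷ []) (+1ᵢ ∷ +1ᵢ ∷ -i ∷ -1ᵢ ∷ [])
    ∷ certificate S4† Sign.+ (3F ∷ 2F ∷ 0F ∷ 1F ∷ []) (+1ᵢ ∷ +1ᵢ ∷ -i ∷ -1ᵢ ∷ [])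
    ∷ certificate S4 Sign.+ (0F ∷ 1F ∷ 2F ∷ 3F ∷ []) (+1ᵢ ∷ -1ᵢ ∷ -i ∷ -i ∷ [])
    ∷ certificate S4† Sign.+ (3F ∷ 0F ∷ 2F ∷ 1F ∷ []) (+1ᵢ ∷ +1ᵢ ∷ -i ∷ -1ᵢ ∷ [])
    ∷ certificate S4† Sign.+ (3F ∷ 1F ∷ 2F ∷ 0F ∷ []) (+1ᵢ ∷ +1ᵢ ∷ -i ∷ -1ᵢ ∷ [])
    ∷ certificate S4 Sign.+ (0F ∷ 2F ∷ 1F ∷ 3F ∷ []) (+1ᵢ ∷ +1ᵢ ∷ ℤi.i ∷ ℤi.i ∷ [])
    ∷ []
  certificates 6 =
      certificate S7 Sign.+ (0F ∷ 1F ∷ 3F ∷ 4F ∷ 2F ∷ 6F ∷ 5F ∷ []) (+1ᵢ ∷ -1ᵢ ∷ +1ᵢ ∷ +1ᵢ ∷ -1ᵢ ∷ +1ᵢ ∷ -1ᵢ ∷ [])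
    ∷ certificate S7 Sign.+ (0F ∷ 2F ∷ 3F ∷ 4F ∷ 1F ∷ 6F ∷ 5F ∷ []) (+1ᵢ ∷ -1ᵢ ∷ +1ᵢ ∷ +1ᵢ ∷ -1ᵢ ∷ +1ᵢ ∷ -1ᵢ ∷ [])
    ∷ certificate S7 Sign.+ (0F ∷ 2F ∷ 4F ∷ 3F ∷ 1F ∷ 6F ∷ 5F ∷ []) (+1ᵢ ∷ +1ᵢ ∷ -1ᵢ ∷ -1ᵢ ∷ +1ᵢ ∷ -1ᵢ ∷ +1ᵢ ∷ [])
    ∷ certificate S7 Sign.+ (0F ∷ 1F ∷ 4F ∷ 3F ∷ 2F ∷ 6F ∷ 5F ∷ []) (+1ᵢ ∷ +1ᵢ ∷ -1ᵢ ∷ -1ᵢ ∷ +1ᵢ ∷ -1ᵢ ∷ +1ᵢ ∷ [])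
    ∷ certificate S7 Sign.+ (1F ∷ 0F ∷ 3F ∷ 5F ∷ 2F ∷ 6F ∷ 4F ∷ []) (+1ᵢ ∷ -1ᵢ ∷ +1ᵢ ∷ +1ᵢ ∷ +1ᵢ ∷ +1ᵢ ∷ -1ᵢ ∷ [])
    ∷ certificate S7 Sign.+ (1F ∷ 0F ∷ 4F ∷ 5F ∷ 2F ∷ 6F ∷ 3F ∷ []) (+1ᵢ ∷ +1ᵢ ∷ +1ᵢ ∷ +1ᵢ ∷ +1ᵢ ∷ +1ᵢ ∷ -1ᵢ ∷ [])
    ∷ certificate S7 Sign.- (3F ∷ 0F ∷ 1F ∷ 6F ∷ 4F ∷ 5F ∷ 2F ∷ []) (+1ᵢ ∷ +1ᵢ ∷ -1ᵢ ∷ -1ᵢ ∷ +1ᵢ ∷ +1ᵢ ∷ +1ᵢ ∷ [])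
    ∷ certificate S7 Sign.- (3F ∷ 0F ∷ 2F ∷ 6F ∷ 4F ∷ 5F ∷ 1F ∷ []) (+1ᵢ ∷ +1ᵢ ∷ -1ᵢ ∷ -1ᵢ ∷ +1ᵢ ∷ +1ᵢ ∷ +1ᵢ ∷ [])
    ∷ []
  certificates 7 =
      certificate S8′ Sign.+ (2F ∷ 0F ∷ 4F ∷ 1F ∷ 6F ∷ 3F ∷ 7F ∷ 5F ∷ []) (+1ᵢ ∷ -1ᵢ ∷ -1ᵢ ∷ -1ᵢ ∷ +1ᵢ ∷ +1ᵢ ∷ -1ᵢ ∷ -1ᵢ ∷ [])
    ∷ certificate S8′ Sign.+ (3F ∷ 0F ∷ 4F ∷ 1F ∷ 6F ∷ 2F ∷ 7F ∷ 5F ∷ []) (+1ᵢ ∷ +1ᵢ ∷ -1ᵢ ∷ -1ᵢ ∷ +1ᵢ ∷ +1ᵢ ∷ -1ᵢ ∷ -1ᵢ ∷ [])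
    ∷ certificate S8′ Sign.+ (3F ∷ 0F ∷ 5F ∷ 1F ∷ 6F ∷ 2F ∷ 7F ∷ 4F ∷ []) (+1ᵢ ∷ +1ᵢ ∷ -1ᵢ ∷ +1ᵢ ∷ +1ᵢ ∷ +1ᵢ ∷ -1ᵢ ∷ -1ᵢ ∷ [])
    ∷ certificate S8′ Sign.+ (2F ∷ 0F ∷ 5F ∷ 1F ∷ 6F ∷ 3F ∷ 7F ∷ 4F ∷ []) (+1ᵢ ∷ -1ᵢ ∷ -1ᵢ ∷ +1ᵢ ∷ +1ᵢ ∷ +1ᵢ ∷ -1ᵢ ∷ -1ᵢ ∷ [])
    ∷ certificate S8′ Sign.+ (1F ∷ 0F ∷ 4F ∷ 2F ∷ 5F ∷ 3F ∷ 7F ∷ 6F ∷ []) (+1ᵢ ∷ +1ᵢ ∷ -1ᵢ ∷ -1ᵢ ∷ +1ᵢ ∷ -1ᵢ ∷ -1ᵢ ∷ -1ᵢ ∷ [])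
    ∷ certificate S8′ Sign.+ (1F ∷ 0F ∷ 4F ∷ 3F ∷ 5F ∷ 2F ∷ 7F ∷ 6F ∷ []) (+1ᵢ ∷ -1ᵢ ∷ -1ᵢ ∷ -1ᵢ ∷ +1ᵢ ∷ -1ᵢ ∷ -1ᵢ ∷ -1ᵢ ∷ [])
    ∷ certificate S8 Sign.+ (0F ∷ 1F ∷ 2F ∷ 4F ∷ 3F ∷ 5F ∷ 6F ∷ 7F ∷ []) (+1ᵢ ∷ +1ᵢ ∷ +1ᵢ ∷ -1ᵢ ∷ +1ᵢ ∷ -1ᵢ ∷ +1ᵢ ∷ -1ᵢ ∷ [])
    ∷ certificate S8 Sign.+ (0F ∷ 1F ∷ 2F ∷ 5F ∷ 3F ∷ 4F ∷ 6F ∷ 7F ∷ []) (+1ᵢ ∷ -1ᵢ ∷ +1ᵢ ∷ -1ᵢ ∷ +1ᵢ ∷ -1ᵢ ∷ +1ᵢ ∷ -1ᵢ ∷ [])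
    ∷ []
  certificates _ = []

  -- B is the table of a principal submatrix. Unless it contains the rung of a ladder, its last row of
  -- norm less than 4 has a further neighbour, and all columns this vertex may have are tried.
  search : ℕ → ∀ {m} → Matrix (suc m) → Bool
  branch : ℕ → ∀ {m} → Matrix (suc m) → Maybe (Fin (suc m)) → Bool
  search zero       B = false
  search (suc fuel) B = valid B ⇒ (some λ a → some (isRung B a)) ∨ branch fuel B (last (not ∘ complete B))
  branch fuel {m} B nothing  = any (certifies B) (certificates m)
  branch fuel     B (just a) =
    columns (λ b → if ⌊ a Finₚ.≟ b ⌋ then representatives else small) (λ b → 4 ∸ total (B b)) 4
      λ c left → all (λ d → (norm (d +i + 0) ≤ᵇ left) ⇒ search fuel (border B c d)) charges

  abstract
    search-succeeds : search 9 {0} (λ _ _ → +1ᵢ) ≡ true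
    search-succeeds = refl

module SearchLemmas where
  open InnerProduct
  open BorderedMatrices
  open GaussianNorms
  open UnextendableMatrices
  open ParityArguments
  open MonomialEquivalence
  open OrthogonalRows
  open LadderEnds
  open TableSearch
  open import Data.Bool.Base using (if_then_else_; true; false; Bool; _∧_; _∨_; not)
  open import Data.Integer.Base using (+_; -[1+_]; 0ℤ; _+_)
  open import Data.Bool.Properties using (T-≡)
  open import Data.List.Membership.Propositional using (_∈_)
  open import Data.List.Relation.Unary.Any using (here; there)
  import Data.List.Membership.DecPropositional _≟ᵢ_ as Gaussian
  open import Data.Maybe.Base using (just; nothing; maybe)
  open import Function.Bundles using (Equivalence)
  open import Relation.Nullary.Decidable using (⌊_⌋; True; toWitness; isYes≗does; dec-true; dec-false)

  ∧-true : ∀ p {q} → p ∧ q ≡ true → p ≡ true × q ≡ true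
  ∧-true true e = refl , e

  ∨-true : ∀ p {q} → p ∨ q ≡ true → p ≡ true ⊎ q ≡ true
  ∨-true true  e = inj₁ refl
  ∨-true false e = inj₂ e

  ⇒-true : ∀ p {q} → (p ⇒ q) ≡ true → p ≡ true → q ≡ true
  ⇒-true true e refl = e

  ∧-intro : ∀ {p q} → p ≡ true → q ≡ true → p ∧ q ≡ true
  ∧-intro refl refl = refl

  ≡ᵇ-true : ∀ m n → (m ℕ.≡ᵇ n) ≡ true → m ≡ n
  ≡ᵇ-true m n e = ℕₚ.≡ᵇ⇒≡ m n (Equivalence.from T-≡ e)

  true-≡ᵇ : ∀ m n → m ≡ n → (m ℕ.≡ᵇ n) ≡ true
  true-≡ᵇ m n e = Equivalence.to T-≡ (ℕₚ.≡⇒≡ᵇ m n e)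

  true-≤ᵇ : ∀ {m n} → m ℕ.≤ n → (m ℕ.≤ᵇ n) ≡ true
  true-≤ᵇ p = Equivalence.to T-≡ (ℕₚ.≤⇒≤ᵇ p)

  not-true : ∀ p → not p ≡ true → p ≢ true
  not-true false _ ()

  every-true : ∀ {m} (p : Fin m → Bool) → every p ≡ true → ∀ a → p a ≡ true
  every-true p e zero    = proj₁ (∧-true (p zero) e)
  every-true p e (suc a) = every-true (p ∘ suc) (proj₂ (∧-true (p zero) e)) a

  true-every : ∀ {m} (p : Fin m → Bool) → (∀ a → p a ≡ true) → every p ≡ true
  true-every {zero}  p h = refl
  true-every {suc m} p h = ∧-intro (h zero) (true-every (p ∘ suc) (h ∘ suc))

  some-true : ∀ {m} (p : Fin m → Bool) → some p ≡ true → ∃[ a ] p a ≡ true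
  some-true {suc m} p e = by (∨-true (p zero) e)
    where
    shift : (∃[ a ] p (suc a) ≡ true) → ∃[ a ] p a ≡ true
    shift (a , q) = suc a , q
    by : p zero ≡ true ⊎ some (p ∘ suc) ≡ true → ∃[ a ] p a ≡ true
    by (inj₁ q) = zero , q
    by (inj₂ q) = shift (some-true (p ∘ suc) q)

  all-true : ∀ {X : Set} (p : X → Bool) xs → all p xs ≡ true → ∀ {x} → x ∈ xs → p x ≡ true
  all-true p (x ∷ xs) e (here refl) = proj₁ (∧-true (p x) e)
  all-true p (x ∷ xs) e (there m)   = all-true p xs (proj₂ (∧-true (p x) e)) m

  any-true : ∀ {X : Set} (p : X → Bool) xs → any p xs ≡ true → ∃[ x ] p x ≡ true
  any-true p (x ∷ xs) e = by (∨-true (p x) e)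
    where
    by : p x ≡ true ⊎ any p xs ≡ true → ∃[ x ] p x ≡ true
    by (inj₁ q) = x , q
    by (inj₂ q) = any-true p xs q

  last-just : ∀ {m} (p : Fin m → Bool) {a} → last p ≡ just a → p a ≡ true
  last-just {suc m} p {a} e = by (last (p ∘ suc)) refl e
    where
    first : ∀ b → p zero ≡ b → (if b then just zero else nothing) ≡ just a → p a ≡ true
    first true  q refl = q
    by : ∀ l → last (p ∘ suc) ≡ l → maybe (just ∘ suc) (if p zero then just zero else nothing) l ≡ just a → p a ≡ true
    by (just b) q refl = last-just (p ∘ suc) q
    by nothing  _ r    = first (p zero) refl r

  last-nothing : ∀ {m} (p : Fin m → Bool) → last p ≡ nothing → ∀ a → p a ≢ true
  last-nothing {suc m} p e a = by (last (p ∘ suc)) refl e a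
    where
    first : ∀ b → (if b then just (zero {m}) else nothing) ≡ nothing → b ≢ true
    first false _ ()
    by : ∀ l → last (p ∘ suc) ≡ l → maybe (just ∘ suc) (if p zero then just zero else nothing) l ≡ nothing → ∀ a → p a ≢ true
    by (just _) _ () _
    by nothing q r zero    = first (p zero) r
    by nothing q r (suc a) = last-nothing (p ∘ suc) q a

  equal-true : ∀ x y → equal x y ≡ true → x ≡ y
  equal-true x y e = cong₂ _+i_ (ℤₚ.i-j≡0⇒i≡j (re x) (re y) (cong re d)) (ℤₚ.i-j≡0⇒i≡j (im x) (im y) (cong im d))
    where
    d : x ⊞ ⊟ y ≡ 0ᵢ
    d = norm≡0 (≡ᵇ-true (norm (x ⊞ ⊟ y)) 0 e)

  ⌊⌋-true : ∀ {m} (a b : Fin m) → ⌊ a Finₚ.≟ b ⌋ ≡ true → a ≡ b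
  ⌊⌋-true a b e = by (a Finₚ.≟ b) e
    where
    by : (d : Dec (a ≡ b)) → ⌊ d ⌋ ≡ true → a ≡ b
    by (yes p) _ = p

  true-⌊⌋ : ∀ {m} (a b : Fin m) → a ≡ b → ⌊ a Finₚ.≟ b ⌋ ≡ true
  true-⌊⌋ a b e = trans (isYes≗does (a Finₚ.≟ b)) (dec-true (a Finₚ.≟ b) e)

  false-⌊⌋ : ∀ {m} {a b : Fin m} → a ≢ b → ⌊ a Finₚ.≟ b ⌋ ≡ false
  false-⌊⌋ {a = a} {b} ne = trans (isYes≗does (a Finₚ.≟ b)) (dec-false (a Finₚ.≟ b) ne)

  private
    listed : ∀ z {_ : True (z Gaussian.∈? small)} → z ∈ small
    listed z {p} = toWitness p

  small-complete : ∀ z → norm z ℕ.≤ 4 → z ∈ small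
  small-complete (a +i b) le = by (proj₁ c) (proj₂ c) le
    where
    c = components (a +i b) (ℕₚ.≤-trans (s≤s le) (s≤s (s≤s (s≤s (s≤s (s≤s z≤n))))))
    by : ∀ {a b} → Small a → Small b → norm (a +i b) ℕ.≤ 4 → a +i b ∈ small
    by s₀  s₀  _ = listed (+ 0 +i + 0)
    by s₀  s₁  _ = listed (+ 0 +i + 1)
    by s₀  s₂  _ = listed (+ 0 +i + 2)
    by s₀  s₋₁ _ = listed (+ 0 +i -[1+ 0 ])
    by s₀  s₋₂ _ = listed (+ 0 +i -[1+ 1 ])
    by s₁  s₀  _ = listed (+ 1 +i + 0)
    by s₁  s₁  _ = listed (+ 1 +i + 1)
    by s₁  s₋₁ _ = listed (+ 1 +i -[1+ 0 ])
    by s₋₁ s₀  _ = listed (-[1+ 0 ] +i + 0)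
    by s₋₁ s₁  _ = listed (-[1+ 0 ] +i + 1)
    by s₋₁ s₋₁ _ = listed (-[1+ 0 ] +i -[1+ 0 ])
    by s₂  s₀  _ = listed (+ 2 +i + 0)
    by s₋₂ s₀  _ = listed (-[1+ 1 ] +i + 0)
    by s₁  s₂  (s≤s (s≤s (s≤s (s≤s ()))))
    by s₁  s₋₂ (s≤s (s≤s (s≤s (s≤s ()))))
    by s₋₁ s₂  (s≤s (s≤s (s≤s (s≤s ()))))
    by s₋₁ s₋₂ (s≤s (s≤s (s≤s (s≤s ()))))
    by s₂  s₁  (s≤s (s≤s (s≤s (s≤s ()))))
    by s₂  s₂  (s≤s (s≤s (s≤s (s≤s ()))))
    by s₂  s₋₁ (s≤s (s≤s (s≤s (s≤s ()))))
    by s₂  s₋₂ (s≤s (s≤s (s≤s (s≤s ()))))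
    by s₋₂ s₁  (s≤s (s≤s (s≤s (s≤s ()))))
    by s₋₂ s₂  (s≤s (s≤s (s≤s (s≤s ()))))
    by s₋₂ s₋₁ (s≤s (s≤s (s≤s (s≤s ()))))
    by s₋₂ s₋₂ (s≤s (s≤s (s≤s (s≤s ()))))

  representative : ∀ z → z ≢ 0ᵢ → norm z ℕ.≤ 4 → ∃[ u ] norm u ≡ 1 × z ⊠ u ∈ representatives
  representative z z≢0 le = by z≢0 (small-complete z le)
    where
    by : ∀ {z} → z ≢ 0ᵢ → z ∈ small → ∃[ u ] norm u ≡ 1 × z ⊠ u ∈ representatives
    by ne (here refl) = contradiction refl ne
    by _ (there (here refl)) = +1ᵢ , refl , here refl
    by _ (there (there (here refl))) = -i , refl , here refl
    by _ (there (there (there (here refl)))) = -1ᵢ , refl , here refl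
    by _ (there (there (there (there (here refl))))) = ℤi.i , refl , here refl
    by _ (there (there (there (there (there (here refl)))))) = +1ᵢ , refl , there (here refl)
    by _ (there (there (there (there (there (there (here refl))))))) = -i , refl , there (here refl)
    by _ (there (there (there (there (there (there (there (here refl)))))))) = -1ᵢ , refl , there (here refl)
    by _ (there (there (there (there (there (there (there (there (here refl))))))))) = ℤi.i , refl , there (here refl)
    by _ (there (there (there (there (there (there (there (there (there (here refl)))))))))) = +1ᵢ , refl , there (there (here refl))
    by _ (there (there (there (there (there (there (there (there (there (there (here refl))))))))))) = -i , refl , there (there (here refl))
    by _ (there (there (there (there (there (there (there (there (there (there (there (here refl)))))))))))) = -1ᵢ , refl , there (there (here refl))
    by _ (there (there (there (there (there (there (there (there (there (there (there (there (here refl))))))))))))) = ℤi.i , refl , there (there (here refl))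

  charges-complete : ∀ d → norm (d +i 0ℤ) ℕ.≤ 4 → d ∈ charges
  charges-complete d le = by (proj₁ (components (d +i 0ℤ) (ℕₚ.≤-trans (s≤s le) (s≤s (s≤s (s≤s (s≤s (s≤s z≤n))))))))
    where
    by : ∀ {d} → Small d → d ∈ charges
    by s₀  = here refl
    by s₁  = there (here refl)
    by s₋₁ = there (there (here refl))
    by s₂  = there (there (there (here refl)))
    by s₋₂ = there (there (there (there (here refl))))

  columns-true : ∀ {m} (options : Fin m → List ℤ[i]) room left k → columns options room left k ≡ true →
    ∀ c → (∀ b → c b ∈ options b) → (∀ b → norm (c b) ℕ.≤ room b) → total c ℕ.≤ left → ∃[ c′ ] (∀ b → c′ b ≡ c b) × k c′ (left ℕ.∸ total c) ≡ true
  columns-true {zero}  options room left k e c _ _ _ = (λ ()) , (λ ()) , e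
  columns-true {suc m} options room left k e c member fits le = extend (columns-true (options ∘ suc) (room ∘ suc) (left ℕ.∸ norm z) (λ c → k (cons z c))
      (⇒-true ((norm z ℕ.≤ᵇ room zero) ∧ (norm z ℕ.≤ᵇ left)) (all-true _ (options zero) e (member zero)) (∧-intro (true-≤ᵇ (fits zero)) (true-≤ᵇ (ℕₚ.m+n≤o⇒m≤o (norm z) le))))
      (c ∘ suc) (member ∘ suc) (fits ∘ suc) (subst (ℕ._≤ left ℕ.∸ norm z) (ℕₚ.m+n∸m≡n (norm z) (total (c ∘ suc))) (ℕₚ.∸-monoˡ-≤ (norm z) le)))
    where
    z : ℤ[i]
    z = c zero
    extend : (∃[ c′ ] (∀ b → c′ b ≡ c (suc b)) × k (cons z c′) (left ℕ.∸ norm z ℕ.∸ total (c ∘ suc)) ≡ true) → ∃[ c′ ] (∀ b → c′ b ≡ c b) × k c′ (left ℕ.∸ total c) ≡ true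
    extend (c′ , same , q) = cons z c′ , same⁺ , trans (cong (k (cons z c′)) (sym (ℕₚ.∸-+-assoc left (norm z) (total (c ∘ suc))))) q
      where
      same⁺ : ∀ b → cons z c′ b ≡ c b
      same⁺ zero    = refl
      same⁺ (suc b) = same b

  eraseAll : ∀ {m n} → (Fin m → Fin n) → (Fin n → ℤ[i]) → Fin n → ℤ[i]
  eraseAll {zero}  f g = g
  eraseAll {suc m} f g = eraseAll (f ∘ suc) (erase (f zero) g)

  module _ {n : ℕ} where
    suc-injective : ∀ {m} {f : Fin (suc m) → Fin n} → Injective f → Injective (f ∘ suc)
    suc-injective inj a b e = Finₚ.suc-injective (inj (suc a) (suc b) e)

    erase-tail : ∀ {m} {f : Fin (suc m) → Fin n} → Injective f → ∀ g a → erase (f zero) g (f (suc a)) ≡ g (f (suc a))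
    erase-tail {f = f} inj g a = erase-other (f zero) (f (suc a)) g λ e → contradiction (inj zero (suc a) e) λ ()

    eraseAll-out : ∀ {m} (f : Fin m → Fin n) g v → (∀ a → f a ≢ v) → eraseAll f g v ≡ g v
    eraseAll-out {zero}  f g v out = refl
    eraseAll-out {suc m} f g v out = trans (eraseAll-out (f ∘ suc) (erase (f zero) g) v (out ∘ suc)) (erase-other (f zero) v g (out zero))

    eraseAll-zero : ∀ {m} (f : Fin m → Fin n) g v → g v ≡ 0ᵢ → eraseAll f g v ≡ 0ᵢ
    eraseAll-zero {zero}  f g v e = e
    eraseAll-zero {suc m} f g v e = eraseAll-zero (f ∘ suc) (erase (f zero) g) v (by (f zero Finₚ.≟ v))
      where
      by : Dec (f zero ≡ v) → erase (f zero) g v ≡ 0ᵢ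
      by (yes refl) = erase-self v g
      by (no ne)    = trans (erase-other (f zero) v g ne) e

    eraseAll-in : ∀ {m} (f : Fin m → Fin n) g a → eraseAll f g (f a) ≡ 0ᵢ
    eraseAll-in f g zero    = eraseAll-zero (f ∘ suc) (erase (f zero) g) (f zero) (erase-self (f zero) g)
    eraseAll-in f g (suc a) = eraseAll-in (f ∘ suc) (erase (f zero) g) a

    eraseAll-total : ∀ {m} (f : Fin m → Fin n) → Injective f → ∀ g → total g ≡ total (g ∘ f) ℕ.+ total (eraseAll f g)
    eraseAll-total {zero}  f inj g = refl
    eraseAll-total {suc m} f inj g = trans (erase-total (f zero) g) (trans (cong (norm (g (f zero)) ℕ.+_) (trans (eraseAll-total (f ∘ suc) (suc-injective inj) (erase (f zero) g))
      (cong (ℕ._+ total (eraseAll f g)) (total-cong (erase-tail inj g))))) (sym (ℕₚ.+-assoc (norm (g (f zero))) (total (g ∘ f ∘ suc)) (total (eraseAll f g)))))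

    eraseAll-sum : ∀ {m} (f : Fin m → Fin n) → Injective f → ∀ (g h : Fin n → ℤ[i]) → Σi (λ k → g k ⊠ h k) ≡ Σi (λ a → g (f a) ⊠ h (f a)) ⊞ Σi (λ k → eraseAll f g k ⊠ h k)
    eraseAll-sum {zero}  f inj g h = sym (Gi.+-identityˡ (Σi (λ k → g k ⊠ h k)))
    eraseAll-sum {suc m} f inj g h = begin
      Σi (λ k → g k ⊠ h k)                            ≡⟨ sum-erase (f zero) g h ⟩
      x ⊞ Σi (λ k → erase (f zero) g k ⊠ h k)         ≡⟨ cong (x ⊞_) (eraseAll-sum (f ∘ suc) (suc-injective inj) (erase (f zero) g) h) ⟩
      x ⊞ (Σi (λ a → erase (f zero) g (f (suc a)) ⊠ h (f (suc a))) ⊞ rest)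
                                                      ≡⟨ cong (λ t → x ⊞ (t ⊞ rest)) (ΣG.sum-cong-≗ λ a → cong (_⊠ h (f (suc a))) (erase-tail inj g a)) ⟩
      x ⊞ (Σi (λ a → g (f (suc a)) ⊠ h (f (suc a))) ⊞ rest)
                                                      ≡⟨ Gi.+-assoc x (Σi (λ a → g (f (suc a)) ⊠ h (f (suc a)))) rest ⟨
      (x ⊞ Σi (λ a → g (f (suc a)) ⊠ h (f (suc a)))) ⊞ rest ∎
      where
      open ≡-Reasoning
      x rest : ℤ[i]
      x    = g (f zero) ⊠ h (f zero)
      rest = Σi (λ k → eraseAll f g k ⊠ h k)

  norm≤total : ∀ {n} (g : Fin n → ℤ[i]) v → norm (g v) ℕ.≤ total g
  norm≤total g v = ℕₚ.≤-trans (ℕₚ.m≤m+n (norm (g v)) (total (erase v g))) (ℕₚ.≤-reflexive (sym (erase-total v g)))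

module SearchSoundness where
  open InnerProduct
  open BorderedMatrices
  open GaussianNorms
  open UnextendableMatrices
  open ParityArguments
  open DegreeTwo using (unit-conj; ⊟-⊠; ⊠-⊟)
  open LowDegreeVertices using (norm-zero; norm⇒≢0)
  open LowNeighbours using (norm-unit-⊠; ⊠≢0)
  open MonomialEquivalence
  open OrthogonalRows
  open LadderStrips
  open LadderEnds
  open TableSearch
  open SearchLemmas
  open import Data.Bool.Base using (if_then_else_; true; false; Bool; _∧_; _∨_; not)
  open import Data.Integer.Base using (+_; 0ℤ; _+_; _*_; -_; _-_)
  open import Data.Sign.Base as Sign using (Sign)
  open import Data.List.Membership.Propositional using (_∈_)
  open import Data.Maybe.Base using (just; nothing)
  open import Data.Vec.Base using (lookup)
  open import Relation.Nullary.Decidable using (⌊_⌋)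

  ⇒-intro : ∀ p {q} → (p ≡ true → q ≡ true) → (p ⇒ q) ≡ true
  ⇒-intro true  h = h refl
  ⇒-intro false h = refl

  ∨-introˡ : ∀ {p q} → p ≡ true → p ∨ q ≡ true
  ∨-introˡ refl = refl

  ∨-introʳ : ∀ p {q} → q ≡ true → p ∨ q ≡ true
  ∨-introʳ true  e = refl
  ∨-introʳ false e = e

  private
    telescope : ∀ a x s y b → norm s ≡ 1 → ((a ⊠ x) ⊠ conj s) ⊠ ((s ⊠ y) ⊠ b) ≡ (a ⊠ (x ⊠ y)) ⊠ b
    telescope a x s y b e = begin
      ((a ⊠ x) ⊠ conj s) ⊠ ((s ⊠ y) ⊠ b)     ≡⟨ Gi.*-assoc ((a ⊠ x) ⊠ conj s) (s ⊠ y) b ⟨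
      (((a ⊠ x) ⊠ conj s) ⊠ (s ⊠ y)) ⊠ b     ≡⟨ cong (_⊠ b) (Gi.*-assoc (a ⊠ x) (conj s) (s ⊠ y)) ⟩
      ((a ⊠ x) ⊠ (conj s ⊠ (s ⊠ y))) ⊠ b     ≡⟨ cong (λ t → ((a ⊠ x) ⊠ t) ⊠ b) (Gi.*-assoc (conj s) s y) ⟨
      ((a ⊠ x) ⊠ ((conj s ⊠ s) ⊠ y)) ⊠ b     ≡⟨ cong (λ t → ((a ⊠ x) ⊠ (t ⊠ y)) ⊠ b) (trans (Gi.*-comm (conj s) s) (unit-conj s e)) ⟩
      ((a ⊠ x) ⊠ (+1ᵢ ⊠ y)) ⊠ b              ≡⟨ cong (λ t → ((a ⊠ x) ⊠ t) ⊠ b) (Gi.*-identityˡ y) ⟩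
      ((a ⊠ x) ⊠ y) ⊠ b                      ≡⟨ cong (_⊠ b) (Gi.*-assoc a x y) ⟩
      (a ⊠ (x ⊠ y)) ⊠ b                      ∎
      where open ≡-Reasoning

    nested : ∀ e z t w e′ → (e ⊠ ((z ⊠ t) ⊠ conj w)) ⊠ conj e′ ≡ ((e ⊠ z) ⊠ t) ⊠ conj (e′ ⊠ w)
    nested e z t w e′ = begin
      (e ⊠ ((z ⊠ t) ⊠ conj w)) ⊠ conj e′     ≡⟨ cong (_⊠ conj e′) (Gi.*-assoc e (z ⊠ t) (conj w)) ⟨
      ((e ⊠ (z ⊠ t)) ⊠ conj w) ⊠ conj e′     ≡⟨ Gi.*-assoc (e ⊠ (z ⊠ t)) (conj w) (conj e′) ⟩
      (e ⊠ (z ⊠ t)) ⊠ (conj w ⊠ conj e′)     ≡⟨ cong₂ _⊠_ (sym (Gi.*-assoc e z t)) (trans (Gi.*-comm (conj w) (conj e′)) (sym (conj-⊠ e′ w))) ⟩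
      ((e ⊠ z) ⊠ t) ⊠ conj (e′ ⊠ w)          ∎
      where open ≡-Reasoning

    ungauge : ∀ e z s → norm e ≡ 1 → norm s ≡ 1 → z ≡ (e ⊠ ((conj e ⊠ z) ⊠ s)) ⊠ conj s
    ungauge e z s p q = sym (begin
      (e ⊠ ((conj e ⊠ z) ⊠ s)) ⊠ conj s      ≡⟨ cong (_⊠ conj s) (Gi.*-assoc e (conj e ⊠ z) s) ⟨
      ((e ⊠ (conj e ⊠ z)) ⊠ s) ⊠ conj s      ≡⟨ Gi.*-assoc (e ⊠ (conj e ⊠ z)) s (conj s) ⟩
      (e ⊠ (conj e ⊠ z)) ⊠ (s ⊠ conj s)      ≡⟨ cong₂ _⊠_ (sym (Gi.*-assoc e (conj e) z)) (unit-conj s q) ⟩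
      ((e ⊠ conj e) ⊠ z) ⊠ +1ᵢ               ≡⟨ Gi.*-identityʳ ((e ⊠ conj e) ⊠ z) ⟩
      (e ⊠ conj e) ⊠ z                       ≡⟨ cong (_⊠ z) (unit-conj e p) ⟩
      +1ᵢ ⊠ z                                ≡⟨ Gi.*-identityˡ z ⟩
      z                                      ∎)
      where open ≡-Reasoning

    norm-gauge : ∀ e x s → norm e ≡ 1 → norm s ≡ 1 → norm ((e ⊠ x) ⊠ s) ≡ norm x
    norm-gauge e x s p q = trans (norm-* (e ⊠ x) s) (trans (cong₂ ℕ._*_ (norm-unit-⊠ e x p) q) (ℕₚ.*-identityʳ (norm x)))

  module _ {n} {A : Matrix n} (sat : Saturated A) where
    open Saturated sat
    open SaturatedFacts sat

    record Copy {m} (B : Matrix m) : Set where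
      field
        f         : Fin m → Fin n
        injective : Injective f
        ε         : Fin m → ℤ[i]
        norm-ε    : ∀ a → norm (ε a) ≡ 1
        entries   : ∀ a b → A (f a) (f b) ≡ (ε a ⊠ B a b) ⊠ conj (ε b)

    module CopyFacts {m} {B : Matrix m} (copy : Copy B) where
      open Copy copy public

      norm-conj-ε : ∀ a → norm (conj (ε a)) ≡ 1
      norm-conj-ε a = trans (norm-conj (ε a)) (norm-ε a)

      norm-entry : ∀ a b → norm (A (f a) (f b)) ≡ norm (B a b)
      norm-entry a b = trans (cong norm (entries a b)) (norm-gauge (ε a) (B a b) (conj (ε b)) (norm-ε a) (norm-conj-ε b))

      outer : Fin m → Fin n → ℤ[i]
      outer a = eraseAll f (A (f a))

      total-split : ∀ a → total (B a) ℕ.+ total (outer a) ≡ 4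
      total-split a = trans (cong (ℕ._+ total (outer a)) (sym (Σℕ.sum-cong-≗ λ b → norm-entry a b))) (trans (sym (eraseAll-total f injective (A (f a)))) (full (f a)))

      outer-zero : ∀ a → complete B a ≡ true → ∀ v → outer a v ≡ 0ᵢ
      outer-zero a e = total≡0 (outer a) (ℕₚ.+-cancelˡ-≡ 4 (total (outer a)) 0 (trans (cong (ℕ._+ total (outer a)) (sym (≡ᵇ-true (total (B a)) 4 e))) (total-split a)))

      image? : ∀ v → (∃[ b ] f b ≡ v) ⊎ (∀ b → f b ≢ v)
      image? v = by (Finₚ.any? (λ b → f b Finₚ.≟ v))
        where
        by : Dec (∃[ b ] f b ≡ v) → (∃[ b ] f b ≡ v) ⊎ (∀ b → f b ≢ v)
        by (yes p) = inj₁ p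
        by (no ¬p) = inj₂ λ b e → ¬p (b , e)

      closed : ∀ a → complete B a ≡ true → ∀ v → A (f a) v ≢ 0ᵢ → ∃[ b ] f b ≡ v
      closed a e v nz = by (image? v)
        where
        by : (∃[ b ] f b ≡ v) ⊎ (∀ b → f b ≢ v) → ∃[ b ] f b ≡ v
        by (inj₁ p) = p
        by (inj₂ o) = contradiction (trans (sym (eraseAll-out f (A (f a)) v o)) (outer-zero a e v)) nz

      sq-zero : ∀ a b → complete B a ≡ true → a ≢ b → norm (sq B a b) ≡ 0
      sq-zero a b e a≢b = trans (sym (norm-gauge (ε a) (sq B a b) (conj (ε b)) (norm-ε a) (norm-conj-ε b))) (trans (cong norm (sym gauged)) (norm-zero (orth (a≢b ∘ injective a b))))
        where
        open ≡-Reasoning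
        gauged : sq A (f a) (f b) ≡ (ε a ⊠ sq B a b) ⊠ conj (ε b)
        gauged = begin
          Σi (λ k → A (f a) k ⊠ A k (f b))                      ≡⟨ eraseAll-sum f injective (A (f a)) (λ k → A k (f b)) ⟩
          Σi (λ k → A (f a) (f k) ⊠ A (f k) (f b)) ⊞ Σi (λ k → outer a k ⊠ A k (f b))
            ≡⟨ cong₂ _⊞_ (ΣG.sum-cong-≗ λ k → trans (cong₂ _⊠_ (entries a k) (entries k b)) (telescope (ε a) (B a k) (ε k) (B k b) (conj (ε b)) (norm-ε k)))
                         (trans (ΣG.sum-cong-≗ λ k → trans (cong (_⊠ A k (f b)) (outer-zero a e k)) (Gi.zeroˡ (A k (f b)))) (ΣG.sum-replicate-zero n)) ⟩
          Σi (λ k → (ε a ⊠ (B a k ⊠ B k b)) ⊠ conj (ε b)) ⊞ 0ᵢ   ≡⟨ Gi.+-identityʳ (Σi (λ k → (ε a ⊠ (B a k ⊠ B k b)) ⊠ conj (ε b))) ⟩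
          Σi (λ k → (ε a ⊠ (B a k ⊠ B k b)) ⊠ conj (ε b))       ≡⟨ ΣG.*-distribʳ-sum (conj (ε b)) (λ k → ε a ⊠ (B a k ⊠ B k b)) ⟨
          Σi (λ k → ε a ⊠ (B a k ⊠ B k b)) ⊠ conj (ε b)         ≡⟨ cong (_⊠ conj (ε b)) (ΣG.*-distribˡ-sum (ε a) (λ k → B a k ⊠ B k b)) ⟨
          (ε a ⊠ sq B a b) ⊠ conj (ε b)                         ∎

      copy-valid : valid B ≡ true
      copy-valid = true-every _ λ a → ⇒-intro (complete B a) λ e → true-every _ λ b → orthogonal a b e (a Finₚ.≟ b)
        where
        orthogonal : ∀ a b → complete B a ≡ true → Dec (a ≡ b) → ⌊ a Finₚ.≟ b ⌋ ∨ (norm (sq B a b) ℕ.≡ᵇ 0) ≡ true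
        orthogonal a b e (yes p) = ∨-introˡ (true-⌊⌋ a b p)
        orthogonal a b e (no ne) = ∨-introʳ ⌊ a Finₚ.≟ b ⌋ (true-≡ᵇ (norm (sq B a b)) 0 (sq-zero a b e ne))

      rung-sound : ∀ a b → isRung B a b ≡ true → Equivalent A
      rung-sound a b e = by (A (f a) (f a)) refl (isUnit (A (f a) (f a)) (trans (norm-entry a a) nd)) (cong im (diagonal (f a)))
        where
        split₁ = ∧-true (not ⌊ a Finₚ.≟ b ⌋) e
        split₂ = ∧-true (norm (B a b) ℕ.≡ᵇ 1) (proj₂ split₁)
        split₃ = ∧-true (norm (B a a) ℕ.≡ᵇ 1) (proj₂ split₂)
        nd : norm (B a a) ≡ 1
        nd = ≡ᵇ-true (norm (B a a)) 1 (proj₁ split₃)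
        ne : f a ≢ f b
        ne p = not-true ⌊ a Finₚ.≟ b ⌋ (proj₁ split₁) (true-⌊⌋ a b (injective a b p))
        edge : norm (A (f a) (f b)) ≡ 1
        edge = trans (norm-entry a b) (≡ᵇ-true (norm (B a b)) 1 (proj₁ split₂))
        on-diagonal : ∀ a → A (f a) (f a) ≡ B a a
        on-diagonal a = trans (entries a a) (diagonal-gauge (ε a) (B a a) (norm-ε a))
        same : A (f b) (f b) ≡ A (f a) (f a)
        same = trans (on-diagonal b) (trans (sym (equal-true (B a a) (B b b) (proj₂ split₃))) (sym (on-diagonal a)))
        by : ∀ z → A (f a) (f a) ≡ z → IsUnit z → im z ≡ 0ℤ → Equivalent A
        by _ p u₁  _ = rung⇒equivalent sat ne p (trans same p) edge
        by _ p u₋₁ _ = Equivalent-⊖ {A = A} (rung⇒equivalent Saturated-⊖ ne (cong ⊟_ p) (cong ⊟_ (trans same p)) (trans (norm-⊟ (A (f a) (f b))) edge))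
        by _ _ uᵢ  ()
        by _ _ u₋ᵢ ()

      module Extend (a : Fin m) (incomplete : complete B a ≢ true) where
        vertex : ∃[ v ] outer a v ≢ 0ᵢ
        vertex = nonzero-entry (outer a) λ z → incomplete (true-≡ᵇ (total (B a)) 4 (trans (sym (ℕₚ.+-identityʳ (total (B a)))) (trans (cong (total (B a) ℕ.+_) (sym z)) (total-split a))))

        v : Fin n
        v = proj₁ vertex

        new : ∀ b → f b ≢ v
        new b e = proj₂ vertex (subst (λ w → outer a w ≡ 0ᵢ) e (eraseAll-in f (A (f a)) b))

        av≢0 : A (f a) v ≢ 0ᵢ
        av≢0 z = proj₂ vertex (trans (eraseAll-out f (A (f a)) v new) z)

        module _ (u : ℤ[i]) (nu : norm u ≡ 1) where
          c : Fin m → ℤ[i]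
          c b = (conj (ε b) ⊠ A (f b) v) ⊠ u

          d : ℤ
          d = re (A v v)

          norm-c : ∀ b → norm (c b) ≡ norm (A (f b) v)
          norm-c b = norm-gauge (conj (ε b)) (A (f b) v) u (norm-conj-ε b) nu

          room : ∀ b → norm (c b) ℕ.≤ 4 ℕ.∸ total (B b)
          room b = subst₂ ℕ._≤_ (trans (cong norm (eraseAll-out f (A (f b)) v new)) (sym (norm-c b)))
            (trans (sym (ℕₚ.m+n∸m≡n (total (B b)) (total (outer b)))) (cong (ℕ._∸ total (B b)) (total-split b))) (norm≤total (outer b) v)

          f⁺ : Fin (suc m) → Fin n
          f⁺ = cons v f

          f⁺-injective : Injective f⁺
          f⁺-injective zero    zero    _ = refl
          f⁺-injective zero    (suc b) e = contradiction (sym e) (new b)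
          f⁺-injective (suc b) zero    e = contradiction e (new b)
          f⁺-injective (suc b) (suc k) e = cong suc (injective b k e)

          new-total : norm (d +i 0ℤ) ℕ.+ total c ℕ.≤ 4
          new-total = ℕₚ.≤-trans (ℕₚ.≤-reflexive (cong₂ ℕ._+_ (cong norm (sym (diagonal v))) (Σℕ.sum-cong-≗ λ b → trans (norm-c b) (norm-sym (f b) v))))
            (ℕₚ.m+n≤o⇒m≤o (total (A v ∘ f⁺)) (ℕₚ.≤-reflexive (trans (sym (eraseAll-total f⁺ f⁺-injective (A v))) (full v))))

          copy⁺ : ∀ c′ → (∀ b → c′ b ≡ c b) → Copy (border B c′ d)
          copy⁺ c′ same = record { f = f⁺ ; injective = f⁺-injective ; ε = cons u ε ; norm-ε = norm-ε⁺ ; entries = entries⁺ }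
            where
            norm-ε⁺ : ∀ b → norm (cons u ε b) ≡ 1
            norm-ε⁺ zero    = nu
            norm-ε⁺ (suc b) = norm-ε b
            column⁺ : ∀ b → A (f b) v ≡ (ε b ⊠ c′ b) ⊠ conj u
            column⁺ b = trans (ungauge (ε b) (A (f b) v) u (norm-ε b) nu) (cong (λ z → (ε b ⊠ z) ⊠ conj u) (sym (same b)))
            entries⁺ : ∀ x y → A (f⁺ x) (f⁺ y) ≡ (cons u ε x ⊠ border B c′ d x y) ⊠ conj (cons u ε y)
            entries⁺ zero    zero    = trans (diagonal v) (sym (diagonal-gauge u (d +i 0ℤ) nu))
            entries⁺ (suc b) zero    = column⁺ b
            entries⁺ zero    (suc b) = trans (herm v (f b)) (trans (cong conj (column⁺ b)) (conj-gauge (ε b) (c′ b) u))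
            entries⁺ (suc b) (suc k) = entries b k

    certificate-sound : ∀ {m} {B : Matrix (suc m)} → Copy B → (∀ a → complete B a ≡ true) → (C : Certificate m) → certifies B C ≡ true → Equivalent A
    certificate-sound {m} {B} copy whole C e = realises⇒equivalent conn (Certificate.listed C) (record
        { f = f ∘ π ; injective = λ a b p → π-injective a b (injective (π a) (π b) p) ; closed = λ a v nz → preimage (closed (π a) (whole (π a)) v nz)
        ; ζ = λ a → ε (π a) ⊠ ζ a ; norm-ζ = λ a → trans (norm-unit-⊠ (ε (π a)) (ζ a) (norm-ε (π a))) (nζ a) ; s = s ; σ = identity
        ; entries = λ a b → trans (entries (π a) (π b)) (trans (cong (λ z → (ε (π a) ⊠ z) ⊠ conj (ε (π b))) (matches a b)) (push s a b)) })
      where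
      open CopyFacts copy
      open Certificate C using (T; s)
      π : Fin (suc m) → Fin (suc m)
      π = lookup (Certificate.π C)
      ζ : Fin (suc m) → ℤ[i]
      ζ = lookup (Certificate.ζ C)
      row : ∀ a → every (certifiesEntry B C a) ≡ true × ((norm (ζ a) ℕ.≡ᵇ 1) ∧ some (hits B C a)) ≡ true
      row a = ∧-true (every (certifiesEntry B C a)) (every-true (certifiesRow B C) e a)
      cell : ∀ a b → equal (B (π a) (π b)) (signed s ((ζ a ⊠ T a b) ⊠ conj (ζ b))) ≡ true × (⌊ π a Finₚ.≟ π b ⌋ ⇒ ⌊ a Finₚ.≟ b ⌋) ≡ true
      cell a b = ∧-true (equal (B (π a) (π b)) (signed s ((ζ a ⊠ T a b) ⊠ conj (ζ b)))) (every-true (certifiesEntry B C a) (proj₁ (row a)) b)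
      matches : ∀ a b → B (π a) (π b) ≡ signed s ((ζ a ⊠ T a b) ⊠ conj (ζ b))
      matches a b = equal-true (B (π a) (π b)) (signed s ((ζ a ⊠ T a b) ⊠ conj (ζ b))) (proj₁ (cell a b))
      π-injective : ∀ a b → π a ≡ π b → a ≡ b
      π-injective a b p = ⌊⌋-true a b (⇒-true ⌊ π a Finₚ.≟ π b ⌋ (proj₂ (cell a b)) (true-⌊⌋ (π a) (π b) p))
      rest : ∀ a → (norm (ζ a) ℕ.≡ᵇ 1) ≡ true × some (hits B C a) ≡ true
      rest a = ∧-true (norm (ζ a) ℕ.≡ᵇ 1) (proj₂ (row a))
      nζ : ∀ a → norm (ζ a) ≡ 1
      nζ a = ≡ᵇ-true (norm (ζ a)) 1 (proj₁ (rest a))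
      preimage : ∀ {v} → (∃[ b ] f b ≡ v) → ∃[ a ] f (π a) ≡ v
      preimage (b , p) = found (some-true (hits B C b) (proj₂ (rest b)))
        where
        found : (∃[ a ] ⌊ π a Finₚ.≟ b ⌋ ≡ true) → ∃[ a ] f (π a) ≡ _
        found (a , q) = a , trans (cong f (⌊⌋-true (π a) b q)) p
      push : ∀ s a b → (ε (π a) ⊠ signed s ((ζ a ⊠ T a b) ⊠ conj (ζ b))) ⊠ conj (ε (π b)) ≡ signed s (((ε (π a) ⊠ ζ a) ⊠ T a b) ⊠ conj (ε (π b) ⊠ ζ b))
      push Sign.+ a b = nested (ε (π a)) (ζ a) (T a b) (ζ b) (ε (π b))
      push Sign.- a b = trans (cong (_⊠ conj (ε (π b))) (⊠-⊟ (ε (π a)) ((ζ a ⊠ T a b) ⊠ conj (ζ b)))) (trans (⊟-⊠ (ε (π a) ⊠ ((ζ a ⊠ T a b) ⊠ conj (ζ b))) (conj (ε (π b))))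
        (cong ⊟_ (nested (ε (π a)) (ζ a) (T a b) (ζ b) (ε (π b)))))

    search-sound : ∀ fuel {m} (B : Matrix (suc m)) → search fuel B ≡ true → Copy B → Equivalent A
    branch-sound : ∀ fuel {m} (B : Matrix (suc m)) l → last (not ∘ complete B) ≡ l → branch fuel B l ≡ true → Copy B → Equivalent A

    search-sound (suc fuel) B e copy = by (∨-true (some λ a → some (isRung B a)) (⇒-true (valid B) e (CopyFacts.copy-valid copy)))
      where
      rung-at : (∃[ a ] some (isRung B a) ≡ true) → Equivalent A
      rung-at (a , q) = CopyFacts.rung-sound copy a (proj₁ (some-true (isRung B a) q)) (proj₂ (some-true (isRung B a) q))
      by : (some λ a → some (isRung B a)) ≡ true ⊎ branch fuel B (last (not ∘ complete B)) ≡ true → Equivalent A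
      by (inj₁ p) = rung-at (some-true (λ a → some (isRung B a)) p)
      by (inj₂ p) = branch-sound fuel B (last (not ∘ complete B)) refl p copy

    branch-sound fuel {m} B nothing e found copy = certificate-sound copy whole (proj₁ certified) (proj₂ certified)
      where
      certified : ∃[ C ] certifies B C ≡ true
      certified = any-true (certifies B) (certificates m) found
      whole : ∀ a → complete B a ≡ true
      whole a = not-not (complete B a) (last-nothing (not ∘ complete B) e a)
        where
        not-not : ∀ b → not b ≢ true → b ≡ true
        not-not true  _  = refl
        not-not false ne = contradiction refl ne
    branch-sound fuel {m} B (just a) e found copy = gauge (representative (conj (ε a) ⊠ A (f a) v) (⊠≢0 {conj (ε a)} {A (f a) v} (norm⇒≢0 {conj (ε a)} (norm-conj-ε a)) av≢0) small-entry)
      where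
      open CopyFacts copy
      open Extend a (not-true (complete B a) (last-just (not ∘ complete B) e))
      small-entry : norm (conj (ε a) ⊠ A (f a) v) ℕ.≤ 4
      small-entry = ℕₚ.≤-trans (ℕₚ.≤-reflexive (norm-unit-⊠ (conj (ε a)) (A (f a) v) (norm-conj-ε a))) (ℕₚ.≤-trans (norm≤total (A (f a)) v) (ℕₚ.≤-reflexive (full (f a))))
      gauge : (∃[ u ] norm u ≡ 1 × (conj (ε a) ⊠ A (f a) v) ⊠ u ∈ representatives) → Equivalent A
      gauge (u , nu , rep) = descend (columns-true options (λ b → 4 ℕ.∸ total (B b)) 4 next found (c u nu) member (room u nu) c≤4)
        where
        continue : (Fin (suc m) → ℤ[i]) → ℕ → ℤ → Bool
        continue c left d = (norm (d +i 0ℤ) ℕ.≤ᵇ left) ⇒ search fuel (border B c d)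
        next : (Fin (suc m) → ℤ[i]) → ℕ → Bool
        next c left = all (continue c left) charges
        options : Fin (suc m) → List ℤ[i]
        options b = if ⌊ a Finₚ.≟ b ⌋ then representatives else small
        member : ∀ b → c u nu b ∈ options b
        member b = by (a Finₚ.≟ b)
          where
          by : Dec (a ≡ b) → c u nu b ∈ options b
          by (yes refl) = subst (λ t → c u nu a ∈ (if t then representatives else small)) (sym (true-⌊⌋ a a refl)) rep
          by (no ne)    = subst (λ t → c u nu b ∈ (if t then representatives else small)) (sym (false-⌊⌋ ne))
            (small-complete (c u nu b) (ℕₚ.≤-trans (room u nu b) (ℕₚ.m∸n≤m 4 (total (B b)))))
        c≤4 : total (c u nu) ℕ.≤ 4
        c≤4 = ℕₚ.m+n≤o⇒n≤o (norm (d u nu +i 0ℤ)) (new-total u nu)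
        d≤ : norm (d u nu +i 0ℤ) ℕ.≤ 4 ℕ.∸ total (c u nu)
        d≤ = ℕₚ.m+n≤o⇒m≤o∸n (norm (d u nu +i 0ℤ)) (new-total u nu)
        descend : (∃[ c′ ] (∀ b → c′ b ≡ c u nu b) × next c′ (4 ℕ.∸ total (c u nu)) ≡ true) → Equivalent A
        descend (c′ , same , q) = search-sound fuel (border B c′ (d u nu)) (⇒-true (norm (d u nu +i 0ℤ) ℕ.≤ᵇ 4 ℕ.∸ total (c u nu))
          (all-true (continue c′ (4 ℕ.∸ total (c u nu))) charges q (charges-complete (d u nu) (ℕₚ.≤-trans d≤ (ℕₚ.m∸n≤m 4 (total (c u nu)))))) (true-≤ᵇ d≤)) (copy⁺ u nu c′ same)

open InnerProduct
open BorderedMatrices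
open GaussianNorms
open UnextendableMatrices
open ParityArguments
open MonomialEquivalence
open OrthogonalRows
open LadderStrips
open LadderEnds
open TableSearch
open SearchLemmas
open SearchSoundness
open EqualDegrees
open MaximalMatrices
open import Data.Integer.Base using (+_; 0ℤ; _+_; -_; _-_)
open import Data.Sign.Base as Sign using (Sign)

module _ {n} {A : Matrix n} (sat : Saturated A) where
  open Saturated sat
  open SaturatedFacts sat

  heavy⇒equivalent : ∀ s q → A q q ≡ signed s (+ 2 +i 0ℤ) → Equivalent A
  heavy⇒equivalent s q e = realises⇒equivalent conn S1 (record
    { f = λ _ → q ; injective = λ { zero zero _ → refl } ; closed = λ _ v nz → zero , by v (q Finₚ.≟ v) nz
    ; ζ = λ _ → +1ᵢ ; norm-ζ = λ _ → refl ; s = s ; σ = identity ; entries = λ { zero zero → e } })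
    where
    norm-4 : ∀ s → norm (signed s (+ 2 +i 0ℤ)) ≡ 4
    norm-4 Sign.+ = refl
    norm-4 Sign.- = refl
    rest : total (erase q (A q)) ≡ 0
    rest = ℕₚ.+-cancelˡ-≡ 4 (total (erase q (A q))) 0 (trans (cong (ℕ._+ total (erase q (A q))) (sym (trans (cong norm e) (norm-4 s)))) (trans (sym (erase-total q (A q))) (full q)))
    by : ∀ v → Dec (q ≡ v) → A q v ≢ 0ᵢ → q ≡ v
    by v (yes p) _  = p
    by v (no ne) nz = contradiction (trans (sym (erase-other q v (A q) ne)) (total≡0 (erase q (A q)) rest v)) nz

  plus⇒equivalent : ∀ q → A q q ≡ +1ᵢ → Equivalent A
  plus⇒equivalent q e = search-sound sat 9 {0} (λ _ _ → +1ᵢ) search-succeeds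
    (record { f = λ _ → q ; injective = λ { zero zero _ → refl } ; ε = λ _ → +1ᵢ ; norm-ε = λ _ → refl ; entries = λ _ _ → e })

charged⇒equivalent : ∀ {n} {A : Matrix n} → Saturated A → ∀ q → A q q ≢ 0ᵢ → Equivalent A
charged⇒equivalent {A = A} sat q nz = by (A q q) refl (cong im (diagonal q)) (proj₁ (components (A q q) (s≤s (ℕₚ.≤-trans (norm≤total (A q) q) (ℕₚ.≤-trans (ℕₚ.≤-reflexive (full q)) (ℕₚ.m≤m+n 4 4))))))
  where
  open Saturated sat
  open SaturatedFacts sat
  by : ∀ z → A q q ≡ z → im z ≡ 0ℤ → Small (re z) → Equivalent A
  by (_ +i _) e refl s₀  = contradiction e nz
  by (_ +i _) e refl s₁  = plus⇒equivalent sat q e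
  by (_ +i _) e refl s₂  = heavy⇒equivalent sat Sign.+ q e
  by (_ +i _) e refl s₋₁ = Equivalent-⊖ {A = A} (plus⇒equivalent Saturated-⊖ q (cong ⊟_ e))
  by (_ +i _) e refl s₋₂ = heavy⇒equivalent sat Sign.- q e

theorem3p3 : ∀ {n} (A : Matrix n) → MaximalIndecomposableCyclotomic A → (∃[ u ] A u u ≢ ℤi.0#) →
    ∃[ B ] IsListed {n} B × A ∼ B
theorem3p3 A maximal (q , nz) = charged⇒equivalent saturated q nz
  where
  core : Core A
  core = maximal⇒core A maximal
  saturated : Saturated A
  saturated = record
    { herm = Core.herm core
    ; conn = Core.conn core
    ; full = all-full core q nz
    ; orth = λ {u} ne → Extensions.full-sq′ core (all-full core q nz u) ne }
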